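{- Let $n\ge 1$, let $\mu$ be a partition of $n$, and let $\mathcal{C}_\mu\subseteq S_n$ be the conjugacy class of permutations of cycle type $\mu$, equipped with the descent map $\mathrm{Des}:\mathcal{C}_\mu\to 2^{[n-1]}$. Then $\mathrm{Des}$ on $\mathcal{C}_\mu$ has a cyclic extension $(\mathrm{cDes},p)$ if and only if $\mu$ is not of the form $(r^s)$ (i.e. $s$ parts all equal to $r$, $rs=n$) for some square-free positive integer $r$.
   Context: $[m]=\{1,\dots,m\}$. For $\pi=[\pi_1,\dots,\pi_n]\in S_n$ in one-line notation, $\mathrm{Des}(\pi)=\{1\le i\le n-1:\pi_i>\pi_{i+1}\}$. Let $\mathrm{sh}:2^{[n]}\to 2^{[n]}$ be the bijection induced by $i\mapsto i+1 \pmod n$. For a finite set $\mathcal{T}$ with a map $\mathrm{Des}:\mathcal{T}\to 2^{[n-1]}$, a cyclic extension of $\mathrm{Des}$ is a pair $(\mathrm{cDes},p)$ where $\mathrm{cDes}:\mathcal{T}\to 2^{[n]}$ is a map and $p:\mathcal{T}\to\mathcal{T}$ is a bijection such that for all $T\in\mathcal{T}$: $\mathrm{cDes}(T)\cap[n-1]=\mathrm{Des}(T)$; $\mathrm{cDes}(p(T))=\mathrm{sh}(\mathrm{cDes}(T))$; and $\varnothing\subsetneq\mathrm{cDes}(T)\subsetneq[n]$. An integer is square-free if no square of a prime divides it; in particular $1$ is square-free. -}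

module Defs where

open import Data.Nat using (ℕ; zero; suc; _+_; _*_; _≤_; _<_; _<ᵇ_; _≤ᵇ_; _≥_)
open import Data.Nat.Properties using (≤-decTotalOrder)
open import Data.Nat.Divisibility using (_∣_)
open import Data.Nat.Primality using (Prime)
open import Data.Bool using (Bool; true; false; _∧_; _∨_; not; T; if_then_else_)
open import Data.Fin using (Fin; toℕ; zero; suc; fromℕ; inject₁)
open import Data.Fin.Subset using (Subset; _∩_; ⊥; ⊤)
open import Data.Vec using (Vec; lookup; tabulate)
open import Data.List.Base using (List; []; _∷_; map; filterᵇ; allFin; upTo; reverse; replicate)
open import Data.Nat.ListAction using (sum)
open import Data.List.Relation.Unary.Linked using (Linked)
open import Data.List.Relation.Unary.All using (All)
import Data.List.Sort.InsertionSort.Base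
open import Data.Product using (Σ; _×_; _,_; ∃; ∃-syntax)
import Data.Nat
import Data.Fin
import Relation.Nullary
open import Relation.Binary.PropositionalEquality using (_≡_; _≢_)
open import Relation.Nullary using (¬_)
open import Relation.Nullary.Decidable using (⌊_⌋; True)
import Data.Fin.Properties as FinP
import Data.List.Properties as ListP
open import Function.Definitions using (Bijective)

-- Conventions.  [n] = {1,…,n} is represented by Fin n, where the index
-- j : Fin n stands for the integer toℕ j + 1.  Subsets of [n] are
-- Subset n (= Vec Bool n).  A permutation π ∈ S_n in one-line notation
-- is a vector v : Vec (Fin n) n with pairwise distinct entries, where
-- lookup v j (0-based) stands for π_{toℕ j + 1} - 1.

IsPartition : ℕ → List ℕ → Set
IsPartition n μ = All (λ k → 1 ≤ k) μ × Linked _≥_ μ × sum μ ≡ n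

SquareFree : ℕ → Set
SquareFree r = ∀ p → Prime p → ¬ (p * p ∣ r)

allᵇ : ∀ {A : Set} → (A → Bool) → List A → Bool
allᵇ p []       = true
allᵇ p (x ∷ xs) = p x ∧ allᵇ p xs

distinctᵇ : ∀ {n} → Vec (Fin n) n → Bool
distinctᵇ {n} v =
  allᵇ (λ i → allᵇ (λ j → not ⌊ lookup v i FinP.≟ lookup v j ⌋ ∨ ⌊ i FinP.≟ j ⌋)
                 (allFin n))
      (allFin n)

iter : ∀ {A : Set} → (A → A) → ℕ → A → A
iter f zero    x = x
iter f (suc k) x = f (iter f k x)

-- search for the least k in {start, start+1, …, start+fuel-1}
-- with f^k i = i; returns 0 if none
firstReturn : ∀ {n} → (Fin n → Fin n) → Fin n → ℕ → ℕ → ℕ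
firstReturn f i start zero = 0
firstReturn f i start (suc fuel) =
  if ⌊ iter f start i FinP.≟ i ⌋ then start
  else firstReturn f i (suc start) fuel

cycleLength : ∀ {n} → Vec (Fin n) n → Fin n → ℕ
cycleLength {n} v i = firstReturn (lookup v) i 1 n

isCycleMin : ∀ {n} → Vec (Fin n) n → Fin n → Bool
isCycleMin {n} v i =
  allᵇ (λ k → toℕ i ≤ᵇ toℕ (iter (lookup v) k i)) (upTo n)

-- cycle type: lengths of the cycles (one entry per cycle, represented
-- by its minimal element), sorted weakly decreasingly
cycleType : ∀ {n} → Vec (Fin n) n → List ℕ
cycleType {n} v =
  reverse (Data.List.Sort.InsertionSort.Base.sort ≤-decTotalOrder
             (map (cycleLength v) (filterᵇ (isCycleMin v) (allFin n))))

-- the conjugacy class C_μ ⊆ S_n of permutations of cycle type μ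
-- (the membership proof is an element of ⊤, so it carries no data)
Class : (n : ℕ) → List ℕ → Set
Class n μ =
  Σ (Vec (Fin n) n) λ v → T (distinctᵇ v ∧ ⌊ ListP.≡-dec Data.Nat._≟_ (cycleType v) μ ⌋)

-- [n-1] as a subset of [n]: position j (standing for j+1) is in iff j+1 < n
upToPred : (n : ℕ) → Subset n
upToPred n = tabulate (λ j → suc (toℕ j) <ᵇ n)

-- descent set Des(π) ⊆ [n-1] ⊆ [n]: position j (i.e. i = j+1) is in iff
-- j+1 < n and π_{j+1} > π_{j+2}
desVec : ∀ {n} → Vec (Fin n) n → Subset n
desVec {zero}  v = tabulate (λ ())
desVec {suc m} v = tabulate λ j → aux j
  where
  aux : Fin (suc m) → Bool
  aux j with toℕ j Data.Nat.<? m
  ... | Relation.Nullary.yes j<m =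
          toℕ (lookup v (suc (Data.Fin.fromℕ< j<m))) <ᵇ toℕ (lookup v j)
  ... | Relation.Nullary.no _ = false

Des : ∀ {n μ} → Class n μ → Subset n
Des (v , _) = desVec v

predMod : ∀ {n} → Fin n → Fin n
predMod {suc m} zero    = Data.Fin.fromℕ m
predMod {suc m} (suc j) = inject₁ j

-- sh(S) = { s+1 mod n : s ∈ S }, i.e. x ∈ sh(S) iff x-1 mod n ∈ S
sh : ∀ {n} → Subset n → Subset n
sh {n} S = tabulate (λ j → lookup S (predMod j))

IsCyclicExtension : ∀ n μ → (Class n μ → Subset n) → (Class n μ → Class n μ) → Set
IsCyclicExtension n μ cDes p =
  Bijective _≡_ _≡_ p ×
  (∀ T → cDes T ∩ upToPred n ≡ Des T) ×
  (∀ T → cDes (p T) ≡ sh (cDes T)) ×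
  (∀ T → cDes T ≢ ⊥ × cDes T ≢ ⊤)

HasCyclicExtension : ∀ n μ → Set
HasCyclicExtension n μ =
  Σ (Class n μ → Subset n) λ cDes →
  Σ (Class n μ → Class n μ) λ p → IsCyclicExtension n μ cDes p

IsSquareFreeRectangle : List ℕ → Set
IsSquareFreeRectangle μ = ∃[ r ] ∃[ s ] (1 ≤ r × SquareFree r × μ ≡ replicate s r)

-- Existence.  For e ∈ J let A(e, J) be the set of members of the class that increase along the
-- cyclic blocks cut out by J, in the linear order of the circle cut at e.  By Möbius inversion it
-- suffices to find a set T and a map cD from T to proper nonempty subsets such that
-- #{t : cD t ⊆ J} = #A(e, J) whenever e ∈ J.  A member of A(e, J) is determined by the block
-- letters read along its cycles, as in the Gessel–Reutenauer bijection.  Recoding this with a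
-- nonconstant colouring k, one lets cD be the cyclic descents of the recoded structure, where the
-- circle is cut at the first drop of k.  If μ has two cycle lengths, k marks one of them.  If
-- μ = (r^s) and p² ∣ r, the orbits of π^(r/p) are columns of prime length p, and k compares the
-- rotations at which consecutive columns have major index 0 mod p; along a cycle the r/p colours
-- sum to 1 mod p, so they cannot all be equal.
--
-- Nonexistence.  With Q letters, let F count the pairs (π, f) where f is weakly increasing, and
-- strictly at the descents of π.  Then n! F is a sum of rising factorials, and rotating by p shows
-- that an extension would force Q² ∣ n · n! · F.  On the other hand, a multiple of F is the sum
-- over commuting pairs (π, g) of the number X of g-invariant words that are primitive on the
-- cycles of π.  If ⟨π, g⟩ is not transitive, then Q² ∣ X.  Otherwise X = 0 or X ≡ ±Q mod Q², with
-- a sign depending only on r: for a prime q not dividing e, the numbers of words of minimal period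
-- e and q e add up to 0 mod Q².  Hence Q ∣ n · n! · K, where K > 0 counts the pairs of the last
-- kind and does not depend on Q, which is absurd for Q = n · n! · K + 1.

module Submission where

open import Defs
open import Data.Bool using (Bool; T; _∧_; _∨_; false; if_then_else_; not; true)
import Data.Bool.Properties as BoolP
open import Data.Empty using (⊥; ⊥-elim)
open import Data.Fin as Fin using (Fin; cast; combine; fromℕ; fromℕ<; inject₁; punchOut; remQuot; suc; toℕ; zero)
open import Data.Fin.Properties as FinP using (all?; any?; cast-is-id; cast-trans; combine-remQuot; fromℕ≢inject₁; injective⇒≤; inject₁-injective; pigeonhole; punchOut-injective; remQuot-combine; toℕ-fromℕ; toℕ-fromℕ<; toℕ-injective; toℕ-inject₁; toℕ<n)
open import Data.Fin.Subset as Sub using (Subset; _∩_; _⊆_)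
import Data.Fin.Subset.Properties as SubP
open import Data.List.Base as L using (List; []; _++_; _∷_; allFin; cartesianProduct; filter; filterᵇ; length; map; replicate; reverse; upTo)
open import Data.List.Membership.Propositional using (_∈_; find; lose)
open import Data.List.Membership.Propositional.Properties using (∈-++⁺ʳ; ∈-++⁺ˡ; ∈-++⁻; ∈-allFin; ∈-cartesianProduct⁺; ∈-filter⁺; ∈-filter⁻; ∈-map⁺; ∈-map⁻; ∈-upTo⁺; ∈-∃++)
open import Data.List.Membership.Propositional.Properties.WithK using (unique∧set⇒bag)
import Data.List.Properties as ListP
open import Data.List.Relation.Binary.BagAndSetEquality using (∼bag⇒↭)
open import Data.List.Relation.Binary.Permutation.Propositional as Perm using (_↭_; prep; ↭-refl; ↭-sym; ↭-trans; ↭⇒↭ₛ)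
import Data.List.Relation.Binary.Permutation.Propositional.Properties as PermP
open import Data.List.Relation.Binary.Pointwise using (Pointwise-≡⇒≡)
open import Data.List.Relation.Binary.Pointwise.Base using (Pointwise; []; _∷_)
open import Data.List.Relation.Unary.All as All using (All; []; _∷_)
import Data.List.Relation.Unary.All.Properties as AllP
open import Data.List.Relation.Unary.AllPairs using ([]; _∷_)
open import Data.List.Relation.Unary.Any as Any using (here; there)
import Data.List.Relation.Unary.Any.Properties as AnyP
open import Data.List.Relation.Unary.Sorted.TotalOrder.Properties using (↗↭↗⇒≋)
open import Data.List.Relation.Unary.Unique.Propositional using (Unique)
import Data.List.Relation.Unary.Unique.Propositional.Properties as UniqueP
import Data.List.Sort.InsertionSort.Base as ISort
import Data.List.Sort.InsertionSort.Properties as ISortP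
open import Data.Nat as ℕ using (>-nonZero; NonZero; _!; _*_; _+_; _<_; _<ᵇ_; _^_; _∸_; _≤_; _≤ᵇ_; nonTrivial⇒n>1; pred; suc; s≤s; zero; z≤n; ℕ)
open import Data.Nat.Coprimality using (Coprime; coprime-divisor) renaming (sym to coprime-sym)
open import Data.Nat.DivMod using (%-distribˡ-+; %-remove-+ʳ; [m+kn]%n≡m%n; _%_; _/_; m%n%n≡m%n; m%n<n; m*n%n≡0; m<n⇒m%n≡m; m≡m%n+[m/n]*n; n%n≡0)
open import Data.Nat.Divisibility using (*-cancelʳ-∣; *-cancelˡ-∣; *-monoʳ-∣; *-monoˡ-∣; *-pres-∣; >⇒∤; _∣0; _∣?_; _∣_; divides; m%n≡0⇒n∣m; m∣m*n; n∣m*n; n∣m⇒m%n≡0; ∣-antisym; ∣-refl; ∣-reflexive; ∣-trans; ∣1⇒≡1; ∣m+n∣m⇒∣n; ∣m⇒∣m*n; ∣m∣n⇒∣m+n; ∣n⇒∣m*n; ∣⇒≤)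
open import Data.Nat.GCD using (gcd; gcd-GCD; gcd[m,n]∣m; gcd[m,n]∣n; gcd[m,n]≡0⇒m≡0; module Bézout)
open import Data.Nat.Induction using (<-rec; <-wellFounded)
open import Data.Nat.ListAction using (product; sum)
open import Data.Nat.Primality using (Prime; euclidsLemma; prime?; prime⇒irreducible; prime⇒nonTrivial; prime⇒nonZero; ¬prime[1])
open import Data.Nat.Primality.Factorisation using (PrimeFactorisation; factorise)
import Data.Nat.Properties as ℕP
open import Data.Nat.Solver using (module +-*-Solver)
open import Data.Product using (_,_; _×_; proj₁; proj₂; Σ; ∃; ∃₂)
open import Data.Sum using (_⊎_; inj₁; inj₂)
open import Data.Unit using (tt; ⊤)
open import Data.Vec.Base as Vec using (Vec; []; _∷_; lookup; tabulate)
open import Data.Vec.Properties as VecP using ([]=⇒lookup; lookup-replicate; lookup-zipWith; lookup⇒[]=; lookup∘tabulate; tabulate-cong; tabulate∘lookup)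
open import Function using (_∘_; case_of_; id)
open import Function.Bundles using (Equivalence; _⇔_; mk⇔)
open import Induction.WellFounded using (Acc; acc)
open import Relation.Binary.Definitions using (DecidableEquality; tri<; tri>; tri≈)
open import Relation.Binary.PropositionalEquality hiding (J)
open import Relation.Nullary using (Dec; contradiction; does; no; yes; ¬?; ¬_)
open import Relation.Nullary.Decidable using (T?; _×-dec_; _→-dec_; _⊎-dec_; decidable-stable; fromWitness; map′; toWitness; ⌊_⌋)

-- What shapes the existence half is the choice of the cut. Blocks are intervals only for a cut in
-- `J`, yet a recoded structure knows neither `e` nor `J`; its cut has to be read off the structure
-- itself and has to lie in every `J` containing its cyclic descents. A drop of `k` serves: inside a
-- block `k` is weakly increasing, so a drop can only be a block end. Drops also make the descent
-- sets nonempty, and rises make them proper.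
--
-- The counts are used twice: the cut at n gives the distribution of `Des`, while conjugation by the
-- rotation, which preserves the class, moves the cut and gives the invariance of `cD` under `sh`.
-- Equal fibre sizes then yield both bijections.
--
-- In the nonexistence half, congruences modulo Q² for one large Q stand in for a double zero at Q =
-- 0 of a polynomial in Q. An extension contributes one factor Q from the rising factorials and
-- another from averaging over the n rotations; the Burnside count leaves a linear term with
-- coefficient ± `K`.

private variable
  A₁ A₂ A₃ : Set
  n : ℕ

-- Iteration and permutations of finite sets

Inj : (A₁ → A₂) → Set
Inj f = ∀ {x y} → f x ≡ f y → x ≡ y

iter-suc : (f : A₁ → A₁) (k : ℕ) (x : A₁) → iter f (suc k) x ≡ iter f k (f x)
iter-suc f zero    x = refl
iter-suc f (suc k) x = cong f (iter-suc f k x)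

iter-+ : (f : A₁ → A₁) (a b : ℕ) (x : A₁) → iter f (a + b) x ≡ iter f a (iter f b x)
iter-+ f zero    b x = refl
iter-+ f (suc a) b x = cong f (iter-+ f a b x)

iter-* : (f : A₁ → A₁) (a b : ℕ) (x : A₁) → iter f (a * b) x ≡ iter (iter f b) a x
iter-* f zero    b x = refl
iter-* f (suc a) b x = trans (iter-+ f b (a * b) x) (cong (iter f b) (iter-* f a b x))

iter-id : {f : A₁ → A₁} {x : A₁} → f x ≡ x → ∀ k → iter f k x ≡ x
iter-id eq zero    = refl
iter-id {f = f} eq (suc k) = trans (cong f (iter-id eq k)) eq

iter-period : {f : A₁ → A₁} {x : A₁} (p : ℕ) → iter f p x ≡ x → ∀ k → iter f (k * p) x ≡ x
iter-period {f = f} {x} p eq k = trans (iter-* f k p x) (iter-id eq k)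

iter-% : {f : A₁ → A₁} {x : A₁} (p : ℕ) .{{_ : NonZero p}} → iter f p x ≡ x → ∀ i → iter f i x ≡ iter f (i % p) x
iter-% {f = f} {x} p eq i = trans (cong (λ j → iter f j x) (m≡m%n+[m/n]*n i p))
  (trans (iter-+ f (i % p) ((i / p) * p) x) (cong (iter f (i % p)) (iter-period p eq (i / p))))

iter-inj : {f : A₁ → A₁} → Inj f → ∀ k → Inj (iter f k)
iter-inj inj zero    eq = eq
iter-inj inj (suc k) eq = iter-inj inj k (inj eq)

iter-cong : {f g : A₁ → A₁} → (∀ x → f x ≡ g x) → ∀ k x → iter f k x ≡ iter g k x
iter-cong eq zero    x = refl
iter-cong {f = f} eq (suc k) x = trans (cong f (iter-cong eq k x)) (eq _)

iter-conj : {f : A₁ → A₁} {g : A₂ → A₂} (φ : A₁ → A₂) → (∀ x → φ (f x) ≡ g (φ x)) → ∀ k x → φ (iter f k x) ≡ iter g k (φ x)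
iter-conj φ eq zero    x = refl
iter-conj {g = g} φ eq (suc k) x = trans (eq _) (cong g (iter-conj φ eq k x))

iter-comm : (f : A₁ → A₁) (a b : ℕ) (x : A₁) → iter f a (iter f b x) ≡ iter f b (iter f a x)
iter-comm f a b x = trans (sym (iter-+ f a b x)) (trans (cong (λ j → iter f j x) (ℕP.+-comm a b)) (iter-+ f b a x))

abstract
  inj⇒surj : {φ : Fin n → Fin n} → Inj φ → ∀ y → ∃ λ x → φ x ≡ y
  inj⇒surj {n} {φ} inj y with any? (λ x → φ x FinP.≟ y)
  ... | yes p = p
  inj⇒surj {suc n} {φ} inj y | no ¬p = ⊥-elim (ℕP.1+n≰n (injective⇒≤ {f = g} g-inj))
    where
    ne : ∀ x → y ≢ φ x
    ne x eq = ¬p (x , sym eq)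
    g : Fin (suc n) → Fin n
    g x = punchOut (ne x)
    g-inj : Inj g
    g-inj {x} {x′} eq = inj (punchOut-injective (ne x) (ne x′) eq)

module Inverse {φ : Fin n → Fin n} (inj : Inj φ) where
  inv : Fin n → Fin n
  inv y = proj₁ (inj⇒surj inj y)
  rinv : ∀ y → φ (inv y) ≡ y
  rinv y = proj₂ (inj⇒surj inj y)
  linv : ∀ x → inv (φ x) ≡ x
  linv x = inj (rinv (φ x))
  inv-inj : Inj inv
  inv-inj {x} {y} eq = trans (sym (rinv x)) (trans (cong φ eq) (rinv y))

-- Counting with indicator sums and enumerations

ind : Dec A₁ → ℕ
ind (yes _) = 1
ind (no  _) = 0

∑ : List A₁ → (A₁ → ℕ) → ℕ
∑ []       f = 0
∑ (x ∷ xs) f = f x + ∑ xs f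

# : {P : A₁ → Set} → (∀ a → Dec (P a)) → List A₁ → ℕ
# P? xs = ∑ xs (λ a → ind (P? a))

ind-cong : {P : Set} {Q : Set} (p : Dec P) (q : Dec Q) → (P → Q) → (Q → P) → ind p ≡ ind q
ind-cong (yes p) (yes q) f g = refl
ind-cong (yes p) (no ¬q) f g = ⊥-elim (¬q (f p))
ind-cong (no ¬p) (yes q) f g = ⊥-elim (¬p (g q))
ind-cong (no ¬p) (no ¬q) f g = refl

ind-mono : {P : Set} {Q : Set} (p : Dec P) (q : Dec Q) → (P → Q) → ind p ≤ ind q
ind-mono (yes p) (yes q) f = s≤s z≤n
ind-mono (yes p) (no ¬q) f = ⊥-elim (¬q (f p))
ind-mono (no ¬p) q       f = z≤n

∑-cong : (xs : List A₁) {f g : A₁ → ℕ} → (∀ x → f x ≡ g x) → ∑ xs f ≡ ∑ xs g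
∑-cong []       eq = refl
∑-cong (x ∷ xs) eq = cong₂ _+_ (eq x) (∑-cong xs eq)

∑-mono : (xs : List A₁) {f g : A₁ → ℕ} → (∀ x → f x ≤ g x) → ∑ xs f ≤ ∑ xs g
∑-mono []       le = z≤n
∑-mono (x ∷ xs) le = ℕP.+-mono-≤ (le x) (∑-mono xs le)

∑-mono-< : {xs : List A₁} {f g : A₁ → ℕ} {a : A₁} → a ∈ xs → (∀ x → f x ≤ g x) → f a < g a → ∑ xs f < ∑ xs g
∑-mono-< {xs = x ∷ xs} (here refl) le lt = ℕP.+-mono-<-≤ lt (∑-mono xs le)
∑-mono-< {xs = x ∷ xs} (there a∈)  le lt = ℕP.+-mono-≤-< (le x) (∑-mono-< a∈ le lt)

∑-const : (xs : List A₁) (c : ℕ) → ∑ xs (λ _ → c) ≡ length xs * c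
∑-const []       c = refl
∑-const (x ∷ xs) c = cong (c +_) (∑-const xs c)

∑-+ : (xs : List A₁) (f g : A₁ → ℕ) → ∑ xs (λ x → f x + g x) ≡ ∑ xs f + ∑ xs g
∑-+ []       f g = refl
∑-+ (x ∷ xs) f g rewrite ∑-+ xs f g = lem (f x) (g x) (∑ xs f) (∑ xs g)
  where
  lem : ∀ a b c d → a + b + (c + d) ≡ a + c + (b + d)
  lem a b c d = trans (ℕP.+-assoc a b (c + d)) (trans (cong (a +_) (trans (sym (ℕP.+-assoc b c d)) (trans (cong (_+ d) (ℕP.+-comm b c)) (ℕP.+-assoc c b d)))) (sym (ℕP.+-assoc a c (b + d))))

∑-*ʳ : (xs : List A₁) (f : A₁ → ℕ) (c : ℕ) → ∑ xs (λ x → c * f x) ≡ c * ∑ xs f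
∑-*ʳ []       f c = sym (ℕP.*-zeroʳ c)
∑-*ʳ (x ∷ xs) f c = trans (cong (c * f x +_) (∑-*ʳ xs f c)) (sym (ℕP.*-distribˡ-+ c (f x) (∑ xs f)))

∑-0 : (xs : List A₁) {f : A₁ → ℕ} → (∀ x → f x ≡ 0) → ∑ xs f ≡ 0
∑-0 []       eq = refl
∑-0 (x ∷ xs) eq = cong₂ _+_ (eq x) (∑-0 xs eq)

∑-swap : (xs : List A₁) (ys : List A₂) (f : A₁ → A₂ → ℕ) → ∑ xs (λ x → ∑ ys (f x)) ≡ ∑ ys (λ y → ∑ xs (λ x → f x y))
∑-swap []       ys f = sym (∑-0 ys (λ _ → refl))
∑-swap (x ∷ xs) ys f = trans (cong (∑ ys (f x) +_) (∑-swap xs ys f)) (sym (∑-+ ys (f x) _))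

∑-++ : (xs ys : List A₁) (f : A₁ → ℕ) → ∑ (xs ++ ys) f ≡ ∑ xs f + ∑ ys f
∑-++ []       ys f = refl
∑-++ (x ∷ xs) ys f = trans (cong (f x +_) (∑-++ xs ys f)) (sym (ℕP.+-assoc (f x) _ _))

∑-map : (g : A₁ → A₂) (xs : List A₁) (f : A₂ → ℕ) → ∑ (map g xs) f ≡ ∑ xs (f ∘ g)
∑-map g []       f = refl
∑-map g (x ∷ xs) f = cong (f (g x) +_) (∑-map g xs f)

∑-× : (xs : List A₁) (ys : List A₂) (f : A₁ × A₂ → ℕ) → ∑ (cartesianProduct xs ys) f ≡ ∑ xs (λ x → ∑ ys (λ y → f (x , y)))
∑-× []       ys f = refl
∑-× (x ∷ xs) ys f = trans (∑-++ (map (x ,_) ys) _ f) (cong₂ _+_ (∑-map (x ,_) ys f) (∑-× xs ys f))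

#≡length : {P : A₁ → Set} (P? : ∀ a → Dec (P a)) (xs : List A₁) → # P? xs ≡ length (filter P? xs)
#≡length P? []       = refl
#≡length P? (x ∷ xs) with P? x
... | yes _ = cong suc (#≡length P? xs)
... | no  _ = #≡length P? xs

unique-⊆⇒length≤ : {xs ys : List A₁} → Unique xs → (∀ {x} → x ∈ xs → x ∈ ys) → length xs ≤ length ys
unique-⊆⇒length≤ {xs = []}     u sub = z≤n
unique-⊆⇒length≤ {xs = x ∷ xs} (x∉ ∷ u) sub with as , bs , refl ← ∈-∃++ (sub (here refl)) =
  subst (suc (length xs) ≤_) (sym lemma) (s≤s (unique-⊆⇒length≤ u sub′))
  where
  lemma : length (as ++ x ∷ bs) ≡ suc (length (as ++ bs))
  lemma = trans (ListP.length-++ as) (trans (ℕP.+-suc (length as) (length bs)) (cong suc (sym (ListP.length-++ as))))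
  sub′ : ∀ {z} → z ∈ xs → z ∈ as ++ bs
  sub′ z∈ with ∈-++⁻ as (sub (there z∈))
  ... | inj₁ z∈as = ∈-++⁺ˡ z∈as
  ... | inj₂ (here refl) = contradiction refl (All.lookup x∉ z∈)
  ... | inj₂ (there z∈bs) = ∈-++⁺ʳ as z∈bs

map-unique : {f : A₁ → A₂} {xs : List A₁} → (∀ {x y} → x ∈ xs → y ∈ xs → f x ≡ f y → x ≡ y) → Unique xs → Unique (map f xs)
map-unique {xs = []}     inj [] = []
map-unique {f = f} {xs = x ∷ xs} inj (x∉ ∷ u) =
  AllP.map⁺ (All.tabulate λ y∈ eq → All.lookup x∉ y∈ (inj (here refl) (there y∈) eq))
  ∷ map-unique (λ p q → inj (there p) (there q)) u

record Enum (A₁ : Set) : Set where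
  field
    list     : List A₁
    complete : ∀ a → a ∈ list
    unique   : Unique list
open Enum public

Enum-Fin : ∀ n → Enum (Fin n)
Enum-Fin n = record { list = allFin n ; complete = ∈-allFin ; unique = UniqueP.allFin⁺ n }

Enum-× : Enum A₁ → Enum A₂ → Enum (A₁ × A₂)
Enum-× a b = record
  { list     = cartesianProduct (list a) (list b)
  ; complete = λ (x , y) → ∈-cartesianProduct⁺ (complete a x) (complete b y)
  ; unique   = UniqueP.cartesianProduct⁺ (unique a) (unique b) }

cons : A₁ × Vec A₁ n → Vec A₁ (suc n)
cons (x , xs) = x ∷ xs

cons-inj : Inj (cons {A₁ = A₁} {n = n})
cons-inj {x = _ , _} {_ , _} refl = refl

Enum-Vec : Enum A₁ → ∀ n → Enum (Vec A₁ n)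
Enum-Vec a zero    = record { list = [] ∷ [] ; complete = λ { [] → here refl } ; unique = [] ∷ [] }
Enum-Vec a (suc n) = record
  { list     = map cons (list (Enum-× a (Enum-Vec a n)))
  ; complete = λ { (x ∷ xs) → ∈-map⁺ cons (complete (Enum-× a (Enum-Vec a n)) (x , xs)) }
  ; unique   = UniqueP.map⁺ cons-inj (unique (Enum-× a (Enum-Vec a n))) }

module _ {P : A₁ → Set} {Q : A₂ → Set} (P? : ∀ a → Dec (P a)) (Q? : ∀ b → Dec (Q b)) (EA : Enum A₁) (EB : Enum A₂) where

  #-inj-≤ : (F : A₁ → A₂) → (∀ a → P a → Q (F a)) → (∀ {a a′} → P a → P a′ → F a ≡ F a′ → a ≡ a′) →
            # P? (list EA) ≤ # Q? (list EB)
  #-inj-≤ F F-ok F-inj = subst₂ _≤_ (trans (ListP.length-map F (filter P? (list EA))) (sym (#≡length P? (list EA)))) (sym (#≡length Q? (list EB)))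
    (unique-⊆⇒length≤
      (map-unique (λ p q → F-inj (proj₂ (∈-filter⁻ P? {xs = list EA} p)) (proj₂ (∈-filter⁻ P? {xs = list EA} q))) (UniqueP.filter⁺ P? (unique EA)))
      λ z∈ → case ∈-map⁻ F z∈ of λ { (a , a∈ , refl) → ∈-filter⁺ Q? (complete EB (F a)) (F-ok a (proj₂ (∈-filter⁻ P? {xs = list EA} a∈))) })

module _ {P : A₁ → Set} {Q : A₂ → Set} (P? : ∀ a → Dec (P a)) (Q? : ∀ b → Dec (Q b)) (EA : Enum A₁) (EB : Enum A₂) where

  #-bij : (F : A₁ → A₂) (G : A₂ → A₁) → (∀ a → P a → Q (F a)) → (∀ b → Q b → P (G b)) →
          (∀ a → P a → G (F a) ≡ a) → (∀ b → Q b → F (G b) ≡ b) → # P? (list EA) ≡ # Q? (list EB)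
  #-bij F G F-ok G-ok GF FG = ℕP.≤-antisym
    (#-inj-≤ P? Q? EA EB F F-ok (λ {a} {a′} p p′ eq → trans (sym (GF a p)) (trans (cong G eq) (GF a′ p′))))
    (#-inj-≤ Q? P? EB EA G G-ok (λ {b} {b′} q q′ eq → trans (sym (FG b q)) (trans (cong F eq) (FG b′ q′))))

#-cong : {P Q : A₁ → Set} (P? : ∀ a → Dec (P a)) (Q? : ∀ a → Dec (Q a)) (xs : List A₁) →
         (∀ a → P a → Q a) → (∀ a → Q a → P a) → # P? xs ≡ # Q? xs
#-cong P? Q? xs f g = ∑-cong xs (λ a → ind-cong (P? a) (Q? a) (f a) (g a))

-- Ranking and sorted arrangements

module Rank (K : Fin n → ℕ) (K-inj : Inj K) where
  private
    below : Fin n → ℕ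
    below x = # (λ y → K y ℕ.<? K x) (allFin n)
    below-mono : ∀ {x y} → K x < K y → below x < below y
    below-mono {x} {y} lt = ∑-mono-< {a = x} (∈-allFin x)
      (λ z → ind-mono (K z ℕ.<? K x) (K z ℕ.<? K y) (λ l → ℕP.<-trans l lt)) strict
      where
      strict : ind (K x ℕ.<? K x) < ind (K x ℕ.<? K y)
      strict with K x ℕ.<? K x | K x ℕ.<? K y
      ... | yes l | _     = ⊥-elim (ℕP.<-irrefl refl l)
      ... | no  _ | yes _ = s≤s z≤n
      ... | no  _ | no ¬l = ⊥-elim (¬l lt)
    below<n : ∀ x → below x < n
    below<n x = subst (below x <_) (trans (∑-const (allFin n) 1) (trans (ℕP.*-identityʳ _) (ListP.length-tabulate id)))
      (∑-mono-< {a = x} (∈-allFin x) (λ z → ind≤1 (K z ℕ.<? K x)) strict)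
      where
      ind≤1 : {P : Set} (p : Dec P) → ind p ≤ 1
      ind≤1 (yes _) = s≤s z≤n
      ind≤1 (no _)  = z≤n
      strict : ind (K x ℕ.<? K x) < 1
      strict with K x ℕ.<? K x
      ... | yes l = ⊥-elim (ℕP.<-irrefl refl l)
      ... | no _  = s≤s z≤n

  abstract
    rank : Fin n → Fin n
    rank x = fromℕ< (below<n x)

    rank-mono : ∀ {x y} → K x < K y → rank x Fin.< rank y
    rank-mono {x} {y} lt = subst₂ _<_ (sym (toℕ-fromℕ< (below<n x))) (sym (toℕ-fromℕ< (below<n y))) (below-mono lt)

    rank-inj : Inj rank
    rank-inj {x} {y} eq with ℕP.<-cmp (K x) (K y)
    ... | tri< lt _ _ = ⊥-elim (ℕP.<-irrefl (cong toℕ eq) (rank-mono lt))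
    ... | tri≈ _ e _  = K-inj e
    ... | tri> _ _ gt = ⊥-elim (ℕP.<-irrefl (cong toℕ (sym eq)) (rank-mono gt))

module SortedUnique {ρ : Fin n → Fin n} (ρ-inj : Inj ρ) where
  Mono : (Fin n → ℕ) → Set
  Mono u = ∀ {x y} → ρ x Fin.< ρ y → u x ≤ u y

  private
    mono≤ : ∀ {u} → Mono u → ∀ {x y} → ρ x Fin.≤ ρ y → u x ≤ u y
    mono≤ {u} mono le with ℕP.m≤n⇒m<n∨m≡n le
    ... | inj₁ lt = mono lt
    ... | inj₂ eq = ℕP.≤-reflexive (cong u (ρ-inj (toℕ-injective eq)))

    -- Pigeonhole. If `u x < v x`, then `θ` sends every element up to `x` to one whose `v`-value is
    -- at most `u x`, hence to a place strictly before `x`; that squeezes k + 1 elements into k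
    -- places.
    half : ∀ {u v} → Mono u → Mono v → {θ : Fin n → Fin n} → Inj θ → (∀ x → v (θ x) ≡ u x) → ∀ x → v x ≤ u x
    half {u} {v} mu mv {θ} θ-inj eq x = ℕP.≮⇒≥ λ u<v →
      let open Inverse ρ-inj
          at : Fin (suc (toℕ (ρ x))) → Fin n
          at j = fromℕ< (ℕP.<-≤-trans (toℕ<n j) (toℕ<n (ρ x)))
          at-toℕ : ∀ j → toℕ (at j) ≡ toℕ j
          at-toℕ j = toℕ-fromℕ< (ℕP.<-≤-trans (toℕ<n j) (toℕ<n (ρ x)))
          el : Fin (suc (toℕ (ρ x))) → Fin n
          el j = inv (at j)
          u≤ : ∀ j → u (el j) ≤ u x
          u≤ j = mono≤ mu (subst (ℕ._≤ toℕ (ρ x)) (sym (trans (cong toℕ (rinv (at j))) (at-toℕ j))) (ℕP.≤-pred (toℕ<n j)))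
          lt : ∀ j → ρ (θ (el j)) Fin.< ρ x
          lt j = ℕP.≰⇒> λ le → ℕP.<-irrefl refl
            (ℕP.<-≤-trans u<v (ℕP.≤-trans (mono≤ mv le) (ℕP.≤-trans (ℕP.≤-reflexive (eq (el j))) (u≤ j))))
          h : Fin (suc (toℕ (ρ x))) → Fin (toℕ (ρ x))
          h j = fromℕ< (lt j)
          h-inj : Inj h
          h-inj {i} {j} e = toℕ-injective (trans (sym (at-toℕ i)) (trans (cong toℕ
             (inv-inj (θ-inj (ρ-inj (toℕ-injective (trans (sym (toℕ-fromℕ< (lt i))) (trans (cong toℕ e) (toℕ-fromℕ< (lt j)))))))))
             (at-toℕ j)))
      in ℕP.1+n≰n (injective⇒≤ {f = h} h-inj)

  -- A multiset of values has only one weakly increasing arrangement: `θ` matches the two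
  -- arrangements, and its inverse supplies the other inequality. The uniqueness of every recoding
  -- below rests on this.
  sorted-unique : ∀ {u v} → Mono u → Mono v → {θ : Fin n → Fin n} → Inj θ → (∀ x → v (θ x) ≡ u x) → ∀ x → u x ≡ v x
  sorted-unique {u} {v} mu mv {θ} θ-inj eq x = ℕP.≤-antisym
    (half mv mu inv-inj (λ y → trans (sym (eq (inv y))) (cong v (rinv y))) x)
    (half mu mv θ-inj eq x)
    where open Inverse θ-inj

  monotone⇒id : {θ : Fin n → Fin n} → Inj θ → (∀ {x y} → ρ x Fin.< ρ y → ρ (θ x) Fin.< ρ (θ y)) → ∀ x → θ x ≡ x
  monotone⇒id {θ} θ-inj mono x = ρ-inj (toℕ-injective
    (sorted-unique {u = λ x → toℕ (ρ (θ x))} {v = λ x → toℕ (ρ x)} (ℕP.<⇒≤ ∘ mono) ℕP.<⇒≤ θ-inj (λ _ → refl) x))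

-- The cyclic order

module Cyc (N : ℕ) where
  E : Set
  E = Fin (suc N)

  last : E
  last = fromℕ N

  predMod-inj : Inj (predMod {suc N})
  predMod-inj {zero}  {zero}  eq = refl
  predMod-inj {zero}  {suc y} eq = ⊥-elim (FinP.fromℕ≢inject₁ eq)
  predMod-inj {suc x} {zero}  eq = ⊥-elim (FinP.fromℕ≢inject₁ (sym eq))
  predMod-inj {suc x} {suc y} eq = cong suc (inject₁-injective eq)

  open Inverse predMod-inj public using () renaming (inv to next; rinv to pred-next; linv to next-pred; inv-inj to next-inj)

  toℕ-next : ∀ x → x ≢ last → toℕ (next x) ≡ suc (toℕ x)
  toℕ-next x x≢ with next x | pred-next x
  ... | zero  | eq = ⊥-elim (x≢ (sym eq))
  ... | suc y | eq = cong suc (trans (sym (toℕ-inject₁ y)) (cong toℕ eq))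

  next-last : next last ≡ zero
  next-last = predMod-inj (pred-next last)

  iter-pred-zero : ∀ k (x : E) → toℕ x ≡ k → iter predMod k x ≡ zero
  iter-pred-zero zero    zero    eq = refl
  iter-pred-zero (suc k) (suc x) eq = trans (iter-suc predMod k (suc x)) (iter-pred-zero k (inject₁ x) (trans (toℕ-inject₁ x) (ℕP.suc-injective eq)))

  iter-next-zero : ∀ k (x : E) → toℕ x ≡ k → iter next k zero ≡ x
  iter-next-zero zero    zero    eq = refl
  iter-next-zero (suc k) (suc x) eq = trans (cong next (iter-next-zero k (inject₁ x) (trans (toℕ-inject₁ x) (ℕP.suc-injective eq)))) (next-pred (suc x))

  pred-comm-next : ∀ k x → iter predMod k (next x) ≡ next (iter predMod k x)
  pred-comm-next zero    x = refl
  pred-comm-next (suc k) x = trans (cong predMod (pred-comm-next k x)) (trans (pred-next _) (sym (next-pred _)))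

  iter-pred-n : ∀ x → iter predMod (suc N) x ≡ x
  iter-pred-n x = trans (cong (iter predMod (suc N)) (sym (iter-next-zero (toℕ x) x refl)))
    (trans (go (toℕ x)) (iter-next-zero (toℕ x) x refl))
    where
    z : iter predMod (suc N) zero ≡ zero
    z = trans (iter-suc predMod N zero) (iter-pred-zero N last (toℕ-fromℕ N))
    go : ∀ k → iter predMod (suc N) (iter next k zero) ≡ iter next k zero
    go zero    = z
    go (suc k) = trans (pred-comm-next (suc N) (iter next k zero)) (cong next (go k))

  -- The position of x when the circle is read starting just after e.
  abstract
    ρ : E → E → E
    ρ e x = iter predMod (suc (toℕ e)) x

    ρ-inj : ∀ e → Inj (ρ e)
    ρ-inj e = iter-inj predMod-inj (suc (toℕ e))

    ρ-self : ∀ e → ρ e e ≡ last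
    ρ-self e = cong predMod (iter-pred-zero (toℕ e) e refl)

    ρ-last : ∀ x → ρ last x ≡ x
    ρ-last x = trans (cong (λ k → iter predMod (suc k) x) (toℕ-fromℕ N)) (iter-pred-n x)

    ρ-next : ∀ e {x} → x ≢ e → toℕ (ρ e (next x)) ≡ suc (toℕ (ρ e x))
    ρ-next e {x} x≢e = trans (cong toℕ (pred-comm-next (suc (toℕ e)) x))
      (toℕ-next (ρ e x) (λ eq → x≢e (ρ-inj e (trans eq (sym (ρ-self e))))))

    ρ-next-next : ∀ e x → ρ (next e) (next x) ≡ ρ e x
    ρ-next-next e x with e FinP.≟ last
    ... | no e≢ = trans (cong (λ k → iter predMod (suc k) (next x)) (toℕ-next e e≢))
                   (trans (iter-suc predMod (suc (toℕ e)) (next x)) (cong (iter predMod (suc (toℕ e))) (pred-next x)))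
    ... | yes refl = trans (cong (λ e → ρ e (next x)) next-last) (trans (pred-next x) (sym (ρ-last x)))

  ρ≤N : ∀ e x → toℕ (ρ e x) ≤ N
  ρ≤N e x = ℕP.≤-pred (toℕ<n (ρ e x))

  reach : ∀ e t x → t + toℕ (ρ e x) ≡ N → iter next t x ≡ e
  reach e zero    x eq = ρ-inj e (toℕ-injective (trans eq (trans (sym (toℕ-fromℕ N)) (cong toℕ (sym (ρ-self e))))))
  reach e (suc t) x eq = trans (iter-suc next t x) (reach e t (next x) (trans (cong (t +_) (ρ-next e x≢e)) (trans (ℕP.+-suc t _) eq)))
    where
    x≢e : x ≢ e
    x≢e refl = ℕP.m≢1+n+m N (sym (trans (cong (λ z → suc (t + z)) (trans (sym (toℕ-fromℕ N)) (cong toℕ (sym (ρ-self e))))) eq))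

  seek : (E → Bool) → ℕ → E → E
  seek J zero    x = x
  seek J (suc k) x = if J x then x else seek J k (next x)

  seek-stable : ∀ J k t x → t < k → J (iter next t x) ≡ true → seek J k x ≡ seek J (suc k) x
  seek-stable J (suc k) t x t<k eq with J x in eqx
  ... | true = refl
  seek-stable J (suc k) zero    x t<k eq | false with () ← trans (sym eqx) eq
  seek-stable J (suc k) (suc t) x t<k eq | false =
    seek-stable J k t (next x) (ℕP.≤-pred t<k) (trans (cong J (sym (iter-suc next t x))) eq)

  abstract
    -- The first member of `J` at or after `x` on the circle. It names the block of `x` and serves
    -- as the letter of `x`.
    blk : (E → Bool) → E → E
    blk J x = seek J (suc N) x

    blk-here : ∀ J x → J x ≡ true → blk J x ≡ x
    blk-here J x eq rewrite eq = refl

  module Block (J : E → Bool) (e : E) (e∈J : J e ≡ true) where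

    notJ⇒≢ : ∀ {x} → J x ≡ false → x ≢ e
    notJ⇒≢ eq refl with () ← trans (sym eq) e∈J

    abstract
      blk-next : ∀ {x} → J x ≡ false → blk J x ≡ blk J (next x)
      blk-next {x} eq rewrite eq = seek-stable J N t (next x) t<N (trans (cong J (reach e t (next x) t-eq)) e∈J)
        where
        t : ℕ
        t = N ∸ toℕ (ρ e (next x))
        t-eq : t + toℕ (ρ e (next x)) ≡ N
        t-eq = ℕP.m∸n+n≡m (ρ≤N e (next x))
        t<N : t < N
        t<N = ℕP.∸-monoʳ-< {o = 0} (subst (0 <_) (sym (ρ-next e (notJ⇒≢ eq))) (s≤s z≤n)) (ρ≤N e (next x))

    private
      -- Induction against the direction of the circle: the distance to `e` shrinks at each step,
      -- and the walk stops at `e` at the latest because `e` lies in `J`.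
      back : (P : E → Set) → (∀ x → J x ≡ true → P x) → (∀ x → J x ≡ false → P (next x) → P x) → ∀ x → P x
      back P hit step x = go (N ∸ toℕ (ρ e x)) x (ℕP.m∸n+n≡m (ρ≤N e x))
        where
        go : ∀ t x → t + toℕ (ρ e x) ≡ N → P x
        go t x eq with J x in eqx
        ... | true = hit x eqx
        go zero    x eq | false = ⊥-elim (notJ⇒≢ eqx (reach e 0 x eq))
        go (suc t) x eq | false = step x eqx (go t (next x) (trans (cong (t +_) (ρ-next e (notJ⇒≢ eqx))) (trans (ℕP.+-suc t _) eq)))

    blk∈J : ∀ x → J (blk J x) ≡ true
    blk∈J = back (λ x → J (blk J x) ≡ true) (λ x eq → trans (cong J (blk-here J x eq)) eq)
      (λ x eq ih → trans (cong J (blk-next eq)) ih)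

    blk-≥ : ∀ x → ρ e x Fin.≤ ρ e (blk J x)
    blk-≥ = back (λ x → ρ e x Fin.≤ ρ e (blk J x)) (λ x eq → ℕP.≤-reflexive (cong (toℕ ∘ ρ e) (sym (blk-here J x eq))))
      (λ x eq ih → ℕP.<⇒≤ (subst₂ _≤_ (ρ-next e (notJ⇒≢ eq)) (cong (toℕ ∘ ρ e) (sym (blk-next eq))) ih))

    private
      fwd : ∀ {x y} → J x ≡ false → ρ e x Fin.< ρ e y → next x ≡ y ⊎ ρ e (next x) Fin.< ρ e y
      fwd {x} {y} eq lt with ℕP.m≤n⇒m<n∨m≡n (subst (_≤ toℕ (ρ e y)) (sym (ρ-next e (notJ⇒≢ eq))) lt)
      ... | inj₁ l = inj₂ l
      ... | inj₂ q = inj₁ (ρ-inj e (toℕ-injective q))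

    blk-mono : ∀ x {y} → ρ e x Fin.< ρ e y → ρ e (blk J x) Fin.≤ ρ e (blk J y)
    blk-mono = back (λ x → ∀ {y} → ρ e x Fin.< ρ e y → ρ e (blk J x) Fin.≤ ρ e (blk J y))
      (λ x eq lt → subst (λ z → toℕ (ρ e z) ≤ _) (sym (blk-here J x eq)) (ℕP.≤-trans (ℕP.<⇒≤ lt) (blk-≥ _)))
      (λ x eq ih lt → subst (λ z → toℕ (ρ e z) ≤ _) (sym (blk-next eq)) (case fwd eq lt of λ where
         (inj₁ refl) → ℕP.≤-refl
         (inj₂ l)    → ih l))

    -- Two points of one block are joined by steps that never leave a member of `J`, so a transitive
    -- relation only has to be checked on such steps.
    blk-chain : (R : E → E → Set) → (∀ {x y z} → R x y → R y z → R x z) → (∀ {i} → J i ≡ false → R i (next i)) →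
      ∀ x {y} → blk J x ≡ blk J y → ρ e x Fin.< ρ e y → R x y
    blk-chain R tr st = back (λ x → ∀ {y} → blk J x ≡ blk J y → ρ e x Fin.< ρ e y → R x y)
      (λ x eq {y} b lt → ⊥-elim (ℕP.<-irrefl refl (ℕP.<-≤-trans lt (ℕP.≤-trans (blk-≥ y)
         (ℕP.≤-reflexive (cong (toℕ ∘ ρ e) (trans (sym b) (blk-here J x eq))))))))
      (λ x eq ih b lt → case fwd eq lt of λ where
         (inj₁ refl) → st eq
         (inj₂ l)    → tr (st eq) (ih (trans (sym (blk-next eq)) b) l))

    step-< : ∀ {i} → J i ≡ false → ρ e i Fin.< ρ e (next i)
    step-< eq = ℕP.≤-reflexive (sym (ρ-next e (notJ⇒≢ eq)))

  -- A step inside a block crosses no cut in `J`, so all such cuts order the block alike. This is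
  -- what allows the given cut to be exchanged for the one read off a structure.
  blk-order : ∀ J {e d} → J e ≡ true → J d ≡ true → ∀ {x y} → blk J x ≡ blk J y → ρ e x Fin.< ρ e y → ρ d x Fin.< ρ d y
  blk-order J {e} {d} e∈ d∈ {x} {y} = Block.blk-chain J e e∈ (λ x y → ρ d x Fin.< ρ d y) ℕP.<-trans (Block.step-< J d d∈) x

-- Relabelling by itineraries

digit-< : ∀ {a b s t W} → s < W → a < b → a * W + s < b * W + t
digit-< {a} {b} {s} {t} {W} s<W a<b = ℕP.<-≤-trans (ℕP.+-monoʳ-< (a * W) s<W)
  (ℕP.≤-trans (ℕP.≤-reflexive (ℕP.+-comm (a * W) W)) (ℕP.≤-trans (ℕP.*-monoˡ-≤ W a<b) (ℕP.m≤m+n (b * W) t)))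

digit-≡ : ∀ {a b s t W} → s < W → t < W → a * W + s ≡ b * W + t → a ≡ b × s ≡ t
digit-≡ {a} {b} {s} {t} {W} s<W t<W eq with ℕP.<-cmp a b
... | tri< l _ _ = ⊥-elim (ℕP.<-irrefl eq (digit-< s<W l))
... | tri> _ _ g = ⊥-elim (ℕP.<-irrefl (sym eq) (digit-< t<W g))
... | tri≈ _ refl _ = refl , ℕP.+-cancelˡ-≡ (a * W) s t eq

module Relabelling {N : ℕ} (ρ : Fin (suc N) → Fin (suc N)) (ρ-inj : Inj ρ) (l : ℕ) (Bd : ℕ)
                   (π : Fin (suc N) → Fin (suc N)) (c : Fin (suc N) → ℕ) where
  private
    E : Set
    E = Fin (suc N)

  -- The itinerary of `x` under `π` as an `l`-digit number in base `Bd`; for colours below `Bd`,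
  -- comparing numbers is comparing itineraries lexicographically.
  Key : ℕ → E → ℕ
  Key zero    x = 0
  Key (suc l) x = c x * Bd ^ l + Key l (π x)

  FullKey : E → ℕ
  FullKey x = Key (suc l) x * suc N + toℕ (ρ x)

  FullKey-inj : Inj FullKey
  FullKey-inj {x} {y} eq = ρ-inj (toℕ-injective (proj₂ (digit-≡ {Key (suc l) x} {Key (suc l) y} (toℕ<n (ρ x)) (toℕ<n (ρ y)) eq)))

  open Rank FullKey FullKey-inj public
  open Inverse ρ-inj using () renaming (inv to ρ⁻; rinv to ρρ⁻; inv-inj to ρ⁻-inj)

  abstract
    -- Moves `x` to the place, counted in the order `ρ`, that its itinerary deserves, with the old
    -- order breaking ties. Conjugating `π` by it is the standardisation step of the
    -- Gessel-Reutenauer bijection.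
    φ : E → E
    φ x = ρ⁻ (rank x)

    φ-inj : Inj φ
    φ-inj eq = rank-inj (ρ⁻-inj eq)

    φ-full : ∀ {x y} → FullKey x < FullKey y → ρ (φ x) Fin.< ρ (φ y)
    φ-full {x} {y} lt = subst₂ Fin._<_ (sym (ρρ⁻ (rank x))) (sym (ρρ⁻ (rank y))) (rank-mono lt)

  open Inverse φ-inj public using () renaming (inv to φ⁻; rinv to φφ⁻; linv to φ⁻φ; inv-inj to φ⁻-inj)

  φ-key : ∀ {x y} → Key (suc l) x < Key (suc l) y → ρ (φ x) Fin.< ρ (φ y)
  φ-key {x} {y} lt = φ-full (digit-< (toℕ<n (ρ x)) lt)

  φ-eq : ∀ {x y} → Key (suc l) x ≡ Key (suc l) y → ρ x Fin.< ρ y → ρ (φ x) Fin.< ρ (φ y)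
  φ-eq {x} {y} eq lt = φ-full (subst (λ z → FullKey x < z * suc N + toℕ (ρ y)) eq (ℕP.+-monoʳ-< (Key (suc l) x * suc N) lt))

  Same : E → E → Set
  Same x y = ∀ i → c (iter π i x) ≡ c (iter π i y)

  Same-sym : ∀ {x y} → Same x y → Same y x
  Same-sym s i = sym (s i)

  Same-iter : ∀ a {x y} → Same x y → Same (iter π a x) (iter π a y)
  Same-iter a {x} {y} s i = trans (cong c (sym (iter-+ π i a x))) (trans (s (i + a)) (cong c (iter-+ π i a y)))

  Same⇒Key : ∀ l {x y} → Same x y → Key l x ≡ Key l y
  Same⇒Key zero    s = refl
  Same⇒Key (suc l) s = cong₂ _+_ (cong (_* Bd ^ l) (s 0)) (Same⇒Key l (Same-iter 1 s))

  φ-same : ∀ {x y} → Same x y → ρ x Fin.< ρ y → ρ (φ x) Fin.< ρ (φ y)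
  φ-same s = φ-eq (Same⇒Key (suc l) s)

  -- The converse direction: an order already sorted by colour, and respected by `π` on equal
  -- colours, is sorted by itineraries of every length.
  key-mono : (∀ {x y} → ρ x Fin.< ρ y → c x ≤ c y) →
             (∀ {x y} → c x ≡ c y → ρ x Fin.< ρ y → ρ (π x) Fin.< ρ (π y)) → (∀ x → c x < Bd) →
             ∀ l {x y} → ρ x Fin.< ρ y → Key l x ≤ Key l y

  module Bounded (c< : ∀ x → c x < Bd) where

    Key< : ∀ l x → Key l x < Bd ^ l
    Key< zero    x = s≤s z≤n
    Key< (suc l) x = ℕP.<-≤-trans (ℕP.+-monoʳ-< (c x * Bd ^ l) (Key< l (π x)))
      (ℕP.≤-trans (ℕP.≤-reflexive (ℕP.+-comm (c x * Bd ^ l) (Bd ^ l))) (ℕP.*-monoˡ-≤ (Bd ^ l) (c< x)))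

    φ-colour : ∀ {x y} → c x < c y → ρ (φ x) Fin.< ρ (φ y)
    φ-colour {x} lt = φ-key (digit-< (Key< l (π x)) lt)

    -- Splits off the last digit instead of the first; comparing an itinerary with its shift by one
    -- step takes both splittings.
    Key-snoc : ∀ l x → Key (suc l) x ≡ Key l x * Bd + c (iter π l x)
    Key-snoc zero    x = trans (ℕP.+-identityʳ _) (ℕP.*-identityʳ (c x))
    Key-snoc (suc l) x = trans (cong (c x * (Bd * Bd ^ l) +_) (Key-snoc l (π x)))
      (trans (sym (ℕP.+-assoc (c x * (Bd * Bd ^ l)) _ _))
        (cong₂ _+_ (trans (cong (_+ Key l (π x) * Bd) (trans (cong (c x *_) (ℕP.*-comm Bd (Bd ^ l))) (sym (ℕP.*-assoc (c x) (Bd ^ l) Bd))))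
                          (sym (ℕP.*-distribʳ-+ Bd (c x * Bd ^ l) (Key l (π x)))))
                   (cong c (sym (iter-suc π l x)))))

    Key⇒prefix : ∀ l {x y} → Key l x ≡ Key l y → ∀ i → i < l → c (iter π i x) ≡ c (iter π i y)
    Key⇒prefix (suc l) {x} {y} eq i i<l with digit-≡ {c x} {c y} (Key< l (π x)) (Key< l (π y)) eq
    Key⇒prefix (suc l) {x} {y} eq zero    i<l | e , es = e
    Key⇒prefix (suc l) {x} {y} eq (suc i) i<l | e , es =
      trans (cong c (iter-suc π i x)) (trans (Key⇒prefix l es i (ℕP.≤-pred i<l)) (cong c (sym (iter-suc π i y))))

    module Periodic (per : ∀ x → iter π (suc l) x ≡ x) where

      Key⇒Same : ∀ {x y} → Key (suc l) x ≡ Key (suc l) y → Same x y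
      Key⇒Same {x} {y} eq i = trans (cong c (iter-% (suc l) (per x) i))
        (trans (Key⇒prefix (suc l) eq (i % suc l) (m%n<n i (suc l))) (cong c (sym (iter-% (suc l) (per y) i))))

      -- Equal first colours leave the other `l` digits to decide, and these are the leading digits
      -- for `π x` and `π y`. If they agree too, periodicity makes the whole itineraries agree, and
      -- `tie` decides.
      φ-compat : (∀ {x y} → Same x y → ρ x Fin.< ρ y → ρ (π x) Fin.< ρ (π y)) →
                 ∀ {x y} → c x ≡ c y → ρ (φ x) Fin.< ρ (φ y) → ρ (φ (π x)) Fin.< ρ (φ (π y))
      φ-compat tie {x} {y} eq lt with ℕP.<-cmp (Key l (π x)) (Key l (π y))
      ... | tri< l< _ _ = φ-key (subst₂ _<_ (sym (Key-snoc l (π x))) (sym (Key-snoc l (π y))) (digit-< (c< _) l<))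
      ... | tri> _ _ g = ⊥-elim (ℕP.<-asym lt (φ-key (ℕP.<-≤-trans (ℕP.+-monoʳ-< (c y * Bd ^ l) g) (ℕP.≤-reflexive (cong (λ z → z * Bd ^ l + Key l (π x)) (sym eq))))))
      ... | tri≈ _ e _ = φ-same (Same-iter 1 same) (tie same x<y)
        where
        k : Key (suc l) x ≡ Key (suc l) y
        k = cong₂ _+_ (cong (_* Bd ^ l) eq) e
        same : Same x y
        same = Key⇒Same k
        x<y : ρ x Fin.< ρ y
        x<y with ℕP.<-cmp (toℕ (ρ x)) (toℕ (ρ y))
        ... | tri< p _ _ = p
        ... | tri≈ _ q _ = ⊥-elim (ℕP.<-irrefl (cong (toℕ ∘ ρ ∘ φ) (ρ-inj (toℕ-injective q))) lt)
        ... | tri> _ _ p = ⊥-elim (ℕP.<-asym lt (φ-same (Same-sym same) p))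

  key-mono sorted compat c< zero    lt = z≤n
  key-mono sorted compat c< (suc l) {x} {y} lt with ℕP.m≤n⇒m<n∨m≡n (sorted lt)
  ... | inj₁ l<  = ℕP.<⇒≤ (digit-< (Bounded.Key< c< l (π x)) l<)
  ... | inj₂ eq  = ℕP.+-mono-≤ (ℕP.≤-reflexive (cong (_* Bd ^ l) eq)) (key-mono sorted compat c< l (compat eq lt))

-- An order-preserving tie between x and one of its iterates would climb for ever.
module Ties {N : ℕ} (ρ : Fin (suc N) → Fin (suc N)) (ρ-inj : Inj ρ) (π : Fin (suc N) → Fin (suc N)) (l : ℕ) (per : ∀ x → iter π (suc l) x ≡ x)
            (_~_ : Fin (suc N) → Fin (suc N) → Set) (~-sym : ∀ {x y} → x ~ y → y ~ x) (~-step : ∀ {x y} → x ~ y → π x ~ π y)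
            (mono : ∀ {x y} → x ~ y → ρ x Fin.< ρ y → ρ (π x) Fin.< ρ (π y)) where

  ~-iter : ∀ a {x y} → x ~ y → iter π a x ~ iter π a y
  ~-iter zero    r = r
  ~-iter (suc a) r = ~-step (~-iter a r)

  mono-iter : ∀ a {x y} → x ~ y → ρ x Fin.< ρ y → ρ (iter π a x) Fin.< ρ (iter π a y)
  mono-iter zero    r lt = lt
  mono-iter (suc a) r lt = mono (~-iter a r) (mono-iter a r lt)

  private
    σ-per : ∀ j x → iter (iter π j) (suc l) x ≡ x
    σ-per j x = trans (sym (iter-* π (suc l) j x)) (trans (cong (λ k → iter π k x) (ℕP.*-comm (suc l) j)) (iter-period (suc l) (per x) j))

    up : ∀ j x → x ~ iter π j x → ρ x Fin.< ρ (iter π j x) → ∀ t → ρ x Fin.< ρ (iter (iter π j) (suc t) x)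
    up j x r lt zero    = lt
    up j x r lt (suc t) = ℕP.<-trans (up j x r lt t) (subst₂ (λ a b → ρ a Fin.< ρ b) (sym (e (suc t))) (sym (trans (iter-suc (iter π j) (suc t) x) (e′ (suc t)))) (mono-iter (suc t * j) r lt))
      where
      e : ∀ t → iter (iter π j) t x ≡ iter π (t * j) x
      e t = sym (iter-* π t j x)
      e′ : ∀ t → iter (iter π j) t (iter π j x) ≡ iter π (t * j) (iter π j x)
      e′ t = sym (iter-* π t j _)

    down : ∀ j x → x ~ iter π j x → ρ (iter π j x) Fin.< ρ x → ∀ t → ρ (iter (iter π j) (suc t) x) Fin.< ρ x
    down j x r lt zero    = lt
    down j x r lt (suc t) = ℕP.<-trans (subst₂ (λ a b → ρ a Fin.< ρ b) (sym (trans (iter-suc (iter π j) (suc t) x) (e′ (suc t)))) (sym (e (suc t))) (mono-iter (suc t * j) (~-sym r) lt)) (down j x r lt t)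
      where
      e : ∀ t → iter (iter π j) t x ≡ iter π (t * j) x
      e t = sym (iter-* π t j x)
      e′ : ∀ t → iter (iter π j) t (iter π j x) ≡ iter π (t * j) (iter π j x)
      e′ t = sym (iter-* π t j _)

  aperiodic : ∀ j x → x ~ iter π j x → iter π j x ≡ x
  aperiodic j x r with ℕP.<-cmp (toℕ (ρ x)) (toℕ (ρ (iter π j x)))
  ... | tri< lt _ _ = ⊥-elim (ℕP.<-irrefl (cong (toℕ ∘ ρ) (sym (σ-per j x))) (up j x r lt l))
  ... | tri≈ _ e _  = sym (ρ-inj (toℕ-injective e))
  ... | tri> _ _ gt = ⊥-elim (ℕP.<-irrefl (cong (toℕ ∘ ρ) (σ-per j x)) (down j x r gt l))

-- Decidable subtypes and bijections that match fibres

ind-yes : {P : Set} (p : Dec P) → P → ind p ≡ 1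
ind-yes (yes _) _ = refl
ind-yes (no ¬p) p = ⊥-elim (¬p p)

ind-no : {P : Set} (p : Dec P) → ¬ P → ind p ≡ 0
ind-no (yes p) ¬p = ⊥-elim (¬p p)
ind-no (no _)  _  = refl

ind-× : {P Q : Set} (p : Dec P) (q : Dec Q) → ind (p ×-dec q) ≡ ind p * ind q
ind-× (yes _) (yes _) = refl
ind-× (yes _) (no _)  = refl
ind-× (no _)  q       = refl

module Subtype (b : A₁ → Bool) where
  restrict : List A₁ → List (Σ A₁ (T ∘ b))
  restrict []       = []
  restrict (a ∷ as) with T? (b a)
  ... | yes p = (a , p) ∷ restrict as
  ... | no  _ = restrict as

  ∈-restrict : ∀ {a as} (p : T (b a)) → a ∈ as → (a , p) ∈ restrict as
  ∈-restrict {a} {as = x ∷ as} p a∈ with T? (b x) | a∈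
  ... | yes q | here refl = here (cong (a ,_) (BoolP.T-irrelevant p q))
  ... | yes q | there a∈′ = there (∈-restrict p a∈′)
  ... | no ¬q | here refl = ⊥-elim (¬q p)
  ... | no ¬q | there a∈′ = ∈-restrict p a∈′

  restrict-∈ : ∀ {as s} → s ∈ restrict as → proj₁ s ∈ as
  restrict-∈ {as = x ∷ as} s∈ with T? (b x) | s∈
  ... | yes q | here refl = here refl
  ... | yes q | there s∈′ = there (restrict-∈ s∈′)
  ... | no ¬q | s∈′       = there (restrict-∈ s∈′)

  restrict-unique : ∀ {as} → Unique as → Unique (restrict as)
  restrict-unique {[]} [] = []
  restrict-unique {x ∷ as} (x∉ ∷ u) with T? (b x)
  ... | yes q = All.tabulate (λ { s∈ refl → All.lookup x∉ (restrict-∈ s∈) refl }) ∷ restrict-unique u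
  ... | no ¬q = restrict-unique u

  ∑-restrict : ∀ as (f : A₁ → ℕ) → ∑ (restrict as) (f ∘ proj₁) ≡ ∑ as (λ a → ind (T? (b a)) * f a)
  ∑-restrict []       f = refl
  ∑-restrict (x ∷ as) f with T? (b x)
  ... | yes q = cong₂ _+_ (sym (ℕP.+-identityʳ (f x))) (∑-restrict as f)
  ... | no ¬q = ∑-restrict as f

  Enum-Σ : Enum A₁ → Enum (Σ A₁ (T ∘ b))
  Enum-Σ EA = record
    { list = restrict (list EA)
    ; complete = λ (a , p) → ∈-restrict p (complete EA a)
    ; unique = restrict-unique (unique EA) }

module _ {R : A₁ → A₂ → Set} where
  transfer : ∀ {xs ys} → Pointwise R xs ys → ∀ {x} → x ∈ xs → ∃ λ y → y ∈ ys × R x y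
  transfer (r ∷ rs) (here refl) = _ , here refl , r
  transfer (r ∷ rs) (there x∈)  = let y , y∈ , q = transfer rs x∈ in y , there y∈ , q

  transfer⁻ : ∀ {xs ys} → Pointwise R xs ys → ∀ {y} → y ∈ ys → ∃ λ x → x ∈ xs × R x y
  transfer⁻ (r ∷ rs) (here refl) = _ , here refl , r
  transfer⁻ (r ∷ rs) (there y∈)  = let x , x∈ , q = transfer⁻ rs y∈ in x , there x∈ , q

  transfer⁻-transfer : ∀ {xs ys} (rs : Pointwise R xs ys) → Unique ys → ∀ {x} (x∈ : x ∈ xs) (y∈ : proj₁ (transfer rs x∈) ∈ ys) → proj₁ (transfer⁻ rs y∈) ≡ x
  transfer⁻-transfer (r ∷ rs) (y∉ ∷ u) (here refl) (here refl) = refl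
  transfer⁻-transfer (r ∷ rs) (y∉ ∷ u) (here refl) (there y∈)  = ⊥-elim (All.lookup y∉ y∈ refl)
  transfer⁻-transfer (r ∷ rs) (y∉ ∷ u) (there x∈)  (here eq)   = ⊥-elim (All.lookup y∉ (proj₁ (proj₂ (transfer rs x∈))) (sym eq))
  transfer⁻-transfer (r ∷ rs) (y∉ ∷ u) (there x∈)  (there y∈)  = transfer⁻-transfer rs u x∈ y∈

  transfer-transfer⁻ : ∀ {xs ys} (rs : Pointwise R xs ys) → Unique xs → ∀ {y} (y∈ : y ∈ ys) (x∈ : proj₁ (transfer⁻ rs y∈) ∈ xs) → proj₁ (transfer rs x∈) ≡ y
  transfer-transfer⁻ (r ∷ rs) (x∉ ∷ u) (here refl) (here refl) = refl
  transfer-transfer⁻ (r ∷ rs) (x∉ ∷ u) (here refl) (there x∈)  = ⊥-elim (All.lookup x∉ x∈ refl)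
  transfer-transfer⁻ (r ∷ rs) (x∉ ∷ u) (there y∈)  (here eq)   = ⊥-elim (All.lookup x∉ (proj₁ (proj₂ (transfer⁻ rs y∈))) (sym eq))
  transfer-transfer⁻ (r ∷ rs) (x∉ ∷ u) (there y∈)  (there x∈)  = transfer-transfer⁻ rs u y∈ x∈

∑-↭ : {xs ys : List A₁} → xs ↭ ys → (f : A₁ → ℕ) → ∑ xs f ≡ ∑ ys f
∑-↭ Perm.refl f = refl
∑-↭ (Perm.prep x p) f = cong (f x +_) (∑-↭ p f)
∑-↭ (Perm.swap {ys = ys} x y p) f = trans (cong (λ z → f x + (f y + z)) (∑-↭ p f))
  (trans (sym (ℕP.+-assoc (f x) (f y) _)) (trans (cong (_+ ∑ ys f) (ℕP.+-comm (f x) (f y))) (ℕP.+-assoc (f y) (f x) _)))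
∑-↭ (Perm.trans p q) f = trans (∑-↭ p f) (∑-↭ q f)

unique-↭ : {xs ys : List A₁} → xs ↭ ys → Unique xs → Unique ys
unique-↭ Perm.refl u = u
unique-↭ (Perm.prep x p) (x∉ ∷ u) = PermP.All-resp-↭ p x∉ ∷ unique-↭ p u
unique-↭ (Perm.swap x y p) ((x≢y ∷ x∉) ∷ y∉ ∷ u) = ((x≢y ∘ sym) ∷ PermP.All-resp-↭ p y∉) ∷ PermP.All-resp-↭ p x∉ ∷ unique-↭ p u
unique-↭ (Perm.trans p q) u = unique-↭ q (unique-↭ p u)

⊆∧≢⇒⊂ : ∀ {n} {p q : Subset n} → p ⊆ q → p ≢ q → p Sub.⊂ q
⊆∧≢⇒⊂ {p = p} {q} sub ne with any? (λ x → (x SubP.∈? q) ×-dec ¬? (x SubP.∈? p))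
... | yes (x , x∈ , x∉) = sub , x , x∈ , x∉
... | no ¬ex = ⊥-elim (ne (SubP.⊆-antisym sub back))
  where
  back : q ⊆ p
  back {x} x∈ with x SubP.∈? p
  ... | yes x∈p = x∈p
  ... | no  x∉p = ⊥-elim (¬ex (x , x∈ , x∉p))

#-pos : {P : A₁ → Set} (P? : ∀ a → Dec (P a)) (xs : List A₁) → 0 < # P? xs → ∃ λ a → a ∈ xs × P a
#-pos P? (x ∷ xs) pos with P? x
... | yes p = x , here refl , p
... | no  _ = let a , a∈ , p = #-pos P? xs pos in a , there a∈ , p

module _ (_≟_ : DecidableEquality A₃) (α : A₁ → A₃) (β : A₂ → A₃) where

  -- The head of `xs` finds a partner because its fibre in `ys` is not empty; removing both keeps
  -- all fibre sizes equal.
  match : (xs : List A₁) (ys : List A₂) → (∀ z → # (λ a → α a ≟ z) xs ≡ # (λ b → β b ≟ z) ys) →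
          ∃ λ ys′ → ys ↭ ys′ × Pointwise (λ a b → α a ≡ β b) xs ys′
  match [] []       eq = [] , ↭-refl , []
  match [] (y ∷ ys) eq = ⊥-elim (ℕP.1+n≢0 (sym (trans (eq (β y)) (cong (_+ # (λ b → β b ≟ β y) ys) (ind-yes (β y ≟ β y) refl)))))
  match (x ∷ xs) ys eq with #-pos (λ b → β b ≟ α x) ys (subst (0 <_) (trans (cong (_+ # (λ a → α a ≟ α x) xs) (sym (ind-yes (α x ≟ α x) refl))) (eq (α x))) (s≤s z≤n))
  ... | b , b∈ , βb with as , bs , refl ← ∈-∃++ b∈ =
    let perm = PermP.shift b as bs
        ys″ , p , pw = match xs (as ++ bs) (λ z → ℕP.+-cancelˡ-≡ (ind (α x ≟ z)) _ _ (trans (eq z) (trans (∑-↭ perm _)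
                         (cong (_+ _) (ind-cong (β b ≟ z) (α x ≟ z) (trans (sym βb)) (trans βb))))))
    in b ∷ ys″ , ↭-trans perm (prep b p) , sym βb ∷ pw

  fibre-bijection : (EA : Enum A₁) (EB : Enum A₂) → (∀ z → # (λ a → α a ≟ z) (list EA) ≡ # (λ b → β b ≟ z) (list EB)) →
    Σ (A₁ → A₂) λ F → Σ (A₂ → A₁) λ G → (∀ a → G (F a) ≡ a) × (∀ b → F (G b) ≡ b) × (∀ a → α a ≡ β (F a))
  fibre-bijection EA EB eq =
      (λ a → proj₁ (transfer pw (complete EA a)))
    , (λ b → proj₁ (transfer⁻ pw (inB b)))
    , (λ a → transfer⁻-transfer pw uniB (complete EA a) (inB _))
    , (λ b → transfer-transfer⁻ pw (unique EA) (inB b) (complete EA _))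
    , (λ a → proj₂ (proj₂ (transfer pw (complete EA a))))
    where
    m = match (list EA) (list EB) eq
    ys′ = proj₁ m
    pw = proj₂ (proj₂ m)
    inB : ∀ b → b ∈ ys′
    inB b = PermP.∈-resp-↭ (proj₁ (proj₂ m)) (complete EB b)
    uniB : Unique ys′
    uniB = unique-↭ (proj₁ (proj₂ m)) (unique EB)

∑-single : (_≟_ : DecidableEquality A₁) (EA : Enum A₁) (a : A₁) (g : A₁ → ℕ) → ∑ (list EA) (λ x → ind (a ≟ x) * g x) ≡ g a
∑-single _≟_ EA a g = go (list EA) (unique EA) (complete EA a)
  where
  none : ∀ xs → ¬ (a ∈ xs) → ∑ xs (λ x → ind (a ≟ x) * g x) ≡ 0
  none []       a∉ = refl
  none (x ∷ xs) a∉ = cong₂ _+_ (cong (_* g x) (ind-no (a ≟ x) (λ { refl → a∉ (here refl) }))) (none xs (a∉ ∘ there))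
  go : ∀ xs → Unique xs → a ∈ xs → ∑ xs (λ x → ind (a ≟ x) * g x) ≡ g a
  go (x ∷ xs) (x∉ ∷ u) (here refl) = trans (cong₂ _+_ (trans (cong (_* g a) (ind-yes (a ≟ a) refl)) (ℕP.+-identityʳ (g a)))
    (none xs (λ a∈ → All.lookup x∉ a∈ refl))) (ℕP.+-identityʳ (g a))
  go (x ∷ xs) (x∉ ∷ u) (there a∈) = cong₂ _+_ (cong (_* g x) (ind-no (a ≟ x) (λ { refl → All.lookup x∉ a∈ refl }))) (go xs u a∈)

-- Inversion over subsets

module Moebius (n : ℕ) (α : A₁ → Subset n) (β : A₂ → Subset n) (xs : List A₁) (ys : List A₂) where
  _≟ˢ_ : DecidableEquality (Subset n)
  _≟ˢ_ = VecP.≡-dec BoolP._≟_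

  EnumS : Enum (Subset n)
  EnumS = Enum-Vec (record { list = true ∷ false ∷ [] ; complete = λ { true → here refl ; false → there (here refl) } ; unique = ((λ ()) ∷ []) ∷ [] ∷ [] }) n

  private
    split : {A₁ : Set} (γ : A₁ → Subset n) (xs : List A₁) (J : Subset n) →
            # (λ a → γ a SubP.⊆? J) xs ≡ ∑ (list EnumS) (λ I → ind (I SubP.⊂? J) * # (λ a → γ a ≟ˢ I) xs) + # (λ a → γ a ≟ˢ J) xs
    split γ xs J = trans (∑-cong xs pt) (trans (∑-+ xs _ _) (cong (_+ # (λ a → γ a ≟ˢ J) xs) (trans (∑-swap xs (list EnumS) _)
      (∑-cong (list EnumS) (λ I → ∑-*ʳ xs _ (ind (I SubP.⊂? J)))))))
      where
      pt : ∀ a → ind (γ a SubP.⊆? J) ≡ ∑ (list EnumS) (λ I → ind (I SubP.⊂? J) * ind (γ a ≟ˢ I)) + ind (γ a ≟ˢ J)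
      pt a = trans step (cong (_+ ind (γ a ≟ˢ J)) (sym (trans (∑-cong (list EnumS) (λ I → ℕP.*-comm (ind (I SubP.⊂? J)) _)) (∑-single _≟ˢ_ EnumS (γ a) (λ I → ind (I SubP.⊂? J))))))
        where
        step : ind (γ a SubP.⊆? J) ≡ ind (γ a SubP.⊂? J) + ind (γ a ≟ˢ J)
        step with γ a ≟ˢ J
        ... | yes refl = trans (ind-yes (γ a SubP.⊆? γ a) SubP.⊆-refl) (cong (_+ 1) (sym (ind-no (γ a SubP.⊂? γ a) (SubP.⊂-irref refl))))
        ... | no ne with γ a SubP.⊆? J
        ...   | yes sub = sym (trans (ℕP.+-identityʳ _) (ind-yes (γ a SubP.⊂? J) (⊆∧≢⇒⊂ sub ne)))
        ...   | no ¬sub = sym (trans (ℕP.+-identityʳ _) (ind-no (γ a SubP.⊂? J) (λ (s , _) → ¬sub s)))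

  -- Möbius inversion without signs: by induction on the size of `J`, the contributions of the
  -- proper subsets agree and cancel.
  exact : (∀ J → # (λ a → α a SubP.⊆? J) xs ≡ # (λ b → β b SubP.⊆? J) ys) → ∀ J → # (λ a → α a ≟ˢ J) xs ≡ # (λ b → β b ≟ˢ J) ys
  exact eq J = <-rec (λ s → ∀ J → Sub.∣ J ∣ ≡ s → # (λ a → α a ≟ˢ J) xs ≡ # (λ b → β b ≟ˢ J) ys) go Sub.∣ J ∣ J refl
    where
    go : ∀ s → (∀ {s′} → s′ < s → ∀ J → Sub.∣ J ∣ ≡ s′ → # (λ a → α a ≟ˢ J) xs ≡ # (λ b → β b ≟ˢ J) ys) → ∀ J → Sub.∣ J ∣ ≡ s → # (λ a → α a ≟ˢ J) xs ≡ # (λ b → β b ≟ˢ J) ys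
    go s rec J refl = ℕP.+-cancelˡ-≡ (∑ (list EnumS) (λ I → ind (I SubP.⊂? J) * # (λ a → α a ≟ˢ I) xs)) _ _
      (trans (sym (split α xs J)) (trans (eq J) (trans (split β ys J) (cong (_+ # (λ b → β b ≟ˢ J) ys) (sym (∑-cong (list EnumS) pt))))))
      where
      pt : ∀ I → ind (I SubP.⊂? J) * # (λ a → α a ≟ˢ I) xs ≡ ind (I SubP.⊂? J) * # (λ b → β b ≟ˢ I) ys
      pt I with I SubP.⊂? J
      ... | yes lt = cong (1 *_) (rec (SubP.p⊂q⇒∣p∣<∣q∣ lt) I refl)
      ... | no _   = refl

⊆-out : ∀ {n} {S J : Subset n} → S ⊆ J → ∀ i → lookup J i ≡ false → lookup S i ≡ false
⊆-out {S = S} sub i eq with lookup S i in e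
... | false = refl
... | true with () ← trans (sym eq) ([]=⇒lookup (sub (lookup⇒[]= i S e)))

out-⊆ : ∀ {n} {S J : Subset n} → (∀ i → lookup J i ≡ false → lookup S i ≡ false) → S ⊆ J
out-⊆ {S = S} {J} h {i} i∈ with lookup J i in e
... | true = lookup⇒[]= i J e
... | false with () ← trans (sym (h i e)) ([]=⇒lookup i∈)

does-false : {P : Set} (p : Dec P) → does p ≡ false → ¬ P
does-false (no ¬p) _ = ¬p

does-false⁻ : {P : Set} (p : Dec P) → ¬ P → does p ≡ false
does-false⁻ (yes p) ¬p = ⊥-elim (¬p p)
does-false⁻ (no _)  _  = refl

does-true⁻ : {P : Set} (p : Dec P) → P → does p ≡ true
does-true⁻ (yes _) _ = refl
does-true⁻ (no ¬p) p = ⊥-elim (¬p p)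

∧-false : ∀ {a b} → b ≡ true → a ∧ b ≡ false → a ≡ false
∧-false {false} _ _ = refl
∧-false {true} {true} _ ()

-- Descent sets of vectors

module _ {N : ℕ} where
  open Cyc N

  upToPred-last : lookup (upToPred (suc N)) last ≡ false
  upToPred-last = trans (lookup∘tabulate (λ j → suc (toℕ j) <ᵇ suc N) last) (lem (ℕP.≤-reflexive (sym (toℕ-fromℕ N))))
    where
    lem : ∀ {a} → N ≤ a → (suc a <ᵇ suc N) ≡ false
    lem {a} le with suc a <ᵇ suc N in e
    ... | false = refl
    ... | true  = ⊥-elim (ℕP.<⇒≱ (ℕP.≤-pred (ℕP.<ᵇ⇒< (suc a) (suc N) (subst T (sym e) tt))) le)

  ≢last⇒< : ∀ {i} → i ≢ last → toℕ i < N
  ≢last⇒< {i} ne = ℕP.≤∧≢⇒< (ℕP.≤-pred (toℕ<n i)) (λ eq → ne (toℕ-injective (trans eq (sym (toℕ-fromℕ N)))))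

  upToPred-≢last : ∀ i → i ≢ last → lookup (upToPred (suc N)) i ≡ true
  upToPred-≢last i ne = trans (lookup∘tabulate (λ j → suc (toℕ j) <ᵇ suc N) i) (lem (≢last⇒< ne))
    where
    lem : ∀ {a} → a < N → (suc a <ᵇ suc N) ≡ true
    lem {a} lt with suc a <ᵇ suc N in e
    ... | true = refl
    ... | false = ⊥-elim (subst T e (ℕP.<⇒<ᵇ (s≤s lt)))

  -- desVec tabulates a local function; unification against this type recovers it.
  tailEntry : ∀ {n} {w : Vec Bool (suc n)} {a : Bool} {h : Fin n → Bool} → w ≡ a Vec.∷ tabulate h → Fin n → Bool
  tailEntry {h = h} _ = h

  desVec-suc : ∀ (v : Vec E (suc N)) i → lookup (desVec v) (suc i) ≡ tailEntry {w = desVec v} refl i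
  desVec-suc v i = lookup∘tabulate _ i

  entry-no : ∀ (v : Vec E (suc N)) i → ¬ (toℕ (suc i) < N) → tailEntry {w = desVec v} refl i ≡ false
  entry-no v i ¬lt with toℕ (suc i) ℕ.<? N
  ... | yes lt = ⊥-elim (¬lt lt)
  ... | no _ = refl

  entry-yes : ∀ (v : Vec E (suc N)) i → toℕ (suc i) < N → tailEntry {w = desVec v} refl i ≡ (toℕ (lookup v (next (suc i))) <ᵇ toℕ (lookup v (suc i)))
  entry-yes v i lt with toℕ (suc i) ℕ.<? N
  ... | yes lt′ = cong (λ z → toℕ (lookup v z) <ᵇ toℕ (lookup v (suc i)))
    (toℕ-injective (trans (cong suc (toℕ-fromℕ< lt′)) (sym (toℕ-next (suc i) (λ e → ℕP.<-irrefl (trans (cong toℕ e) (toℕ-fromℕ N)) lt)))))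
  ... | no ¬lt = ⊥-elim (¬lt lt)

  desVec-no : ∀ (v : Vec E (suc N)) i → ¬ (toℕ i < N) → lookup (desVec v) i ≡ false
  desVec-no v zero ¬lt with toℕ (zero {N}) ℕ.<? N
  ... | yes lt = ⊥-elim (¬lt lt)
  ... | no _ = refl
  desVec-no v (suc i) ¬lt = trans (desVec-suc v i) (entry-no v i ¬lt)

  desVec-yes : ∀ (v : Vec E (suc N)) i → toℕ i < N → lookup (desVec v) i ≡ (toℕ (lookup v (next i)) <ᵇ toℕ (lookup v i))
  desVec-yes v zero lt with toℕ (zero {N}) ℕ.<? N
  ... | yes lt′ = cong (λ z → toℕ (lookup v z) <ᵇ toℕ (lookup v zero))
    (toℕ-injective (trans (cong suc (toℕ-fromℕ< lt′)) (sym (toℕ-next zero (λ e → ℕP.<-irrefl (trans (cong toℕ e) (toℕ-fromℕ N)) lt)))))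
  ... | no ¬lt = ⊥-elim (¬lt lt)
  desVec-yes v (suc i) lt = trans (desVec-suc v i) (entry-yes v i lt)

  desVec-last : ∀ (v : Vec E (suc N)) → lookup (desVec v) last ≡ false
  desVec-last v = desVec-no v last (ℕP.<-irrefl (toℕ-fromℕ N))

  desVec-≢last : ∀ (v : Vec E (suc N)) i → i ≢ last → lookup (desVec v) i ≡ (toℕ (lookup v (next i)) <ᵇ toℕ (lookup v i))
  desVec-≢last v i ne = desVec-yes v i (≢last⇒< ne)

  -- A descent set never contains n, so it lies in `J` exactly when it lies in `J` with n added; the
  -- enlarged set admits the cut at n.
  orLast : Subset (suc N) → E → Bool
  orLast J i = lookup J i ∨ does (i FinP.≟ last)

  orLast-last : ∀ J → orLast J last ≡ true
  orLast-last J = trans (cong (lookup J last ∨_) (does-true⁻ (last FinP.≟ last) refl)) (BoolP.∨-zeroʳ (lookup J last))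

  orLast-false : ∀ J {i} → orLast J i ≡ false → lookup J i ≡ false × i ≢ last
  orLast-false J {i} eq with lookup J i | i FinP.≟ last
  ... | false | no ne = refl , ne

  orLast-false⁻ : ∀ J {i} → lookup J i ≡ false → i ≢ last → orLast J i ≡ false
  orLast-false⁻ J {i} eq ne = cong₂ _∨_ eq (does-false⁻ (i FinP.≟ last) ne)

member : ∀ {n} → List ℕ → Vec (Fin n) n → Bool
member μ v = distinctᵇ v ∧ ⌊_⌋ (ListP.≡-dec ℕ._≟_ (cycleType v) μ)

-- Codings

module _ {N B : ℕ} where
  km : (k m : Fin (suc N) → Fin B) → Fin (suc N) → ℕ
  km k m x = toℕ (k x) * B + toℕ (m x)

  km-< : ∀ k m x → km k m x < B * B
  km-< k m x = ℕP.<-≤-trans (ℕP.+-monoʳ-< (toℕ (k x) * B) (toℕ<n (m x)))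
    (ℕP.≤-trans (ℕP.≤-reflexive (ℕP.+-comm (toℕ (k x) * B) B)) (ℕP.*-monoˡ-≤ B (toℕ<n (k x))))

  km-≡ : ∀ k m k′ m′ {x y} → km k m x ≡ km k′ m′ y → k x ≡ k′ y × m x ≡ m′ y
  km-≡ k m k′ m′ {x} {y} eq with digit-≡ {toℕ (k x)} {toℕ (k′ y)} (toℕ<n (m x)) (toℕ<n (m′ y)) eq
  ... | a , b = toℕ-injective a , toℕ-injective b

  km-cong : ∀ k m k′ m′ {x y} → k x ≡ k′ y → m x ≡ m′ y → km k m x ≡ km k′ m′ y
  km-cong k m k′ m′ a b = cong₂ (λ a b → toℕ a * B + toℕ b) a b

-- Different points of one cycle have different itineraries, i.e. the words along the cycles are
-- primitive.
Prim : {N : ℕ} → (π f : Fin (suc N) → Fin (suc N)) → Set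
Prim π f = ∀ x j → (∀ i → f (iter π i x) ≡ f (iter π i (iter π j x))) → iter π j x ≡ x

-- A structure (π , f), with letters f, is recoded as (σ , m , k) with a colouring k that is
-- never constant; ρ is the linear order of the circle cut at some point.  AV and TV are the
-- admissible structures of either kind, and (P₂ , M , K) and P₁ the translations.
record Coding (N : ℕ) : Set₁ where
  E : Set
  E = Fin (suc N)
  field
    l B : ℕ
    𝒞   : (E → E) → Set
    𝒞?  : ∀ (v : Vec E (suc N)) → Dec (𝒞 (lookup v))
    𝒞-period : ∀ {π} → 𝒞 π → ∀ x → iter π (suc l) x ≡ x
    𝒞-iso : ∀ {π π′} (φ : E → E) → Inj φ → (∀ x → φ (π x) ≡ π′ (φ x)) → 𝒞 π → 𝒞 π′
    AV  : (π f : E → E) → Set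
    AV-𝒞 : ∀ {π f} → AV π f → 𝒞 π
    prim⇒AV : ∀ {π f} → 𝒞 π → Prim π f → AV π f
    TV  : (ρ f σ : E → E) (m k : E → Fin B) → Set
    TV? : ∀ ρ (σ : Vec E (suc N)) (m k : Vec (Fin B) (suc N)) → Dec (TV ρ id (lookup σ) (lookup m) (lookup k))
    TV-iso : ∀ {ρ f σ m k f′ σ′ m′ k′} (φ : E → E) → Inj φ → (∀ x → φ (σ x) ≡ σ′ (φ x)) →
      (∀ x → m′ (φ x) ≡ m x) → (∀ x → k′ (φ x) ≡ k x) → (∀ x → f′ (φ x) ≡ f x) → TV ρ f σ m k → TV ρ f′ σ′ m′ k′
    -- A recoded structure is tested with all points as distinct letters, because it does not know
    -- `J`; inside the bijection the letters are blocks. This field and `TV-refine` say that the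
    -- test does not notice the difference, provided that points of one block are ordered
    -- consistently with (colour, `m`).
    TV-coarsen : ∀ {ρ f σ m k} → Inj ρ → (∀ {x y} → ρ (f x) Fin.< ρ (f y) → ρ x Fin.< ρ y) →
      (∀ {x y} → f x ≡ f y → km k m x < km k m y → ρ x Fin.< ρ y) → TV ρ id σ m k → TV ρ f σ m k
    TV-refine : ∀ {ρ f σ m k} → Inj ρ → (∀ {x y} → ρ (f x) Fin.< ρ (f y) → ρ x Fin.< ρ y) →
      (∀ {x y} → f x ≡ f y → km k m x < km k m y → ρ x Fin.< ρ y) → TV ρ f σ m k → TV ρ id σ m k
    TV-inj : ∀ {ρ f σ m k} → TV ρ f σ m k → Inj σ
    TV-period : ∀ {ρ f σ m k} → TV ρ f σ m k → ∀ x → iter σ (suc l) x ≡ x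
    TV-nonconst : ∀ {ρ f σ m k} → TV ρ f σ m k → ∃₂ λ x y → k x ≢ k y
    K   : (π f : E → E) → E → Fin B
    M   : (ρ π f : E → E) → E → Fin B
    P₂  : (ρ π f : E → E) → E → E
    P₁  : (f σ : E → E) (m k : E → Fin B) → E → E
  Same₂ : (f σ : E → E) (m k : E → Fin B) (f′ σ′ : E → E) (m′ k′ : E → Fin B) → E → E → Set
  Same₂ f σ m k f′ σ′ m′ k′ x y = ∀ i → f (iter σ i x) ≡ f′ (iter σ′ i y) × k (iter σ i x) ≡ k′ (iter σ′ i y) × m (iter σ i x) ≡ m′ (iter σ′ i y)
  Prim₂ : (f σ : E → E) (m k : E → Fin B) → Set
  Prim₂ f σ m k = ∀ x j → Same₂ f σ m k f σ m k x (iter σ j x) → iter σ j x ≡ x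
  field
    fwd   : ∀ {ρ π f} → Inj ρ → AV π f → TV ρ f (P₂ ρ π f) (M ρ π f) (K π f)
    bwd   : ∀ {ρ f σ m k} → Inj ρ → TV ρ f σ m k → Prim₂ f σ m k → AV (P₁ f σ m k) f
    P₁P₂  : ∀ {ρ π f} → Inj ρ → AV π f → ∀ x → P₁ f (P₂ ρ π f) (M ρ π f) (K π f) x ≡ π x
    P₂P₁  : ∀ {ρ f σ m k} → Inj ρ → TV ρ f σ m k → Prim₂ f σ m k →
            ∀ x → P₂ ρ (P₁ f σ m k) f x ≡ σ x × M ρ (P₁ f σ m k) f x ≡ m x × K (P₁ f σ m k) f x ≡ k x
    -- Naturality: the recoding at a point depends only on its itinerary, and moves by the same
    -- power at points that share it. Hence recoding commutes with relabelling, and tied points stay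
    -- tied.
    nat-fwd : ∀ {ρ π π′ f} → AV π f → AV π′ f → ∀ x y → (∀ i → f (iter π i x) ≡ f (iter π′ i y)) →
      K π f x ≡ K π′ f y × M ρ π f x ≡ M ρ π′ f y × ∃ λ a → P₂ ρ π f x ≡ iter π a x × P₂ ρ π′ f y ≡ iter π′ a y
    nat-bwd : ∀ {ρ f σ m k σ′ m′ k′} → Inj ρ → TV ρ f σ m k → TV ρ f σ′ m′ k′ → ∀ x y → Same₂ f σ m k f σ′ m′ k′ x y →
      ∃ λ a → P₁ f σ m k x ≡ iter σ a x × P₁ f σ′ m′ k′ y ≡ iter σ′ a y

-- From a coding to the equality of the two counts

module Generic {N : ℕ} (cod : Coding N) where
  open Coding cod hiding (E)
  open Cyc N

  Tstr : Set
  Tstr = Vec (Fin B) (suc N) × Vec E (suc N) × Vec (Fin B) (suc N)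

  private
    drop? : (χ : Vec (Fin B) (suc N)) → Dec (∃ λ i → lookup χ (next i) Fin.< lookup χ i)
    drop? χ = any? (λ i → lookup χ (next i) FinP.<? lookup χ i)

  abstract
    drop : Vec (Fin B) (suc N) → E
    drop χ with drop? χ
    ... | yes (i , _) = i
    -- A filler value: valid structures have nonconstant colourings, and these drop somewhere on the
    -- circle.
    ... | no _ = zero

    iter-next-reaches : ∀ x y → ∃ λ t → iter next t x ≡ y
    iter-next-reaches x y = N ∸ toℕ (ρ y x) , reach y _ x (ℕP.m∸n+n≡m (ρ≤N y x))

    drop-spec : ∀ χ → (∃₂ λ x y → lookup χ x ≢ lookup χ y) → lookup χ (next (drop χ)) Fin.< lookup χ (drop χ)
    drop-spec χ (x , y , x≢y) with drop? χ
    ... | yes (i , lt) = lt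
    ... | no ¬lt = ⊥-elim (x≢y (FinP.≤-antisym (le x y) (le y x)))
      where
      up : ∀ t x → lookup χ x Fin.≤ lookup χ (iter next t x)
      up zero    x = ℕP.≤-refl
      up (suc t) x = ℕP.≤-trans (up t x) (ℕP.≮⇒≥ (λ lt → ¬lt (_ , lt)))
      le : ∀ x y → lookup χ x Fin.≤ lookup χ y
      le x y = subst (λ z → lookup χ x Fin.≤ lookup χ z) (proj₂ (iter-next-reaches x y)) (up (proj₁ (iter-next-reaches x y)) x)

    rise : ∀ (χ : Vec (Fin B) (suc N)) → (∃₂ λ x y → lookup χ x ≢ lookup χ y) → ∃ λ i → lookup χ i Fin.< lookup χ (next i)
    rise χ (x , y , x≢y) with any? (λ i → lookup χ i FinP.<? lookup χ (next i))
    ... | yes p = p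
    ... | no ¬lt = ⊥-elim (x≢y (FinP.≤-antisym (le y x) (le x y)))
      where
      dn : ∀ t x → lookup χ (iter next t x) Fin.≤ lookup χ x
      dn zero    x = ℕP.≤-refl
      dn (suc t) x = ℕP.≤-trans (ℕP.≮⇒≥ (λ lt → ¬lt (_ , lt))) (dn t x)
      le : ∀ x y → lookup χ y Fin.≤ lookup χ x
      le x y = subst (λ z → lookup χ z Fin.≤ lookup χ x) (proj₂ (iter-next-reaches x y)) (dn (proj₁ (iter-next-reaches x y)) x)

  -- The comparison is between cyclic neighbours, so position n is on the same footing as the
  -- others; the cut matters only when colour and `m` tie.
  Desc : Tstr → E → Set
  Desc (χ , σ , m) i = let d = drop χ; q = km (lookup χ) (lookup m) in
    q (next i) < q i ⊎ (q i ≡ q (next i) × ρ d (lookup σ (next i)) Fin.< ρ d (lookup σ i))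

  Desc? : ∀ t i → Dec (Desc t i)
  Desc? (χ , σ , m) i = (_ ℕ.<? _) ⊎-dec ((_ ℕ.≟ _) ×-dec (_ FinP.<? _))

  TOK : Tstr → Set
  TOK (χ , σ , m) = TV (ρ (drop χ)) id (lookup σ) (lookup m) (lookup χ)

  TOK? : ∀ t → Dec (TOK t)
  TOK? (χ , σ , m) = TV? (ρ (drop χ)) σ m χ

  Tin : (E → Bool) → Tstr → Set
  Tin J t = TOK t × (∀ i → J i ≡ false → ¬ Desc t i)

  Tin? : ∀ J t → Dec (Tin J t)
  Tin? J t = TOK? t ×-dec all? (λ i → (J i BoolP.≟ false) →-dec ¬? (Desc? t i))

  Ain : E → (E → Bool) → Vec E (suc N) → Set
  Ain e J v = 𝒞 (lookup v) × (∀ i → J i ≡ false → ρ e (lookup v i) Fin.< ρ e (lookup v (next i)))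

  Ain? : ∀ e J v → Dec (Ain e J v)
  Ain? e J v = 𝒞? v ×-dec all? (λ i → (J i BoolP.≟ false) →-dec (_ FinP.<? _))

  EnumT : Enum Tstr
  EnumT = Enum-× (Enum-Vec (Enum-Fin B) (suc N)) (Enum-× (Enum-Vec (Enum-Fin (suc N)) (suc N)) (Enum-Vec (Enum-Fin B) (suc N)))

  EnumA : Enum (Vec E (suc N))
  EnumA = Enum-Vec (Enum-Fin (suc N)) (suc N)

  codeBd : ℕ
  codeBd = suc N * (B * B)

  -- Block, colour and `m` packed into one digit in this order of priority. The block leads, so
  -- relabelling by itineraries of these digits never moves a point to another block.
  code : (d : E) (f : E → E) (k m : E → Fin B) → E → ℕ
  code d f k m x = toℕ (ρ d (f x)) * (B * B) + km k m x

  code< : ∀ d f k m x → code d f k m x < codeBd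
  code< d f k m x = ℕP.<-≤-trans (ℕP.+-monoʳ-< (toℕ (ρ d (f x)) * (B * B)) (km-< k m x))
    (ℕP.≤-trans (ℕP.≤-reflexive (ℕP.+-comm _ (B * B))) (ℕP.*-monoˡ-≤ (B * B) (toℕ<n (ρ d (f x)))))

  code-≡ : ∀ d f k m f′ k′ m′ {x y} → code d f k m x ≡ code d f′ k′ m′ y → f x ≡ f′ y × k x ≡ k′ y × m x ≡ m′ y
  code-≡ d f k m f′ k′ m′ {x} {y} eq with digit-≡ {toℕ (ρ d (f x))} {toℕ (ρ d (f′ y))} (km-< k m x) (km-< k′ m′ y) eq
  ... | a , b with km-≡ k m k′ m′ b
  ... | c , e = ρ-inj d (toℕ-injective a) , c , e

  code-cong : ∀ d f k m f′ k′ m′ {x y} → f x ≡ f′ y → k x ≡ k′ y → m x ≡ m′ y → code d f k m x ≡ code d f′ k′ m′ y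
  code-cong d f k m f′ k′ m′ a b c = cong₂ _+_ (cong (λ z → toℕ (ρ d z) * (B * B)) a) (km-cong k m k′ m′ b c)

  letter : (e : E) (f : E → E) → E → ℕ
  letter e f x = toℕ (ρ e (f x))

  module Rel₀ (e : E) (f : E → E) (k : E → Fin B) = Relabelling (ρ e) (ρ-inj e) 0 (suc N * B) id (λ x → toℕ (ρ e (f x)) * B + toℕ (k x))
  module RelA (e : E) (f π : E → E) = Relabelling (ρ e) (ρ-inj e) l (suc N) π (letter e f)
  module RelT (d : E) (f σ : E → E) (m k : E → Fin B) = Relabelling (ρ d) (ρ-inj d) l codeBd σ (code d f k m)

  -- Breaks a circularity: `P₂` and `M` depend on the cut, and the cut is a drop of the recoded
  -- colouring, which is placed with their help. Inside a block that colouring is merely sorted, so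
  -- itineraries of length one predict it from `k` alone.
  pattern₀ : E → (E → Bool) → (E → Fin B) → Vec (Fin B) (suc N)
  pattern₀ e J k = tabulate (k ∘ Rel₀.φ⁻ e (blk J) k)

  toT : E → (E → Bool) → Vec E (suc N) → Tstr
  toT e J v = tabulate (k ∘ R.φ⁻) , tabulate (R.φ ∘ σ ∘ R.φ⁻) , tabulate (m ∘ R.φ⁻)
    where
    f k : _
    f = blk J
    k = K (lookup v) f
    d : E
    d = drop (pattern₀ e J k)
    σ : E → E
    σ = P₂ (ρ d) (lookup v) f
    m : E → Fin B
    m = M (ρ d) (lookup v) f
    module R = RelT d f σ m k

  toA : E → (E → Bool) → Tstr → Vec E (suc N)
  toA e J (χ , σ , m) = tabulate (R.φ ∘ π ∘ R.φ⁻)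
    where
    π : E → E
    π = P₁ (blk J) (lookup σ) (lookup m) (lookup χ)
    module R = RelA e (blk J) π

  module Bij (e : E) (J : E → Bool) (e∈J : J e ≡ true) where
    f : E → E
    f = blk J
    module Be = Block J e e∈J

    toOrder : ∀ {d} → J d ≡ true → ∀ {x y} → f x ≡ f y → ρ e x Fin.< ρ e y → ρ d x Fin.< ρ d y
    toOrder d∈ = blk-order J e∈J d∈
    fromOrder : ∀ {d} → J d ≡ true → ∀ {x y} → f x ≡ f y → ρ d x Fin.< ρ d y → ρ e x Fin.< ρ e y
    fromOrder d∈ = blk-order J d∈ e∈J

    same-blk : ∀ {i} → J i ≡ false → f i ≡ f (next i)
    same-blk = Be.blk-next

    blk-letters : ∀ {d} → J d ≡ true → ∀ {x y} → ρ d (f x) Fin.< ρ d (f y) → ρ d x Fin.< ρ d y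
    blk-letters {d} d∈ {x} {y} lt with ℕP.<-cmp (toℕ (ρ d x)) (toℕ (ρ d y))
    ... | tri< p _ _ = p
    ... | tri≈ _ q _ = ⊥-elim (ℕP.<-irrefl (cong (toℕ ∘ ρ d ∘ f) (ρ-inj d (toℕ-injective q))) lt)
    ... | tri> _ _ g = ⊥-elim (ℕP.<-irrefl refl (ℕP.<-≤-trans lt (Block.blk-mono J d d∈ y g)))

    -- Along the cut at `d`, both `f` and `f` composed with the inverse of `φ` are sorted
    -- arrangements of the same multiset of blocks, so they coincide.
    blk-pres : ∀ {d} → J d ≡ true → {φ : E → E} → Inj φ → (∀ {x y} → ρ d (f x) Fin.< ρ d (f y) → ρ d (φ x) Fin.< ρ d (φ y)) →
               ∀ x → f (φ x) ≡ f x
    blk-pres {d} d∈ {φ} φ-inj mono x = ρ-inj d (toℕ-injective (trans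
      (SortedUnique.sorted-unique (ρ-inj d) {u = λ z → toℕ (ρ d (f z))} {v = λ z → toℕ (ρ d (f (inv z)))}
        (Block.blk-mono J d d∈ _)
        (λ {a} {b} lt → ℕP.≮⇒≥ λ g → ℕP.<-asym lt (subst₂ (λ s t → ρ d s Fin.< ρ d t) (rinv b) (rinv a) (mono g)))
        φ-inj (λ z → cong (toℕ ∘ ρ d ∘ f) (linv z)) (φ x))
      (cong (toℕ ∘ ρ d ∘ f) (linv x))))
      where open Inverse φ-inj

    WS : (E → ℕ) → Set
    WS u = ∀ {x y} → f x ≡ f y → ρ e x Fin.< ρ e y → u x ≤ u y

    -- Putting the block in front as a leading digit turns sorting inside blocks into sorting along
    -- the whole circle, where `sorted-unique` applies.
    ws-unique : ∀ {u v : E → ℕ} {W} → (∀ x → u x < W) → (∀ x → v x < W) → WS u → WS v → {θ : E → E} → Inj θ →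
                (∀ x → f (θ x) ≡ f x) → (∀ x → v (θ x) ≡ u x) → ∀ x → u x ≡ v x
    ws-unique {u} {v} {W} u< v< wu wv {θ} θ-inj fθ vθ x = proj₂ (digit-≡ {toℕ (ρ e (f x))} {toℕ (ρ e (f x))} (u< x) (v< x)
      (SortedUnique.sorted-unique (ρ-inj e) {u = λ z → toℕ (ρ e (f z)) * W + u z} {v = λ z → toℕ (ρ e (f z)) * W + v z}
        (mono u u< wu) (mono v v< wv) θ-inj (λ z → cong₂ (λ a b → toℕ (ρ e a) * W + b) (fθ z) (vθ z)) x))
      where
      mono : (u : E → ℕ) → (∀ x → u x < W) → WS u → ∀ {x y} → ρ e x Fin.< ρ e y → toℕ (ρ e (f x)) * W + u x ≤ toℕ (ρ e (f y)) * W + u y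
      mono u u< ws {x} {y} lt with ℕP.m≤n⇒m<n∨m≡n (Be.blk-mono x lt)
      ... | inj₁ l< = ℕP.<⇒≤ (digit-< (u< x) l<)
      ... | inj₂ q  = ℕP.+-mono-≤ (ℕP.≤-reflexive (cong (_* W) q)) (ws (ρ-inj e (toℕ-injective q)) lt)

    -- χ₀ sorts the colours k inside each block; the circle is cut at its first drop d.
    module Pattern (k : E → Fin B) (nonconst : ∃₂ λ x y → k x ≢ k y) where
      module R₀ = Rel₀ e f k
      χ₀ : Vec (Fin B) (suc N)
      χ₀ = pattern₀ e J k
      d : E
      d = drop χ₀

      private
        c< : ∀ x → toℕ (ρ e (f x)) * B + toℕ (k x) < suc N * B
        c< x = ℕP.<-≤-trans (ℕP.+-monoʳ-< _ (toℕ<n (k x))) (ℕP.≤-trans (ℕP.≤-reflexive (ℕP.+-comm _ B)) (ℕP.*-monoˡ-≤ B (toℕ<n (ρ e (f x)))))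

      φ₀-blk : ∀ x → f (R₀.φ x) ≡ f x
      φ₀-blk = blk-pres e∈J R₀.φ-inj (λ {x} {y} lt → R₀.Bounded.φ-colour c< (digit-< (toℕ<n (k x)) lt))

      χ₀-φ : ∀ x → lookup χ₀ (R₀.φ x) ≡ k x
      χ₀-φ x = trans (lookup∘tabulate (k ∘ R₀.φ⁻) (R₀.φ x)) (cong k (R₀.φ⁻φ x))

      χ₀-ws : WS (λ x → toℕ (lookup χ₀ x))
      χ₀-ws {x} {y} q lt = ℕP.≮⇒≥ λ g → ℕP.<-asym lt
        (subst₂ (λ a b → ρ e a Fin.< ρ e b) (R₀.φφ⁻ y) (R₀.φφ⁻ x) (R₀.Bounded.φ-colour c<
          (subst₂ _<_ refl (cong (λ z → toℕ (ρ e z) * B + toℕ (k (R₀.φ⁻ x))) fq)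
            (ℕP.+-monoʳ-< (toℕ (ρ e (f (R₀.φ⁻ y))) * B) (subst₂ _<_ (cong toℕ (lookup∘tabulate (k ∘ R₀.φ⁻) y)) (cong toℕ (lookup∘tabulate (k ∘ R₀.φ⁻) x)) g)))))
        where
        fq : f (R₀.φ⁻ y) ≡ f (R₀.φ⁻ x)
        fq = trans (sym (φ₀-blk _)) (trans (cong f (R₀.φφ⁻ y)) (trans (sym q) (trans (cong f (sym (R₀.φφ⁻ x))) (φ₀-blk _))))

      χ₀-nonconst : ∃₂ λ x y → lookup χ₀ x ≢ lookup χ₀ y
      χ₀-nonconst = let x , y , ne = nonconst in R₀.φ x , R₀.φ y , λ q → ne (trans (sym (χ₀-φ x)) (trans q (χ₀-φ y)))

      d∈J : J d ≡ true
      d∈J with J d in eq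
      ... | true = refl
      -- Colours sorted inside a block cannot drop between two neighbours of that block.
      ... | false = ⊥-elim (ℕP.<⇒≱ (drop-spec χ₀ χ₀-nonconst) (χ₀-ws (same-blk eq) (Be.step-< eq)))

      χ₀-unique : (χ : Vec (Fin B) (suc N)) {θ : E → E} → Inj θ → (∀ x → f (θ x) ≡ f x) → (∀ x → lookup χ (θ x) ≡ k x) →
               WS (λ x → toℕ (lookup χ x)) → χ ≡ χ₀
      χ₀-unique χ {θ} θ-inj fθ χθ ws = trans (sym (tabulate∘lookup χ)) (trans (tabulate-cong (λ x → toℕ-injective
        (ws-unique {u = λ x → toℕ (lookup χ x)} {v = λ x → toℕ (lookup χ₀ x)} {W = B} (λ x → toℕ<n (lookup χ x)) (λ x → toℕ<n (lookup χ₀ x)) ws χ₀-ws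
          {θ = R₀.φ ∘ inv} (λ q → inv-inj (R₀.φ-inj q))
          (λ x → trans (φ₀-blk _) (trans (sym (fθ _)) (cong f (rinv x))))
          (λ x → cong toℕ (trans (χ₀-φ _) (trans (sym (χθ _)) (cong (lookup χ) (rinv x))))) x)))
        (tabulate∘lookup χ₀))
        where open Inverse θ-inj

    FSame : (π : E → E) → E → E → Set
    FSame π x y = ∀ i → f (iter π i x) ≡ f (iter π i y)

    FSame-iter : ∀ π a {x y} → FSame π x y → FSame π (iter π a x) (iter π a y)
    FSame-iter π a {x} {y} s i = trans (cong f (sym (iter-+ π i a x))) (trans (s (i + a)) (cong f (iter-+ π i a y)))

    letter< : ∀ x → letter e f x < suc N
    letter< x = toℕ<n (ρ e (f x))

    letter-≡ : ∀ {x y} → letter e f x ≡ letter e f y → f x ≡ f y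
    letter-≡ q = ρ-inj e (toℕ-injective q)

    -- The two codings (π , f) and (σ , m , k) of one structure.
    module Pair {d : E} (d∈J : J d ≡ true) {π σ : E → E} {m k : E → Fin B} (av : AV π f) (tv : TV (ρ d) f σ m k)
                (P₁≡ : ∀ x → P₁ f σ m k x ≡ π x) (P₂≡ : ∀ x → P₂ (ρ d) π f x ≡ σ x)
                (M≡ : ∀ x → M (ρ d) π f x ≡ m x) (K≡ : ∀ x → K π f x ≡ k x) where
      module RA = RelA e f π
      module RT = RelT d f σ m k

      S₂ : E → E → Set
      S₂ = Same₂ f σ m k f σ m k

      RT⇒S₂ : ∀ {x y} → RT.Same x y → S₂ x y
      RT⇒S₂ s i = code-≡ d f k m f k m (s i)

      S₂⇒RT : ∀ {x y} → S₂ x y → RT.Same x y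
      S₂⇒RT s i = code-cong d f k m f k m (proj₁ (s i)) (proj₁ (proj₂ (s i))) (proj₂ (proj₂ (s i)))

      RA⇒F : ∀ {x y} → RA.Same x y → FSame π x y
      RA⇒F s i = letter-≡ (s i)

      F⇒RA : ∀ {x y} → FSame π x y → RA.Same x y
      F⇒RA s i = cong (toℕ ∘ ρ e) (s i)

      S₂-iter : ∀ a {x y} → S₂ x y → S₂ (iter σ a x) (iter σ a y)
      S₂-iter a s = RT⇒S₂ (RT.Same-iter a (S₂⇒RT s))

      π-via-σ : ∀ {x y} → S₂ x y → ∃ λ a → π x ≡ iter σ a x × π y ≡ iter σ a y
      π-via-σ {x} {y} s = let a , p , q = nat-bwd (ρ-inj d) tv tv x y s in a , trans (sym (P₁≡ x)) p , trans (sym (P₁≡ y)) q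

      σ-via-π : ∀ {x y} → FSame π x y → k x ≡ k y × m x ≡ m y × ∃ λ a → σ x ≡ iter π a x × σ y ≡ iter π a y
      σ-via-π {x} {y} s = let p , q , a , u , w = nat-fwd av av x y s in
        trans (sym (K≡ x)) (trans p (K≡ y)) , trans (sym (M≡ x)) (trans q (M≡ y)) , a , trans (sym (P₂≡ x)) u , trans (sym (P₂≡ y)) w

      S₂-π : ∀ {x y} → S₂ x y → S₂ (π x) (π y)
      S₂-π s = let a , p , q = π-via-σ s in subst₂ S₂ (sym p) (sym q) (S₂-iter a s)

      F-σ : ∀ {x y} → FSame π x y → FSame π (σ x) (σ y)
      F-σ s = let _ , _ , a , p , q = σ-via-π s in subst₂ (FSame π) (sym p) (sym q) (FSame-iter π a s)

      -- Both codings have the same ties: by naturality `π` is one and the same power of `σ` at tied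
      -- points, so it keeps them tied, and `F⇒S₂` argues likewise with the roles exchanged.
      S₂⇒F : ∀ {x y} → S₂ x y → FSame π x y
      S₂⇒F s i = proj₁ (go i s 0)
        where
        go : ∀ i {x y} → S₂ x y → S₂ (iter π i x) (iter π i y)
        go zero    s = s
        go (suc i) s = S₂-π (go i s)

      F⇒S₂ : ∀ {x y} → FSame π x y → S₂ x y
      F⇒S₂ s i = let s′ = go i s; a , b , _ = σ-via-π s′ in s′ 0 , a , b
        where
        go : ∀ i {x y} → FSame π x y → FSame π (iter σ i x) (iter σ i y)
        go zero    s = s
        go (suc i) s = F-σ (go i s)

      code<′ : ∀ x → code d f k m x < codeBd
      code<′ = code< d f k m

      module TB = RT.Bounded code<′
      module TP = TB.Periodic (TV-period tv)
      module AB = RA.Bounded letter<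
      module AP = AB.Periodic (𝒞-period (AV-𝒞 av))

      φ-blk : ∀ x → f (RT.φ x) ≡ f x
      φ-blk = blk-pres d∈J RT.φ-inj (λ {x} lt → TB.φ-colour (digit-< (km-< k m x) lt))

      ψ-blk : ∀ x → f (RA.φ x) ≡ f x
      ψ-blk = blk-pres e∈J RA.φ-inj AB.φ-colour

    module FromA (v : Vec E (suc N)) (ok : Ain e J v) where
      π : E → E
      π = lookup v

      compat : ∀ {x y} → f x ≡ f y → ρ e x Fin.< ρ e y → ρ e (π x) Fin.< ρ e (π y)
      compat {x} = Be.blk-chain (λ x y → ρ e (π x) Fin.< ρ e (π y)) ℕP.<-trans (proj₂ ok _) x

      open Ties (ρ e) (ρ-inj e) π l (𝒞-period (proj₁ ok)) (FSame π) (λ s i → sym (s i)) (FSame-iter π 1) (λ s → compat (s 0))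

      av : AV π f
      av = prim⇒AV (proj₁ ok) (λ x j s → aperiodic j x s)

      k : E → Fin B
      k = K π f

      open Pattern k (TV-nonconst (fwd (ρ-inj e) av)) public

      σ : E → E
      σ = P₂ (ρ d) π f
      m : E → Fin B
      m = M (ρ d) π f
      tv : TV (ρ d) f σ m k
      tv = fwd (ρ-inj d) av

      open Pair d∈J {π} {σ} {m} {k} av tv (P₁P₂ (ρ-inj d) av) (λ _ → refl) (λ _ → refl) (λ _ → refl) public

      -- At tied points `σ` is a common power of `π`, whose iterates preserve the order of ties for
      -- the cut at `e`; tied points stay in a common block, where the cuts at `e` and `d` agree.
      tie : ∀ {x y} → RT.Same x y → ρ d x Fin.< ρ d y → ρ d (σ x) Fin.< ρ d (σ y)
      tie {x} {y} s lt = subst₂ (λ a b → ρ d a Fin.< ρ d b) (sym p) (sym q)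
        (toOrder d∈J (s′ a) (mono-iter a s′ (fromOrder d∈J (s′ 0) lt)))
        where
        s′ : FSame π x y
        s′ = S₂⇒F (RT⇒S₂ s)
        a : ℕ
        a = proj₁ (proj₂ (proj₂ (σ-via-π s′)))
        p : σ x ≡ iter π a x
        p = proj₁ (proj₂ (proj₂ (proj₂ (σ-via-π s′))))
        q : σ y ≡ iter π a y
        q = proj₂ (proj₂ (proj₂ (proj₂ (σ-via-π s′))))

      open RT using (φ; φ⁻; φφ⁻; φ⁻φ; φ-inj)

      φ⁻-blk : ∀ x → f (φ⁻ x) ≡ f x
      φ⁻-blk x = trans (sym (φ-blk (φ⁻ x))) (cong f (φφ⁻ x))

      χ : Vec (Fin B) (suc N)
      χ = tabulate (k ∘ φ⁻)
      σ′ m′ k′ : _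
      σ′ = lookup (tabulate (φ ∘ σ ∘ φ⁻))
      m′ = lookup (tabulate (m ∘ φ⁻))
      k′ = lookup χ

      m′≡ : ∀ x → m′ x ≡ m (φ⁻ x)
      m′≡ = lookup∘tabulate (m ∘ φ⁻)
      k′≡ : ∀ x → k′ x ≡ k (φ⁻ x)
      k′≡ = lookup∘tabulate (k ∘ φ⁻)
      σ′≡ : ∀ x → σ′ x ≡ φ (σ (φ⁻ x))
      σ′≡ = lookup∘tabulate (φ ∘ σ ∘ φ⁻)
      m′φ : ∀ x → m′ (φ x) ≡ m x
      m′φ x = trans (m′≡ (φ x)) (cong m (φ⁻φ x))
      k′φ : ∀ x → k′ (φ x) ≡ k x
      k′φ x = trans (k′≡ (φ x)) (cong k (φ⁻φ x))
      σ′φ : ∀ x → φ (σ x) ≡ σ′ (φ x)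
      σ′φ x = sym (trans (σ′≡ (φ x)) (cong (φ ∘ σ) (φ⁻φ x)))

      q≡ : ∀ x → km k′ m′ x ≡ km k m (φ⁻ x)
      q≡ x = km-cong k′ m′ k m {x} {φ⁻ x} (k′≡ x) (m′≡ x)

      sorted : ∀ {x y} → f x ≡ f y → ρ d x Fin.< ρ d y → km k′ m′ x ≤ km k′ m′ y
      sorted {x} {y} fq lt = ℕP.≮⇒≥ λ g → ℕP.<-asym lt (subst₂ (λ a b → ρ d a Fin.< ρ d b) (φφ⁻ y) (φφ⁻ x)
        (TB.φ-colour (subst₂ _<_ refl (cong (λ z → toℕ (ρ d z) * (B * B) + km k m (φ⁻ x)) (trans (φ⁻-blk y) (trans (sym fq) (sym (φ⁻-blk x)))))
          (ℕP.+-monoʳ-< (toℕ (ρ d (f (φ⁻ y))) * (B * B)) (subst₂ _<_ (q≡ y) (q≡ x) g)))))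

      sorted⇒ws : WS (λ x → toℕ (k′ x))
      sorted⇒ws {x} {y} fq lt = ℕP.≮⇒≥ λ g → ℕP.<⇒≱ (digit-< {toℕ (k′ y)} {toℕ (k′ x)} {toℕ (m′ y)} {toℕ (m′ x)} (toℕ<n (m′ y)) g) (sorted {x} {y} fq (toOrder d∈J fq lt))

      -- The relabelled colouring is sorted inside blocks and has the same colours there as the
      -- prediction, so the prediction was right and its drop is the cut of the finished structure.
      χ≡χ₀ : χ ≡ χ₀
      χ≡χ₀ = χ₀-unique χ φ-inj φ-blk k′φ sorted⇒ws

      dχ : drop χ ≡ d
      dχ = cong drop χ≡χ₀

      tv′ : TV (ρ d) f σ′ m′ k′
      tv′ = TV-iso φ φ-inj σ′φ m′φ k′φ φ-blk tv

      t : Tstr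
      t = toT e J v

      noDesc : ∀ i → J i ≡ false → ¬ (km k′ m′ (next i) < km k′ m′ i ⊎ (km k′ m′ i ≡ km k′ m′ (next i) × ρ d (σ′ (next i)) Fin.< ρ d (σ′ i)))
      noDesc i i∉ (inj₁ lt) = ℕP.<⇒≱ lt (sorted (same-blk i∉) (Block.step-< J d d∈J i∉))
      noDesc i i∉ (inj₂ (q , lt)) = ℕP.<-asym lt (subst₂ (λ a b → ρ d a Fin.< ρ d b) (sym (σ′≡ i)) (sym (σ′≡ (next i)))
        (TP.φ-compat tie {φ⁻ i} {φ⁻ (next i)}
          (cong₂ (λ a b → toℕ (ρ d a) * (B * B) + b) (trans (φ⁻-blk i) (trans (same-blk i∉) (sym (φ⁻-blk (next i))))) (trans (sym (q≡ i)) (trans q (q≡ (next i)))))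
          (subst₂ (λ a b → ρ d a Fin.< ρ d b) (sym (φφ⁻ i)) (sym (φφ⁻ (next i))) (Block.step-< J d d∈J i∉))))

      t-ok : Tin J t
      t-ok = subst (λ z → TV (ρ z) id σ′ m′ k′) (sym dχ) (TV-refine (ρ-inj d) (blk-letters d∈J) finer tv′)
           , λ i i∉ → subst (λ z → ¬ (km k′ m′ (next i) < km k′ m′ i ⊎ (km k′ m′ i ≡ km k′ m′ (next i) × ρ z (σ′ (next i)) Fin.< ρ z (σ′ i)))) (sym dχ) (noDesc i i∉)
        where
        finer : ∀ {x y} → f x ≡ f y → km k′ m′ x < km k′ m′ y → ρ d x Fin.< ρ d y
        finer {x} {y} fq lt with ℕP.<-cmp (toℕ (ρ d x)) (toℕ (ρ d y))
        ... | tri< p _ _ = p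
        ... | tri≈ _ q _ = ⊥-elim (ℕP.<-irrefl (cong (km k′ m′) (ρ-inj d (toℕ-injective q))) lt)
        ... | tri> _ _ g = ⊥-elim (ℕP.<⇒≱ lt (sorted (sym fq) g))

    module FromT (t : Tstr) (ok : Tin J t) where
      χ : Vec (Fin B) (suc N)
      χ = proj₁ t
      k m σ : _
      k = lookup χ
      m = lookup (proj₂ (proj₂ t))
      σ = lookup (proj₁ (proj₂ t))
      d : E
      d = drop χ
      q : E → ℕ
      q = km k m

      d∈J : J d ≡ true
      d∈J with J d in eq
      ... | true = refl
      -- A drop of the colouring is a descent, and the structure has no descents outside `J`.
      ... | false = ⊥-elim (proj₂ ok d eq (inj₁ (digit-< (toℕ<n (m (next d))) (drop-spec χ (TV-nonconst (proj₁ ok))))))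

      Asc : E → E → Set
      Asc x y = q x < q y ⊎ (q x ≡ q y × ρ d (σ x) Fin.< ρ d (σ y))

      Asc-trans : ∀ {x y z} → Asc x y → Asc y z → Asc x z
      Asc-trans (inj₁ a) (inj₁ b) = inj₁ (ℕP.<-trans a b)
      Asc-trans {x} (inj₁ a) (inj₂ (b , _)) = inj₁ (subst (q x <_) b a)
      Asc-trans {z = z} (inj₂ (a , _)) (inj₁ b) = inj₁ (subst (_< q z) (sym a) b)
      Asc-trans (inj₂ (a , u)) (inj₂ (b , w)) = inj₂ (trans a b , ℕP.<-trans u w)

      asc : ∀ {i} → J i ≡ false → Asc i (next i)
      asc {i} i∉ with ℕP.<-cmp (q i) (q (next i))
      ... | tri< lt _ _ = inj₁ lt
      ... | tri> _ _ gt = ⊥-elim (proj₂ ok i i∉ (inj₁ gt))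
      ... | tri≈ _ eq _ with ℕP.<-cmp (toℕ (ρ d (σ i))) (toℕ (ρ d (σ (next i))))
      ...   | tri< lt _ _ = inj₂ (eq , lt)
      ...   | tri> _ _ gt = ⊥-elim (proj₂ ok i i∉ (inj₂ (eq , gt)))
      ...   | tri≈ _ p _  = ⊥-elim (ℕP.<-irrefl (cong (toℕ ∘ ρ e) (TV-inj (proj₁ ok) (ρ-inj d (toℕ-injective p)))) (Be.step-< i∉))

      compat : ∀ {x y} → f x ≡ f y → ρ d x Fin.< ρ d y → Asc x y
      compat {x} = Block.blk-chain J d d∈J Asc Asc-trans asc x

      sorted : ∀ {x y} → f x ≡ f y → ρ d x Fin.< ρ d y → q x ≤ q y
      sorted fq lt with compat fq lt
      ... | inj₁ l< = ℕP.<⇒≤ l<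
      ... | inj₂ (eq , _) = ℕP.≤-reflexive eq

      finer : ∀ {x y} → f x ≡ f y → q x < q y → ρ d x Fin.< ρ d y
      finer {x} {y} fq lt with ℕP.<-cmp (toℕ (ρ d x)) (toℕ (ρ d y))
      ... | tri< p _ _ = p
      ... | tri≈ _ p _ = ⊥-elim (ℕP.<-irrefl (cong q (ρ-inj d (toℕ-injective p))) lt)
      ... | tri> _ _ g = ⊥-elim (ℕP.<⇒≱ lt (sorted (sym fq) g))

      tv : TV (ρ d) f σ m k
      tv = TV-coarsen (ρ-inj d) (blk-letters d∈J) finer (proj₁ ok)

      tieσ : ∀ {x y} → q x ≡ q y → f x ≡ f y → ρ d x Fin.< ρ d y → ρ d (σ x) Fin.< ρ d (σ y)
      tieσ qq fq lt with compat fq lt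
      ... | inj₁ l< = ⊥-elim (ℕP.<-irrefl qq l<)
      ... | inj₂ (_ , l<) = l<

      private
        S : E → E → Set
        S = Same₂ f σ m k f σ m k
        S-step : ∀ {x y} → S x y → S (σ x) (σ y)
        S-step {x} {y} s i = subst₂ (λ a b → f a ≡ f b × k a ≡ k b × m a ≡ m b) (iter-suc σ i x) (iter-suc σ i y) (s (suc i))
        S-q : ∀ {x y} → S x y → q x ≡ q y
        S-q s = km-cong k m k m (proj₁ (proj₂ (s 0))) (proj₂ (proj₂ (s 0)))

      open Ties (ρ d) (ρ-inj d) σ l (TV-period tv) S (λ s i → sym (proj₁ (s i)) , sym (proj₁ (proj₂ (s i))) , sym (proj₂ (proj₂ (s i)))) S-step
                (λ s → tieσ (S-q s) (proj₁ (s 0)))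

      prim₂ : Prim₂ f σ m k
      prim₂ x j s = aperiodic j x s

      π : E → E
      π = P₁ f σ m k
      av : AV π f
      av = bwd (ρ-inj d) tv prim₂

      inverse : ∀ x → P₂ (ρ d) π f x ≡ σ x × M (ρ d) π f x ≡ m x × K π f x ≡ k x
      inverse = P₂P₁ (ρ-inj d) tv prim₂

      open Pair d∈J {π} {σ} {m} {k} av tv (λ _ → refl) (proj₁ ∘ inverse) (proj₁ ∘ proj₂ ∘ inverse) (proj₂ ∘ proj₂ ∘ inverse) public

      tie : ∀ {x y} → RA.Same x y → ρ e x Fin.< ρ e y → ρ e (π x) Fin.< ρ e (π y)
      tie {x} {y} s lt = subst₂ (λ a b → ρ e a Fin.< ρ e b) (sym p) (sym r)
        (fromOrder d∈J (proj₁ (s′ a)) (mono-iter a s′ (toOrder d∈J (proj₁ (s′ 0)) lt)))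
        where
        s′ : S x y
        s′ = F⇒S₂ (RA⇒F s)
        a : ℕ
        a = proj₁ (π-via-σ s′)
        p : π x ≡ iter σ a x
        p = proj₁ (proj₂ (π-via-σ s′))
        r : π y ≡ iter σ a y
        r = proj₂ (proj₂ (π-via-σ s′))

      open RA using () renaming (φ to ψ; φ⁻ to ψ⁻; φφ⁻ to ψψ⁻; φ⁻φ to ψ⁻ψ; φ-inj to ψ-inj)

      v : Vec E (suc N)
      v = toA e J t

      v≡ : ∀ x → lookup v x ≡ ψ (π (ψ⁻ x))
      v≡ = lookup∘tabulate (ψ ∘ π ∘ ψ⁻)

      vψ : ∀ x → ψ (π x) ≡ lookup v (ψ x)
      vψ x = sym (trans (v≡ (ψ x)) (cong (ψ ∘ π) (ψ⁻ψ x)))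

      ψ⁻-blk : ∀ x → f (ψ⁻ x) ≡ f x
      ψ⁻-blk x = trans (sym (ψ-blk (ψ⁻ x))) (cong f (ψψ⁻ x))

      v-ok : Ain e J v
      v-ok = 𝒞-iso ψ ψ-inj vψ (AV-𝒞 av) , λ i i∉ → subst₂ (λ a b → ρ e a Fin.< ρ e b) (sym (v≡ i)) (sym (v≡ (next i)))
        (AP.φ-compat tie (cong (toℕ ∘ ρ e) (trans (ψ⁻-blk i) (trans (same-blk i∉) (sym (ψ⁻-blk (next i))))))
          (subst₂ (λ a b → ρ e a Fin.< ρ e b) (sym (ψψ⁻ i)) (sym (ψψ⁻ (next i))) (Be.step-< i∉)))

      χ-ws : WS (λ x → toℕ (k x))
      χ-ws {x} {y} fq lt = ℕP.≮⇒≥ λ g → ℕP.<⇒≱ (digit-< {toℕ (k y)} {toℕ (k x)} {toℕ (m y)} {toℕ (m x)} (toℕ<n (m y)) g) (sorted {x} {y} fq (toOrder d∈J fq lt))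

    -- Relabelling forth by `φ` and back by `ψ` sorts the same itineraries twice, and ties keep
    -- their order both times. So the composite preserves the order of the cut at `e` and is the
    -- identity.
    toA-toT : ∀ v → Ain e J v → toA e J (toT e J v) ≡ v
    toA-toT v ok = trans (tabulate-cong λ i → trans (cong (ψ ∘ π″) (ψ⁻≡ i)) (trans (cong ψ (π″φ i)) (ψφ (π i)))) (tabulate∘lookup v)
      where
      open FromA v ok
      open RT using (φ; φ-inj)
      π″ : E → E
      π″ = P₁ f σ′ m′ k′
      module R″ = RelA e f π″
      open R″ using () renaming (φ to ψ; φ⁻ to ψ⁻; φ⁻φ to ψ⁻ψ; φ-inj to ψ-inj)
      π″φ : ∀ x → π″ (φ x) ≡ φ (π x)
      π″φ x = let a , p , q = nat-bwd (ρ-inj d) tv tv′ x (φ x) same in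
              trans q (trans (sym (iter-conj φ σ′φ a x)) (cong φ (trans (sym p) (P₁P₂ (ρ-inj d) av x))))
        where
        same : Same₂ f σ m k f σ′ m′ k′ x (φ x)
        same i = subst (λ z → f (iter σ i x) ≡ f z × k (iter σ i x) ≡ k′ z × m (iter σ i x) ≡ m′ z) (iter-conj φ σ′φ i x)
                   (sym (φ-blk _) , sym (k′φ _) , sym (m′φ _))
      key≡ : ∀ l x → R″.Key l (φ x) ≡ RA.Key l x
      key≡ zero    x = refl
      key≡ (suc l) x = cong₂ _+_ (cong (λ z → toℕ (ρ e z) * suc N ^ l) (φ-blk x)) (trans (cong (R″.Key l) (π″φ x)) (key≡ l (π x)))
      mono : ∀ {x y} → ρ e x Fin.< ρ e y → ρ e (ψ (φ x)) Fin.< ρ e (ψ (φ y))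
      mono {x} {y} lt with ℕP.m≤n⇒m<n∨m≡n (RA.key-mono (Be.blk-mono _) (compat ∘ letter-≡) letter< (suc l) lt)
      ... | inj₁ l< = R″.φ-key (subst₂ _<_ (sym (key≡ (suc l) x)) (sym (key≡ (suc l) y)) l<)
      ... | inj₂ eq = R″.φ-eq (trans (key≡ (suc l) x) (trans eq (sym (key≡ (suc l) y))))
                        (fromOrder d∈J (trans (φ-blk x) (trans (s 0) (sym (φ-blk y)))) (RT.φ-same (S₂⇒RT (F⇒S₂ s)) (toOrder d∈J (s 0) lt)))
        where
        s : FSame π x y
        s = RA⇒F (AP.Key⇒Same eq)
      ψφ : ∀ x → ψ (φ x) ≡ x
      ψφ = SortedUnique.monotone⇒id (ρ-inj e) (λ q → φ-inj (ψ-inj q)) mono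
      ψ⁻≡ : ∀ i → ψ⁻ i ≡ φ i
      ψ⁻≡ i = trans (cong ψ⁻ (sym (ψφ i))) (ψ⁻ψ (φ i))

    -- The same argument with the cut at `d`. It also has to be seen that the colours, and with them
    -- the cut, are recovered; naturality gives the colours and `χ₀-unique` the cut.
    toT-toA : ∀ t → Tin J t → toT e J (toA e J t) ≡ t
    toT-toA t ok = cong₂ _,_ (back (λ i → trans (cong A.k (φ⁻≡ i)) (kψ i)))
      (cong₂ _,_ (back (λ i → trans (cong (φ ∘ A.σ) (φ⁻≡ i)) (trans (cong φ (σψ i)) (φψ (σ i))))) (back (λ i → trans (cong A.m (φ⁻≡ i)) (mψ i))))
      where
      open FromT t ok
      module A = FromA v v-ok
      open RA using () renaming (φ to ψ; φ-inj to ψ-inj)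
      open A.RT using (φ; φ⁻; φ⁻φ; φ-inj)
      back : ∀ {X : Set} {w : Vec X (suc N)} {g : E → X} → (∀ i → g i ≡ lookup w i) → tabulate g ≡ w
      back {w = w} eq = trans (tabulate-cong eq) (tabulate∘lookup w)
      same : ∀ x i → f (iter π i x) ≡ f (iter (lookup v) i (ψ x))
      same x i = trans (sym (ψ-blk _)) (cong f (iter-conj ψ vψ i x))
      nat : ∀ x → _
      nat x = nat-fwd {ρ = ρ d} av A.av x (ψ x) (same x)
      kψ : ∀ x → A.k (ψ x) ≡ k x
      kψ x = trans (sym (proj₁ (nat x))) (proj₂ (proj₂ (inverse x)))
      χ≡ : χ ≡ A.χ₀
      χ≡ = A.χ₀-unique χ {θ = RA.φ⁻} RA.φ⁻-inj ψ⁻-blk (λ x → trans (sym (kψ (RA.φ⁻ x))) (cong A.k (RA.φφ⁻ x))) χ-ws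
      d≡ : A.d ≡ d
      d≡ = cong drop (sym χ≡)
      mψ : ∀ x → A.m (ψ x) ≡ m x
      mψ x = trans (cong (λ z → M (ρ z) (lookup v) f (ψ x)) d≡) (trans (sym (proj₁ (proj₂ (nat x)))) (proj₁ (proj₂ (inverse x))))
      σψ : ∀ x → A.σ (ψ x) ≡ ψ (σ x)
      σψ x = let _ , _ , a , p , r = nat x in
        trans (cong (λ z → P₂ (ρ z) (lookup v) f (ψ x)) d≡) (trans r (trans (sym (iter-conj ψ vψ a x)) (cong ψ (trans (sym p) (proj₁ (inverse x))))))
      key≡ : ∀ l x → A.RT.Key l (ψ x) ≡ RT.Key l x
      key≡ zero    x = refl
      key≡ (suc l) x = cong₂ _+_
        (cong (_* codeBd ^ l) (cong₂ _+_ (cong₂ (λ a b → toℕ (ρ a b) * (B * B)) d≡ (ψ-blk x)) (km-cong A.k A.m k m (kψ x) (mψ x))))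
        (trans (cong (A.RT.Key l) (σψ x)) (key≡ l (σ x)))
      to : ∀ {a b} → ρ d a Fin.< ρ d b → ρ A.d a Fin.< ρ A.d b
      to {a} {b} = subst (λ z → ρ z a Fin.< ρ z b) (sym d≡)
      from : ∀ {a b} → ρ A.d a Fin.< ρ A.d b → ρ d a Fin.< ρ d b
      from {a} {b} = subst (λ z → ρ z a Fin.< ρ z b) d≡
      code-mono : ∀ {x y} → ρ d x Fin.< ρ d y → code d f k m x ≤ code d f k m y
      code-mono {x} {y} lt with ℕP.m≤n⇒m<n∨m≡n (Block.blk-mono J d d∈J x lt)
      ... | inj₁ l< = ℕP.<⇒≤ (digit-< (km-< k m x) l<)
      ... | inj₂ eq = ℕP.+-mono-≤ (ℕP.≤-reflexive (cong (_* (B * B)) eq)) (sorted (ρ-inj d (toℕ-injective eq)) lt)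
      code-compat : ∀ {x y} → code d f k m x ≡ code d f k m y → ρ d x Fin.< ρ d y → ρ d (σ x) Fin.< ρ d (σ y)
      code-compat eq lt = let a , b , c = code-≡ d f k m f k m eq in tieσ (km-cong k m k m b c) a lt
      mono : ∀ {x y} → ρ d x Fin.< ρ d y → ρ d (φ (ψ x)) Fin.< ρ d (φ (ψ y))
      mono {x} {y} lt with ℕP.m≤n⇒m<n∨m≡n (RT.key-mono code-mono code-compat code<′ (suc l) lt)
      ... | inj₁ l< = from (A.RT.φ-key (subst₂ _<_ (sym (key≡ (suc l) x)) (sym (key≡ (suc l) y)) l<))
      ... | inj₂ eq = from (A.RT.φ-eq (trans (key≡ (suc l) x) (trans eq (sym (key≡ (suc l) y))))
                        (to (toOrder d∈J (trans (ψ-blk x) (trans (s 0) (sym (ψ-blk y)))) (RA.φ-same (F⇒RA s) (fromOrder d∈J (s 0) lt)))))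
        where
        s : FSame π x y
        s = S₂⇒F (RT⇒S₂ (TP.Key⇒Same eq))
      φψ : ∀ x → φ (ψ x) ≡ x
      φψ = SortedUnique.monotone⇒id (ρ-inj d) (λ p → ψ-inj (φ-inj p)) mono
      φ⁻≡ : ∀ i → φ⁻ i ≡ ψ i
      φ⁻≡ i = trans (cong φ⁻ (sym (φψ i))) (φ⁻φ (ψ i))

    #A≡#T : # (Ain? e J) (list EnumA) ≡ # (Tin? J) (list EnumT)
    #A≡#T = #-bij (Ain? e J) (Tin? J) EnumA EnumT (toT e J) (toA e J) FromA.t-ok FromT.v-ok toA-toT toT-toA

  -- Assembling the cyclic extension

  module Assemble (μ : List ℕ) (to : ∀ v → 𝒞 (lookup v) → T (member μ v)) (from : ∀ v → T (member μ v) → 𝒞 (lookup v)) where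

    𝒞-inj : ∀ {π} → 𝒞 π → Inj π
    𝒞-inj {π} c {x} {y} eq = trans (sym (𝒞-period c x)) (trans (iter-suc π l x) (trans (cong (iter π l) eq) (trans (sym (iter-suc π l y)) (𝒞-period c y))))

    C : Set
    C = Class (suc N) μ
    EnumC : Enum C
    EnumC = Subtype.Enum-Σ (member μ) EnumA
    TS : Set
    TS = Σ Tstr (λ t → T (⌊ TOK? t ⌋))
    EnumTS : Enum TS
    EnumTS = Subtype.Enum-Σ (λ t → ⌊ TOK? t ⌋) EnumT

    cD : Tstr → Subset (suc N)
    cD t = tabulate (λ i → does (Desc? t i))

    cD-false : ∀ t i → lookup (cD t) i ≡ false → ¬ Desc t i
    cD-false t i eq = does-false (Desc? t i) (trans (sym (lookup∘tabulate (λ i → does (Desc? t i)) i)) eq)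
    cD-false⁻ : ∀ t i → ¬ Desc t i → lookup (cD t) i ≡ false
    cD-false⁻ t i nd = trans (lookup∘tabulate (λ i → does (Desc? t i)) i) (does-false⁻ (Desc? t i) nd)

    count-T : (J : E → Bool) {Q : Tstr → Set} (Q? : ∀ t → Dec (Q t)) → (∀ t → Q t → ∀ i → J i ≡ false → ¬ Desc t i) →
              (∀ t → (∀ i → J i ≡ false → ¬ Desc t i) → Q t) → # (λ (s : TS) → Q? (proj₁ s)) (list EnumTS) ≡ # (Tin? J) (list EnumT)
    count-T J Q? f g = trans (Subtype.∑-restrict (λ t → ⌊ TOK? t ⌋) (list EnumT) (λ t → ind (Q? t)))
      (∑-cong (list EnumT) λ t → trans (sym (ind-× (T? (⌊ TOK? t ⌋)) (Q? t)))
        (ind-cong (T? (⌊ TOK? t ⌋) ×-dec Q? t) (Tin? J t)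
          (λ (a , b) → toWitness {a? = TOK? t} a , f t b) (λ (a , b) → fromWitness {a? = TOK? t} a , g t b)))

    count-C : (J : Subset (suc N)) → # (λ (c : C) → Des c SubP.⊆? J) (list EnumC) ≡ # (Ain? last (orLast J)) (list EnumA)
    count-C J = trans (Subtype.∑-restrict (member μ) (list EnumA) (λ v → ind (desVec v SubP.⊆? J)))
      (∑-cong (list EnumA) λ v → trans (sym (ind-× (T? (member μ v)) (desVec v SubP.⊆? J)))
        (ind-cong (T? (member μ v) ×-dec (desVec v SubP.⊆? J)) (Ain? last (orLast J) v) (λ (a , b) → f v a b) (λ (a , b) → to v a , g v b)))
      where
      f : ∀ v → T (member μ v) → desVec v ⊆ J → Ain last (orLast J) v
      f v mem sub = from v mem , λ i eq → let eqJ , ne = orLast-false J eq in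
        subst₂ Fin._<_ (sym (ρ-last (lookup v i))) (sym (ρ-last (lookup v (next i))))
          (ℕP.≤∧≢⇒< (ℕP.≮⇒≥ λ lt → subst T (trans (sym (desVec-≢last v i ne)) (⊆-out {S = desVec v} sub i eqJ)) (ℕP.<⇒<ᵇ lt))
            (λ e → ℕP.m≢1+n+m (toℕ i) {0} (trans (cong toℕ (𝒞-inj (from v mem) (toℕ-injective e))) (toℕ-next i ne))))
      g : ∀ v → (∀ i → orLast J i ≡ false → ρ last (lookup v i) Fin.< ρ last (lookup v (next i))) → desVec v ⊆ J
      g v inc = out-⊆ {S = desVec v} out
        where
        out : ∀ i → lookup J i ≡ false → lookup (desVec v) i ≡ false
        out i eq with i FinP.≟ last
        ... | yes refl = desVec-last v
        ... | no ne with lookup (desVec v) i in e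
        ...   | false = refl
        ...   | true  = ⊥-elim (ℕP.<-asym (subst₂ Fin._<_ (ρ-last (lookup v i)) (ρ-last (lookup v (next i))) (inc i (orLast-false⁻ J eq ne)))
                          (ℕP.<ᵇ⇒< _ _ (subst T (trans (sym e) (desVec-≢last v i ne)) tt)))

    Des′ : TS → Subset (suc N)
    Des′ s = cD (proj₁ s) ∩ upToPred (suc N)

    counts₁ : ∀ J → # (λ (c : C) → Des c SubP.⊆? J) (list EnumC) ≡ # (λ s → Des′ s SubP.⊆? J) (list EnumTS)
    counts₁ J = trans (count-C J) (trans (Bij.#A≡#T last (orLast J) (orLast-last J))
      (sym (count-T (orLast J) (λ t → (cD t ∩ upToPred (suc N)) SubP.⊆? J)
        (λ t sub i eq → let eqJ , ne = orLast-false J eq in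
          cD-false t i (∧-false (upToPred-≢last i ne) (trans (sym (lookup-zipWith _∧_ i (cD t) (upToPred (suc N)))) (⊆-out {S = cD t ∩ upToPred (suc N)} sub i eqJ))))
        (λ t h → out-⊆ {S = cD t ∩ upToPred (suc N)} (λ i eqJ → trans (lookup-zipWith _∧_ i (cD t) (upToPred (suc N))) (out t h i eqJ))))))
      where
      out : ∀ t → (∀ i → orLast J i ≡ false → ¬ Desc t i) → ∀ i → lookup J i ≡ false → lookup (cD t) i ∧ lookup (upToPred (suc N)) i ≡ false
      out t h i eqJ with i FinP.≟ last
      ... | yes refl = trans (cong (lookup (cD t) last ∧_) (upToPred-last {N})) (BoolP.∧-zeroʳ _)
      ... | no ne = cong (_∧ _) (cD-false⁻ t i (h i (orLast-false⁻ J eqJ ne)))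

    Desc-drop : ∀ t → TOK t → Desc t (drop (proj₁ t))
    Desc-drop (χ , σ , m) tok = inj₁ (digit-< (toℕ<n (lookup m (next (drop χ)))) (drop-spec χ (TV-nonconst tok)))

    not-Desc-rise : ∀ t → TOK t → ∃ λ i → ¬ Desc t i
    not-Desc-rise (χ , σ , m) tok = let i , lt = rise χ (TV-nonconst tok)
                                        q< : km (lookup χ) (lookup m) i < km (lookup χ) (lookup m) (next i)
                                        q< = digit-< (toℕ<n (lookup m i)) lt in
      i , λ { (inj₁ g) → ℕP.<-asym q< g ; (inj₂ (e , _)) → ℕP.<-irrefl e q< }

    -- Conjugation by the rotation preserves the cycle type and carries the cut and the blocks
    -- along.
    rotate : ∀ e J → # (Ain? e J) (list EnumA) ≡ # (Ain? (predMod e) (J ∘ next)) (list EnumA)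
    rotate e J = #-bij (Ain? e J) (Ain? (predMod e) (J ∘ next)) EnumA EnumA
      (λ v → tabulate (predMod ∘ lookup v ∘ next)) (λ w → tabulate (next ∘ lookup w ∘ predMod))
      (λ v (c , inc) → 𝒞-iso predMod predMod-inj (λ x → sym (trans (lookup∘tabulate (predMod ∘ lookup v ∘ next) (predMod x)) (cong (predMod ∘ lookup v) (next-pred x)))) c
        , λ i eq → subst₂ Fin._<_ (lem₁ v i) (lem₁ v (next i)) (inc (next i) eq))
      (λ w (c , inc) → 𝒞-iso next next-inj (λ x → sym (trans (lookup∘tabulate (next ∘ lookup w ∘ predMod) (next x)) (cong (next ∘ lookup w) (pred-next x)))) c
        , λ i eq → subst₂ Fin._<_ (lem₂ w i refl) (lem₂ w (next i) (trans (pred-next i) (sym (next-pred i))))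
            (inc (predMod i) (trans (cong J (next-pred i)) eq)))
      (λ v _ → trans (tabulate-cong {g = lookup v} λ i → trans (cong next (trans (lookup∘tabulate (predMod ∘ lookup v ∘ next) (predMod i)) (cong (predMod ∘ lookup v) (next-pred i)))) (next-pred (lookup v i))) (tabulate∘lookup v))
      (λ w _ → trans (tabulate-cong {g = lookup w} λ i → trans (cong predMod (trans (lookup∘tabulate (next ∘ lookup w ∘ predMod) (next i)) (cong (next ∘ lookup w) (pred-next i)))) (pred-next (lookup w i))) (tabulate∘lookup w))
      where
      ρ-pred : ∀ y → ρ e y ≡ ρ (predMod e) (predMod y)
      ρ-pred y = trans (cong₂ ρ (sym (next-pred e)) (sym (next-pred y))) (ρ-next-next (predMod e) (predMod y))
      lem₁ : ∀ v i → ρ e (lookup v (next i)) ≡ ρ (predMod e) (lookup (tabulate (predMod ∘ lookup v ∘ next)) i)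
      lem₁ v i = trans (ρ-pred _) (cong (ρ (predMod e)) (sym (lookup∘tabulate (predMod ∘ lookup v ∘ next) i)))
      lem₂ : ∀ w i {j} → predMod i ≡ j → ρ (predMod e) (lookup w j) ≡ ρ e (lookup (tabulate (next ∘ lookup w ∘ predMod)) i)
      lem₂ w i refl = sym (trans (cong (ρ e) (lookup∘tabulate (next ∘ lookup w ∘ predMod) i)) (trans (ρ-pred _) (cong (ρ (predMod e)) (pred-next _))))

    cDs : TS → Subset (suc N)
    cDs s = cD (proj₁ s)

    -- For nonempty `J` the counts are carried to permutations, where `rotate` compares them. For
    -- empty `J` both vanish, since every structure has a descent.
    counts₂ : ∀ J → # (λ s → sh (cDs s) SubP.⊆? J) (list EnumTS) ≡ # (λ s → cDs s SubP.⊆? J) (list EnumTS)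
    counts₂ J = trans (count-T (lookup J ∘ next) (λ t → sh (cD t) SubP.⊆? J)
        (λ t sub i eq → cD-false t i (trans (sym (trans (lookup∘tabulate (λ j → lookup (cD t) (predMod j)) (next i)) (cong (lookup (cD t)) (pred-next i)))) (⊆-out {S = sh (cD t)} sub (next i) eq)))
        (λ t h → out-⊆ {S = sh (cD t)} (λ i eq → trans (lookup∘tabulate (λ j → lookup (cD t) (predMod j)) i) (cD-false⁻ t (predMod i) (h (predMod i) (trans (cong (lookup J) (next-pred i)) eq))))))
      (trans mid (sym (count-T (lookup J) (λ t → cD t SubP.⊆? J)
        (λ t sub i eq → cD-false t i (⊆-out {S = cD t} sub i eq)) (λ t h → out-⊆ {S = cD t} (λ i eq → cD-false⁻ t i (h i eq))))))
      where
      mid : # (Tin? (lookup J ∘ next)) (list EnumT) ≡ # (Tin? (lookup J)) (list EnumT)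
      mid with any? (λ e → lookup J e BoolP.≟ true)
      ... | yes (e , e∈) = trans (sym (Bij.#A≡#T (predMod e) (lookup J ∘ next) (trans (cong (lookup J) (next-pred e)) e∈)))
                           (trans (sym (rotate e (lookup J))) (Bij.#A≡#T e (lookup J) e∈))
      ... | no ¬e = trans (∑-0 (list EnumT) λ t → ind-no (Tin? (lookup J ∘ next) t) λ (tok , h) → h (drop (proj₁ t)) (out _) (Desc-drop t tok))
                      (sym (∑-0 (list EnumT) λ t → ind-no (Tin? (lookup J) t) λ (tok , h) → h (drop (proj₁ t)) (out _) (Desc-drop t tok)))
        where
        out : ∀ i → lookup J i ≡ false
        out i with lookup J i in e
        ... | false = refl
        ... | true  = ⊥-elim (¬e (i , e))

    hasCyclicExtension : HasCyclicExtension (suc N) μ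
    hasCyclicExtension = cDes , p , (p-inj , p-surj) , (λ c → sym (F-des c)) , p-sh , λ c → ne⊥ (F c) , ne⊤ (F c)
      where
      module M₁ = Moebius (suc N) (Des {suc N} {μ}) Des′ (list EnumC) (list EnumTS)
      module M₂ = Moebius (suc N) (sh ∘ cDs) cDs (list EnumTS) (list EnumTS)
      fb₁ = fibre-bijection M₁._≟ˢ_ (Des {suc N} {μ}) Des′ EnumC EnumTS (M₁.exact counts₁)
      fb₂ = fibre-bijection M₂._≟ˢ_ (sh ∘ cDs) cDs EnumTS EnumTS (M₂.exact counts₂)
      F : C → TS
      F = proj₁ fb₁
      G : TS → C
      G = proj₁ (proj₂ fb₁)
      GF : ∀ c → G (F c) ≡ c
      GF = proj₁ (proj₂ (proj₂ fb₁))
      FG : ∀ s → F (G s) ≡ s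
      FG = proj₁ (proj₂ (proj₂ (proj₂ fb₁)))
      F-des : ∀ c → Des c ≡ Des′ (F c)
      F-des = proj₂ (proj₂ (proj₂ (proj₂ fb₁)))
      P Q : TS → TS
      P = proj₁ fb₂
      Q = proj₁ (proj₂ fb₂)
      QP : ∀ s → Q (P s) ≡ s
      QP = proj₁ (proj₂ (proj₂ fb₂))
      PQ : ∀ s → P (Q s) ≡ s
      PQ = proj₁ (proj₂ (proj₂ (proj₂ fb₂)))
      P-sh : ∀ s → sh (cDs s) ≡ cDs (P s)
      P-sh = proj₂ (proj₂ (proj₂ (proj₂ fb₂)))
      cDes : C → Subset (suc N)
      cDes c = cDs (F c)
      p : C → C
      p c = G (P (F c))
      p-inj : ∀ {x y} → p x ≡ p y → x ≡ y
      p-inj {x} {y} eq = trans (sym (GF x)) (trans (cong G (trans (sym (QP (F x))) (trans (cong Q (trans (sym (FG _)) (trans (cong F eq) (FG _)))) (QP (F y))))) (GF y))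
      p-surj : ∀ y → ∃ λ x → ∀ {z} → z ≡ x → p z ≡ y
      p-surj y = G (Q (F y)) , λ { refl → trans (cong (G ∘ P) (FG _)) (trans (cong G (PQ (F y))) (GF y)) }
      p-sh : ∀ c → cDes (p c) ≡ sh (cDes c)
      p-sh c = trans (cong cDs (FG _)) (sym (P-sh (F c)))
      ne⊥ : ∀ s → cDs s ≢ Sub.⊥
      ne⊥ (t , tok) eq = cD-false t (drop (proj₁ t)) (trans (cong (λ S → lookup S (drop (proj₁ t))) eq) (lookup-replicate (drop (proj₁ t)) false)) (Desc-drop t (toWitness {a? = TOK? t} tok))
      ne⊤ : ∀ s → cDs s ≢ Sub.⊤
      ne⊤ (t , tok) eq with not-Desc-rise t (toWitness {a? = TOK? t} tok)
      ... | i , nd with () ← trans (sym (cD-false⁻ t i nd)) (trans (cong (λ S → lookup S i) eq) (lookup-replicate i true))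

-- Cycle types

allᵇ⇒ : (p : A₁ → Bool) (xs : List A₁) → T (allᵇ p xs) → ∀ {x} → x ∈ xs → T (p x)
allᵇ⇒ p (x ∷ xs) t (here refl) = proj₁ (Equivalence.to BoolP.T-∧ t)
allᵇ⇒ p (x ∷ xs) t (there x∈)  = allᵇ⇒ p xs (proj₂ (Equivalence.to (BoolP.T-∧ {p x}) t)) x∈

⇒allᵇ : (p : A₁ → Bool) (xs : List A₁) → (∀ {x} → x ∈ xs → T (p x)) → T (allᵇ p xs)
⇒allᵇ p []       h = tt
⇒allᵇ p (x ∷ xs) h = Equivalence.from BoolP.T-∧ (h (here refl) , ⇒allᵇ p xs (h ∘ there))

distinct⇒inj : (v : Vec (Fin n) n) → T (distinctᵇ v) → Inj (lookup v)
distinct⇒inj {n} v t {x} {y} eq with allᵇ⇒ _ (allFin n) (allᵇ⇒ _ (allFin n) t (∈-allFin x)) (∈-allFin y)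
... | t′ with lookup v x FinP.≟ lookup v y | x FinP.≟ y
...   | yes _ | yes p = p
...   | no ¬p | _     = ⊥-elim (¬p eq)

inj⇒distinct : (v : Vec (Fin n) n) → Inj (lookup v) → T (distinctᵇ v)
inj⇒distinct {n} v inj = ⇒allᵇ _ (allFin n) λ {x} _ → ⇒allᵇ _ (allFin n) λ {y} _ → go x y
  where
  go : ∀ x y → T (not ⌊ lookup v x FinP.≟ lookup v y ⌋ ∨ ⌊ x FinP.≟ y ⌋)
  go x y with lookup v x FinP.≟ lookup v y | x FinP.≟ y
  ... | no _  | _     = tt
  ... | yes _ | yes _ = tt
  ... | yes e | no ¬p = ¬p (inj e)

firstReturn-spec : (f : Fin n → Fin n) (i : Fin n) (fuel start k : ℕ) → start ≤ k → k < start + fuel → iter f k i ≡ i →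
  let ℓ = firstReturn f i start fuel in start ≤ ℓ × ℓ ≤ k × iter f ℓ i ≡ i × (∀ j → start ≤ j → j < ℓ → iter f j i ≢ i)
firstReturn-spec f i zero start k s≤k k< eq = ⊥-elim (ℕP.<⇒≱ k< (subst (_≤ k) (sym (ℕP.+-identityʳ start)) s≤k))
firstReturn-spec f i (suc fuel) start k s≤k k< eq with iter f start i FinP.≟ i
... | yes e = ℕP.≤-refl , s≤k , e , λ j s≤j j<s → ⊥-elim (ℕP.<⇒≱ j<s s≤j)
... | no ¬e with firstReturn-spec f i fuel (suc start) k (ℕP.≤∧≢⇒< s≤k (λ { refl → ¬e eq })) (subst (k <_) (ℕP.+-suc start fuel) k<) eq
...   | a , b , c , d = ℕP.<⇒≤ a , b , c , λ j s≤j j<ℓ → case ℕP.m≤n⇒m<n∨m≡n s≤j of λ where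
  (inj₁ s<j)  → d j s<j j<ℓ
  (inj₂ refl) → ¬e

module Cycles (v : Vec (Fin n) n) (inj : Inj (lookup v)) where
  π : Fin n → Fin n
  π = lookup v

  len : Fin n → ℕ
  len = cycleLength v

  private
    returns : ∀ x → ∃ λ k → 1 ≤ k × k < 1 + n × iter π k x ≡ x
    returns x with pigeonhole (ℕP.n<1+n n) (λ k → iter π (toℕ k) x)
    ... | i , j , i<j , eq = toℕ j ∸ toℕ i , ℕP.m<n⇒0<n∸m i<j , ℕP.≤-<-trans (ℕP.m∸n≤m (toℕ j) (toℕ i)) (toℕ<n j) ,
      iter-inj inj (toℕ i) (trans (sym (iter-+ π (toℕ i) (toℕ j ∸ toℕ i) x)) (trans (cong (λ k → iter π k x) (ℕP.m+[n∸m]≡n (ℕP.<⇒≤ i<j))) (sym eq)))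

    spec : ∀ x → 1 ≤ len x × len x ≤ proj₁ (returns x) × iter π (len x) x ≡ x × (∀ j → 1 ≤ j → j < len x → iter π j x ≢ x)
    spec x = let k , a , b , c = returns x in firstReturn-spec π x n 1 k a b c

  abstract
    len-pos : ∀ x → 1 ≤ len x
    len-pos x = proj₁ (spec x)

    len≤n : ∀ x → len x ≤ n
    len≤n x = ℕP.≤-trans (proj₁ (proj₂ (spec x))) (ℕP.≤-pred (proj₁ (proj₂ (proj₂ (returns x)))))

    len-return : ∀ x → iter π (len x) x ≡ x
    len-return x = proj₁ (proj₂ (proj₂ (spec x)))

    len-min : ∀ x j → 1 ≤ j → j < len x → iter π j x ≢ x
    len-min x = proj₂ (proj₂ (proj₂ (spec x)))

    len-∣ : ∀ x j → iter π j x ≡ x → len x ∣ j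
    len-∣ x j eq = m%n≡0⇒n∣m j (len x) {{nz}} (go (j % len x) refl)
      where
      instance
        nz : NonZero (len x)
        nz = >-nonZero (len-pos x)
      go : ∀ r → j % len x ≡ r → r ≡ 0
      go zero    e = refl
      go (suc r) e = ⊥-elim (len-min x (suc r) (s≤s z≤n) (subst (_< len x) e (m%n<n j (len x)))
        (trans (cong (λ k → iter π k x) (sym e)) (trans (sym (iter-% (len x) (len-return x) j)) eq)))

    ∣-len : ∀ x j → len x ∣ j → iter π j x ≡ x
    ∣-len x j (divides q refl) = iter-period (len x) (len-return x) q

  Orb : Fin n → Fin n → Set
  Orb x y = ∃ λ k → iter π k x ≡ y

  orb-trans : ∀ {x y z} → Orb x y → Orb y z → Orb x z
  orb-trans {x} (a , refl) (b , refl) = b + a , iter-+ π b a x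

  orb-sym : ∀ {x y} → Orb x y → Orb y x
  orb-sym {x} (a , refl) = a * len x ∸ a ,
    trans (sym (iter-+ π (a * len x ∸ a) a x)) (trans (cong (λ k → iter π k x) (ℕP.m∸n+n≡m (ℕP.m≤m*n a (len x) {{>-nonZero (len-pos x)}}))) (iter-period (len x) (len-return x) a))

  len-orb : ∀ {x y} → Orb x y → len x ≡ len y
  len-orb {x} {y} o = ∣-antisym (half o) (half (orb-sym o))
    where
    half : ∀ {x y} → Orb x y → len x ∣ len y
    half {x} (a , refl) = len-∣ x _ (iter-inj inj a (trans (iter-comm π a (len (iter π a x)) x) (len-return (iter π a x))))

  IsMin : Fin n → Set
  IsMin x = ∀ {y} → Orb x y → x Fin.≤ y

  min⇒ : ∀ x → T (isCycleMin v x) → IsMin x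
  min⇒ x t (k , refl) = subst (λ z → x Fin.≤ z) (sym (iter-% (len x) (len-return x) k))
    (ℕP.≤ᵇ⇒≤ _ _ (allᵇ⇒ (λ k → toℕ x ≤ᵇ toℕ (iter π k x)) (upTo n) t (∈-upTo⁺ (ℕP.<-≤-trans (m%n<n k (len x)) (len≤n x)))))
    where
    instance
      nz : NonZero (len x)
      nz = >-nonZero (len-pos x)

  ⇒min : ∀ x → IsMin x → T (isCycleMin v x)
  ⇒min x m = ⇒allᵇ (λ k → toℕ x ≤ᵇ toℕ (iter π k x)) (upTo n) (λ {k} _ → ℕP.≤⇒≤ᵇ (m (k , refl)))

  isMin? : ∀ x → Dec (T (isCycleMin v x))
  isMin? x = T? (isCycleMin v x)

  private
    least : ∀ x → Acc _<_ (toℕ x) → ∃ λ y → Orb x y × IsMin y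
    least x (acc rec) with any? (λ (k : Fin (len x)) → iter π (toℕ k) x FinP.<? x)
    ... | yes (k , lt) = let y , o , m = least (iter π (toℕ k) x) (rec lt) in y , orb-trans (toℕ k , refl) o , m
    ... | no ¬lt = x , (0 , refl) , λ { (k , refl) → ℕP.≮⇒≥ λ lt →
        ¬lt (fromℕ< (m%n<n k (len x)) , subst (Fin._< x) (trans (iter-% (len x) (len-return x) k) (cong (λ j → iter π j x) (sym (toℕ-fromℕ< (m%n<n k (len x)))))) lt) }
      where
      instance
        nz : NonZero (len x)
        nz = >-nonZero (len-pos x)

  abstract
    minOf : Fin n → Fin n
    minOf x = proj₁ (least x (<-wellFounded (toℕ x)))

    minOf-orb : ∀ x → Orb x (minOf x)
    minOf-orb x = proj₁ (proj₂ (least x (<-wellFounded (toℕ x))))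

    minOf-min : ∀ x → IsMin (minOf x)
    minOf-min x = proj₂ (proj₂ (least x (<-wellFounded (toℕ x))))

  min-unique : ∀ {x y} → IsMin x → IsMin y → Orb x y → x ≡ y
  min-unique mx my o = FinP.≤-antisym (mx o) (my (orb-sym o))

  minOf-cong : ∀ {x y} → Orb x y → minOf x ≡ minOf y
  minOf-cong {x} {y} o = min-unique (minOf-min x) (minOf-min y) (orb-trans (orb-sym (minOf-orb x)) (orb-trans o (minOf-orb y)))

  mins : List (Fin n)
  mins = filterᵇ (isCycleMin v) (allFin n)

  mins-unique : Unique mins
  mins-unique = UniqueP.filter⁺ isMin? (UniqueP.allFin⁺ n)

  ∈-mins : ∀ {x} → IsMin x → x ∈ mins
  ∈-mins {x} m = ∈-filter⁺ isMin? (∈-allFin x) (⇒min x m)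

  mins-∈ : ∀ {x} → x ∈ mins → IsMin x
  mins-∈ {x} x∈ = min⇒ x (proj₂ (∈-filter⁻ isMin? {xs = allFin n} x∈))

  ∈-cycleType : ∀ x → len x ∈ cycleType v
  ∈-cycleType x = AnyP.reverse⁺ (PermP.∈-resp-↭ (↭-sym (ISortP.sort-↭ ℕP.≤-decTotalOrder (map len mins)))
    (subst (_∈ map len mins) (sym (len-orb (minOf-orb x))) (∈-map⁺ len (∈-mins (minOf-min x)))))

  cycleType-∈ : ∀ {z} → z ∈ cycleType v → ∃ λ x → len x ≡ z
  cycleType-∈ {z} z∈ = let x , _ , eq = ∈-map⁻ len (PermP.∈-resp-↭ (ISortP.sort-↭ ℕP.≤-decTotalOrder (map len mins)) (AnyP.reverse⁻ z∈)) in x , sym eq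

  length-cycleType : length (cycleType v) ≡ length mins
  length-cycleType = trans (ListP.length-reverse (ISort.sort ℕP.≤-decTotalOrder (map len mins)))
    (trans (PermP.↭-length (ISortP.sort-↭ ℕP.≤-decTotalOrder (map len mins))) (ListP.length-map len mins))

sort-cong : {xs ys : List ℕ} → xs ↭ ys → ISort.sort ℕP.≤-decTotalOrder xs ≡ ISort.sort ℕP.≤-decTotalOrder ys
sort-cong {xs} {ys} p = Pointwise-≡⇒≡ (↗↭↗⇒≋ ℕP.≤-totalOrder (ISortP.sort-↗ ℕP.≤-decTotalOrder xs) (ISortP.sort-↗ ℕP.≤-decTotalOrder ys)
  (↭⇒↭ₛ (↭-trans (ISortP.sort-↭ ℕP.≤-decTotalOrder xs) (↭-trans p (↭-sym (ISortP.sort-↭ ℕP.≤-decTotalOrder ys))))))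

-- `θ` need not send least elements of cycles to least elements, so cycles are matched by taking the
-- least element of the image cycle.
cycleType-iso : (v w : Vec (Fin n) n) (iv : Inj (lookup v)) (iw : Inj (lookup w)) (θ : Fin n → Fin n) → Inj θ →
  (∀ {x y} → Cycles.Orb v iv x y → Cycles.Orb w iw (θ x) (θ y)) → (∀ {x y} → Cycles.Orb w iw (θ x) (θ y) → Cycles.Orb v iv x y) →
  (∀ x → cycleLength w (θ x) ≡ cycleLength v x) → cycleType v ≡ cycleType w
cycleType-iso v w iv iw θ θ-inj to from len≡ = cong reverse (sort-cong perm)
  where
  module V = Cycles v iv
  module W = Cycles w iw
  open Inverse θ-inj
  F : _ → _
  F x = W.minOf (θ x)
  F-inj : ∀ {x y} → x ∈ V.mins → y ∈ V.mins → F x ≡ F y → x ≡ y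
  F-inj {x} {y} x∈ y∈ eq = V.min-unique (V.mins-∈ x∈) (V.mins-∈ y∈)
    (from (W.orb-trans (W.minOf-orb (θ x)) (subst (λ z → W.Orb z (θ y)) (sym eq) (W.orb-sym (W.minOf-orb (θ y))))))
  onto : ∀ {y} → y ∈ W.mins → y ∈ map F V.mins
  onto {y} y∈ = subst (_∈ map F V.mins) eq (∈-map⁺ F (V.∈-mins (V.minOf-min (inv y))))
    where
    eq : F (V.minOf (inv y)) ≡ y
    eq = trans (sym (W.minOf-cong (subst (λ z → W.Orb z (θ (V.minOf (inv y)))) (rinv y) (to (V.minOf-orb (inv y))))))
      (W.min-unique (W.minOf-min y) (W.mins-∈ y∈) (W.orb-sym (W.minOf-orb y)))
  into : ∀ {y} → y ∈ map F V.mins → y ∈ W.mins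
  into y∈ with ∈-map⁻ F y∈
  ... | x , _ , refl = W.∈-mins (W.minOf-min (θ x))
  perm : map V.len V.mins ↭ map W.len W.mins
  perm = subst (_↭ map W.len W.mins) (trans (sym (ListP.map-∘ V.mins)) (ListP.map-cong (λ x → trans (sym (W.len-orb (W.minOf-orb (θ x)))) (len≡ x)) V.mins))
    (PermP.map⁺ W.len (∼bag⇒↭ (unique∧set⇒bag (map-unique F-inj V.mins-unique) W.mins-unique (mk⇔ into onto))))

-- The class as a predicate on functions, since conjugates and recodings arise as functions rather
-- than as vectors.
Mem : List ℕ → (Fin n → Fin n) → Set
Mem μ π = Inj π × cycleType (tabulate π) ≡ μ

member⇒Mem : ∀ μ (v : Vec (Fin n) n) → T (member μ v) → Mem μ (lookup v)
member⇒Mem μ v t = distinct⇒inj v (proj₁ (Equivalence.to BoolP.T-∧ t)) ,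
  trans (cong cycleType (tabulate∘lookup v)) (toWitness (proj₂ (Equivalence.to (BoolP.T-∧ {distinctᵇ v}) t)))

Mem⇒member : ∀ μ (v : Vec (Fin n) n) → Mem μ (lookup v) → T (member μ v)
Mem⇒member μ v (inj , ct) = Equivalence.from BoolP.T-∧ (inj⇒distinct v inj , fromWitness (trans (sym (cong cycleType (tabulate∘lookup v))) ct))

Mem? : ∀ μ (v : Vec (Fin n) n) → Dec (Mem μ (lookup v))
Mem? μ v with T? (member μ v)
... | yes t = yes (member⇒Mem μ v t)
... | no ¬t = no (¬t ∘ Mem⇒member μ v)

tab-inj : {π : Fin n → Fin n} → Inj π → Inj (lookup (tabulate π))
tab-inj {π = π} inj {x} {y} eq = inj (trans (sym (lookup∘tabulate π x)) (trans eq (lookup∘tabulate π y)))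

module CyclesOf (π : Fin n → Fin n) (inj : Inj π) where
  module C = Cycles (tabulate π) (tab-inj inj)
  open C public using (len; len-pos; len≤n)

  it : ∀ k x → iter (lookup (tabulate π)) k x ≡ iter π k x
  it = iter-cong (lookup∘tabulate π)

  len-return : ∀ x → iter π (len x) x ≡ x
  len-return x = trans (sym (it (len x) x)) (C.len-return x)

  len-∣ : ∀ x j → iter π j x ≡ x → len x ∣ j
  len-∣ x j eq = C.len-∣ x j (trans (it j x) eq)

  ∣-len : ∀ x j → len x ∣ j → iter π j x ≡ x
  ∣-len x j d = trans (sym (it j x)) (C.∣-len x j d)

  len-unique : ∀ x ℓ → 1 ≤ ℓ → iter π ℓ x ≡ x → (∀ j → iter π j x ≡ x → ℓ ∣ j) → len x ≡ ℓ
  len-unique x ℓ _ ret min = ∣-antisym (len-∣ x ℓ ret) (min (len x) (len-return x))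

Mem-iso : ∀ {μ} {π π′ : Fin n → Fin n} (φ : Fin n → Fin n) → Inj φ → (∀ x → φ (π x) ≡ π′ (φ x)) → Mem μ π → Mem μ π′
Mem-iso {n} {μ} {π} {π′} φ φ-inj comm (inj , ct) = inj′ , trans (sym (cycleType-iso (tabulate π) (tabulate π′) (tab-inj inj) (tab-inj inj′) φ φ-inj to from len≡)) ct
  where
  open Inverse φ-inj
  inj′ : Inj π′
  inj′ {x} {y} eq = trans (sym (rinv x)) (trans (cong φ (inj (φ-inj (trans (comm _) (trans (cong π′ (rinv x)) (trans eq (trans (cong π′ (sym (rinv y))) (sym (comm _))))))))) (rinv y))
  module C = CyclesOf π inj
  module C′ = CyclesOf π′ inj′
  iter≡ : ∀ k x → φ (iter π k x) ≡ iter π′ k (φ x)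
  iter≡ = iter-conj φ comm
  to : ∀ {x y} → C.C.Orb x y → C′.C.Orb (φ x) (φ y)
  to {x} (k , refl) = k , trans (C′.it k (φ x)) (trans (sym (iter≡ k x)) (cong φ (sym (C.it k x))))
  from : ∀ {x y} → C′.C.Orb (φ x) (φ y) → C.C.Orb x y
  from {x} (k , eq) = k , trans (C.it k x) (φ-inj (trans (iter≡ k x) (trans (sym (C′.it k (φ x))) eq)))
  len≡ : ∀ x → C′.len (φ x) ≡ C.len x
  len≡ x = ∣-antisym (C′.len-∣ (φ x) (C.len x) (trans (sym (iter≡ (C.len x) x)) (cong φ (C.len-return x))))
    (C.len-∣ x (C′.len (φ x)) (φ-inj (trans (iter≡ (C′.len (φ x)) x) (C′.len-return (φ x)))))

-- If each map is pointwise a power of the other, their cycles coincide as sets. This is how a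
-- recoding that reorders the points of a cycle is seen to keep the cycle type.
Mem-orbits : ∀ {μ} {π π′ : Fin n → Fin n} (inj′ : Inj π′) → (mem : Mem μ π) →
  (∀ x → ∃ λ a → π′ x ≡ iter π a x) → (∀ x → ∃ λ a → π x ≡ iter π′ a x) → (∀ x → CyclesOf.len π′ inj′ x ≡ CyclesOf.len π (proj₁ mem) x) → Mem μ π′
Mem-orbits {n} {μ} {π} {π′} inj′ (inj , ct) via via′ len≡ = inj′ , trans (sym (cycleType-iso (tabulate π) (tabulate π′) (tab-inj inj) (tab-inj inj′) id id
    (λ { {x} (k , refl) → subst (C′.C.Orb x) (sym (C.it k x)) (sub (λ x → let a , e = via′ x in a , trans (C′.it a x) (sym e)) k x) })
    (λ { {x} (k , refl) → subst (C.C.Orb x) (sym (C′.it k x)) (sub′ (λ x → let a , e = via x in a , trans (C.it a x) (sym e)) k x) }) len≡)) ct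
  where
  module C = CyclesOf π inj
  module C′ = CyclesOf π′ inj′
  sub : (∀ x → C′.C.Orb x (π x)) → ∀ k x → C′.C.Orb x (iter π k x)
  sub h zero    x = 0 , refl
  sub h (suc k) x = C′.C.orb-trans (sub h k x) (h _)
  sub′ : (∀ x → C.C.Orb x (π′ x)) → ∀ k x → C.C.Orb x (iter π′ k x)
  sub′ h zero    x = 0 , refl
  sub′ h (suc k) x = C.C.orb-trans (sub′ h k x) (h _)

-- Two different cycle lengths

∣-factorial : ∀ {m} n → 1 ≤ m → m ≤ n → m ∣ n !
∣-factorial zero    p q = ⊥-elim (ℕP.<⇒≱ p q)
∣-factorial {m} (suc n) p q with ℕP.m≤n⇒m<n∨m≡n q
... | inj₁ lt   = ∣-trans (∣-factorial n p (ℕP.≤-pred lt)) (n∣m*n (suc n))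
... | inj₂ refl = m∣m*n (n !)

module TwoLengths {N : ℕ} (μ : List ℕ) {z z′ : ℕ} (z∈ : z ∈ μ) (z′∈ : z′ ∈ μ) (z≢ : z ≢ z′) where
  private
    E : Set
    E = Fin (suc N)

  κ : (E → E) → E → Fin 2
  κ π x with cycleLength (tabulate π) x ℕ.≟ z
  ... | yes _ = suc zero
  ... | no  _ = zero

  κ-cong : ∀ π π′ {x y} → cycleLength (tabulate π) x ≡ cycleLength (tabulate π′) y → κ π x ≡ κ π′ y
  κ-cong π π′ {x} {y} eq with cycleLength (tabulate π) x ℕ.≟ z | cycleLength (tabulate π′) y ℕ.≟ z
  ... | yes _ | yes _ = refl
  ... | no _  | no _  = refl
  ... | yes p | no q  = ⊥-elim (q (trans (sym eq) p))
  ... | no p  | yes q = ⊥-elim (p (trans eq q))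

  κ-yes : ∀ π {x} → cycleLength (tabulate π) x ≡ z → κ π x ≡ suc zero
  κ-yes π {x} eq with cycleLength (tabulate π) x ℕ.≟ z
  ... | yes _ = refl
  ... | no p  = ⊥-elim (p eq)

  κ-no : ∀ π {x} → cycleLength (tabulate π) x ≡ z′ → κ π x ≡ zero
  κ-no π {x} eq with cycleLength (tabulate π) x ℕ.≟ z
  ... | yes p = ⊥-elim (z≢ (trans (sym p) eq))
  ... | no _  = refl

  κ-iso : ∀ {π π′} (φ : E → E) → Inj φ → Inj π → Inj π′ → (∀ x → φ (π x) ≡ π′ (φ x)) → ∀ x → κ π′ (φ x) ≡ κ π x
  κ-iso {π} {π′} φ φ-inj inj inj′ comm x = κ-cong π′ π (∣-antisym
    (C′.len-∣ (φ x) (C.len x) (trans (sym (iter-conj φ comm (C.len x) x)) (cong φ (C.len-return x))))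
    (C.len-∣ x (C′.len (φ x)) (φ-inj (trans (iter-conj φ comm (C′.len (φ x)) x) (C′.len-return (φ x))))))
    where
    module C = CyclesOf π inj
    module C′ = CyclesOf π′ inj′

  κ-orbit : ∀ π → Inj π → ∀ j x → κ π (iter π j x) ≡ κ π x
  κ-orbit π inj j x = κ-iso (iter π j) (iter-inj inj j) inj inj (λ y → sym (iter-suc π j y)) x

  per : ∀ {π} → Mem μ π → ∀ x → iter π (suc (pred (suc N !))) x ≡ x
  per {π} (inj , _) x = subst (λ L → iter π L x ≡ x) (sym (ℕP.suc-pred (suc N !) {{ℕP._!≢0 (suc N)}}))
    (C.∣-len x (suc N !) (∣-factorial (suc N) (C.len-pos x) (C.len≤n x)))
    where module C = CyclesOf π inj

  coding : Coding N
  coding = record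
    -- n! is a common period of all permutations of n points; the field holds the predecessor of a
    -- period.
    { l = pred (suc N !)
    ; B = 2
    ; 𝒞 = Mem μ
    ; 𝒞? = Mem? μ
    ; 𝒞-period = per
    ; 𝒞-iso = Mem-iso
    ; AV = λ π f → Mem μ π × Prim π f
    ; AV-𝒞 = proj₁
    ; prim⇒AV = _,_
    ; TV = λ ρ f σ m k → Mem μ σ × (∀ x → m x ≡ zero) × (∀ x → k x ≡ κ σ x)
    ; TV? = λ ρ σ m k → Mem? μ σ ×-dec (all? (λ x → lookup m x FinP.≟ zero) ×-dec all? (λ x → lookup k x FinP.≟ κ (lookup σ) x))
    ; TV-iso = λ {ρ} {f} {σ} {m} {k} {f′} {σ′} {m′} {k′} φ φ-inj cσ cm ck _ (mem , m0 , kκ) →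
        let open Inverse φ-inj in
          Mem-iso φ φ-inj cσ mem
        , (λ x → trans (cong m′ (sym (rinv x))) (trans (cm (inv x)) (m0 (inv x))))
        , (λ x → trans (cong k′ (sym (rinv x))) (trans (ck (inv x)) (trans (kκ (inv x))
            (trans (sym (κ-iso φ φ-inj (proj₁ mem) (proj₁ (Mem-iso φ φ-inj cσ mem)) cσ (inv x))) (cong (κ σ′) (rinv x))))))
    ; TV-coarsen = λ _ _ _ t → t
    ; TV-refine = λ _ _ _ t → t
    ; TV-inj = λ (mem , _) → proj₁ mem
    ; TV-period = λ (mem , _) → per mem
    ; TV-nonconst = λ {_} {_} {σ} (mem , _ , kκ) → nonconst mem kκ
    ; K = λ π f → κ π
    ; M = λ ρ π f x → zero
    -- The permutation itself stays as it is; the recoding only adds the marking of cycles of length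
    -- `z`.
    ; P₂ = λ ρ π f → π
    ; P₁ = λ f σ m k → σ
    ; fwd = λ _ (mem , _) → mem , (λ _ → refl) , λ _ → refl
    ; bwd = λ {ρ} {f} {σ} {m} {k} _ (mem , m0 , kκ) prim → mem , λ x j same → prim x j λ i →
        same i
        , trans (kκ _) (trans (κ-orbit σ (proj₁ mem) i x) (sym (trans (kκ _) (trans (κ-orbit σ (proj₁ mem) i _) (κ-orbit σ (proj₁ mem) j x)))))
        , trans (m0 _) (sym (m0 _))
    ; P₁P₂ = λ _ _ _ → refl
    ; P₂P₁ = λ _ (mem , m0 , kκ) _ x → refl , sym (m0 x) , sym (kκ x)
    ; nat-fwd = λ {ρ} {π} {π′} {f} (mem , prim) (mem′ , prim′) x y same →
        κ-cong π π′ (∣-antisym (half {f = f} mem mem′ prim y x (λ i → sym (same i))) (half {f = f} mem′ mem prim′ x y same)) , refl , 1 , refl , refl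
    ; nat-bwd = λ _ _ _ _ _ _ → 1 , refl , refl
    }
    where
    nonconst : ∀ {σ : E → E} {k : E → Fin 2} → Mem μ σ → (∀ x → k x ≡ κ σ x) → ∃₂ λ x y → k x ≢ k y
    nonconst {σ} {k} (inj , ct) kκ = x , y , λ eq → case (trans (sym (κ-yes σ (proj₂ ex))) (trans (sym (kκ x)) (trans eq (trans (kκ y) (κ-no σ (proj₂ ey))))))
      where
      ex = CyclesOf.C.cycleType-∈ σ inj (subst (z ∈_) (sym ct) z∈)
      ey = CyclesOf.C.cycleType-∈ σ inj (subst (z′ ∈_) (sym ct) z′∈)
      x y : E
      x = proj₁ ex
      y = proj₁ ey
      case : suc zero ≡ zero → ⊥
      case ()
    -- The word read from `y` repeats after the length of its cycle. A point `x` with the same word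
    -- must return by then, as its word is primitive; so tied points lie on cycles of equal length
    -- and get equal marks.
    half : ∀ {π π′ f : E → E} → (mem : Mem μ π) (mem′ : Mem μ π′) → Prim π f → ∀ y x → (∀ i → f (iter π′ i y) ≡ f (iter π i x)) →
           cycleLength (tabulate π) x ∣ cycleLength (tabulate π′) y
    half {π} {π′} {f} mem mem′ prim y x same = C.len-∣ x ℓ (prim x ℓ λ i →
        trans (sym (same i)) (trans (cong f (trans (cong (iter π′ i) (sym (C′.len-return y))) (sym (iter-+ π′ i ℓ y)))) (trans (same (i + ℓ)) (cong f (iter-+ π i ℓ x)))))
      where
      module C = CyclesOf π (proj₁ mem)
      module C′ = CyclesOf π′ (proj₁ mem′)
      ℓ = C′.len y

  extension : HasCyclicExtension (suc N) μ
  extension = Generic.Assemble.hasCyclicExtension coding μ (Mem⇒member μ) (member⇒Mem μ)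

-- Major indices modulo a prime

∑< : ℕ → (ℕ → ℕ) → ℕ
∑< zero    g = 0
∑< (suc k) g = g 0 + ∑< k (g ∘ suc)

∑<-cong : ∀ k {g h : ℕ → ℕ} → (∀ j → j < k → g j ≡ h j) → ∑< k g ≡ ∑< k h
∑<-cong zero    eq = refl
∑<-cong (suc k) eq = cong₂ _+_ (eq 0 (s≤s z≤n)) (∑<-cong k (λ j lt → eq (suc j) (s≤s lt)))

∑<-snoc : ∀ k g → ∑< (suc k) g ≡ ∑< k g + g k
∑<-snoc zero    g = ℕP.+-identityʳ (g 0)
∑<-snoc (suc k) g = trans (cong (g 0 +_) (∑<-snoc k (g ∘ suc))) (sym (ℕP.+-assoc (g 0) _ _))

∑<-+ : ∀ k g h → ∑< k (λ j → g j + h j) ≡ ∑< k g + ∑< k h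
∑<-+ zero    g h = refl
∑<-+ (suc k) g h = trans (cong (g 0 + h 0 +_) (∑<-+ k (g ∘ suc) (h ∘ suc))) (lem (g 0) (h 0) (∑< k (g ∘ suc)) (∑< k (h ∘ suc)))
  where
  lem : ∀ a b c d → a + b + (c + d) ≡ a + c + (b + d)
  lem a b c d = trans (ℕP.+-assoc a b (c + d)) (trans (cong (a +_) (trans (sym (ℕP.+-assoc b c d)) (trans (cong (_+ d) (ℕP.+-comm b c)) (ℕP.+-assoc c b d)))) (sym (ℕP.+-assoc a c (b + d))))

∑<-const : ∀ k c → ∑< k (λ _ → c) ≡ k * c
∑<-const zero    c = refl
∑<-const (suc k) c = cong (c +_) (∑<-const k c)

∑<-mono : ∀ k {g h : ℕ → ℕ} → (∀ j → j < k → g j ≤ h j) → ∑< k g ≤ ∑< k h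
∑<-mono zero    le = z≤n
∑<-mono (suc k) le = ℕP.+-mono-≤ (le 0 (s≤s z≤n)) (∑<-mono k (λ j lt → le (suc j) (s≤s lt)))

∑<-mono-< : ∀ k {g h : ℕ → ℕ} → (∀ j → j < k → g j ≤ h j) → ∀ i → i < k → g i < h i → ∑< k g < ∑< k h
∑<-mono-< (suc k) le zero    i<k lt = ℕP.+-mono-<-≤ lt (∑<-mono k (λ j l → le (suc j) (s≤s l)))
∑<-mono-< (suc k) le (suc i) i<k lt = ℕP.+-mono-≤-< (le 0 (s≤s z≤n)) (∑<-mono-< k (λ j l → le (suc j) (s≤s l)) i (ℕP.≤-pred i<k) lt)

abstract
  first : {P : ℕ → Set} → ℕ → (∀ i → Dec (P i)) → ℕ
  first zero    P? = 0
  first (suc k) P? with P? 0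
  ... | yes _ = 0
  ... | no  _ = suc (first k (P? ∘ suc))

  first-unique : {P : ℕ → Set} (k : ℕ) (P? : ∀ i → Dec (P i)) → ∀ i → i < k → P i → (∀ j → j < i → ¬ P j) → first k P? ≡ i
  first-unique (suc k) P? i i<k pi mn with P? 0
  first-unique (suc k) P? zero    i<k pi mn | yes p = refl
  first-unique (suc k) P? (suc i) i<k pi mn | yes p = ⊥-elim (mn 0 (s≤s z≤n) p)
  first-unique (suc k) P? zero    i<k pi mn | no ¬p = ⊥-elim (¬p pi)
  first-unique (suc k) P? (suc i) i<k pi mn | no ¬p = cong suc (first-unique k (P? ∘ suc) i (ℕP.≤-pred i<k) pi (λ j lt → mn (suc j) (s≤s lt)))

  first-spec : {P : ℕ → Set} (k : ℕ) (P? : ∀ i → Dec (P i)) → (∃ λ i → i < k × P i) → first k P? < k × P (first k P?) × (∀ j → j < first k P? → ¬ P j)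
  first-spec (suc k) P? ex with P? 0
  first-spec (suc k) P? ex | yes p = s≤s z≤n , p , λ _ ()
  first-spec (suc k) P? (zero , i<k , pi) | no ¬p = ⊥-elim (¬p pi)
  first-spec (suc k) P? (suc i , i<k , pi) | no ¬p =
    let a , b , c = first-spec k (P? ∘ suc) (i , ℕP.≤-pred i<k , pi) in
    s≤s a , b , λ { zero _ → ¬p ; (suc j) lt → c j (ℕP.≤-pred lt) }

  first-cong : {P Q : ℕ → Set} (k : ℕ) (P? : ∀ i → Dec (P i)) (Q? : ∀ i → Dec (Q i)) → (∀ i → P i → Q i) → (∀ i → Q i → P i) → first k P? ≡ first k Q?
  first-cong zero    P? Q? f g = refl
  first-cong (suc k) P? Q? f g with P? 0 | Q? 0
  ... | yes _ | yes _ = refl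
  ... | no _  | no _  = cong suc (first-cong k (P? ∘ suc) (Q? ∘ suc) (f ∘ suc) (g ∘ suc))
  ... | yes p | no ¬q = ⊥-elim (¬q (f 0 p))
  ... | no ¬p | yes q = ⊥-elim (¬p (g 0 q))

%-diff : ∀ {p} .{{_ : NonZero p}} a b c d → a + c ≡ b + p * d → a % p ≡ b % p → p ∣ c
%-diff {p} a b c d eq meq = ∣m+n∣m⇒∣n {m = a / p * p} (divides (b / p + d) key) (n∣m*n (a / p))
  where
  key : a / p * p + c ≡ (b / p + d) * p
  key = ℕP.+-cancelˡ-≡ (a % p) _ _ (begin
    a % p + (a / p * p + c)   ≡⟨ sym (ℕP.+-assoc (a % p) _ c) ⟩
    a % p + a / p * p + c     ≡⟨ cong (_+ c) (sym (m≡m%n+[m/n]*n a p)) ⟩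
    a + c                     ≡⟨ eq ⟩
    b + p * d                 ≡⟨ cong₂ _+_ (m≡m%n+[m/n]*n b p) (ℕP.*-comm p d) ⟩
    b % p + b / p * p + d * p ≡⟨ ℕP.+-assoc (b % p) _ _ ⟩
    b % p + (b / p * p + d * p) ≡⟨ cong₂ _+_ (sym meq) (sym (ℕP.*-distribʳ-+ p (b / p) d)) ⟩
    a % p + (b / p + d) * p   ∎)
    where open ≡-Reasoning

module Words {A : Set} {k : ℕ} (code : A → Fin k) (p : ℕ) .{{_ : NonZero p}} where
  desc? : ∀ a b → Dec (code b Fin.< code a)
  desc? a b = code b FinP.<? code a

  δ : (ℕ → A) → ℕ → ℕ
  δ c j = ind (desc? (c j) (c (suc j)))

  -- The sum includes the wrap-around descent of a periodic word; its weight is p, so modulo p this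
  -- is the usual major index.
  maj cdes : (ℕ → A) → ℕ
  maj c = ∑< p (λ j → suc j * δ c j)
  cdes c = ∑< p (δ c)

  shift : ℕ → (ℕ → A) → ℕ → A
  shift t c j = c (j + t)

  rot : ℕ → (ℕ → A) → ℕ
  rot v c = first p (λ t → maj (shift t c) % p ℕ.≟ v)

Per NC : {A : Set} (p : ℕ) → (ℕ → A) → Set
Per p c = ∀ j → c (j + p) ≡ c j
NC p c = ∃ λ (j : Fin p) → c (toℕ j) ≢ c 0

module Majors {A : Set} {k : ℕ} (code : A → Fin k) (code-inj : Inj code) (p : ℕ) (prime : Prime p) .{{_ : NonZero p}} where
  open Words code p public

  δ-cong : ∀ {c c′} → (∀ j → c j ≡ c′ j) → ∀ j → δ c j ≡ δ c′ j
  δ-cong eq j = cong₂ (λ a b → ind (desc? a b)) (eq j) (eq (suc j))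

  maj-cong : ∀ {c c′} → (∀ j → c j ≡ c′ j) → maj c ≡ maj c′
  maj-cong eq = ∑<-cong p (λ j _ → cong (suc j *_) (δ-cong eq j))

  -- Rotating by one lowers the weight of every cyclic descent by one, except that a descent at the
  -- front moves to the end and receives weight p.
  maj-step : ∀ c → Per p c → maj (shift 1 c) + cdes c ≡ maj c + p * δ c 0
  maj-step c per = begin
    maj (shift 1 c) + cdes c       ≡⟨ cong (_+ cdes c) e₁ ⟩
    X + p * δ c 0 + cdes c         ≡⟨ ℕP.+-assoc X _ _ ⟩
    X + (p * δ c 0 + cdes c)       ≡⟨ cong (X +_) (ℕP.+-comm (p * δ c 0) (cdes c)) ⟩
    X + (cdes c + p * δ c 0)       ≡⟨ sym (ℕP.+-assoc X _ _) ⟩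
    X + cdes c + p * δ c 0         ≡⟨ cong (_+ p * δ c 0) (sym e₂) ⟩
    maj c + p * δ c 0              ∎
    where
    open ≡-Reasoning
    X : ℕ
    X = ∑< p (λ j → j * δ c j)
    δp : δ c p ≡ δ c 0
    δp = cong₂ (λ a b → ind (desc? a b)) (per 0) (per 1)
    e₁ : maj (shift 1 c) ≡ X + p * δ c 0
    e₁ = trans (∑<-cong p (λ j _ → cong (suc j *_) (cong₂ (λ a b → ind (desc? (c a) (c b))) (ℕP.+-comm j 1) (cong suc (ℕP.+-comm j 1)))))
         (trans (∑<-snoc p (λ j → j * δ c j)) (cong (λ z → X + p * z) δp))
    e₂ : maj c ≡ X + cdes c
    e₂ = trans (∑<-+ p (δ c) (λ j → j * δ c j)) (ℕP.+-comm (cdes c) X)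

  cdes-shift : ∀ c → Per p c → cdes (shift 1 c) ≡ cdes c
  cdes-shift c per = ℕP.+-cancelˡ-≡ (δ c 0) _ _ (trans (cong (δ c 0 +_) (∑<-cong p (λ j _ → cong₂ (λ a b → ind (desc? (c a) (c b))) (ℕP.+-comm j 1) (cong suc (ℕP.+-comm j 1)))))
    (trans (∑<-snoc p (δ c)) (trans (ℕP.+-comm (cdes c) (δ c p)) (cong (_+ cdes c) (cong₂ (λ a b → ind (desc? a b)) (per 0) (per 1))))))

  shift-Per : ∀ t c → Per p c → Per p (shift t c)
  shift-Per t c per j = trans (cong c (trans (ℕP.+-assoc j p t) (trans (cong (j +_) (ℕP.+-comm p t)) (sym (ℕP.+-assoc j t p))))) (per (j + t))

  maj-shift : ∀ t c → Per p c → ∃ λ a → maj (shift t c) + t * cdes c ≡ maj c + p * a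
  maj-shift zero    c per = 0 , cong₂ _+_ (maj-cong (λ j → cong c (ℕP.+-identityʳ j))) (sym (ℕP.*-zeroʳ p))
  maj-shift (suc t) c per with maj-shift t (shift 1 c) (shift-Per 1 c per)
  ... | a , eq = a + δ c 0 , (begin
    maj (shift (suc t) c) + (cdes c + t * cdes c)           ≡⟨ cong₂ _+_ (maj-cong (λ j → cong c (trans (ℕP.+-suc j t) (ℕP.+-comm 1 (j + t))))) (ℕP.+-comm (cdes c) (t * cdes c)) ⟩
    maj (shift t (shift 1 c)) + (t * cdes c + cdes c)       ≡⟨ sym (ℕP.+-assoc (maj (shift t (shift 1 c))) _ _) ⟩
    maj (shift t (shift 1 c)) + t * cdes c + cdes c         ≡⟨ cong (λ z → maj (shift t (shift 1 c)) + t * z + cdes c) (sym (cdes-shift c per)) ⟩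
    maj (shift t (shift 1 c)) + t * cdes (shift 1 c) + cdes c ≡⟨ cong (_+ cdes c) eq ⟩
    maj (shift 1 c) + p * a + cdes c                        ≡⟨ lem (maj (shift 1 c)) (p * a) (cdes c) ⟩
    maj (shift 1 c) + cdes c + p * a                        ≡⟨ cong (_+ p * a) (maj-step c per) ⟩
    maj c + p * δ c 0 + p * a                               ≡⟨ lem (maj c) (p * δ c 0) (p * a) ⟩
    maj c + p * a + p * δ c 0                               ≡⟨ ℕP.+-assoc (maj c) _ _ ⟩
    maj c + (p * a + p * δ c 0)                             ≡⟨ cong (maj c +_) (sym (ℕP.*-distribˡ-+ p a (δ c 0))) ⟩
    maj c + p * (a + δ c 0)                                 ∎)
    where
    open ≡-Reasoning
    lem : ∀ x y z → x + y + z ≡ x + z + y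
    lem x y z = trans (ℕP.+-assoc x y z) (trans (cong (x +_) (ℕP.+-comm y z)) (sym (ℕP.+-assoc x z y)))

  private
    δ≤1 : ∀ c j → δ c j ≤ 1
    δ≤1 c j with desc? (c j) (c (suc j))
    ... | yes _ = s≤s z≤n
    ... | no _  = z≤n

  -- A periodic word that never falls is constant.
  cdes>0 : ∀ c → Per p c → NC p c → 0 < cdes c
  cdes>0 c per (j , ne) with any? (λ (i : Fin p) → desc? (c (toℕ i)) (c (suc (toℕ i))))
  ... | yes (i , d) = subst (_< cdes c) (trans (∑<-const p 0) (ℕP.*-zeroʳ p))
          (∑<-mono-< p (λ _ _ → z≤n) (toℕ i) (toℕ<n i) (subst (0 <_) (sym (ind-yes (desc? _ _) d)) (s≤s z≤n)))
  ... | no none = ⊥-elim (ne (code-inj (toℕ-injective (ℕP.≤-antisym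
            (subst (λ z → toℕ (code (c (toℕ j))) ≤ toℕ (code z)) (trans (cong c (ℕP.m∸n+n≡m (ℕP.<⇒≤ (toℕ<n j)))) (per 0)) (up (p ∸ toℕ j) (toℕ j) (ℕP.≤-reflexive (ℕP.m∸n+n≡m (ℕP.<⇒≤ (toℕ<n j))))))
            (subst (λ z → toℕ (code (c 0)) ≤ toℕ (code (c z))) (ℕP.+-identityʳ (toℕ j)) (up (toℕ j) 0 (ℕP.≤-trans (ℕP.≤-reflexive (ℕP.+-identityʳ (toℕ j))) (ℕP.<⇒≤ (toℕ<n j)))))))))
    where
    up : ∀ t i → t + i ≤ p → toℕ (code (c i)) ≤ toℕ (code (c (t + i)))
    up zero    i le = ℕP.≤-refl
    up (suc t) i le = ℕP.≤-trans (up t i (ℕP.<⇒≤ le)) (ℕP.≮⇒≥ λ d → none (fromℕ< le , subst (λ z → code (c (suc z)) Fin.< code (c z)) (sym (toℕ-fromℕ< le)) d))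

  -- A word falling at every step would end its period below its own beginning.
  cdes<p : ∀ c → Per p c → cdes c < p
  cdes<p c per with all? (λ (i : Fin p) → desc? (c (toℕ i)) (c (suc (toℕ i))))
  ... | no ¬all = let i , nd = FinP.¬∀⟶∃¬ p _ (λ (i : Fin p) → desc? (c (toℕ i)) (c (suc (toℕ i)))) ¬all in
        subst (cdes c <_) (trans (∑<-const p 1) (ℕP.*-identityʳ p)) (∑<-mono-< p (λ j _ → δ≤1 c j) (toℕ i) (toℕ<n i) (subst (_< 1) (sym (ind-no (desc? _ _) nd)) (s≤s z≤n)))
  ... | yes all = ⊥-elim (ℕP.<-irrefl (cong (toℕ ∘ code) (per 0)) (subst (λ z → toℕ (code (c z)) < toℕ (code (c 0))) (ℕP.suc-pred p) (down (pred p) (ℕP.≤-reflexive (ℕP.suc-pred p)))))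
    where
    st : ∀ i → i < p → toℕ (code (c (suc i))) < toℕ (code (c i))
    st i lt = subst (λ z → toℕ (code (c (suc z))) < toℕ (code (c z))) (toℕ-fromℕ< lt) (all (fromℕ< lt))
    down : ∀ t → suc t ≤ p → toℕ (code (c (suc t))) < toℕ (code (c 0))
    down zero    le = st 0 le
    down (suc t) le = ℕP.<-trans (st (suc t) le) (down t (ℕP.<⇒≤ le))

  NC-shift : ∀ t c → Per p c → NC p c → NC p (shift t c)
  NC-shift zero    c per (j , ne) = j , λ e → ne (trans (cong c (sym (ℕP.+-identityʳ (toℕ j)))) e)
  NC-shift (suc t) c per nc with one (shift t c) (shift-Per t c per) (NC-shift t c per nc)
    where
    one : ∀ c → Per p c → NC p c → NC p (shift 1 c)
    one c per (j , ne) with any? (λ (i : Fin p) → ¬? (code (shift 1 c (toℕ i)) FinP.≟ code (shift 1 c 0)))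
    ... | yes (i , q) = i , λ e → q (cong code e)
    ... | no none = ⊥-elim (ne (trans (eqs (toℕ j) (toℕ<n j)) (sym (eqs 0 (ℕP.≤-trans (s≤s z≤n) (toℕ<n j))))))
      where
      tail : ∀ i → i < p → c (suc i) ≡ c 1
      tail i lt with code (shift 1 c (toℕ (fromℕ< lt))) FinP.≟ code (shift 1 c 0)
      ... | yes q = trans (cong c (trans (ℕP.+-comm 1 i) (cong (_+ 1) (sym (toℕ-fromℕ< lt))))) (code-inj q)
      ... | no q  = ⊥-elim (none (fromℕ< lt , q))
      eqs : ∀ i → i < p → c i ≡ c 1
      eqs zero    lt = trans (sym (per 0)) (trans (cong c (sym (ℕP.suc-pred p))) (tail (pred p) (ℕP.≤-reflexive (ℕP.suc-pred p))))
      eqs (suc i) lt = tail i (ℕP.<⇒≤ lt)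
  ... | j , ne = j , λ e → ne (trans (cong c (ℕP.+-assoc (toℕ j) 1 t)) e)

  private
    -- Equal residues at rotations `t` and `t′` make p divide the product of `t′ ∸ t` and the number
    -- of cyclic descents. Both factors lie strictly between 0 and p; primality of p is used here.
    distinct< : ∀ c → Per p c → NC p c → ∀ {t t′} → t < t′ → t′ < p → maj (shift t c) % p ≢ maj (shift t′ c) % p
    distinct< c per nc {t} {t′} t<t′ t′<p eq with maj-shift (t′ ∸ t) (shift t c) (shift-Per t c per)
    ... | a , e with euclidsLemma (t′ ∸ t) (cdes (shift t c)) prime
                       (%-diff (maj (shift (t′ ∸ t) (shift t c))) (maj (shift t c)) _ a e
                         (trans (cong (_% p) (maj-cong (λ j → cong c (trans (ℕP.+-assoc j (t′ ∸ t) t) (cong (j +_) (ℕP.m∸n+n≡m (ℕP.<⇒≤ t<t′))))))) (sym eq)))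
    ...   | inj₁ d = >⇒∤ {{ℕ.>-nonZero (ℕP.m<n⇒0<n∸m t<t′)}} (ℕP.≤-<-trans (ℕP.m∸n≤m t′ t) t′<p) d
    ...   | inj₂ d = >⇒∤ {{ℕ.>-nonZero (cdes>0 _ (shift-Per t c per) (NC-shift t c per nc))}} (cdes<p _ (shift-Per t c per)) d

  rot-unique : ∀ c → Per p c → NC p c → ∀ {t t′} → t < p → t′ < p → maj (shift t c) % p ≡ maj (shift t′ c) % p → t ≡ t′
  rot-unique c per nc {t} {t′} t< t′< eq with ℕP.<-cmp t t′
  ... | tri< lt _ _ = ⊥-elim (distinct< c per nc lt t′< eq)
  ... | tri≈ _ e _ = e
  ... | tri> _ _ gt = ⊥-elim (distinct< c per nc gt t< (sym eq))

  -- The p rotations have pairwise different residues, so every residue occurs.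
  rot-exists : ∀ c → Per p c → NC p c → ∀ v → v < p → ∃ λ t → t < p × maj (shift t c) % p ≡ v
  rot-exists c per nc v v<p = let t , e = inj⇒surj {φ = ψ} ψ-inj (fromℕ< v<p) in
      toℕ t , toℕ<n t , trans (sym (toℕ-fromℕ< (m%n<n _ p))) (trans (cong toℕ e) (toℕ-fromℕ< v<p))
    where
    ψ : Fin p → Fin p
    ψ t = fromℕ< (m%n<n (maj (shift (toℕ t) c)) p)
    ψ-inj : Inj ψ
    ψ-inj {t} {t′} e = toℕ-injective (rot-unique c per nc (toℕ<n t) (toℕ<n t′)
      (trans (sym (toℕ-fromℕ< (m%n<n (maj (shift (toℕ t) c)) p))) (trans (cong toℕ e) (toℕ-fromℕ< (m%n<n (maj (shift (toℕ t′) c)) p)))))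

  rot-spec : ∀ c → Per p c → NC p c → ∀ v → v < p → rot v c < p × maj (shift (rot v c) c) % p ≡ v
  rot-spec c per nc v v<p = let a , b , _ = first-spec p (λ t → maj (shift t c) % p ℕ.≟ v) (rot-exists c per nc v v<p) in a , b

  rot-cong : ∀ {c c′} → (∀ j → c j ≡ c′ j) → ∀ v → rot v c ≡ rot v c′
  rot-cong {c} {c′} eq v = first-cong p _ _ (λ t e → trans (cong (_% p) (maj-cong (λ j → sym (eq (j + t))))) e) (λ t e → trans (cong (_% p) (maj-cong (λ j → eq (j + t)))) e)

-- Rectangular cycle types

module Mod (p : ℕ) .{{_ : NonZero p}} where
  infix 4 _≈_
  _≈_ : ℕ → ℕ → Set
  a ≈ b = a % p ≡ b % p

  ≈-+ : ∀ {a a′ b b′} → a ≈ a′ → b ≈ b′ → a + b ≈ a′ + b′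
  ≈-+ {a} {a′} {b} {b′} p₁ p₂ = trans (%-distribˡ-+ a b p) (trans (cong₂ (λ x y → (x + y) % p) p₁ p₂) (sym (%-distribˡ-+ a′ b′ p)))

  ≈-% : ∀ a → a % p ≈ a
  ≈-% a = m%n%n≡m%n a p

  ≈-*p : ∀ a b → a * p + b ≈ b
  ≈-*p a b = trans (cong (_% p) (ℕP.+-comm (a * p) b)) ([m+kn]%n≡m%n b a p)

  ≈-cancel : ∀ a {b c} → a + b ≈ a + c → b ≈ c
  ≈-cancel a {b} {c} eq = trans (sym (key b)) (trans (≈-+ {a * pred p} refl eq) (key c))
    where
    key : ∀ b → a * pred p + (a + b) ≈ b
    key b = trans (cong (_% p) (trans (sym (ℕP.+-assoc (a * pred p) a b))
      (cong (_+ b) (trans (ℕP.+-comm (a * pred p) a) (trans (sym (ℕP.*-suc a (pred p))) (cong (a *_) (ℕP.suc-pred p))))))) (≈-*p a b)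

  small : ∀ {a b} → a < p → b < p → a ≈ b → a ≡ b
  small a<p b<p eq = trans (sym (m<n⇒m%n≡m a<p)) (trans eq (m<n⇒m%n≡m b<p))

  zero% : 0 % p ≡ 0
  zero% = m*n%n≡0 0 p

  compl : ∀ {x} → x ≤ p → (p ∸ x) % p + x ≈ 0
  compl {x} x≤p = trans (≈-+ {(p ∸ x) % p} {p ∸ x} (≈-% (p ∸ x)) refl) (trans (cong (_% p) (ℕP.m∸n+n≡m x≤p)) (trans (n%n≡0 p) (sym zero%)))

pick : {P X : Set} → Dec P → X → X → X
pick (yes _) a b = a
pick (no _)  a b = b

pick-yes : {P X : Set} (d : Dec P) {a b : X} → P → pick d a b ≡ a
pick-yes (yes _) _ = refl
pick-yes (no ¬p) p = ⊥-elim (¬p p)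

pick-no : {P X : Set} (d : Dec P) {a b : X} → ¬ P → pick d a b ≡ b
pick-no (yes p) ¬p = ⊥-elim (¬p p)
pick-no (no _)  _  = refl

replicate-∈ : ∀ s {r x : ℕ} → x ∈ replicate s r → x ≡ r
replicate-∈ (suc s) (here eq)  = eq
replicate-∈ (suc s) (there x∈) = replicate-∈ s x∈

module Rect {N : ℕ} (p rp s : ℕ) (prime : Prime p) .{{p≢0 : NonZero p}} .{{rp≢0 : NonZero rp}} where
  E : Set
  E = Fin (suc N)

  open Mod p

  r : ℕ
  r = p * rp

  instance
    r≢0 : NonZero r
    r≢0 = ℕP.m*n≢0 p rp

  μ : List ℕ
  μ = replicate s r

  1<p : 1 < p
  1<p = nonTrivial⇒n>1 p {{prime⇒nonTrivial prime}}

  0<p : 0 < p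
  0<p = ℕP.<⇒≤ 1<p

  mem-len : ∀ {π : E → E} → (mem : Mem μ π) → ∀ x → CyclesOf.len π (proj₁ mem) x ≡ r
  mem-len {π} (inj , ct) x = replicate-∈ s (subst (CyclesOf.len π inj x ∈_) ct (CyclesOf.C.∈-cycleType π inj x))

  mem-per : ∀ {π : E → E} → Mem μ π → ∀ x → iter π r x ≡ x
  mem-per {π} mem x = subst (λ k → iter π k x ≡ x) (mem-len mem x) (CyclesOf.len-return π (proj₁ mem) x)

  mem-free : ∀ {π : E → E} → Mem μ π → ∀ x j → iter π j x ≡ x → r ∣ j
  mem-free {π} mem x j eq = subst (_∣ j) (mem-len mem x) (CyclesOf.len-∣ π (proj₁ mem) x j eq)

  per⇒inj : ∀ {π : E → E} (k : ℕ) .{{_ : NonZero k}} → (∀ x → iter π k x ≡ x) → Inj π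
  per⇒inj {π} (suc k) per {x} {y} eq = trans (sym (per x)) (trans (iter-suc π k x) (trans (cong (iter π k) eq) (trans (sym (iter-suc π k y)) (per y))))

  mem-change : ∀ {π π′ : E → E} → Mem μ π → (∀ x → ∃ λ a → π′ x ≡ iter π a x) → (∀ x → ∃ λ a → π x ≡ iter π′ a x) →
    (∀ x → iter π′ r x ≡ x) → (∀ x j → iter π′ j x ≡ x → r ∣ j) → Mem μ π′
  mem-change {π} {π′} mem via via′ per free = Mem-orbits (per⇒inj r per) mem via via′
    (λ x → trans (CyclesOf.len-unique π′ (per⇒inj r per) x r (ℕ.>-nonZero⁻¹ r) (per x) (free x)) (sym (mem-len mem x)))

  abstract
    NC? : ∀ (c : ℕ → E) → Dec (NC p c)
    NC? c = any? (λ j → ¬? (c (toℕ j) FinP.≟ c 0))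

  NC-cong : ∀ {c c′ : ℕ → E} → (∀ j → c j ≡ c′ j) → NC p c → NC p c′
  NC-cong eq (j , ne) = j , λ e → ne (trans (eq (toℕ j)) (trans e (sym (eq 0))))

  -- The linear major index of p consecutive entries. It omits the wrap-around term of `maj`, which
  -- is a multiple of p, so the two agree modulo p on a column (`majAt-row`).
  rowMaj : (ρ f σ : E → E) → E → ℕ
  rowMaj ρ f σ x = ∑< (pred p) (λ j → suc j * ind (Words.desc? ρ p (f (iter σ j x)) (f (iter σ (suc j) x))))

  module Tau (τ f : E → E) (τ-per : ∀ x → iter τ p x ≡ x) (τ-free : ∀ x {a b} → iter τ a x ≡ iter τ b x → a ≈ b) where
    cs : E → ℕ → E
    cs x j = f (iter τ j x)

    τ-≈ : ∀ {a b} x → a ≈ b → iter τ a x ≡ iter τ b x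
    τ-≈ {a} {b} x eq = trans (iter-% p (τ-per x) a) (trans (cong (λ k → iter τ k x) eq) (sym (iter-% p (τ-per x) b)))

    cs-per : ∀ x → Per p (cs x)
    cs-per x j = cong f (trans (iter-+ τ j p x) (cong (iter τ j) (τ-per x)))

    cs-shift : ∀ t x j → cs x (j + t) ≡ cs (iter τ t x) j
    cs-shift t x j = cong f (iter-+ τ j t x)

    nc-τ : ∀ a {x} → NC p (cs x) → NC p (cs (iter τ a x))
    nc-τ a {x} nc = NC-cong (cs-shift a x) (Majors.NC-shift (λ (y : E) → y) (λ e → e) p prime a (cs x) (cs-per x) nc)

    nc-τ⁻ : ∀ a {x} → NC p (cs (iter τ a x)) → NC p (cs x)
    nc-τ⁻ a {x} nc = subst (λ z → NC p (cs z)) (trans (sym (iter-+ τ (a * pred p) a x))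
      (trans (τ-≈ x (trans (cong (_% p) (trans (ℕP.+-comm (a * pred p) a) (trans (sym (ℕP.*-suc a (pred p))) (cong (a *_) (ℕP.suc-pred p))))) (trans (m*n%n≡0 a p) (sym zero%)))) refl)) (nc-τ (a * pred p) nc)

    const : ∀ {x} → ¬ NC p (cs x) → ∀ j → f (iter τ j x) ≡ f x
    const {x} ¬nc j with f (iter τ (j % p) x) FinP.≟ f x
    ... | yes e = trans (cong f (iter-% p (τ-per x) j)) e
    ... | no ne = ⊥-elim (¬nc (fromℕ< (m%n<n j p) , λ e → ne (trans (cong (λ k → f (iter τ k x)) (sym (toℕ-fromℕ< (m%n<n j p)))) e)))

    majAt : (E → E) → E → ℕ
    majAt ρ x = Words.maj ρ p (cs x)

    rotAt : (E → E) → ℕ → E → ℕ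
    rotAt ρ v x = Words.rot ρ p v (cs x)

    module _ {ρ : E → E} (ρ-inj : Inj ρ) where
      private module M = Majors ρ ρ-inj p prime

      uniq : ∀ {x} a b → NC p (cs x) → majAt ρ (iter τ a x) ≈ majAt ρ (iter τ b x) → iter τ a x ≡ iter τ b x
      uniq {x} a b nc eq = τ-≈ x (M.rot-unique (cs x) (cs-per x) nc (m%n<n a p) (m%n<n b p) (trans (red a) (trans eq (sym (red b)))))
        where
        red : ∀ a → M.maj (M.shift (a % p) (cs x)) ≈ majAt ρ (iter τ a x)
        red a = cong (_% p) (trans (M.maj-cong (cs-shift (a % p) x)) (cong (majAt ρ) (sym (iter-% p (τ-per x) a))))

      rotAt-spec : ∀ {x} v → v < p → NC p (cs x) → rotAt ρ v x < p × majAt ρ (iter τ (rotAt ρ v x) x) % p ≡ v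
      rotAt-spec {x} v v<p nc = let a , b = M.rot-spec (cs x) (cs-per x) nc v v<p in
        a , trans (cong (_% p) (sym (M.maj-cong (cs-shift (rotAt ρ v x) x)))) b

      maj-const : ∀ {x} → ¬ NC p (cs x) → majAt ρ x ≡ 0
      maj-const {x} ¬nc = trans (∑<-cong p (λ j _ → trans (cong (suc j *_) (ind-no (M.desc? _ _) (λ lt → ℕP.<-irrefl (cong (toℕ ∘ ρ) (trans (const ¬nc (suc j)) (sym (const ¬nc j)))) lt))) (ℕP.*-zeroʳ (suc j))))
        (trans (∑<-const p 0) (ℕP.*-zeroʳ p))

    majAt-row : ∀ (ρ σ : E → E) x → (∀ j → j < p → iter τ j x ≡ iter σ j x) → majAt ρ x ≈ rowMaj ρ f σ x
    majAt-row ρ σ x eq = trans (cong (_% p) split) (trans ([m+kn]%n≡m%n _ last p) (cong (_% p) (∑<-cong (pred p) λ j lt →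
        cong (suc j *_) (cong₂ (λ a b → ind (Words.desc? ρ p (f a) (f b))) (eq j (ℕP.<-≤-trans lt ℕP.pred[n]≤n)) (eq (suc j) (subst (suc j <_) (ℕP.suc-pred p) (s≤s lt)))))))
      where
      g : ℕ → ℕ
      g j = suc j * Words.δ ρ p (cs x) j
      last : ℕ
      last = Words.δ ρ p (cs x) (pred p)
      split : majAt ρ x ≡ ∑< (pred p) g + last * p
      split = trans (cong (λ k → ∑< k g) (sym (ℕP.suc-pred p))) (trans (∑<-snoc (pred p) g) (cong (∑< (pred p) g +_) (trans (ℕP.*-comm _ last) (cong (last *_) (ℕP.suc-pred p)))))

  -- Columns are the orbits of τ = π ^ rp.

  module _ (π f : E → E) where
    csA : E → ℕ → E
    csA x j = f (iter (iter π rp) j x)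

    ncA? : ∀ x → Dec (NC p (csA x))
    ncA? x = NC? (csA x)

    abstract
      -- Each column gets a base point, and `gA x` rotates `x` to it. In a nonconstant column it is
      -- the rotation with major index 0 modulo p; a constant column, where no rotation stands out,
      -- borrows the rotation of the first nonconstant column ahead along `π`. The order of letters
      -- is a fixed one, so base points do not depend on the cut. `kA` measures how far `π` carries
      -- a base point past the next one.
      firstA gA kA : E → ℕ
      firstA x = first rp (λ i → ncA? (iter π i x))
      gA x = Words.rot {E} (λ y → y) p 0 (csA (iter π (firstA x) x))
      kA x = (gA x + (p ∸ gA (π x))) % p

      -- Each column also gets a start, where its row begins. In a nonconstant column it is the
      -- rotation whose major index, now for the order `ρ` of the cut, equals the colour, so that
      -- the row alone reveals the colour. In a constant column start and base point agree. `mA` is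
      -- the place in the row.
      hA mA : (E → E) → E → ℕ
      hA ρ x = pick (ncA? x) (Words.rot ρ p (kA x) (csA x)) (gA x)
      mA ρ x = (p ∸ hA ρ x) % p

      -- The recoded map runs through a column from its start by powers of `π ^ rp` and then passes
      -- to the start of the next column: the cycle of `π` is reread row by row.
      P₂A : (E → E) → E → E
      P₂A ρ x = pick (suc (mA ρ x) ℕ.<? p) (iter π rp x) (iter (iter π rp) (hA ρ (π x)) (π x))

      KA : E → Fin p
      KA x = fromℕ< (m%n<n (gA x + (p ∸ gA (π x))) p)

      MA : (E → E) → E → Fin p
      MA ρ x = fromℕ< (m%n<n (p ∸ hA ρ x) p)

      firstA-spec : ∀ x → (∃ λ i → i < rp × NC p (csA (iter π i x))) → firstA x < rp × NC p (csA (iter π (firstA x) x)) × (∀ j → j < firstA x → ¬ NC p (csA (iter π j x)))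
      firstA-spec x = first-spec rp (λ i → ncA? (iter π i x))

      firstA-unique : ∀ x i → i < rp → NC p (csA (iter π i x)) → (∀ j → j < i → ¬ NC p (csA (iter π j x))) → firstA x ≡ i
      firstA-unique x = first-unique rp (λ i → ncA? (iter π i x))

      gA-≡ : ∀ x → gA x ≡ Words.rot {E} (λ y → y) p 0 (csA (iter π (firstA x) x))
      gA-≡ x = refl

      kA-≡ : ∀ x → kA x ≡ (gA x + (p ∸ gA (π x))) % p
      kA-≡ x = refl

      hA-yes : ∀ ρ x → NC p (csA x) → hA ρ x ≡ Words.rot ρ p (kA x) (csA x)
      hA-yes ρ x nc = pick-yes (ncA? x) nc

      hA-no : ∀ ρ x → ¬ NC p (csA x) → hA ρ x ≡ gA x
      hA-no ρ x ¬nc = pick-no (ncA? x) ¬nc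

      mA-≡ : ∀ ρ x → mA ρ x ≡ (p ∸ hA ρ x) % p
      mA-≡ ρ x = refl

      P₂A-lt : ∀ ρ x → suc (mA ρ x) < p → P₂A ρ x ≡ iter π rp x
      P₂A-lt ρ x lt = pick-yes (suc (mA ρ x) ℕ.<? p) lt

      P₂A-end : ∀ ρ x → ¬ suc (mA ρ x) < p → P₂A ρ x ≡ iter (iter π rp) (hA ρ (π x)) (π x)
      P₂A-end ρ x ¬lt = pick-no (suc (mA ρ x) ℕ.<? p) ¬lt

      KA-≡ : ∀ x → toℕ (KA x) ≡ kA x
      KA-≡ x = toℕ-fromℕ< (m%n<n _ p)

      MA-≡ : ∀ ρ x → toℕ (MA ρ x) ≡ mA ρ x
      MA-≡ ρ x = toℕ-fromℕ< (m%n<n _ p)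

  AVr : (π f : E → E) → Set
  AVr π f = Mem μ π × (∀ x → ∃ λ i → i < rp × NC p (csA π f (iter π i x)))

  -- Cycles of `σ` are cut into rows of length p, with `m` the place in the row and `k` constant
  -- along each row. `row` ties the colour to the row; `tot` encodes that `rp` steps of the original
  -- permutation make one step in a column.
  record TVr (ρ f σ : E → E) (m k : E → Fin p) : Set where
    field
      mem : Mem μ σ
      m-σ : ∀ x → toℕ (m (σ x)) ≡ suc (toℕ (m x)) % p
      k-σ : ∀ x → suc (toℕ (m x)) < p → k (σ x) ≡ k x
      row : ∀ x → toℕ (m x) ≡ 0 → rowMaj ρ f σ x % p ≡ toℕ (k x)
      tot : ∀ x → toℕ (m x) ≡ 0 → ∑< rp (λ i → toℕ (k (iter σ (i * p) x))) % p ≡ 1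

  module TauA (π f : E → E) (mem : Mem μ π) where
    τ : E → E
    τ = iter π rp

    τ-iter : ∀ a x → iter τ a x ≡ iter π (a * rp) x
    τ-iter a x = sym (iter-* π a rp x)

    τ-per : ∀ x → iter τ p x ≡ x
    τ-per x = trans (τ-iter p x) (mem-per mem x)

    private
      half : ∀ x {a b} → a ≤ b → iter τ a x ≡ iter τ b x → a ≈ b
      half x {a} {b} le eq = sym (trans (cong (_% p) (sym (ℕP.m+[n∸m]≡n le))) (%-remove-+ʳ a
        (*-cancelʳ-∣ {m = p} {n = b ∸ a} rp (mem-free mem (iter τ a x) ((b ∸ a) * rp) (trans (sym (τ-iter (b ∸ a) (iter τ a x)))
          (trans (sym (iter-+ τ (b ∸ a) a x)) (trans (cong (λ k → iter τ k x) (ℕP.m∸n+n≡m le)) (sym eq))))))))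

    τ-free : ∀ x {a b} → iter τ a x ≡ iter τ b x → a ≈ b
    τ-free x {a} {b} eq with ℕP.≤-total a b
    ... | inj₁ le = half x le eq
    ... | inj₂ ge = sym (half x ge (sym eq))

    open Tau τ f τ-per τ-free public

    π-inj : Inj π
    π-inj = proj₁ mem

    πτ : ∀ a x → π (iter τ a x) ≡ iter τ a (π x)
    πτ a x = iter-conj π (λ y → iter-suc π rp y) a x

    πτi : ∀ i a x → iter π i (iter τ a x) ≡ iter τ a (iter π i x)
    πτi zero    a x = refl
    πτi (suc i) a x = trans (cong π (πτi i a x)) (πτ a (iter π i x))

  -- From permutations to rows

  module ASide (π f : E → E) (av : AVr π f) where
    open TauA π f (proj₁ av) public

    private
      idi : Inj (λ (x : E) → x)
      idi e = e

    first-spec′ : ∀ x → firstA π f x < rp × NC p (cs (iter π (firstA π f x) x)) × (∀ j → j < firstA π f x → ¬ NC p (cs (iter π j x)))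
    first-spec′ x = firstA-spec π f x (proj₂ av x)

    g : E → ℕ
    g = gA π f

    g-spec : ∀ x → g x < p × majAt (λ y → y) (iter τ (g x) (iter π (firstA π f x) x)) % p ≡ 0
    g-spec x = subst (λ t → t < p × majAt (λ y → y) (iter τ t (iter π (firstA π f x) x)) % p ≡ 0) (sym (gA-≡ π f x)) (rotAt-spec {λ y → y} idi {iter π (firstA π f x) x} 0 0<p (proj₁ (proj₂ (first-spec′ x))))

    b : E → E
    b x = iter τ (g x) x

    -- Frees the base point from the search that defines it: any rotation that makes the first
    -- nonconstant column ahead have major index 0 leads to it.
    b-char : ∀ x i → i < rp → NC p (cs (iter π i x)) → (∀ j → j < i → ¬ NC p (cs (iter π j x))) →
             ∀ a → majAt (λ y → y) (iter τ a (iter π i x)) % p ≡ 0 → iter τ a x ≡ b x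
    b-char x i i< nc mn a eq = iter-inj π-inj i (trans (πτi i a x) (trans
      (uniq idi a (g x) nc (trans eq (sym (trans (cong (λ j → majAt (λ y → y) (iter τ (g x) (iter π j x)) % p) (sym first≡)) (proj₂ (g-spec x))))))
      (sym (πτi i (g x) x))))
      where
      first≡ : firstA π f x ≡ i
      first≡ = firstA-unique π f x i i< nc mn

    b-τ : ∀ x → b (τ x) ≡ b x
    b-τ x = trans (sym (iter-suc τ (g (τ x)) x)) (b-char x i i<
        (nc-τ⁻ 1 (subst (λ z → NC p (cs z)) (πτi i 1 x) nc)) (λ j lt nc′ → mn j lt (subst (λ z → NC p (cs z)) (sym (πτi j 1 x)) (nc-τ 1 nc′)))
        (suc (g (τ x))) (trans (cong (λ z → majAt (λ y → y) z % p) (trans (iter-suc τ (g (τ x)) (iter π i x)) (cong (iter τ (g (τ x))) (sym (πτi i 1 x))))) (proj₂ (g-spec (τ x)))))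
      where
      i : ℕ
      i = firstA π f (τ x)
      i< = proj₁ (first-spec′ (τ x))
      nc = proj₁ (proj₂ (first-spec′ (τ x)))
      mn = proj₂ (proj₂ (first-spec′ (τ x)))

    b-τa : ∀ a x → b (iter τ a x) ≡ b x
    b-τa zero    x = refl
    b-τa (suc a) x = trans (b-τ (iter τ a x)) (b-τa a x)

    -- From a constant column the search ends in the same column as the search from the next one, so
    -- `π` carries base point to base point.
    b-const : ∀ x → ¬ NC p (cs x) → π (b x) ≡ b (π x)
    b-const x ¬nc = go (firstA π f x) refl
      where
      go : ∀ i → firstA π f x ≡ i → π (b x) ≡ b (π x)
      go zero    eq = ⊥-elim (¬nc (subst (λ i → NC p (cs (iter π i x))) eq (proj₁ (proj₂ (first-spec′ x)))))
      go (suc i) eq = trans (πτ (g x) x) (b-char (π x) i (ℕP.<⇒≤ (subst (_< rp) eq (proj₁ (first-spec′ x))))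
            (subst (λ z → NC p (cs z)) (trans (cong (λ i → iter π i x) eq) (iter-suc π i x)) (proj₁ (proj₂ (first-spec′ x))))
            (λ j lt nc′ → proj₂ (proj₂ (first-spec′ x)) (suc j) (subst (suc j <_) (sym eq) (s≤s lt)) (subst (λ z → NC p (cs z)) (sym (iter-suc π j x)) nc′))
            (g x) (trans (cong (λ z → majAt (λ y → y) (iter τ (g x) z) % p) (sym (trans (cong (λ i → iter π i x) eq) (iter-suc π i x)))) (proj₂ (g-spec x))))

    k : E → ℕ
    k = kA π f

    k<p : ∀ x → k x < p
    k<p x = subst (_< p) (sym (kA-≡ π f x)) (m%n<n _ p)

    k-spec : ∀ x → π (b x) ≡ iter τ (k x) (b (π x))
    k-spec x = trans (πτ (g x) x) (trans (τ-≈ (π x) (sym (trans (≈-+ {k x} (trans (cong (_% p) (kA-≡ π f x)) (≈-% (g x + (p ∸ g (π x))))) refl)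
      (trans (cong (_% p) (trans (ℕP.+-assoc (g x) _ _) (cong (g x +_) (ℕP.m∸n+n≡m (ℕP.<⇒≤ (proj₁ (g-spec (π x)))))))) (trans (cong (λ z → (g x + z) % p) (sym (ℕP.*-identityˡ p))) ([m+kn]%n≡m%n (g x) 1 p)))))) (iter-+ τ (k x) (g (π x)) (π x)))

    k-char : ∀ x κ → κ < p → π (b x) ≡ iter τ κ (b (π x)) → κ ≡ k x
    k-char x κ κ<p eq = small κ<p (k<p x) (τ-free (b (π x)) (trans (sym eq) (k-spec x)))

    k-τ : ∀ x → k (τ x) ≡ k x
    k-τ x = k-char x (k (τ x)) (k<p (τ x)) (trans (cong π (sym (b-τ x))) (trans (k-spec (τ x)) (cong (iter τ (k (τ x))) (trans (cong b (πτ 1 x)) (b-τ (π x))))))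

    k-τa : ∀ a x → k (iter τ a x) ≡ k x
    k-τa zero    x = refl
    k-τa (suc a) x = trans (k-τ (iter τ a x)) (k-τa a x)

    -- A constant word has no descents, hence major index 0 as well; this makes the condition `row`
    -- hold on constant columns.
    k-const : ∀ x → ¬ NC p (cs x) → k x ≡ 0
    k-const x ¬nc = sym (k-char x 0 0<p (b-const x ¬nc))

    k-total : ∀ x i → iter π i (b x) ≡ iter τ (∑< i (λ j → k (iter π j x))) (b (iter π i x))
    k-total x zero    = refl
    k-total x (suc i) = trans (cong π (k-total x i)) (trans (πτ Sᵢ _) (trans (cong (iter τ Sᵢ) (k-spec (iter π i x)))
      (trans (sym (iter-+ τ Sᵢ (k (iter π i x)) _)) (cong (λ z → iter τ z (b (iter π (suc i) x))) (sym (∑<-snoc i (λ j → k (iter π j x))))))))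
      where
      Sᵢ : ℕ
      Sᵢ = ∑< i (λ j → k (iter π j x))

    -- After `rp` steps `π` has acted as `τ`: the column has turned by exactly one place, while its
    -- base point is the old one.
    k-sum : ∀ x → ∑< rp (λ j → k (iter π j x)) % p ≡ 1
    k-sum x = trans (sym (τ-free (b x) {1} (trans (k-total x rp) (cong (iter τ (∑< rp (λ j → k (iter π j x)))) (b-τ x))))) (m<n⇒m%n≡m 1<p)

    module Start (ρ : E → E) (ρ-inj : Inj ρ) where
      h m : E → ℕ
      h = hA π f ρ
      m = mA π f ρ

      st σ : E → E
      st x = iter τ (h x) x
      σ = P₂A π f ρ

      h<p : ∀ x → h x < p
      h<p x with ncA? π f x
      ... | yes nc = subst (_< p) (sym (hA-yes π f ρ x nc)) (proj₁ (rotAt-spec ρ-inj (k x) (k<p x) nc))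
      ... | no ¬nc = subst (_< p) (sym (hA-no π f ρ x ¬nc)) (proj₁ (g-spec x))

      st-nc : ∀ x → NC p (cs x) → majAt ρ (st x) % p ≡ k x
      st-nc x nc = subst (λ t → majAt ρ (iter τ t x) % p ≡ k x) (sym (hA-yes π f ρ x nc)) (proj₂ (rotAt-spec {ρ} ρ-inj {x} (k x) (k<p x) nc))

      st-const : ∀ x → ¬ NC p (cs x) → st x ≡ b x
      st-const x ¬nc = cong (λ t → iter τ t x) (hA-no π f ρ x ¬nc)

      st-char : ∀ x → NC p (cs x) → ∀ a → majAt ρ (iter τ a x) % p ≡ k x → iter τ a x ≡ st x
      st-char x nc a eq = uniq ρ-inj a (h x) nc (trans eq (sym (st-nc x nc)))

      st-τ : ∀ x → st (τ x) ≡ st x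
      st-τ x with ncA? π f x
      ... | yes nc = trans (sym (iter-suc τ (h (τ x)) x)) (st-char x nc (suc (h (τ x))) (trans (cong (λ z → majAt ρ z % p) (iter-suc τ (h (τ x)) x)) (trans (st-nc (τ x) (nc-τ 1 nc)) (k-τ x))))
      ... | no ¬nc = trans (st-const (τ x) (λ nc → ¬nc (nc-τ⁻ 1 nc))) (trans (b-τ x) (sym (st-const x ¬nc)))

      st-τa : ∀ a x → st (iter τ a x) ≡ st x
      st-τa zero    x = refl
      st-τa (suc a) x = trans (st-τ (iter τ a x)) (st-τa a x)

      m<p : ∀ x → m x < p
      m<p x = subst (_< p) (sym (mA-≡ π f ρ x)) (m%n<n _ p)

      m-spec : ∀ x → iter τ (m x) (st x) ≡ x
      m-spec x = trans (sym (iter-+ τ (m x) (h x) x)) (τ-≈ {m x + h x} {0} x (trans (cong (λ z → (z + h x) % p) (mA-≡ π f ρ x)) (compl (ℕP.<⇒≤ (h<p x)))))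

      m-char : ∀ x a → a < p → iter τ a (st x) ≡ x → a ≡ m x
      m-char x a a<p eq = small a<p (m<p x) (τ-free (st x) (trans eq (sym (m-spec x))))

      st-st : ∀ x → st (st x) ≡ st x
      st-st x = st-τa (h x) x

      m-row : ∀ a x → a < p → m (iter τ a (st x)) ≡ a
      m-row a x a<p = sym (m-char _ a a<p (cong (iter τ a) (trans (st-τa a (st x)) (st-st x))))

      σ-lt : ∀ x → suc (m x) < p → σ x ≡ τ x
      σ-lt = P₂A-lt π f ρ

      σ-end : ∀ x → ¬ suc (m x) < p → σ x ≡ st (π x)
      σ-end = P₂A-end π f ρ

      σ-row : ∀ j x → j < p → iter σ j (st x) ≡ iter τ j (st x)
      σ-row zero    x lt = refl
      σ-row (suc j) x lt = trans (cong σ (σ-row j x (ℕP.<⇒≤ lt))) (σ-lt _ (subst (λ z → suc z < p) (sym (m-row j x (ℕP.<⇒≤ lt))) lt))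

      st-π : ∀ a x → st (π (iter τ a x)) ≡ st (π x)
      st-π a x = trans (cong st (πτ a x)) (st-τa a (π x))

      -- A whole row leads from start to start, so on starts `σ` to the power `i * p` follows `π` to
      -- the power `i`. The period and the freeness of `σ` both come from this.
      σ-p : ∀ x → iter σ p (st x) ≡ st (π x)
      σ-p x = trans (cong (λ j → iter σ j (st x)) (sym (ℕP.suc-pred p))) (trans (cong σ (σ-row (pred p) x pp<)) (trans (σ-end _ (λ lt → ℕP.<-irrefl (trans (cong suc (m-row (pred p) x pp<)) (ℕP.suc-pred p)) lt))
        (trans (st-π (pred p) (st x)) (st-π (h x) x))))
        where
        pp< : pred p < p
        pp< = ℕP.≤-reflexive (ℕP.suc-pred p)

      σ-ip : ∀ i x → iter σ (i * p) (st x) ≡ st (iter π i x)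
      σ-ip zero    x = refl
      σ-ip (suc i) x = trans (iter-+ σ p (i * p) (st x)) (trans (cong (iter σ p) (σ-ip i x)) (σ-p (iter π i x)))

      σ-m : ∀ x → iter σ (m x) (st x) ≡ x
      σ-m x = trans (σ-row (m x) x (m<p x)) (m-spec x)

      σ-per : ∀ x → iter σ r x ≡ x
      σ-per x = trans (cong (iter σ r) (sym (σ-m x))) (trans (iter-comm σ r (m x) (st x)) (trans (cong (iter σ (m x))
        (trans (cong (λ j → iter σ j (st x)) (ℕP.*-comm p rp)) (trans (σ-ip rp x) (st-τ x)))) (σ-m x)))

      st-back : ∀ x → iter σ (r ∸ m x) x ≡ st x
      st-back x = trans (cong (iter σ (r ∸ m x)) (sym (σ-m x))) (trans (sym (iter-+ σ (r ∸ m x) (m x) (st x)))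
        (trans (cong (λ j → iter σ j (st x)) (ℕP.m∸n+n≡m (ℕP.≤-trans (ℕP.<⇒≤ (m<p x)) (ℕP.m≤m*n p rp)))) (σ-per (st x))))

      via : ∀ x → ∃ λ a → σ x ≡ iter π a x
      via x with suc (m x) ℕ.<? p
      ... | yes lt = rp , σ-lt x lt
      ... | no ¬lt = h (π x) * rp + 1 , trans (σ-end x ¬lt) (trans (τ-iter (h (π x)) (π x)) (sym (iter-+ π (h (π x) * rp) 1 x)))

      via′ : ∀ x → ∃ λ a → π x ≡ iter σ a x
      via′ x = m (π x) + (p + (r ∸ m x)) , sym (trans (iter-+ σ (m (π x)) (p + (r ∸ m x)) x)
        (trans (cong (iter σ (m (π x))) (trans (iter-+ σ p (r ∸ m x) x) (trans (cong (iter σ p) (st-back x)) (σ-p x)))) (σ-m (π x))))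

      -- The place in the row forces p to divide `j`. Then `j / p` steps of `π` lead from `x` back
      -- into its own column, which forces `rp` to divide `j / p`.
      σ-free : ∀ x j → iter σ j x ≡ x → r ∣ j
      σ-free x j eq = subst (r ∣_) (sym (trans (m≡m%n+[m/n]*n j p) (cong (_+ j / p * p) b≡0)))
        (subst (_∣ j / p * p) (ℕP.*-comm rp p) (*-monoˡ-∣ p rp∣))
        where
        σ-inj : Inj σ
        σ-inj = per⇒inj r σ-per
        eq₀ : iter σ j (st x) ≡ st x
        eq₀ = iter-inj σ-inj (m x) (trans (iter-comm σ (m x) j (st x)) (trans (cong (iter σ j) (σ-m x)) (trans eq (sym (σ-m x)))))
        y : E
        y = iter π (j / p) x
        eq₁ : iter τ (j % p) (st y) ≡ st x
        eq₁ = trans (sym (trans (cong (λ i → iter σ i (st x)) (m≡m%n+[m/n]*n j p)) (trans (iter-+ σ (j % p) (j / p * p) (st x)) (trans (cong (iter σ (j % p)) (σ-ip (j / p) x)) (σ-row (j % p) y (m%n<n j p)))))) eq₀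
        b≡0 : j % p ≡ 0
        b≡0 = trans (sym (m-row (j % p) y (m%n<n j p))) (subst (λ w → m w ≡ 0) (sym eq₁) (m-row 0 x 0<p))
        eq₂ : st y ≡ st x
        eq₂ = trans (cong (λ i → iter τ i (st y)) (sym b≡0)) eq₁
        -- y and x lie in one column, so y = τ ^ c x
        c : ℕ
        c = m y + h x
        y≡ : iter π (j / p) x ≡ iter π (c * rp) x
        y≡ = trans (trans (sym (m-spec y)) (trans (cong (iter τ (m y)) eq₂) (sym (iter-+ τ (m y) (h x) x)))) (τ-iter c x)
        -- In place of a subtraction, `r ∸ 1` further multiples of `c * rp` are added, completing a
        -- multiple of the period `r`.
        rp∣ : rp ∣ j / p
        rp∣ = ∣m+n∣m⇒∣n {m = c * rp * (r ∸ 1)} (∣-trans (n∣m*n p) (mem-free (proj₁ av) x (c * rp * (r ∸ 1) + j / p)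
          (trans (iter-+ π (c * rp * (r ∸ 1)) (j / p) x) (trans (cong (iter π (c * rp * (r ∸ 1))) y≡) (trans (sym (iter-+ π (c * rp * (r ∸ 1)) (c * rp) x))
            (trans (cong (λ i → iter π i x) (trans (ℕP.+-comm (c * rp * (r ∸ 1)) (c * rp)) (trans (sym (ℕP.*-suc (c * rp) (r ∸ 1))) (cong (c * rp *_) (ℕP.suc-pred r))))) (iter-period r (mem-per (proj₁ av) x) (c * rp))))))))
          (∣-trans (n∣m*n c) (m∣m*n (r ∸ 1)))

      m-σ : ∀ x → m (σ x) ≡ suc (m x) % p
      m-σ x with suc (m x) ℕ.<? p
      ... | yes lt = trans (cong m (σ-lt x lt)) (trans (sym (m-char (τ x) (suc (m x)) lt (trans (cong (iter τ (suc (m x))) (st-τ x)) (cong τ (m-spec x))))) (sym (m<n⇒m%n≡m lt)))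
      ... | no ¬lt = trans (cong m (σ-end x ¬lt)) (trans (m-row 0 (π x) 0<p) (sym (trans (cong (_% p) (ℕP.≤-antisym (m<p x) (ℕP.≮⇒≥ ¬lt))) (n%n≡0 p))))

      kF : E → Fin p
      kF = KA π f
      mF : E → Fin p
      mF = MA π f ρ

      kF≡ : ∀ x → toℕ (kF x) ≡ k x
      kF≡ = KA-≡ π f
      mF≡ : ∀ x → toℕ (mF x) ≡ m x
      mF≡ = MA-≡ π f ρ

      fwd : TVr ρ f σ mF kF
      fwd = record
        { mem = mem-change (proj₁ av) via via′ σ-per σ-free
        ; m-σ = λ x → trans (mF≡ (σ x)) (trans (m-σ x) (cong (λ z → suc z % p) (sym (mF≡ x))))
        ; k-σ = λ x lt → toℕ-injective (trans (kF≡ (σ x)) (trans (cong k (σ-lt x (subst (λ z → suc z < p) (mF≡ x) lt))) (trans (k-τ x) (sym (kF≡ x)))))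
        ; row = λ x m0 → let x≡ = trans (sym (cong (λ z → iter τ z (st x)) (trans (sym (mF≡ x)) m0))) (m-spec x) in
            trans (sym (majAt-row ρ σ x (λ j lt → subst (λ z → iter τ j z ≡ iter σ j z) x≡ (sym (σ-row j x lt))))) (trans (start x x≡) (sym (kF≡ x)))
        ; tot = λ x m0 → let x≡ = trans (sym (cong (λ z → iter τ z (st x)) (trans (sym (mF≡ x)) m0))) (m-spec x) in
            trans (cong (_% p) (∑<-cong rp λ i _ → trans (kF≡ _) (trans (cong k (trans (cong (iter σ (i * p)) (sym x≡)) (σ-ip i x))) (k-τa (h (iter π i x)) (iter π i x))))) (k-sum x)
        }
        where
        start : ∀ x → st x ≡ x → majAt ρ x % p ≡ k x
        start x x≡ with ncA? π f x
        ... | yes nc = trans (cong (λ z → majAt ρ z % p) (sym x≡)) (st-nc x nc)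
        ... | no ¬nc = trans (cong (_% p) (maj-const ρ-inj ¬nc)) (trans (m<n⇒m%n≡m 0<p) (sym (k-const x ¬nc)))

  0<rp : 0 < rp
  0<rp = ℕ.>-nonZero⁻¹ rp

  p≤r : p ≤ r
  p≤r = ℕP.m≤m*n p rp

  -- From rows back to permutations

  module _ (f σ : E → E) (m k : E → Fin p) where
    stT τT nxT : E → E
    stT x = iter σ (r ∸ toℕ (m x)) x
    τT x = iter σ (suc (toℕ (m x)) % p) (stT x)
    nxT x = iter σ p (stT x)

    csT : E → ℕ → E
    csT x j = f (iter τT j x)

    abstract
      -- Recovers the base points from the rows. A constant column takes its row start, which is
      -- where the forward recoding has put its base point, so no search ahead is involved.
      gT : E → ℕ
      gT x = pick (NC? (csT x)) (Words.rot {E} (λ y → y) p 0 (csT x)) ((p ∸ toℕ (m x)) % p)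

      -- Sends `x`, seen as a rotation of its base point, to the same rotation of the next base
      -- point, advanced by the colour; this undoes the definition of `kA`.
      P₁T : E → E
      P₁T x = iter τT ((p ∸ gT x) + toℕ (k x)) (iter τT (gT (nxT x)) (nxT x))

      gT-yes : ∀ x → NC p (csT x) → gT x ≡ Words.rot {E} (λ y → y) p 0 (csT x)
      gT-yes x nc = pick-yes (NC? (csT x)) nc

      gT-no : ∀ x → ¬ NC p (csT x) → gT x ≡ (p ∸ toℕ (m x)) % p
      gT-no x ¬nc = pick-no (NC? (csT x)) ¬nc

      P₁T-≡ : ∀ x → P₁T x ≡ iter τT ((p ∸ gT x) + toℕ (k x)) (iter τT (gT (nxT x)) (nxT x))
      P₁T-≡ x = refl

  private
    idi : Inj (λ (x : E) → x)
    idi e = e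

  module TSide (ρ f σ : E → E) (m k : E → Fin p) (ρ-inj : Inj ρ) (tv : TVr ρ f σ m k) where
    open TVr tv

    mN kN : E → ℕ
    mN x = toℕ (m x)
    kN x = toℕ (k x)

    st τ nx : E → E
    st = stT f σ m k
    τ = τT f σ m k
    nx = nxT f σ m k

    mN<p : ∀ x → mN x < p
    mN<p x = toℕ<n (m x)

    σ-per : ∀ x → iter σ r x ≡ x
    σ-per = mem-per mem

    m-iter : ∀ j x → mN (iter σ j x) ≡ (mN x + j) % p
    m-iter zero    x = sym (trans (cong (_% p) (ℕP.+-identityʳ (mN x))) (m<n⇒m%n≡m (mN<p x)))
    m-iter (suc j) x = trans (m-σ (iter σ j x)) (trans (cong (λ z → suc z % p) (m-iter j x))
      (trans (≈-+ {1} {1} refl (≈-% (mN x + j))) (cong (_% p) (sym (ℕP.+-suc (mN x) j)))))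

    m-st : ∀ x → mN (st x) ≡ 0
    m-st x = trans (m-iter (r ∸ mN x) x) (trans (cong (_% p) (ℕP.m+[n∸m]≡n (ℕP.≤-trans (ℕP.<⇒≤ (mN<p x)) p≤r))) (trans (cong (_% p) (ℕP.*-comm p rp)) (m*n%n≡0 rp p)))

    σ-m : ∀ x → iter σ (mN x) (st x) ≡ x
    σ-m x = trans (sym (iter-+ σ (mN x) (r ∸ mN x) x)) (trans (cong (λ j → iter σ j x) (ℕP.m+[n∸m]≡n (ℕP.≤-trans (ℕP.<⇒≤ (mN<p x)) p≤r))) (σ-per x))

    m-row : ∀ {y} → mN y ≡ 0 → ∀ j → j < p → mN (iter σ j y) ≡ j
    m-row {y} m0 j lt = trans (m-iter j y) (trans (cong (λ z → (z + j) % p) m0) (m<n⇒m%n≡m lt))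

    st-row : ∀ {y} → mN y ≡ 0 → ∀ j → j < p → st (iter σ j y) ≡ y
    st-row {y} m0 j lt = trans (cong (λ z → iter σ (r ∸ z) (iter σ j y)) (m-row m0 j lt)) (trans (sym (iter-+ σ (r ∸ j) j y))
      (trans (cong (λ i → iter σ i y) (ℕP.m∸n+n≡m (ℕP.≤-trans (ℕP.<⇒≤ lt) p≤r))) (σ-per y)))

    τ-iter : ∀ a x → iter τ a x ≡ iter σ ((mN x + a) % p) (st x)
    τ-iter zero    x = sym (trans (cong (λ j → iter σ j (st x)) (trans (cong (_% p) (ℕP.+-identityʳ (mN x))) (m<n⇒m%n≡m (mN<p x)))) (σ-m x))
    τ-iter (suc a) x = trans (cong τ (τ-iter a x)) (trans (cong₂ (λ u w → iter σ (suc u % p) w) (m-row (m-st x) A A<p) (st-row (m-st x) A A<p))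
      (cong (λ j → iter σ j (st x)) (trans (≈-+ {1} {1} refl (≈-% (mN x + a))) (cong (_% p) (sym (ℕP.+-suc (mN x) a))))))
      where
      A : ℕ
      A = (mN x + a) % p
      A<p : A < p
      A<p = m%n<n _ p

    τ-per : ∀ x → iter τ p x ≡ x
    τ-per x = trans (τ-iter p x) (trans (cong (λ j → iter σ j (st x)) (trans (cong (λ z → (mN x + z) % p) (sym (ℕP.*-identityˡ p))) (trans ([m+kn]%n≡m%n (mN x) 1 p) (m<n⇒m%n≡m (mN<p x))))) (σ-m x))

    m-τ : ∀ a x → mN (iter τ a x) ≡ (mN x + a) % p
    m-τ a x = trans (cong mN (τ-iter a x)) (m-row (m-st x) ((mN x + a) % p) (m%n<n _ p))

    τ-free : ∀ x {a b} → iter τ a x ≡ iter τ b x → a ≈ b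
    τ-free x {a} {b} eq = ≈-cancel (mN x) (trans (sym (m-τ a x)) (trans (cong mN eq) (m-τ b x)))

    open Tau τ f τ-per τ-free public

    st-τ : ∀ a x → st (iter τ a x) ≡ st x
    st-τ a x = trans (cong st (τ-iter a x)) (st-row (m-st x) ((mN x + a) % p) (m%n<n _ p))

    st-start : ∀ {y} → mN y ≡ 0 → st y ≡ y
    st-start m0 = st-row m0 0 0<p

    τ-start : ∀ {y} → mN y ≡ 0 → ∀ j → j < p → iter τ j y ≡ iter σ j y
    τ-start {y} m0 j lt = trans (τ-iter j y) (cong₂ (iter σ) (trans (cong (λ z → (z + j) % p) m0) (m<n⇒m%n≡m lt)) (st-start m0))

    to-st : ∀ x → iter τ ((p ∸ mN x) % p) x ≡ st x
    to-st x = trans (τ-iter ((p ∸ mN x) % p) x) (cong (λ j → iter σ j (st x)) (trans (cong (_% p) (ℕP.+-comm (mN x) _)) (trans (compl (ℕP.<⇒≤ (mN<p x))) zero%)))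

    g : E → ℕ
    g = gT f σ m k

    b : E → E
    b x = iter τ (g x) x

    b-nc : ∀ x → NC p (cs x) → majAt (λ y → y) (b x) % p ≡ 0
    b-nc x nc = subst (λ t → majAt (λ y → y) (iter τ t x) % p ≡ 0) (sym (gT-yes f σ m k x nc)) (proj₂ (rotAt-spec {λ y → y} idi {x} 0 0<p nc))

    b-const : ∀ x → ¬ NC p (cs x) → b x ≡ st x
    b-const x ¬nc = trans (cong (λ t → iter τ t x) (gT-no f σ m k x ¬nc)) (to-st x)

    g<p : ∀ x → g x < p
    g<p x with NC? (cs x)
    ... | yes nc = subst (_< p) (sym (gT-yes f σ m k x nc)) (proj₁ (rotAt-spec idi 0 0<p nc))
    ... | no ¬nc = subst (_< p) (sym (gT-no f σ m k x ¬nc)) (m%n<n _ p)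

    b-τ : ∀ a x → b (iter τ a x) ≡ b x
    b-τ a x with NC? (cs x)
    ... | yes nc = trans (sym (iter-+ τ (g (iter τ a x)) a x)) (uniq idi (g (iter τ a x) + a) (g x) nc
          (trans (cong (λ z → majAt (λ y → y) z % p) (iter-+ τ (g (iter τ a x)) a x)) (trans (b-nc (iter τ a x) (nc-τ a nc)) (sym (b-nc x nc)))))
    ... | no ¬nc = trans (b-const _ (λ nc → ¬nc (nc-τ⁻ a nc))) (trans (st-τ a x) (sym (b-const x ¬nc)))

    back : ∀ x → iter τ (p ∸ g x) (b x) ≡ x
    back x = trans (sym (iter-+ τ (p ∸ g x) (g x) x)) (trans (cong (λ j → iter τ j x) (ℕP.m∸n+n≡m (ℕP.<⇒≤ (g<p x)))) (τ-per x))

    m-nx : ∀ x → mN (nx x) ≡ 0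
    m-nx x = trans (m-iter p (st x)) (trans (cong (λ z → (z + p) % p) (m-st x)) (n%n≡0 p))

    nx-τ : ∀ a x → nx (iter τ a x) ≡ nx x
    nx-τ a x = cong (iter σ p) (st-τ a x)

    k-row : ∀ {y} → mN y ≡ 0 → ∀ j → j < p → k (iter σ j y) ≡ k y
    k-row m0 zero    lt = refl
    k-row m0 (suc j) lt = trans (k-σ _ (subst (λ z → suc z < p) (sym (m-row m0 j (ℕP.<⇒≤ lt))) lt)) (k-row m0 j (ℕP.<⇒≤ lt))

    k-st : ∀ x → k (st x) ≡ k x
    k-st x = sym (trans (cong k (sym (σ-m x))) (k-row (m-st x) (mN x) (mN<p x)))

    k-τ : ∀ a x → k (iter τ a x) ≡ k x
    k-τ a x = trans (sym (k-st (iter τ a x))) (trans (cong k (st-τ a x)) (k-st x))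

    π : E → E
    π = P₁T f σ m k

    -- In coordinates relative to the base points, the decoded map is translation by the colour;
    -- commutation with `τ` is then immediate.
    π-char : ∀ a x → π (iter τ a (b x)) ≡ iter τ (a + kN x) (b (nx x))
    π-char a x = trans (P₁T-≡ f σ m k z) (trans (cong₂ (λ u w → iter τ ((p ∸ g z) + toℕ u) (b w)) (trans (k-τ a (b x)) (k-τ (g x) x)) (trans (nx-τ a (b x)) (nx-τ (g x) x)))
      (τ-≈ (b (nx x)) (≈-+ {p ∸ g z} {a} (τ-free (b x) {p ∸ g z} {a} (trans (cong (iter τ (p ∸ g z)) (sym (trans (b-τ a (b x)) (b-τ (g x) x)))) (back z))) refl)))
      where
      z : E
      z = iter τ a (b x)

    πτ : ∀ a x → π (iter τ a x) ≡ iter τ a (π x)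
    πτ a x = trans (cong π (trans (cong (iter τ a) (sym (back x))) (sym (iter-+ τ a (p ∸ g x) (b x))))) (trans (π-char (a + (p ∸ g x)) x)
      (trans (cong (λ j → iter τ j (b (nx x))) (ℕP.+-assoc a _ _)) (trans (iter-+ τ a ((p ∸ g x) + kN x) _) (cong (iter τ a) (sym (trans (cong π (sym (back x))) (π-char (p ∸ g x) x)))))))

    π-next : ∀ x → ∃ λ a → π x ≡ iter τ a (nx x)
    π-next x = (p ∸ g x) + kN x + g (nx x) , trans (P₁T-≡ f σ m k x) (sym (iter-+ τ ((p ∸ g x) + kN x) (g (nx x)) (nx x)))

    st-π : ∀ x → st (π x) ≡ nx x
    st-π x = let a , e = π-next x in trans (cong st e) (trans (st-τ a (nx x)) (st-start (m-nx x)))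

    b-π : ∀ x → b (π x) ≡ b (nx x)
    b-π x = let a , e = π-next x in trans (cong b e) (b-τ a (nx x))

    k-spec : ∀ x → π (b x) ≡ iter τ (kN x) (b (π x))
    k-spec x = trans (π-char 0 x) (cong (iter τ (kN x)) (sym (b-π x)))

    st-πi : ∀ i x → st (iter π i x) ≡ iter σ (i * p) (st x)
    st-πi zero    x = refl
    st-πi (suc i) x = trans (st-π (iter π i x)) (trans (cong (iter σ p) (st-πi i x)) (sym (iter-+ σ p (i * p) (st x))))

    k-πi : ∀ i x → k (iter σ (i * p) (st x)) ≡ k (iter π i x)
    k-πi i x = trans (cong k (sym (st-πi i x))) (k-st (iter π i x))

    total : ∀ x i → iter π i (b x) ≡ iter τ (∑< i (λ j → kN (iter π j x))) (b (iter π i x))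
    total x zero    = refl
    total x (suc i) = trans (cong π (total x i)) (trans (πτ Sᵢ _) (trans (cong (iter τ Sᵢ) (k-spec (iter π i x)))
      (trans (sym (iter-+ τ Sᵢ (kN (iter π i x)) _)) (cong (λ z → iter τ z (b (iter π (suc i) x))) (sym (∑<-snoc i (λ j → kN (iter π j x))))))))
      where
      Sᵢ : ℕ
      Sᵢ = ∑< i (λ j → kN (iter π j x))

    k-sum : ∀ x → ∑< rp (λ j → kN (iter π j x)) % p ≡ 1
    k-sum x = trans (cong (_% p) (∑<-cong rp (λ i _ → cong toℕ (sym (k-πi i x))))) (tot (st x) (m-st x))

    b-st : ∀ x → b (st x) ≡ b x
    b-st x = trans (cong b (sym (to-st x))) (b-τ ((p ∸ mN x) % p) x)

    -- Passing through `rp` rows returns to the same column with the base point advanced by the sum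
    -- of the colours, which is 1 modulo p by `tot`.
    π-rp : ∀ x → iter π rp x ≡ τ x
    π-rp x = trans (cong (iter π rp) (sym (back x))) (trans (πiτ rp (p ∸ g x) (b x)) (trans (cong (iter τ (p ∸ g x)) main)
      (trans (iter-comm τ (p ∸ g x) 1 (b x)) (cong τ (back x)))))
      where
      πiτ : ∀ i a y → iter π i (iter τ a y) ≡ iter τ a (iter π i y)
      πiτ zero    a y = refl
      πiτ (suc i) a y = trans (cong π (πiτ i a y)) (πτ a (iter π i y))
      same-col : b (iter π rp x) ≡ b x
      same-col = trans (sym (b-st _)) (trans (cong b (trans (st-πi rp x) (trans (cong (λ j → iter σ j (st x)) (ℕP.*-comm rp p)) (σ-per (st x))))) (b-st x))
      main : iter π rp (b x) ≡ τ (b x)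
      main = trans (total x rp) (trans (cong (iter τ (∑< rp (λ j → kN (iter π j x)))) same-col) (τ-≈ {∑< rp (λ j → kN (iter π j x))} {1} (b x) (trans (k-sum x) (sym (m<n⇒m%n≡m 1<p)))))

    π-τ : ∀ j x → iter (iter π rp) j x ≡ iter τ j x
    π-τ j x = iter-cong π-rp j x

    π-per : ∀ x → iter π r x ≡ x
    π-per x = trans (iter-* π p rp x) (trans (π-τ p x) (τ-per x))

    π-free : ∀ x j → iter π j x ≡ x → r ∣ j
    π-free x j eq with *-cancelʳ-∣ {m = rp} {n = j} p (subst (_∣ j * p) (ℕP.*-comm p rp) (mem-free mem (st x) (j * p) (trans (sym (st-πi j x)) (cong st eq))))
    ... | divides c refl = *-monoˡ-∣ rp (m%n≡0⇒n∣m c p (trans (τ-free x {c} {0} (trans (sym (π-τ c x)) (trans (sym (iter-* π c rp x)) eq))) zero%))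

    -- The exponent is built from `g`, `k` and `m` alone, and these agree at tied points; so `π` is
    -- the same power of `σ` at both, as `nat-bwd` asks.
    jump : E → ℕ
    jump x = ((p ∸ g x) + kN x + g (nx x)) % p + (p + (r ∸ mN x))

    π-via-σ : ∀ x → π x ≡ iter σ (jump x) x
    π-via-σ x = trans (P₁T-≡ f σ m k x) (trans (sym (iter-+ τ ((p ∸ g x) + kN x) (g (nx x)) (nx x))) (trans (τ-iter ((p ∸ g x) + kN x + g (nx x)) (nx x))
      (trans (cong₂ (λ u w → iter σ ((u + ((p ∸ g x) + kN x + g (nx x))) % p) w) (m-nx x) (st-start (m-nx x)))
        (sym (trans (iter-+ σ (((p ∸ g x) + kN x + g (nx x)) % p) (p + (r ∸ mN x)) x) (cong (iter σ (((p ∸ g x) + kN x + g (nx x)) % p)) (iter-+ σ p (r ∸ mN x) x)))))))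

    σ-lt : ∀ x → suc (mN x) < p → σ x ≡ τ x
    σ-lt x lt = trans (cong σ (sym (σ-m x))) (cong (λ j → iter σ j (st x)) (sym (m<n⇒m%n≡m lt)))

    σ-end : ∀ x → ¬ suc (mN x) < p → σ x ≡ nx x
    σ-end x ¬lt = trans (cong σ (sym (σ-m x))) (cong (λ j → iter σ j (st x)) (ℕP.≤-antisym (mN<p x) (ℕP.≮⇒≥ ¬lt)))

    σ-via-π : ∀ x → ∃ λ a → σ x ≡ iter π a x
    σ-via-π x with suc (mN x) ℕ.<? p
    ... | yes lt = rp , trans (σ-lt x lt) (sym (π-rp x))
    ... | no ¬lt = c * rp + 1 , trans (σ-end x ¬lt) (trans (sym (st-π x)) (trans (sym (to-st (π x))) (trans (sym (π-τ c (π x))) (trans (sym (iter-* π c rp (π x))) (sym (iter-+ π (c * rp) 1 x))))))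
      where
      c : ℕ
      c = (p ∸ mN (π x)) % p

    memπ : Mem μ π
    memπ = mem-change mem (λ x → jump x , π-via-σ x) σ-via-π π-per π-free

    k-maj : ∀ x → majAt ρ (st x) % p ≡ kN x
    k-maj x = trans (majAt-row ρ σ (st x) (τ-start (m-st x))) (trans (row (st x) (m-st x)) (cong toℕ (k-st x)))

    nc-st⁻ : ∀ x → NC p (cs (st x)) → NC p (cs x)
    nc-st⁻ x nc = nc-τ⁻ ((p ∸ mN x) % p) (subst (λ z → NC p (cs z)) (sym (to-st x)) nc)

    k-const : ∀ x → ¬ NC p (cs x) → kN x ≡ 0
    k-const x ¬nc = trans (sym (k-maj x)) (trans (cong (_% p) (maj-const ρ-inj (λ nc → ¬nc (nc-st⁻ x nc)))) zero%)

    csA≡ : ∀ x j → cs x j ≡ csA π f x j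
    csA≡ x j = cong f (sym (π-τ j x))

    av : AVr π f
    av = memπ , ex
      where
      ex : ∀ x → ∃ λ i → i < rp × NC p (csA π f (iter π i x))
      ex x with any? (λ (i : Fin rp) → NC? (cs (iter π (toℕ i) x)))
      ... | yes (i , nc) = toℕ i , toℕ<n i , NC-cong (csA≡ (iter π (toℕ i) x)) nc
      -- If all columns were constant, all colours would be 0 and could not sum to 1.
      ... | no none = ⊥-elim (ℕP.1+n≢0 (sym (trans (sym zero%) (trans (cong (_% p) (sym (trans (∑<-cong rp λ i lt →
                k-const (iter π i x) (λ nc → none (fromℕ< lt , subst (λ j → NC p (cs (iter π j x))) (sym (toℕ-fromℕ< lt)) nc))) (trans (∑<-const rp 0) (ℕP.*-zeroʳ rp))))) (k-sum x)))))

    module A = ASide π f av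
    module S = A.Start ρ ρ-inj

    Aτ : ∀ j x → iter A.τ j x ≡ iter τ j x
    Aτ = π-τ

    A-maj : ∀ ρ x → A.majAt ρ x ≡ majAt ρ x
    A-maj ρ x = Majors′ ρ
      where
      Majors′ : ∀ ρ → A.majAt ρ x ≡ majAt ρ x
      Majors′ ρ = ∑<-cong p (λ j _ → cong (suc j *_) (cong₂ (λ a b → ind (Words.desc? ρ p a b)) (sym (csA≡ x j)) (sym (csA≡ x (suc j)))))

    πb : ∀ i x → (∀ j → j < i → ¬ NC p (cs (iter π j x))) → iter π i (b x) ≡ b (iter π i x)
    πb zero    x mn = refl
    πb (suc i) x mn = trans (cong π (πb i x (λ j lt → mn j (ℕP.<-trans lt (ℕP.n<1+n i))))) (trans (k-spec (iter π i x))
      (cong (λ z → iter τ z (b (iter π (suc i) x))) (k-const (iter π i x) (mn i (ℕP.n<1+n i)))))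

    -- Constant columns have colour 0, so the decoded map carries base point to base point up to the
    -- first nonconstant column, and there both definitions single out the same rotation.
    b≡ : ∀ x → A.b x ≡ b x
    b≡ x = trans (sym (A.b-char x i i< nc mn (g x) (trans (cong (_% p) (A-maj (λ y → y) _)) (trans (cong (λ z → majAt (λ y → y) z % p)
        (trans (sym (A.πτi i (g x) x)) (trans (cong (iter π i) (Aτ (g x) x)) (πb i x (λ j lt nc′ → mn j lt (NC-cong (csA≡ (iter π j x)) nc′))))))
        (b-nc (iter π i x) (NC-cong (λ j → sym (csA≡ (iter π i x) j)) nc)))))) (Aτ (g x) x)
      where
      i : ℕ
      i = firstA π f x
      i< = proj₁ (A.first-spec′ x)
      nc = proj₁ (proj₂ (A.first-spec′ x))
      mn = proj₂ (proj₂ (A.first-spec′ x))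

    k≡ : ∀ x → A.k x ≡ kN x
    k≡ x = sym (A.k-char x (kN x) (toℕ<n (k x)) (trans (cong π (b≡ x)) (trans (k-spec x) (trans (sym (Aτ (kN x) _)) (cong (iter A.τ (kN x)) (sym (b≡ (π x))))))))

    st≡ : ∀ x → S.st x ≡ st x
    st≡ x with NC? (cs x)
    ... | yes nc = trans (sym (S.st-char x (NC-cong (csA≡ x) nc) a (trans (cong (_% p) (A-maj ρ _)) (trans (cong (λ z → majAt ρ z % p) (trans (Aτ a x) (to-st x))) (trans (k-maj x) (sym (k≡ x))))))) (trans (Aτ a x) (to-st x))
      where
      a : ℕ
      a = (p ∸ mN x) % p
    ... | no ¬nc = trans (S.st-const x (λ nc → ¬nc (NC-cong (λ j → sym (csA≡ x j)) nc))) (trans (b≡ x) (b-const x ¬nc))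

    m≡ : ∀ x → S.m x ≡ mN x
    m≡ x = sym (S.m-char x (mN x) (mN<p x) (trans (cong (iter A.τ (mN x)) (st≡ x)) (trans (Aτ (mN x) (st x)) (trans (τ-start (m-st x) (mN x) (mN<p x)) (σ-m x)))))

    P₂P₁ : ∀ x → P₂A π f ρ x ≡ σ x × MA π f ρ x ≡ m x × KA π f x ≡ k x
    P₂P₁ x = σ≡ , toℕ-injective (trans (S.mF≡ x) (m≡ x)) , toℕ-injective (trans (S.kF≡ x) (k≡ x))
      where
      σ≡ : S.σ x ≡ σ x
      σ≡ with suc (mN x) ℕ.<? p
      ... | yes lt = trans (S.σ-lt x (subst (λ z → suc z < p) (sym (m≡ x)) lt)) (trans (π-rp x) (sym (σ-lt x lt)))
      ... | no ¬lt = trans (S.σ-end x (λ lt → ¬lt (subst (λ z → suc z < p) (m≡ x) lt))) (trans (st≡ (π x)) (trans (st-π x) (sym (σ-end x ¬lt))))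

  P₁P₂ : ∀ {ρ π f} → Inj ρ → AVr π f → ∀ x → P₁T f (P₂A π f ρ) (MA π f ρ) (KA π f) x ≡ π x
  P₁P₂ {ρ} {π} {f} ρ-inj av x = begin
    T.π x                                        ≡⟨ cong T.π (sym (T.back x)) ⟩
    T.π (iter T.τ c (T.b x))                     ≡⟨ T.π-char c x ⟩
    iter T.τ (c + T.kN x) (T.b (T.nx x))         ≡⟨ sym (τi (c + T.kN x) _) ⟩
    iter A.τ (c + T.kN x) (T.b (T.nx x))         ≡⟨ cong (iter A.τ (c + T.kN x)) (trans (b≡ (T.nx x)) (trans (cong A.b nx≡) (A.b-τa (S.h (π x)) (π x)))) ⟩
    iter A.τ (c + T.kN x) (A.b (π x))            ≡⟨ iter-+ A.τ c (T.kN x) _ ⟩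
    iter A.τ c (iter A.τ (T.kN x) (A.b (π x)))   ≡⟨ cong (λ z → iter A.τ c (iter A.τ z (A.b (π x)))) (S.kF≡ x) ⟩
    iter A.τ c (iter A.τ (A.k x) (A.b (π x)))    ≡⟨ cong (iter A.τ c) (sym (A.k-spec x)) ⟩
    iter A.τ c (π (A.b x))                       ≡⟨ sym (A.πτ c (A.b x)) ⟩
    π (iter A.τ c (A.b x))                       ≡⟨ cong π (trans (cong (iter A.τ c) (sym (b≡ x))) (trans (τi c (T.b x)) (T.back x))) ⟩
    π x                                          ∎
    where
    open ≡-Reasoning
    module A = ASide π f av
    module S = A.Start ρ ρ-inj
    module T = TSide ρ f S.σ S.mF S.kF ρ-inj S.fwd
    c : ℕ
    c = p ∸ T.g x
    st≡ : ∀ x → T.st x ≡ S.st x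
    st≡ x = trans (cong (λ z → iter S.σ (r ∸ z) x) (S.mF≡ x)) (S.st-back x)
    τ≡ : ∀ x → A.τ x ≡ T.τ x
    τ≡ x = sym (trans (cong₂ (λ u w → iter S.σ (suc u % p) w) (S.mF≡ x) (st≡ x)) (trans (S.σ-row (suc (S.m x) % p) x (m%n<n _ p))
      (trans (A.τ-≈ {suc (S.m x) % p} {suc (S.m x)} (S.st x) (≈-% (suc (S.m x)))) (cong A.τ (S.m-spec x)))))
    τi : ∀ j x → iter A.τ j x ≡ iter T.τ j x
    τi j x = iter-cong τ≡ j x
    nx≡ : T.nx x ≡ S.st (π x)
    nx≡ = trans (cong (iter S.σ p) (st≡ x)) (S.σ-p x)
    cs≡ : ∀ x j → A.cs x j ≡ T.cs x j
    cs≡ x j = cong f (τi j x)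
    b≡ : ∀ x → T.b x ≡ A.b x
    b≡ x with NC? (A.cs x)
    ... | yes nc = trans (sym (τi (T.g x) x)) (A.b-char x 0 0<rp nc (λ _ ()) (T.g x)
          (trans (cong (_% p) (∑<-cong p (λ j _ → cong (suc j *_) (cong₂ (λ a b → ind (Words.desc? {E} (λ y → y) p a b)) (maj≡ j) (maj≡ (suc j)))))) (T.b-nc x (NC-cong (cs≡ x) nc))))
      where
      maj≡ : ∀ j → A.cs (iter A.τ (T.g x) x) j ≡ T.cs (T.b x) j
      maj≡ j = trans (cong (λ z → A.cs z j) (τi (T.g x) x)) (cs≡ (T.b x) j)
    ... | no ¬nc = trans (T.b-const x (λ nc → ¬nc (NC-cong (λ j → sym (cs≡ x j)) nc))) (trans (st≡ x) (S.st-const x ¬nc))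

  module NatFwd {π π′ f : E → E} (av : AVr π f) (av′ : AVr π′ f) where
    _~_ : E → E → Set
    x ~ y = ∀ i → f (iter π i x) ≡ f (iter π′ i y)

    ~-iter : ∀ a {x y} → x ~ y → iter π a x ~ iter π′ a y
    ~-iter a {x} {y} s i = trans (cong f (sym (iter-+ π i a x))) (trans (s (i + a)) (cong f (iter-+ π′ i a y)))

    cs~ : ∀ {x y} → x ~ y → ∀ j → csA π f x j ≡ csA π′ f y j
    cs~ {x} {y} s j = trans (cong f (sym (iter-* π j rp x))) (trans (s (j * rp)) (cong f (iter-* π′ j rp y)))

    first~ : ∀ {x y} → x ~ y → firstA π f x ≡ firstA π′ f y
    first~ {x} {y} s = let a , b , c = firstA-spec π′ f y (proj₂ av′ y) in
      firstA-unique π f x (firstA π′ f y) a (NC-cong (λ j → sym (cs~ (~-iter (firstA π′ f y) s) j)) b)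
        (λ j lt nc → c j lt (NC-cong (cs~ (~-iter j s)) nc))

    g~ : ∀ {x y} → x ~ y → gA π f x ≡ gA π′ f y
    g~ {x} {y} s = trans (gA-≡ π f x) (trans (Majors.rot-cong (λ (y : E) → y) (λ e → e) p prime
      (λ j → trans (cong (λ i → csA π f (iter π i x) j) (first~ s)) (cs~ (~-iter (firstA π′ f y) s) j)) 0) (sym (gA-≡ π′ f y)))

    k~ : ∀ {x y} → x ~ y → kA π f x ≡ kA π′ f y
    k~ {x} {y} s = trans (kA-≡ π f x) (trans (cong₂ (λ a b → (a + (p ∸ b)) % p) (g~ s) (g~ (~-iter 1 s))) (sym (kA-≡ π′ f y)))

    module _ {ρ : E → E} where
      private
        rot-cong₀ : ∀ v {c c′ : ℕ → E} → (∀ j → c j ≡ c′ j) → Words.rot ρ p v c ≡ Words.rot ρ p v c′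
        rot-cong₀ v {c} {c′} eq = first-cong p _ _ (λ t e → trans (cong (_% p) (mc (λ j → sym (eq (j + t))))) e) (λ t e → trans (cong (_% p) (mc (λ j → eq (j + t)))) e)
          where
          mc : ∀ {c c′ : ℕ → E} → (∀ j → c j ≡ c′ j) → Words.maj ρ p c ≡ Words.maj ρ p c′
          mc eq = ∑<-cong p (λ j _ → cong (suc j *_) (cong₂ (λ a b → ind (Words.desc? ρ p a b)) (eq j) (eq (suc j))))

      h~ : ∀ {x y} → x ~ y → hA π f ρ x ≡ hA π′ f ρ y
      h~ {x} {y} s with NC? (csA π f x)
      ... | yes nc = trans (hA-yes π f ρ x nc) (trans (cong (λ v → Words.rot ρ p v (csA π f x)) (k~ s)) (trans (rot-cong₀ _ (cs~ s)) (sym (hA-yes π′ f ρ y (NC-cong (cs~ s) nc)))))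
      ... | no ¬nc = trans (hA-no π f ρ x ¬nc) (trans (g~ s) (sym (hA-no π′ f ρ y (λ nc → ¬nc (NC-cong (λ j → sym (cs~ s j)) nc)))))

      m~ : ∀ {x y} → x ~ y → mA π f ρ x ≡ mA π′ f ρ y
      m~ {x} {y} s = trans (mA-≡ π f ρ x) (trans (cong (λ z → (p ∸ z) % p) (h~ s)) (sym (mA-≡ π′ f ρ y)))

      nat : ∀ x y → x ~ y → KA π f x ≡ KA π′ f y × MA π f ρ x ≡ MA π′ f ρ y × ∃ λ a → P₂A π f ρ x ≡ iter π a x × P₂A π′ f ρ y ≡ iter π′ a y
      nat x y s = toℕ-injective (trans (KA-≡ π f x) (trans (k~ s) (sym (KA-≡ π′ f y))))
                , toℕ-injective (trans (MA-≡ π f ρ x) (trans (m~ s) (sym (MA-≡ π′ f ρ y)))) , exps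
        where
        exps : ∃ λ a → P₂A π f ρ x ≡ iter π a x × P₂A π′ f ρ y ≡ iter π′ a y
        exps with suc (mA π f ρ x) ℕ.<? p
        ... | yes lt = rp , P₂A-lt π f ρ x lt , P₂A-lt π′ f ρ y (subst (λ z → suc z < p) (m~ s) lt)
        ... | no ¬lt = hA π f ρ (π x) * rp + 1 , trans (P₂A-end π f ρ x ¬lt) (trans (sym (iter-* π (hA π f ρ (π x)) rp (π x))) (sym (iter-+ π (hA π f ρ (π x) * rp) 1 x)))
            , trans (P₂A-end π′ f ρ y (λ lt → ¬lt (subst (λ z → suc z < p) (sym (m~ s)) lt)))
                (trans (sym (iter-* π′ (hA π′ f ρ (π′ y)) rp (π′ y))) (trans (sym (iter-+ π′ (hA π′ f ρ (π′ y) * rp) 1 y)) (cong (λ z → iter π′ (z * rp + 1) y) (sym (h~ (~-iter 1 s))))))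

  -- The coding when p² divides r

  module RectCoding (p∣rp : p ∣ rp) where

    suc-l : suc (pred r) ≡ r
    suc-l = ℕP.suc-pred r

    per : ∀ {π : E → E} → Mem μ π → ∀ x → iter π (suc (pred r)) x ≡ x
    per {π} mem x = subst (λ k → iter π k x ≡ x) (sym suc-l) (mem-per mem x)

    -- If all columns met by a cycle were constant, a point and its image under `π ^ rp` would have
    -- the same itinerary, although `rp < r`.
    prim⇒AV : ∀ {π f : E → E} → Mem μ π → Prim π f → AVr π f
    prim⇒AV {π} {f} mem prim = mem , λ x → ex x
      where
      open TauA π f mem
      ex : ∀ x → ∃ λ i → i < rp × NC p (csA π f (iter π i x))
      ex x with any? (λ (i : Fin rp) → NC? (cs (iter π (toℕ i) x)))
      ... | yes (i , nc) = toℕ i , toℕ<n i , nc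
      ... | no none = ⊥-elim (>⇒∤ (subst (rp <_) (ℕP.*-comm rp p) (ℕP.m<m*n rp p 1<p)) (mem-free mem x rp (prim x rp same)))
        where
        split : ∀ i → iter π i x ≡ iter τ (i / rp) (iter π (i % rp) x)
        split i = trans (cong (λ k → iter π k x) (m≡m%n+[m/n]*n i rp)) (trans (cong (λ k → iter π k x) (ℕP.+-comm (i % rp) (i / rp * rp)))
          (trans (iter-+ π (i / rp * rp) (i % rp) x) (sym (τ-iter (i / rp) (iter π (i % rp) x)))))
        con : ∀ i j → f (iter τ j (iter π (i % rp) x)) ≡ f (iter π (i % rp) x)
        con i j = const (λ nc → none (fromℕ< (m%n<n i rp) , subst (λ k → NC p (cs (iter π k x))) (sym (toℕ-fromℕ< (m%n<n i rp))) nc)) j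
        same : ∀ i → f (iter π i x) ≡ f (iter π i (iter π rp x))
        same i = trans (cong f (split i)) (trans (con i (i / rp)) (trans (sym (con i (suc (i / rp))))
          (cong f (trans (cong τ (sym (split i))) (iter-comm π rp i x)))))

    -- This is where p² ∣ r enters: a constant colour would be summed `rp` times, giving a multiple
    -- of p instead of 1.
    nonconst : ∀ {ρ f σ : E → E} {m k : E → Fin p} → TVr ρ f σ m k → ∃₂ λ x y → k x ≢ k y
    nonconst {ρ} {f} {σ} {m} {k} tv with all? (λ y → k y FinP.≟ k x₀)
      where
      x₀ : E
      x₀ = iter σ (r ∸ toℕ (m zero)) zero
    ... | no ¬all = let y , ne = FinP.¬∀⟶∃¬ (suc N) _ (λ y → k y FinP.≟ k (iter σ (r ∸ toℕ (m zero)) zero)) ¬all in y , iter σ (r ∸ toℕ (m zero)) zero , ne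
    ... | yes all = ⊥-elim (ℕP.1+n≢0 (sym (trans (sym (n∣m⇒m%n≡0 (rp * toℕ (k x₀)) p (∣m⇒∣m*n (toℕ (k x₀)) p∣rp)))
            (trans (cong (_% p) (sym (trans (∑<-cong rp (λ i _ → cong toℕ (all (iter σ (i * p) x₀)))) (∑<-const rp (toℕ (k x₀)))))) (tot x₀ m0)))))
      where
      open TVr tv
      x₀ : E
      x₀ = iter σ (r ∸ toℕ (m zero)) zero
      m-iter : ∀ j x → toℕ (m (iter σ j x)) ≡ (toℕ (m x) + j) % p
      m-iter zero    x = sym (trans (cong (_% p) (ℕP.+-identityʳ (toℕ (m x)))) (m<n⇒m%n≡m (toℕ<n (m x))))
      m-iter (suc j) x = trans (m-σ (iter σ j x)) (trans (cong (λ z → suc z % p) (m-iter j x))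
        (trans (≈-+ {1} {1} refl (≈-% (toℕ (m x) + j))) (cong (_% p) (sym (ℕP.+-suc (toℕ (m x)) j)))))
      m0 : toℕ (m x₀) ≡ 0
      m0 = trans (m-iter (r ∸ toℕ (m zero)) zero) (trans (cong (_% p) (ℕP.m+[n∸m]≡n (ℕP.≤-trans (ℕP.<⇒≤ (toℕ<n (m zero))) p≤r))) (trans (cong (_% p) (ℕP.*-comm p rp)) (m*n%n≡0 rp p)))

    iso : ∀ {ρ f σ : E → E} {m k : E → Fin p} {f′ σ′ : E → E} {m′ k′ : E → Fin p} (φ : E → E) → Inj φ → (∀ x → φ (σ x) ≡ σ′ (φ x)) →
        (∀ x → m′ (φ x) ≡ m x) → (∀ x → k′ (φ x) ≡ k x) → (∀ x → f′ (φ x) ≡ f x) → TVr ρ f σ m k → TVr ρ f′ σ′ m′ k′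
    iso {ρ} {f} {σ} {m} {k} {f′} {σ′} {m′} {k′} φ φ-inj cσ cm ck cf tv = record
      { mem = Mem-iso φ φ-inj cσ mem
      ; m-σ = λ x → at (λ x → toℕ (m′ (σ′ x)) ≡ suc (toℕ (m′ x)) % p) x λ x →
          trans (cong (toℕ ∘ m′) (sym (cσ x))) (trans (cong toℕ (cm (σ x))) (trans (m-σ x) (cong (λ z → suc (toℕ z) % p) (sym (cm x)))))
      ; k-σ = λ x → at (λ x → suc (toℕ (m′ x)) < p → k′ (σ′ x) ≡ k′ x) x λ x lt →
          trans (cong k′ (sym (cσ x))) (trans (ck (σ x)) (trans (k-σ x (subst (λ z → suc (toℕ z) < p) (cm x) lt)) (sym (ck x))))
      ; row = λ x → at (λ x → toℕ (m′ x) ≡ 0 → rowMaj ρ f′ σ′ x % p ≡ toℕ (k′ x)) x λ x m0 →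
          trans (cong (_% p) (∑<-cong (pred p) λ j _ → cong (suc j *_) (cong₂ (λ a b → ind (Words.desc? ρ p a b)) (letters j x) (letters (suc j) x))))
            (trans (row x (trans (cong toℕ (sym (cm x))) m0)) (cong toℕ (sym (ck x))))
      ; tot = λ x → at (λ x → toℕ (m′ x) ≡ 0 → ∑< rp (λ i → toℕ (k′ (iter σ′ (i * p) x))) % p ≡ 1) x λ x m0 →
          trans (cong (_% p) (∑<-cong rp λ i _ → cong toℕ (trans (cong k′ (sym (iter-conj φ cσ (i * p) x))) (ck (iter σ (i * p) x))))) (tot x (trans (cong toℕ (sym (cm x))) m0))
      }
      where
      open TVr tv
      open Inverse φ-inj
      at : (P : E → Set) → ∀ x → (∀ x → P (φ x)) → P x
      at P x h = subst P (rinv x) (h (inv x))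
      letters : ∀ j x → f′ (iter σ′ j (φ x)) ≡ f (iter σ j x)
      letters j x = trans (cong f′ (sym (iter-conj φ cσ j x))) (cf (iter σ j x))

    -- Ties inside a row are broken from left to right, so they do not affect its major index.
    rows : ∀ {ρ f σ : E → E} {m k : E → Fin p} → Inj ρ → (∀ {x y} → ρ (f x) Fin.< ρ (f y) → ρ x Fin.< ρ y) →
        (∀ {x y} → f x ≡ f y → km k m x < km k m y → ρ x Fin.< ρ y) →
        (∀ x → toℕ (m (σ x)) ≡ suc (toℕ (m x)) % p) → (∀ x → suc (toℕ (m x)) < p → k (σ x) ≡ k x) →
        ∀ x → toℕ (m x) ≡ 0 → rowMaj ρ id σ x ≡ rowMaj ρ f σ x
    rows {ρ} {f} {σ} {m} {k} ρ-inj coarse fine m-σ k-σ x m0 = ∑<-cong (pred p) λ j lt → cong (suc j *_) (ind-cong _ _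
        (λ l → case-f j lt l) coarse)
      where
      m-row : ∀ j → j < p → toℕ (m (iter σ j x)) ≡ j
      m-row zero    lt = m0
      m-row (suc j) lt = trans (m-σ (iter σ j x)) (trans (cong (λ z → suc z % p) (m-row j (ℕP.<⇒≤ lt))) (m<n⇒m%n≡m lt))
      case-f : ∀ j → j < pred p → ρ (iter σ (suc j) x) Fin.< ρ (iter σ j x) → ρ (f (iter σ (suc j) x)) Fin.< ρ (f (iter σ j x))
      case-f j lt l with ℕP.<-cmp (toℕ (ρ (f (iter σ (suc j) x)))) (toℕ (ρ (f (iter σ j x))))
      ... | tri< q _ _ = q
      ... | tri> _ _ q = ⊥-elim (ℕP.<-asym l (coarse q))
      ... | tri≈ _ q _ = ⊥-elim (ℕP.<-asym l (fine (sym (ρ-inj (toℕ-injective q))) km<))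
        where
        lt′ : suc j < p
        lt′ = subst (suc j <_) (ℕP.suc-pred p) (s≤s lt)
        km< : km k m (iter σ j x) < km k m (iter σ (suc j) x)
        km< = subst (λ z → km k m (iter σ j x) < toℕ z * p + toℕ (m (iter σ (suc j) x))) (sym (k-σ (iter σ j x) (subst (λ z → suc z < p) (sym (m-row j (ℕP.<⇒≤ lt′))) lt′)))
          (ℕP.+-monoʳ-< (toℕ (k (iter σ j x)) * p) (subst₂ _<_ (sym (m-row j (ℕP.<⇒≤ lt′))) (sym (m-row (suc j) lt′)) (ℕP.n<1+n j)))

    TV? : ∀ ρ (σ : Vec E (suc N)) (m k : Vec (Fin p) (suc N)) → Dec (TVr ρ id (lookup σ) (lookup m) (lookup k))
    TV? ρ σ m k = map′ (λ (a , b , c , d , e) → record { mem = a ; m-σ = b ; k-σ = c ; row = d ; tot = e })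
      (λ t → TVr.mem t , TVr.m-σ t , TVr.k-σ t , TVr.row t , TVr.tot t)
      (Mem? μ σ ×-dec (all? (λ x → _ ℕ.≟ _) ×-dec (all? (λ x → (_ ℕ.<? _) →-dec (_ FinP.≟ _)) ×-dec
        (all? (λ x → (_ ℕ.≟ _) →-dec (_ ℕ.≟ _)) ×-dec all? (λ x → (_ ℕ.≟ _) →-dec (_ ℕ.≟ _))))))

    module NatBwd {ρ ρ′ f σ σ′ : E → E} {m k m′ k′ : E → Fin p} (ρ-inj : Inj ρ) (ρ′-inj : Inj ρ′) (tv : TVr ρ f σ m k) (tv′ : TVr ρ′ f σ′ m′ k′) where
      module T = TSide ρ f σ m k ρ-inj tv
      module T′ = TSide ρ′ f σ′ m′ k′ ρ′-inj tv′

      _~_ : E → E → Set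
      x ~ y = ∀ i → f (iter σ i x) ≡ f (iter σ′ i y) × k (iter σ i x) ≡ k′ (iter σ′ i y) × m (iter σ i x) ≡ m′ (iter σ′ i y)

      ~-iter : ∀ a {x y} → x ~ y → iter σ a x ~ iter σ′ a y
      ~-iter a {x} {y} s i = subst₂ (λ u w → f u ≡ f w × k u ≡ k′ w × m u ≡ m′ w) (iter-+ σ i a x) (iter-+ σ′ i a y) (s (i + a))

      m~ : ∀ {x y} → x ~ y → T.mN x ≡ T′.mN y
      m~ s = cong toℕ (proj₂ (proj₂ (s 0)))

      cs~ : ∀ {x y} → x ~ y → ∀ j → T.cs x j ≡ T′.cs y j
      cs~ {x} {y} s j = trans (cong f (trans (T.τ-iter j x) (sym (iter-+ σ ((T.mN x + j) % p) (r ∸ T.mN x) x))))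
        (trans (proj₁ (s ((T.mN x + j) % p + (r ∸ T.mN x)))) (trans (cong (λ z → f (iter σ′ ((z + j) % p + (r ∸ z)) y)) (m~ s))
          (cong f (sym (trans (T′.τ-iter j y) (sym (iter-+ σ′ ((T′.mN y + j) % p) (r ∸ T′.mN y) y)))))))

      g~ : ∀ {x y} → x ~ y → T.g x ≡ T′.g y
      g~ {x} {y} s with NC? (T.cs x)
      ... | yes nc = trans (gT-yes f σ m k x nc) (trans (Majors.rot-cong (λ (y : E) → y) (λ e → e) p prime (cs~ s) 0) (sym (gT-yes f σ′ m′ k′ y (NC-cong (cs~ s) nc))))
      ... | no ¬nc = trans (gT-no f σ m k x ¬nc) (trans (cong (λ z → (p ∸ z) % p) (m~ s)) (sym (gT-no f σ′ m′ k′ y (λ nc → ¬nc (NC-cong (λ j → sym (cs~ s j)) nc)))))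

      nx~ : ∀ {x y} → x ~ y → T.nx x ~ T′.nx y
      nx~ {x} {y} s = subst (λ z → T.nx x ~ iter σ′ p (iter σ′ (r ∸ z) y)) (m~ s) (~-iter p (~-iter (r ∸ T.mN x) s))

      nat : ∀ x y → x ~ y → ∃ λ a → P₁T f σ m k x ≡ iter σ a x × P₁T f σ′ m′ k′ y ≡ iter σ′ a y
      nat x y s = T.jump x , T.π-via-σ x , trans (T′.π-via-σ y) (cong (λ j → iter σ′ j y) (sym jump≡))
        where
        jump≡ : T.jump x ≡ T′.jump y
        jump≡ = cong₂ (λ u w → u % p + (p + (r ∸ w))) (cong₂ _+_ (cong₂ (λ a b → (p ∸ a) + toℕ b) (g~ s) (proj₁ (proj₂ (s 0)))) (g~ (nx~ s))) (m~ s)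

    coding : Coding N
    coding = record
      { l = pred r
      ; B = p
      ; 𝒞 = Mem μ
      ; 𝒞? = Mem? μ
      ; 𝒞-period = per
      ; 𝒞-iso = Mem-iso
      ; AV = AVr
      ; AV-𝒞 = proj₁
      ; prim⇒AV = λ {π} {f} → prim⇒AV {π} {f}
      ; TV = TVr
      ; TV? = TV?
      ; TV-iso = iso
      ; TV-coarsen = λ {ρ} {f} {σ} {m} {k} ρ-inj coarse fine tv → let open TVr tv in record
          { mem = mem ; m-σ = m-σ ; k-σ = k-σ ; tot = tot
          ; row = λ x m0 → trans (cong (_% p) (sym (rows {k = k} ρ-inj coarse fine m-σ k-σ x m0))) (row x m0) }
      ; TV-refine = λ {ρ} {f} {σ} {m} {k} ρ-inj coarse fine tv → let open TVr tv in record
          { mem = mem ; m-σ = m-σ ; k-σ = k-σ ; tot = tot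
          ; row = λ x m0 → trans (cong (_% p) (rows {k = k} ρ-inj coarse fine m-σ k-σ x m0)) (row x m0) }
      ; TV-inj = λ tv → proj₁ (TVr.mem tv)
      ; TV-period = λ tv → per (TVr.mem tv)
      ; TV-nonconst = nonconst
      ; K = KA
      ; M = λ ρ π f → MA π f ρ
      ; P₂ = λ ρ π f → P₂A π f ρ
      ; P₁ = P₁T
      ; fwd = λ {ρ} {π} {f} ρ-inj av → ASide.Start.fwd π f av ρ ρ-inj
      ; bwd = λ {ρ} {f} {σ} {m} {k} ρ-inj tv _ → TSide.av ρ f σ m k ρ-inj tv
      ; P₁P₂ = P₁P₂
      ; P₂P₁ = λ {ρ} {f} {σ} {m} {k} ρ-inj tv _ → TSide.P₂P₁ ρ f σ m k ρ-inj tv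
      ; nat-fwd = λ {ρ} av av′ → NatFwd.nat av av′ {ρ}
      ; nat-bwd = λ ρ-inj tv tv′ → NatBwd.nat ρ-inj ρ-inj tv tv′
      }

    extension : HasCyclicExtension (suc N) μ
    extension = Generic.Assemble.hasCyclicExtension coding μ (Mem⇒member μ) (member⇒Mem μ)

-- Compatible words and commuting pairs

-- For `φ = id` these are the weakly increasing words that increase strictly at the descents of `π`;
-- a general `φ` gives the same condition for the conjugate of `π` by `φ`.
Comp : ∀ {N Q} (φ π : Fin (suc N) → Fin (suc N)) (f : Fin (suc N) → Fin Q) → Set
Comp φ π f = ∀ x y → φ x Fin.< φ y → f x Fin.< f y ⊎ (f x ≡ f y × φ (π x) Fin.< φ (π y))

PrimF : ∀ {N Q} (π : Fin (suc N) → Fin (suc N)) (f : Fin (suc N) → Fin Q) → Set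
PrimF π f = ∀ x j → (∀ i → f (iter π i x) ≡ f (iter π i (iter π j x))) → iter π j x ≡ x

module GR {N : ℕ} (Q l : ℕ) where
  E : Set
  E = Fin (suc N)

  module One (π : E → E) (inj : Inj π) (per : ∀ x → iter π (suc l) x ≡ x) where
    module C = CyclesOf π inj

    minπ : ∀ x → C.C.minOf (π x) ≡ C.C.minOf x
    minπ x = sym (C.C.minOf-cong (1 , lookup∘tabulate π x))

    -- Points with equal itineraries on different cycles are ordered by cycle, which `π` respects;
    -- on one cycle such ties are excluded by primitivity.
    tieKey : E → ℕ
    tieKey x = toℕ (C.C.minOf x) * suc N + toℕ x

    tieKey-inj : Inj tieKey
    tieKey-inj {x} {y} eq = toℕ-injective (proj₂ (digit-≡ {toℕ (C.C.minOf x)} {toℕ (C.C.minOf y)} (toℕ<n x) (toℕ<n y) eq))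

    module R₀ = Rank tieKey tieKey-inj
    ρ₀ : E → E
    ρ₀ = R₀.rank

    module RL (f : E → Fin Q) = Relabelling ρ₀ R₀.rank-inj l Q π (toℕ ∘ f)

    -- A canonical compatible order for a primitive word, sorting the points by itinerary; other
    -- compatible orders are compared with it.
    φ₀ : (E → Fin Q) → E → E
    φ₀ f x = ρ₀ (RL.φ f x)

    φ₀-inj : ∀ f → Inj (φ₀ f)
    φ₀-inj f eq = RL.φ-inj f (R₀.rank-inj eq)

    same⇒F : ∀ f {x y} → RL.Same f x y → ∀ i → f (iter π i x) ≡ f (iter π i y)
    same⇒F f s i = toℕ-injective (s i)

    tie : ∀ f → PrimF π f → ∀ {x y} → RL.Same f x y → ρ₀ x Fin.< ρ₀ y → ρ₀ (π x) Fin.< ρ₀ (π y)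
    tie f prim {x} {y} s lt with ℕP.<-cmp (toℕ (C.C.minOf x)) (toℕ (C.C.minOf y))
    ... | tri< l< _ _ = R₀.rank-mono (digit-< (toℕ<n (π x)) (subst₂ (λ a b → toℕ a < toℕ b) (sym (minπ x)) (sym (minπ y)) l<))
    ... | tri> _ _ g = ⊥-elim (ℕP.<-asym lt (R₀.rank-mono (digit-< (toℕ<n y) g)))
    ... | tri≈ _ e _ = ⊥-elim (same-cycle (C.C.orb-trans (C.C.minOf-orb x) (subst (λ z → C.C.Orb z y) (sym (toℕ-injective e)) (C.C.orb-sym (C.C.minOf-orb y)))))
      where
      same-cycle : C.C.Orb x y → ⊥
      same-cycle (j , eq) = ℕP.<-irrefl (cong (λ z → toℕ (ρ₀ z)) (sym y≡x)) lt
        where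
        y≡ : iter π j x ≡ y
        y≡ = trans (sym (C.it j x)) eq
        y≡x : y ≡ x
        y≡x = trans (sym y≡) (prim x j (λ i → trans (same⇒F f s i) (cong (λ z → f (iter π i z)) (sym y≡))))

    φ₀-comp : ∀ f → PrimF π f → Comp (φ₀ f) π f
    φ₀-comp f prim x y lt with ℕP.<-cmp (toℕ (f x)) (toℕ (f y))
    ... | tri< l< _ _ = inj₁ l<
    ... | tri≈ _ e _ = inj₂ (toℕ-injective e , RL.Bounded.Periodic.φ-compat f (λ x → toℕ<n (f x)) per (tie f prim) e lt)
    ... | tri> _ _ g = ⊥-elim (ℕP.<-asym lt (RL.Bounded.φ-colour f (λ x → toℕ<n (f x)) g))

    module _ {φ : E → E} (φ-inj : Inj φ) {f : E → Fin Q} (comp : Comp φ π f) where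
      private module RΦ = Relabelling φ φ-inj l Q π (toℕ ∘ f)

      mono : ∀ {x y} → f x ≡ f y → φ x Fin.< φ y → φ (π x) Fin.< φ (π y)
      mono {x} {y} e lt with comp x y lt
      ... | inj₁ l< = ⊥-elim (ℕP.<-irrefl (cong toℕ e) l<)
      ... | inj₂ (_ , l<) = l<

      sorted : ∀ {x y} → φ x Fin.< φ y → toℕ (f x) ≤ toℕ (f y)
      sorted {x} {y} lt with comp x y lt
      ... | inj₁ l< = ℕP.<⇒≤ l<
      ... | inj₂ (e , _) = ℕP.≤-reflexive (cong toℕ e)

      comp⇒prim : PrimF π f
      comp⇒prim x j s = Ties.aperiodic φ φ-inj π l per RΦ.Same RΦ.Same-sym (RΦ.Same-iter 1) (λ s → mono (toℕ-injective (s 0))) j x (λ i → cong toℕ (s i))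

      key-same : ∀ l x → RΦ.Key l x ≡ RL.Key f l x
      key-same zero    x = refl
      key-same (suc l) x = cong (toℕ (f x) * Q ℕ.^ l +_) (key-same l (π x))

      key-mono : ∀ {x y} → φ x Fin.< φ y → RL.Key f (suc l) x ≤ RL.Key f (suc l) y
      key-mono {x} {y} lt = subst₂ _≤_ (key-same (suc l) x) (key-same (suc l) y) (RΦ.key-mono sorted (mono ∘ toℕ-injective) (λ x → toℕ<n (f x)) (suc l) lt)

    π⁻ : E → E
    π⁻ = iter π l

    ππ⁻ : ∀ x → π (π⁻ x) ≡ x
    ππ⁻ = per

    π⁻π : ∀ x → π⁻ (π x) ≡ x
    π⁻π x = trans (sym (iter-suc π l x)) (per x)

    -- Two compatible orders of one structure differ by an automorphism.
    module Two {φ ψ : E → E} (φ-inj : Inj φ) (ψ-inj : Inj ψ) {f : E → Fin Q} (cφ : Comp φ π f) (cψ : Comp ψ π f) where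
      open Inverse ψ-inj using () renaming (inv to ψ⁻; rinv to ψψ⁻; inv-inj to ψ⁻-inj)
      open Inverse φ-inj using () renaming (inv to φ⁻; rinv to φφ⁻; linv to φ⁻φ; inv-inj to φ⁻-inj)
      open RL f using (Key; Same; Same-iter; Same⇒Key; Same-sym)
      open RL.Bounded.Periodic f (λ x → toℕ<n (f x)) per using (Key⇒Same)

      g : E → E
      g x = ψ⁻ (φ x)

      ψg : ∀ x → ψ (g x) ≡ φ x
      ψg x = ψψ⁻ (φ x)

      g-inj : Inj g
      g-inj eq = φ-inj (ψ⁻-inj eq)

      K : E → ℕ
      K = Key (suc l)

      -- Along the order `φ`, the itineraries of `x` and of `g x` are two sorted arrangements of one
      -- multiset, so they agree place by place.
      Kg : ∀ x → K (g x) ≡ K x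
      Kg x = sym (SortedUnique.sorted-unique φ-inj {u = K} {v = λ x → K (g x)} (key-mono φ-inj cφ)
        (λ {a} {b} lt → key-mono ψ-inj cψ (subst₂ Fin._<_ (sym (ψg a)) (sym (ψg b)) lt)) {θ = Inverse.inv g-inj} (Inverse.inv-inj g-inj) (λ x → cong K (Inverse.rinv g-inj x)) x)

      g-same : ∀ x → Same (g x) x
      g-same x = Key⇒Same (Kg x)

      -- The conjugate of `g` by `π`. It too carries the order `φ` to the order `ψ`, and only one
      -- map does so; hence it equals `g`, i.e. `g` commutes with `π`.
      ĝ : E → E
      ĝ x = π⁻ (g (π x))

      ĝ-same : ∀ x → Same (ĝ x) x
      ĝ-same x = subst (Same (ĝ x)) (π⁻π x) (Same-iter l (g-same (π x)))

      same-trans : ∀ {x y z} → Same x y → Same y z → Same x z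
      same-trans p q i = trans (p i) (q i)

      ĝ-mono : ∀ {x y} → φ x Fin.< φ y → ψ (ĝ x) Fin.< ψ (ĝ y)
      ĝ-mono {x} {y} lt with ℕP.<-cmp (toℕ (ψ (ĝ x))) (toℕ (ψ (ĝ y)))
      ... | tri< l< _ _ = l<
      ... | tri≈ _ e _ = ⊥-elim (ℕP.<-irrefl (cong (toℕ ∘ φ) (inj (g-inj (iter-inj inj l (ψ-inj (toℕ-injective e)))))) lt)
      ... | tri> _ _ gt with ℕP.m≤n⇒m<n∨m≡n (key-mono φ-inj cφ lt)
      ...   | inj₁ K< = ⊥-elim (ℕP.<⇒≱ (subst₂ _<_ (sym (Same⇒Key (suc l) (ĝ-same x))) (sym (Same⇒Key (suc l) (ĝ-same y))) K<) (key-mono ψ-inj cψ gt))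
      ...   | inj₂ K≡ = ⊥-elim (ℕP.<-asym (subst₂ Fin._<_ (sym (ψg (π x))) (sym (ψg (π y))) (mono φ-inj cφ (toℕ-injective (s 0)) lt))
                 (subst₂ (λ a b → ψ a Fin.< ψ b) (ππ⁻ (g (π y))) (ππ⁻ (g (π x))) (mono ψ-inj cψ (toℕ-injective (same-trans (ĝ-same y) (same-trans (Same-sym s) (Same-sym (ĝ-same x))) 0)) gt)))
        where
        s : Same x y
        s = Key⇒Same K≡

      ψĝ : ∀ x → ψ (ĝ x) ≡ φ x
      ψĝ x = trans (cong (ψ ∘ ĝ) (sym (φ⁻φ x))) (SortedUnique.monotone⇒id {ρ = λ i → i} (λ e → e) {θ = λ i → ψ (ĝ (φ⁻ i))}
        (λ e → φ⁻-inj (inj (g-inj (iter-inj inj l (ψ-inj e))))) (λ {i} {j} lt → ĝ-mono (subst₂ Fin._<_ (sym (φφ⁻ i)) (sym (φφ⁻ j)) lt)) (φ x))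

      g-comm : ∀ x → g (π x) ≡ π (g x)
      g-comm x = trans (sym (ππ⁻ (g (π x)))) (cong π (ψ-inj (trans (ψĝ x) (sym (ψg x)))))

      g-f : ∀ x → f (g x) ≡ f x
      g-f x = toℕ-injective (g-same x 0)

    Left : Vec E (suc N) × Vec (Fin Q) (suc N) → Set
    Left (φ , f₀) = Inj (lookup φ) × Comp (lookup φ) π (lookup f₀ ∘ lookup φ)

    Right : Vec (Fin Q) (suc N) × Vec E (suc N) → Set
    Right (f , g) = Inj (lookup g) × (∀ x → lookup g (π x) ≡ π (lookup g x)) × (∀ x → lookup f (lookup g x) ≡ lookup f x) × PrimF π (lookup f)

    private
      φ₀⁻ : (E → Fin Q) → E → E
      φ₀⁻ f = Inverse.inv (φ₀-inj f)

    -- A compatible order amounts to the word it carries together with the automorphism that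
    -- compares it with the canonical order of that word.
    toR : Vec E (suc N) × Vec (Fin Q) (suc N) → Vec (Fin Q) (suc N) × Vec E (suc N)
    toR (φ , f₀) = tabulate (lookup f₀ ∘ lookup φ) , tabulate (φ₀⁻ (lookup (tabulate (lookup f₀ ∘ lookup φ))) ∘ lookup φ)

    toL : Vec (Fin Q) (suc N) × Vec E (suc N) → Vec E (suc N) × Vec (Fin Q) (suc N)
    toL (f , g) = tabulate (φ₀ (lookup f) ∘ lookup g) , tabulate (lookup f ∘ φ₀⁻ (lookup f))

    Comp-ext : ∀ {φ φ′ : E → E} {f f′ : E → Fin Q} → (∀ x → φ x ≡ φ′ x) → (∀ x → f x ≡ f′ x) → Comp φ π f → Comp φ′ π f′
    Comp-ext eφ ef c x y lt with c x y (subst₂ Fin._<_ (sym (eφ x)) (sym (eφ y)) lt)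
    ... | inj₁ l< = inj₁ (subst₂ Fin._<_ (ef x) (ef y) l<)
    ... | inj₂ (e , l<) = inj₂ (trans (sym (ef x)) (trans e (ef y)) , subst₂ Fin._<_ (eφ (π x)) (eφ (π y)) l<)

    module L→R (φ : Vec E (suc N)) (f₀ : Vec (Fin Q) (suc N)) (left : Left (φ , f₀)) where
      f : E → Fin Q
      f = lookup (tabulate (lookup f₀ ∘ lookup φ))
      f≡ : ∀ x → f x ≡ lookup f₀ (lookup φ x)
      f≡ = lookup∘tabulate (lookup f₀ ∘ lookup φ)
      cφ : Comp (lookup φ) π f
      cφ = Comp-ext (λ _ → refl) (λ x → sym (f≡ x)) (proj₂ left)
      prim : PrimF π f
      prim = comp⇒prim (proj₁ left) cφ
      open Two (proj₁ left) (φ₀-inj f) cφ (φ₀-comp f prim) public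
      g′ : E → E
      g′ = lookup (proj₂ (toR (φ , f₀)))
      g≡ : ∀ x → g′ x ≡ g x
      g≡ = lookup∘tabulate g
      right : Right (toR (φ , f₀))
      right = (λ {x} {y} e → g-inj (trans (sym (g≡ x)) (trans e (g≡ y))))
            , (λ x → trans (g≡ (π x)) (trans (g-comm x) (cong π (sym (g≡ x)))))
            , (λ x → trans (cong f (g≡ x)) (g-f x)) , prim

      back : toL (toR (φ , f₀)) ≡ (φ , f₀)
      back = cong₂ _,_ (trans (tabulate-cong (λ x → trans (cong (φ₀ f) (g≡ x)) (ψg x))) (tabulate∘lookup φ))
        (trans (tabulate-cong e₀) (tabulate∘lookup f₀))
        where
        open Inverse (proj₁ left)
        e₀ : ∀ i → f (φ₀⁻ f i) ≡ lookup f₀ i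
        e₀ i = trans (cong (f ∘ φ₀⁻ f) (sym (rinv i))) (trans (g-f (inv i)) (trans (f≡ (inv i)) (cong (lookup f₀) (rinv i))))

    module R→L (f : Vec (Fin Q) (suc N)) (g : Vec E (suc N)) (right : Right (f , g)) where
      private
        F : E → Fin Q
        F = lookup f
        G : E → E
        G = lookup g
      φ′ : E → E
      φ′ = lookup (proj₁ (toL (f , g)))
      φ≡ : ∀ x → φ′ x ≡ φ₀ F (G x)
      φ≡ = lookup∘tabulate (φ₀ F ∘ G)
      f₀≡ : ∀ x → lookup (proj₂ (toL (f , g))) (φ′ x) ≡ F x
      f₀≡ x = trans (lookup∘tabulate (F ∘ φ₀⁻ F) (φ′ x)) (trans (cong F (trans (cong (φ₀⁻ F) (φ≡ x)) (Inverse.linv (φ₀-inj F) (G x)))) (proj₁ (proj₂ (proj₂ right)) x))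
      c₀ : Comp (φ₀ F) π F
      c₀ = φ₀-comp F (proj₂ (proj₂ (proj₂ right)))
      left : Left (toL (f , g))
      left = (λ {x} {y} e → proj₁ right (φ₀-inj F (trans (sym (φ≡ x)) (trans e (φ≡ y))))) , Comp-ext (λ x → sym (φ≡ x)) (λ x → sym (f₀≡ x)) c
        where
        c : Comp (φ₀ F ∘ G) π F
        c x y lt = go (c₀ (G x) (G y) lt)
          where
          go : F (G x) Fin.< F (G y) ⊎ (F (G x) ≡ F (G y) × φ₀ F (π (G x)) Fin.< φ₀ F (π (G y))) → F x Fin.< F y ⊎ (F x ≡ F y × φ₀ F (G (π x)) Fin.< φ₀ F (G (π y)))
          go (inj₁ l<) = inj₁ (subst₂ Fin._<_ (proj₁ (proj₂ (proj₂ right)) x) (proj₁ (proj₂ (proj₂ right)) y) l<)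
          go (inj₂ (e , l<)) = inj₂ (trans (sym (proj₁ (proj₂ (proj₂ right)) x)) (trans e (proj₁ (proj₂ (proj₂ right)) y))
            , subst₂ (λ a b → φ₀ F a Fin.< φ₀ F b) (sym (proj₁ (proj₂ right) x)) (sym (proj₁ (proj₂ right) y)) l<)
      back : toR (toL (f , g)) ≡ (f , g)
      back = cong₂ _,_ f-eq (trans (tabulate-cong e) (tabulate∘lookup g))
        where
        f-eq : tabulate (lookup (proj₂ (toL (f , g))) ∘ φ′) ≡ f
        f-eq = trans (tabulate-cong f₀≡) (tabulate∘lookup f)
        e : ∀ x → φ₀⁻ (lookup (tabulate (lookup (proj₂ (toL (f , g))) ∘ φ′))) (φ′ x) ≡ G x
        e x = trans (cong (λ w → φ₀⁻ (lookup w) (φ′ x)) f-eq) (trans (cong (φ₀⁻ F) (φ≡ x)) (Inverse.linv (φ₀-inj F) (G x)))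

    #Left≡#Right : (L? : ∀ x → Dec (Left x)) (R? : ∀ x → Dec (Right x)) →
      # L? (list (Enum-× (Enum-Vec (Enum-Fin (suc N)) (suc N)) (Enum-Vec (Enum-Fin Q) (suc N)))) ≡
      # R? (list (Enum-× (Enum-Vec (Enum-Fin Q) (suc N)) (Enum-Vec (Enum-Fin (suc N)) (suc N))))
    #Left≡#Right L? R? = #-bij L? R? (Enum-× (Enum-Vec (Enum-Fin (suc N)) (suc N)) (Enum-Vec (Enum-Fin Q) (suc N))) (Enum-× (Enum-Vec (Enum-Fin Q) (suc N)) (Enum-Vec (Enum-Fin (suc N)) (suc N)))
      toR toL (λ (φ , f₀) l → L→R.right φ f₀ l) (λ (f , g) r → R→L.left f g r) (λ (φ , f₀) l → L→R.back φ f₀ l) (λ (f , g) r → R→L.back f g r)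

-- Rising factorials and weakly increasing words

∑-perm : (EA : Enum A₁) (p : A₁ → A₁) → Inj p → (∀ y → ∃ λ x → p x ≡ y) → (g : A₁ → ℕ) → ∑ (list EA) (g ∘ p) ≡ ∑ (list EA) g
∑-perm EA p inj surj g = trans (sym (∑-map p (list EA) g)) (∑-↭ (∼bag⇒↭ (unique∧set⇒bag (map-unique (λ _ _ → inj) (unique EA)) (unique EA)
  (λ {y} → mk⇔ (λ _ → complete EA y) (λ _ → let x , e = surj y in subst (_∈ map p (list EA)) e (∈-map⁺ p (complete EA x)))))) g)

∑-allFin : ∀ n (g : Fin (suc n) → ℕ) → ∑ (allFin (suc n)) g ≡ g zero + ∑ (allFin n) (g ∘ suc)
∑-allFin n g = cong (g zero +_) (trans (cong (λ xs → ∑ xs g) (sym (ListP.map-tabulate id suc))) (∑-map suc (allFin n) g))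

∑-allFin-last : ∀ n (g : Fin (suc n) → ℕ) → ∑ (allFin (suc n)) g ≡ ∑ (allFin n) (g ∘ inject₁) + g (fromℕ n)
∑-allFin-last zero    g = ℕP.+-comm (g zero) 0
∑-allFin-last (suc n) g = trans (∑-allFin (suc n) g) (trans (cong (g zero +_) (∑-allFin-last n (g ∘ suc)))
  (trans (sym (ℕP.+-assoc (g zero) _ _)) (cong (_+ g (fromℕ (suc n))) (sym (∑-allFin n (g ∘ inject₁))))))

bit : Bool → ℕ
bit true  = 1
bit false = 0

-- The rising factorial a (a + 1) ... (a + n - 1).
rise : ℕ → ℕ → ℕ
rise a zero    = 1
rise a (suc n) = a * rise (suc a) n

rise-snoc : ∀ a n → rise a (suc n) ≡ rise a n * (a + n)
rise-snoc a zero    = trans (ℕP.*-identityʳ a) (trans (sym (ℕP.+-identityʳ a)) (sym (ℕP.+-identityʳ (a + 0))))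
rise-snoc a (suc n) = trans (cong (a *_) (rise-snoc (suc a) n)) (trans (sym (ℕP.*-assoc a (rise (suc a) n) (suc a + n))) (cong (a * rise (suc a) n *_) (sym (ℕP.+-suc a n))))

-- Pascal's rule for multiset coefficients with the denominators cleared. At `X = 0` the truncated
-- predecessor is harmless, since both sides vanish.
rise-pascal : ∀ X n → rise (pred X) (suc (suc n)) + suc (suc n) * rise X (suc n) ≡ rise X (suc (suc n))
rise-pascal zero    n = ℕP.*-zeroʳ (suc (suc n))
rise-pascal (suc Y) n = trans (sym (ℕP.*-distribʳ-+ (rise (suc Y) (suc n)) Y (suc (suc n)))) (trans (ℕP.*-comm (Y + suc (suc n)) (rise (suc Y) (suc n)))
  (trans (cong (rise (suc Y) (suc n) *_) (ℕP.+-suc Y (suc n))) (sym (rise-snoc (suc Y) (suc n)))))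

rise-∣ : ∀ a n k → k < n → a + k ∣ rise a n
rise-∣ a (suc n) zero    lt = subst (_∣ rise a (suc n)) (sym (ℕP.+-identityʳ a)) (m∣m*n (rise (suc a) n))
rise-∣ a (suc n) (suc k) lt = ∣n⇒∣m*n a (subst (_∣ rise (suc a) n) (sym (ℕP.+-suc a k)) (rise-∣ (suc a) n k (ℕP.≤-pred lt)))

module Counting (Q : ℕ) where
  low : Bool → Fin Q → ℕ
  low true  a = suc (toℕ a)
  low false a = toℕ a

  Inc : ∀ {n} → Vec Bool n → Fin Q → Vec (Fin Q) n → Set
  Inc []       a []       = ⊤
  Inc (b ∷ bs) a (c ∷ cs) = low b a ≤ toℕ c × Inc bs c cs

  Inc? : ∀ {n} (bs : Vec Bool n) a cs → Dec (Inc bs a cs)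
  Inc? []       a []       = yes tt
  Inc? (b ∷ bs) a (c ∷ cs) = (low b a ℕ.≤? toℕ c) ×-dec Inc? bs c cs

  vecs : ∀ n → List (Vec (Fin Q) n)
  vecs n = list (Enum-Vec (Enum-Fin Q) n)

  ∑-vecs : ∀ n (g : Vec (Fin Q) (suc n) → ℕ) → ∑ (vecs (suc n)) g ≡ ∑ (allFin Q) (λ c → ∑ (vecs n) (λ cs → g (c ∷ cs)))
  ∑-vecs n g = trans (∑-map cons (list (Enum-× (Enum-Fin Q) (Enum-Vec (Enum-Fin Q) n))) g) (∑-× (allFin Q) (vecs n) (g ∘ cons))

  tails : ∀ {n} → Vec Bool n → Fin Q → ℕ
  tails {n} bs a = # (Inc? bs a) (vecs n)

  from : ∀ {n} → Vec Bool n → ℕ → ℕ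
  from bs t = ∑ (allFin Q) (λ c → ind (t ℕ.≤? toℕ c) * tails bs c)

  tails-∷ : ∀ {n} b (bs : Vec Bool n) a → tails (b ∷ bs) a ≡ from bs (low b a)
  tails-∷ {n} b bs a = trans (∑-vecs n _) (∑-cong (allFin Q) λ c → trans (∑-cong (vecs n) (λ cs → ind-× (low b a ℕ.≤? toℕ c) (Inc? bs c cs))) (∑-*ʳ (vecs n) _ (ind (low b a ℕ.≤? toℕ c))))

  from-end : ∀ {n} (bs : Vec Bool n) t → Q ≤ t → from bs t ≡ 0
  from-end bs t le = ∑-0 (allFin Q) λ c → cong (_* tails bs c) (ind-no (t ℕ.≤? toℕ c) λ t≤c → ℕP.<⇒≱ (toℕ<n c) (ℕP.≤-trans le t≤c))

  from-step : ∀ {n} (bs : Vec Bool n) (a : Fin Q) → from bs (toℕ a) ≡ tails bs a + from bs (suc (toℕ a))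
  from-step bs a = trans (∑-cong (allFin Q) pt) (trans (∑-+ (allFin Q) _ _) (cong (_+ from bs (suc (toℕ a))) (∑-single FinP._≟_ (Enum-Fin Q) a (tails bs))))
    where
    pt : ∀ c → ind (toℕ a ℕ.≤? toℕ c) * tails bs c ≡ ind (a FinP.≟ c) * tails bs c + ind (suc (toℕ a) ℕ.≤? toℕ c) * tails bs c
    pt c = trans (cong (_* tails bs c) e) (ℕP.*-distribʳ-+ (tails bs c) (ind (a FinP.≟ c)) _)
      where
      e : ind (toℕ a ℕ.≤? toℕ c) ≡ ind (a FinP.≟ c) + ind (suc (toℕ a) ℕ.≤? toℕ c)
      e with ℕP.<-cmp (toℕ a) (toℕ c)
      ... | tri< lt ne _ = trans (ind-yes (_ ℕ.≤? _) (ℕP.<⇒≤ lt)) (cong₂ _+_ (sym (ind-no (a FinP.≟ c) (λ q → ne (cong toℕ q)))) (sym (ind-yes (_ ℕ.≤? _) lt)))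
      ... | tri≈ _ eq _ = trans (ind-yes (_ ℕ.≤? _) (ℕP.≤-reflexive eq)) (cong₂ _+_ (sym (ind-yes (a FinP.≟ c) (toℕ-injective eq))) (sym (ind-no (_ ℕ.≤? _) (ℕP.<-irrefl eq))))
      ... | tri> nlt ne gt = trans (ind-no (_ ℕ.≤? _) (ℕP.<⇒≱ gt)) (cong₂ _+_ (sym (ind-no (a FinP.≟ c) (λ q → ne (cong toℕ q)))) (sym (ind-no (_ ℕ.≤? _) nlt)))

  des : ∀ {n} → Vec Bool n → ℕ
  des []       = 0
  des (b ∷ bs) = bit b + des bs

  -- A weakly increasing word over the `k` letters from `t` on, strict at every flag, amounts to a
  -- multiset over `k ∸ des bs` letters, as each flag uses one up. The induction peels off the
  -- letter `t`; truncation gives the correct value 0 when the letters run out.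
  from-rise : ∀ {n} (bs : Vec Bool n) k t → k + t ≡ Q → suc n ! * from bs t ≡ rise (k ∸ des bs) (suc n)
  from-rise {n} bs zero t refl = trans (cong (suc n ! *_) (from-end bs t ℕP.≤-refl)) (trans (ℕP.*-zeroʳ (suc n !)) (cong (λ z → rise z (suc n)) (sym (ℕP.0∸n≡0 (des bs)))))
  from-rise {n} bs (suc k) t eq = trans (cong (λ z → suc n ! * from bs z) (sym t≡)) (trans (cong (suc n ! *_) (trans (from-step bs a) (cong (λ z → tails bs a + from bs (suc z)) t≡)))
      (trans (ℕP.*-distribˡ-+ (suc n !) (tails bs a) (from bs (suc t))) (go bs)))
    where
    t<Q : t < Q
    t<Q = subst (t <_) eq (s≤s (ℕP.m≤n+m t k))
    a : Fin Q
    a = fromℕ< t<Q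
    t≡ : toℕ a ≡ t
    t≡ = toℕ-fromℕ< t<Q
    eq′ : k + suc t ≡ Q
    eq′ = trans (ℕP.+-suc k t) eq
    mid : ∀ {n} (bs : Vec Bool n) u X → from bs u * (suc n !) ≡ rise X (suc n) → suc (suc n) ! * from bs u ≡ suc (suc n) * rise X (suc n)
    mid {n} bs u X e = trans (ℕP.*-assoc (suc (suc n)) (suc n !) (from bs u)) (cong (suc (suc n) *_) (trans (ℕP.*-comm (suc n !) (from bs u)) e))
    go : ∀ {n} (bs : Vec Bool n) → suc n ! * tails bs a + suc n ! * from bs (suc t) ≡ rise (suc k ∸ des bs) (suc n)
    go []       = trans (cong₂ _+_ (cong (1 *_) refl) (from-rise [] k (suc t) eq′)) refl
    go {suc n} (b ∷ bs) = trans (ℕP.+-comm _ (suc (suc n) ! * from (b ∷ bs) (suc t))) (trans (cong₂ _+_ (from-rise (b ∷ bs) k (suc t) eq′) (trans (cong (suc (suc n) ! *_) (tails-∷ b bs a)) (case b)))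
        (trans (cong (λ z → rise z (suc (suc n)) + suc (suc n) * rise X (suc n)) predX) (rise-pascal X n)))
      where
      X : ℕ
      X = suc k ∸ (bit b + des bs)
      predX : k ∸ (bit b + des bs) ≡ pred X
      predX = sym (ℕP.pred[m∸n]≡m∸[1+n] (suc k) (bit b + des bs))
      case : ∀ b → suc (suc n) ! * from bs (low b a) ≡ suc (suc n) * rise (suc k ∸ (bit b + des bs)) (suc n)
      case true  = mid bs (suc (toℕ a)) (k ∸ des bs) (trans (ℕP.*-comm (from bs (suc (toℕ a))) (suc n !)) (from-rise bs k (suc (toℕ a)) (trans (cong (λ z → k + suc z) t≡) eq′)))
      case false = mid bs (toℕ a) (suc k ∸ des bs) (trans (ℕP.*-comm (from bs (toℕ a)) (suc n !)) (from-rise bs (suc k) (toℕ a) (trans (cong (suc k +_) t≡) eq)))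

  total : ∀ {n} (bs : Vec Bool n) → suc n ! * ∑ (allFin Q) (tails bs) ≡ rise (Q ∸ des bs) (suc n)
  total {n} bs = trans (cong (suc n ! *_) (∑-cong (allFin Q) (λ c → sym (trans (cong (_* tails bs c) (ind-yes (0 ℕ.≤? toℕ c) z≤n)) (ℕP.+-identityʳ _))))) (from-rise bs Q 0 (ℕP.+-identityʳ Q))

  Inc⇒ : ∀ {n} (bs : Vec Bool n) a cs → Inc bs a cs → ∀ i → low (lookup bs i) (lookup (a ∷ cs) (inject₁ i)) ≤ toℕ (lookup (a ∷ cs) (suc i))
  Inc⇒ (b ∷ bs) a (c ∷ cs) (p , q) zero    = p
  Inc⇒ (b ∷ bs) a (c ∷ cs) (p , q) (suc i) = Inc⇒ bs c cs q i

  ⇒Inc : ∀ {n} (bs : Vec Bool n) a cs → (∀ i → low (lookup bs i) (lookup (a ∷ cs) (inject₁ i)) ≤ toℕ (lookup (a ∷ cs) (suc i))) → Inc bs a cs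
  ⇒Inc []       a []       h = tt
  ⇒Inc (b ∷ bs) a (c ∷ cs) h = h zero , ⇒Inc bs c cs (h ∘ suc)

  des-tabulate : ∀ n (h : Fin n → Bool) → des (tabulate h) ≡ ∑ (allFin n) (bit ∘ h)
  des-tabulate zero    h = refl
  des-tabulate (suc n) h = trans (cong (bit (h zero) +_) (des-tabulate n (h ∘ suc))) (sym (∑-allFin n (bit ∘ h)))

size : ∀ {n} → Subset n → ℕ
size {n} S = ∑ (allFin n) (λ x → bit (lookup S x))

-- Words compatible with a permutation

module Descents {N : ℕ} (Q : ℕ) where
  open Cyc N
  open Counting Q

  Comp? : ∀ (φ π : E → E) (f : E → Fin Q) → Dec (Comp φ π f)
  Comp? φ π f = all? λ x → all? λ y → (_ FinP.<? _) →-dec ((_ FinP.<? _) ⊎-dec ((_ FinP.≟ _) ×-dec (_ FinP.<? _)))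

  flags : Vec E (suc N) → Vec Bool N
  flags v = tabulate (λ i → lookup (desVec v) (inject₁ i))

  des-flags : ∀ v → des (flags v) ≡ size (desVec v)
  des-flags v = trans (des-tabulate N (λ i → lookup (desVec v) (inject₁ i))) (sym (trans (∑-allFin-last N (λ x → bit (lookup (desVec v) x)))
    (trans (cong (λ z → ∑ (allFin N) (λ i → bit (lookup (desVec v) (inject₁ i))) + bit z) (desVec-last v)) (ℕP.+-identityʳ _))))

  next-inject₁ : ∀ (i : Fin N) → next (inject₁ i) ≡ suc i
  next-inject₁ i = next-pred (suc i)

  inject₁≢last : ∀ (i : Fin N) → inject₁ i ≢ last
  inject₁≢last i e = fromℕ≢inject₁ (sym e)

  flag≡ : ∀ v i → lookup (flags v) i ≡ (toℕ (lookup v (suc i)) <ᵇ toℕ (lookup v (inject₁ i)))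
  flag≡ v i = trans (lookup∘tabulate (λ i → lookup (desVec v) (inject₁ i)) i) (trans (desVec-≢last v (inject₁ i) (inject₁≢last i)) (cong (λ z → toℕ (lookup v z) <ᵇ toℕ (lookup v (inject₁ i))) (next-inject₁ i)))

  Adj : Vec E (suc N) → Vec (Fin Q) (suc N) → Set
  Adj v f = ∀ (i : Fin N) → lookup f (inject₁ i) Fin.< lookup f (suc i) ⊎ (lookup f (inject₁ i) ≡ lookup f (suc i) × lookup v (inject₁ i) Fin.< lookup v (suc i))

  Comp⇒Adj : ∀ v f → Comp id (lookup v) (lookup f) → Adj v f
  Comp⇒Adj v f c i = c (inject₁ i) (suc i) (ℕP.≤-reflexive (cong suc (toℕ-inject₁ i)))

  -- Adjacent comparisons chain up along the line, which is the single block cut out by the last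
  -- position.
  Adj⇒Comp : ∀ v f → Adj v f → Comp id (lookup v) (lookup f)
  Adj⇒Comp v f adj x y lt = Block.blk-chain J last J-last R R-trans step x (trans (all-last x) (sym (all-last y))) (subst₂ Fin._<_ (sym (ρ-last x)) (sym (ρ-last y)) lt)
    where
    J : E → Bool
    J i = Relation.Nullary.does (i FinP.≟ last)
    J-last : J last ≡ true
    J-last = does-true⁻ (last FinP.≟ last) refl
    J-true : ∀ i → J i ≡ true → i ≡ last
    J-true i e with i FinP.≟ last
    ... | yes p = p
    all-last : ∀ x → blk J x ≡ last
    all-last x = J-true (blk J x) (Block.blk∈J J last J-last x)
    R : E → E → Set
    R x y = lookup f x Fin.< lookup f y ⊎ (lookup f x ≡ lookup f y × lookup v x Fin.< lookup v y)
    R-trans : ∀ {x y z} → R x y → R y z → R x z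
    R-trans (inj₁ a) (inj₁ b) = inj₁ (ℕP.<-trans a b)
    R-trans {x} (inj₁ a) (inj₂ (b , _)) = inj₁ (subst (lookup f x Fin.<_) b a)
    R-trans {z = z} (inj₂ (a , _)) (inj₁ b) = inj₁ (subst (Fin._< lookup f z) (sym a) b)
    R-trans (inj₂ (a , u)) (inj₂ (b , w)) = inj₂ (trans a b , ℕP.<-trans u w)
    step : ∀ {i} → J i ≡ false → R i (next i)
    step {i} e = subst (λ z → R z (next z)) inj≡ (subst (R (inject₁ j)) (sym (next-inject₁ j)) (adj j))
      where
      lt′ : toℕ i < N
      lt′ = ≢last⇒< (λ { refl → does-false (last FinP.≟ last) e refl })
      j : Fin N
      j = fromℕ< lt′
      inj≡ : inject₁ j ≡ i
      inj≡ = toℕ-injective (trans (toℕ-inject₁ j) (toℕ-fromℕ< lt′))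

  Adj⇔ : ∀ v → Inj (lookup v) → ∀ a cs → (Adj v (a ∷ cs) → Inc (flags v) a cs) × (Inc (flags v) a cs → Adj v (a ∷ cs))
  Adj⇔ v inj a cs = (λ adj → ⇒Inc (flags v) a cs (λ i → to i (adj i))) , (λ inc i → from′ i (Inc⇒ (flags v) a cs inc i))
    where
    f : Vec (Fin Q) (suc N)
    f = a ∷ cs
    to : ∀ i → lookup f (inject₁ i) Fin.< lookup f (suc i) ⊎ (lookup f (inject₁ i) ≡ lookup f (suc i) × lookup v (inject₁ i) Fin.< lookup v (suc i)) →
         low (lookup (flags v) i) (lookup f (inject₁ i)) ≤ toℕ (lookup f (suc i))
    to i h with lookup (flags v) i | flag≡ v i | h
    ... | true  | _ | inj₁ lt = lt
    ... | true  | e | inj₂ (_ , lt) = ⊥-elim (ℕP.<-asym lt (ℕP.<ᵇ⇒< _ _ (subst T e tt)))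
    ... | false | _ | inj₁ lt = ℕP.<⇒≤ lt
    ... | false | _ | inj₂ (q , _) = ℕP.≤-reflexive (cong toℕ q)
    from′ : ∀ i → low (lookup (flags v) i) (lookup f (inject₁ i)) ≤ toℕ (lookup f (suc i)) →
         lookup f (inject₁ i) Fin.< lookup f (suc i) ⊎ (lookup f (inject₁ i) ≡ lookup f (suc i) × lookup v (inject₁ i) Fin.< lookup v (suc i))
    from′ i h with lookup (flags v) i | flag≡ v i
    ... | true  | _ = inj₁ h
    ... | false | e with ℕP.m≤n⇒m<n∨m≡n h
    ...   | inj₁ lt = inj₁ lt
    ...   | inj₂ q  = inj₂ (toℕ-injective q , ℕP.≤∧≢⇒< (ℕP.≮⇒≥ (λ lt → subst T (sym e) (ℕP.<⇒<ᵇ lt)))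
                        (λ q′ → ℕP.m≢1+n+m (toℕ i) {0} (trans (sym (toℕ-inject₁ i)) (cong toℕ (inj (toℕ-injective q′))))))

  count-rise : ∀ v → Inj (lookup v) → suc N ! * # (λ f → Comp? id (lookup v) (lookup f)) (vecs (suc N)) ≡ rise (Q ∸ size (desVec v)) (suc N)
  count-rise v inj = trans (cong (suc N ! *_) (trans (∑-vecs N _) (∑-cong (allFin Q) λ a → ∑-cong (vecs N) λ cs →
      ind-cong (Comp? id (lookup v) (lookup (a ∷ cs))) (Inc? (flags v) a cs) (λ c → proj₁ (Adj⇔ v inj a cs) (Comp⇒Adj v (a ∷ cs) c)) (λ i → Adj⇒Comp v (a ∷ cs) (proj₂ (Adj⇔ v inj a cs) i)))))
    (trans (total (flags v)) (cong (λ z → rise (Q ∸ z) (suc N)) (des-flags v)))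

-- Divisibility forced by a cyclic extension

∑-∣ : {A : Set} {d : ℕ} (xs : List A) {f : A → ℕ} → (∀ x → d ∣ f x) → d ∣ ∑ xs f
∑-∣ {d = d} []       h = d ∣0
∑-∣ (x ∷ xs) h = ∣m∣n⇒∣m+n (h x) (∑-∣ xs h)

lookup-ext : ∀ {A : Set} {n} {v w : Vec A n} → (∀ i → lookup v i ≡ lookup w i) → v ≡ w
lookup-ext {v = v} {w} h = trans (sym (tabulate∘lookup v)) (trans (tabulate-cong h) (tabulate∘lookup w))

size-pos : ∀ {n} (S : Subset n) → S ≢ Sub.⊥ → 1 ≤ size S
size-pos {n} S ne with any? (λ x → lookup S x BoolP.≟ true)
... | yes (x , e) = subst (_< size S) (∑-0 (allFin n) (λ _ → refl)) (∑-mono-< (∈-allFin x) (λ _ → z≤n) (subst (0 <_) (cong bit (sym e)) (s≤s z≤n)))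
... | no ¬ex = ⊥-elim (ne (lookup-ext λ i → trans (BoolP.¬-not (λ e → ¬ex (i , e))) (sym (lookup-replicate i false))))

size-< : ∀ {n} (S : Subset n) → S ≢ Sub.⊤ → size S < n
size-< {n} S ne with any? (λ x → lookup S x BoolP.≟ false)
... | yes (x , e) = subst (size S <_) (trans (∑-const (allFin n) 1) (trans (ℕP.*-identityʳ _) (ListP.length-tabulate id)))
      (∑-mono-< (∈-allFin x) (λ y → bit≤1 (lookup S y)) (subst (_< 1) (cong bit (sym e)) (s≤s z≤n)))
  where
  bit≤1 : ∀ b → bit b ≤ 1
  bit≤1 true  = s≤s z≤n
  bit≤1 false = z≤n
... | no ¬ex = ⊥-elim (ne (lookup-ext λ i → trans (BoolP.¬-not (λ e → ¬ex (i , e))) (sym (lookup-replicate i true))))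

module _ {N : ℕ} where
  open Cyc N

  turn-toℕ : ∀ k → k ≤ N → toℕ (iter predMod k last) + k ≡ N
  turn-toℕ zero    le = trans (ℕP.+-identityʳ _) (FinP.toℕ-fromℕ N)
  turn-toℕ (suc k) le with iter predMod k last | turn-toℕ k (ℕP.<⇒≤ le)
  ... | zero  | e = ⊥-elim (ℕP.<-irrefl e le)
  ... | suc y | e = trans (cong (_+ suc k) (FinP.toℕ-inject₁ y)) (trans (ℕP.+-suc (toℕ y) k) e)

  pred-reach : ∀ (x y : E) → ∃ λ k → iter predMod k x ≡ y
  pred-reach x y = (suc N ∸ toℕ y) + toℕ x , trans (iter-+ predMod (suc N ∸ toℕ y) (toℕ x) x)
    (trans (cong (iter predMod (suc N ∸ toℕ y)) (trans (iter-pred-zero (toℕ x) x refl) (sym (iter-pred-zero (toℕ y) y refl))))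
    (trans (sym (iter-+ predMod (suc N ∸ toℕ y) (toℕ y) y)) (trans (cong (λ k → iter predMod k y) (ℕP.m∸n+n≡m (ℕP.<⇒≤ (toℕ<n y)))) (iter-pred-n y))))

  pred-free : ∀ (x : E) j → iter predMod j x ≡ x → suc N ∣ j
  pred-free x j e = m%n≡0⇒n∣m j (suc N) (go (j % suc N) refl)
    where
    e₀ : iter predMod j zero ≡ zero
    e₀ = trans (cong (iter predMod j) (sym (iter-pred-zero (toℕ x) x refl))) (trans (iter-comm predMod j (toℕ x) x) (trans (cong (iter predMod (toℕ x)) e) (iter-pred-zero (toℕ x) x refl)))
    go : ∀ t → j % suc N ≡ t → t ≡ 0
    go zero    _  = refl
    go (suc t) eq = ⊥-elim (ℕP.<-irrefl (trans (sym (cong (λ w → toℕ w + t) z≡)) (turn-toℕ t (ℕP.<⇒≤ t<N))) t<N)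
      where
      t<N : t < N
      t<N = ℕP.≤-pred (subst (_< suc N) eq (m%n<n j (suc N)))
      z≡ : iter predMod t last ≡ zero
      z≡ = trans (sym (iter-suc predMod t zero)) (trans (cong (λ k → iter predMod k zero) (sym eq)) (trans (sym (iter-% (suc N) (iter-pred-n zero) j)) e₀))

module Compatible {N : ℕ} (μ : List ℕ) (Q : ℕ) where
  open Cyc N
  open Counting Q using (vecs)
  open Descents {N} Q

  EnumV : Enum (Vec E (suc N))
  EnumV = Enum-Vec (Enum-Fin (suc N)) (suc N)

  compatible : Vec E (suc N) → ℕ
  compatible v = # (λ f → Comp? id (lookup v) (lookup f)) (vecs (suc N))

  F : ℕ
  F = ∑ (list EnumV) (λ v → ind (Mem? μ v) * compatible v)

  module Rotation (cDes : Class (suc N) μ → Subset (suc N)) (p : Class (suc N) μ → Class (suc N) μ) (ext : IsCyclicExtension (suc N) μ cDes p) (N≤Q : N ≤ Q) where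
    C : Set
    C = Class (suc N) μ
    EnumC : Enum C
    EnumC = Subtype.Enum-Σ (member μ) EnumV

    p-inj : Inj p
    p-inj = proj₁ (proj₁ ext)
    p-surj : ∀ y → ∃ λ x → p x ≡ y
    p-surj y = let x , e = proj₂ (proj₁ ext) y in x , e refl

    iter-surj : ∀ i y → ∃ λ x → iter p i x ≡ y
    iter-surj zero    y = y , refl
    iter-surj (suc i) y = let z , e = p-surj y ; x , e′ = iter-surj i z in x , trans (cong p e′) e

    cDes-iter : ∀ i c x → lookup (cDes (iter p i c)) x ≡ lookup (cDes c) (iter predMod i x)
    cDes-iter zero    c x = refl
    cDes-iter (suc i) c x = trans (cong (λ S → lookup S x) (proj₁ (proj₂ (proj₂ ext)) (iter p i c)))
      (trans (lookup∘tabulate (λ j → lookup (cDes (iter p i c)) (predMod j)) x) (trans (cDes-iter i c (predMod x)) (cong (lookup (cDes c)) (sym (iter-suc predMod i x)))))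

    size-iter : ∀ i c → size (cDes (iter p i c)) ≡ size (cDes c)
    size-iter i c = trans (∑-cong (allFin (suc N)) (λ x → cong bit (cDes-iter i c x)))
      (∑-perm (Enum-Fin (suc N)) (iter predMod i) (iter-inj predMod-inj i) (inj⇒surj (iter-inj predMod-inj i)) (bit ∘ lookup (cDes c)))

    size-Des : ∀ c → size (Des c) + bit (lookup (cDes c) last) ≡ size (cDes c)
    size-Des c@(v , _) = trans (cong (_+ bit (lookup (cDes c) last)) (trans (∑-allFin-last N (bit ∘ lookup (Des c)))
        (trans (cong₂ _+_ (∑-cong (allFin N) (λ i → cong bit (at i))) (cong bit (desVec-last v))) (ℕP.+-identityʳ _))))
      (sym (∑-allFin-last N (bit ∘ lookup (cDes c))))
      where
      at : ∀ i → lookup (Des c) (inject₁ i) ≡ lookup (cDes c) (inject₁ i)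
      at i = trans (cong (λ S → lookup S (inject₁ i)) (sym (proj₁ (proj₂ ext) c))) (trans (lookup-zipWith _∧_ (inject₁ i) (cDes c) (upToPred (suc N)))
        (trans (cong (lookup (cDes c) (inject₁ i) ∧_) (upToPred-≢last (inject₁ i) (inject₁≢last i))) (BoolP.∧-identityʳ _)))

    R : C → ℕ
    R c = rise (Q ∸ size (Des c)) (suc N)

    module _ (c : C) where
      j : ℕ
      j = size (cDes c)
      1≤j : 1 ≤ j
      1≤j = size-pos (cDes c) (proj₁ (proj₂ (proj₂ (proj₂ ext)) c))
      j≤N : j ≤ N
      j≤N = ℕP.≤-pred (size-< (cDes c) (proj₂ (proj₂ (proj₂ (proj₂ ext)) c)))
      a A : ℕ
      a = Q ∸ j
      A = rise (suc a) N
      a+j : a + j ≡ Q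
      a+j = ℕP.m∸n+n≡m (ℕP.≤-trans j≤N N≤Q)

      -- If n is not in the cyclic descent set, there are `j` descents and the factors are a, ..., a
      -- + N; otherwise there are j - 1, and the factors are a + 1, ..., a + N + 1. The N common
      -- factors form `A`.
      value : ∀ b d → d + bit b ≡ j → rise (Q ∸ d) (suc N) ≡ A * (a + suc N * bit b)
      value false d e = trans (cong (λ z → rise (Q ∸ z) (suc N)) (trans (sym (ℕP.+-identityʳ d)) e))
        (trans (ℕP.*-comm a A) (cong (A *_) (sym (trans (cong (a +_) (ℕP.*-zeroʳ (suc N))) (ℕP.+-identityʳ a)))))
      value true d e = trans (cong (λ z → rise z (suc N)) Q∸d) (trans (rise-snoc (suc a) N)
          (cong (A *_) (trans (sym (ℕP.+-suc a N)) (cong (a +_) (sym (ℕP.*-identityʳ (suc N)))))))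
        where
        Q∸d : Q ∸ d ≡ suc a
        Q∸d = trans (cong (_∸ d) (trans (sym a+j) (trans (cong (a +_) (trans (sym e) (ℕP.+-comm d 1))) (ℕP.+-suc a d)))) (ℕP.m+n∸n≡m (suc a) d)

      turn : E → E
      turn i = iter predMod (toℕ i) last

      turn-inj : Inj turn
      turn-inj {x} {y} e = toℕ-injective (ℕP.+-cancelˡ-≡ (toℕ (turn x)) (toℕ x) (toℕ y)
        (trans (turn-toℕ (toℕ x) (ℕP.≤-pred (toℕ<n x))) (sym (trans (cong (λ z → toℕ z + toℕ y) e) (turn-toℕ (toℕ y) (ℕP.≤-pred (toℕ<n y)))))))

      R-iter : ∀ i → R (iter p i c) ≡ A * (a + suc N * bit (lookup (cDes c) (iter predMod i last)))
      R-iter i = value (lookup (cDes c) (iter predMod i last)) (size (Des (iter p i c)))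
        (trans (cong (λ b → size (Des (iter p i c)) + bit b) (sym (cDes-iter i c last))) (trans (size-Des (iter p i c)) (size-iter i c)))

      -- Q = a + j is one of the factors a + 1, ..., a + N because 1 ≤ j ≤ N; this is what a
      -- nonempty and proper cyclic descent set buys.
      Q∣A : Q ∣ A
      Q∣A = subst (_∣ A) e (rise-∣ (suc a) N (pred j) (subst (_≤ N) (sym (ℕP.suc-pred j {{ℕ.>-nonZero 1≤j}})) j≤N))
        where
        e : suc a + pred j ≡ Q
        e = trans (sym (ℕP.+-suc a (pred j))) (trans (cong (a +_) (ℕP.suc-pred j {{ℕ.>-nonZero 1≤j}})) a+j)

      -- Among the n rotations of a cyclic descent set of size j, exactly j contain the last position.
      orbit-sum : ∑ (allFin (suc N)) (λ i → R (iter p (toℕ i) c)) ≡ A * (suc N * Q)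
      orbit-sum = trans (∑-cong (allFin (suc N)) (λ i → R-iter (toℕ i)))
        (trans (∑-perm (Enum-Fin (suc N)) turn turn-inj (inj⇒surj turn-inj) (λ x → A * (a + suc N * bit (lookup (cDes c) x))))
        (trans (∑-*ʳ (allFin (suc N)) _ A) (cong (A *_)
        (trans (∑-+ (allFin (suc N)) (λ _ → a) _) (trans (cong₂ _+_ (trans (∑-const (allFin (suc N)) a) (cong (_* a) (ListP.length-tabulate {n = suc N} id))) (∑-*ʳ (allFin (suc N)) (bit ∘ lookup (cDes c)) (suc N)))
        (trans (sym (ℕP.*-distribˡ-+ (suc N) a j)) (cong (suc N *_) a+j)))))))

      orbit-∣ : Q * Q ∣ ∑ (allFin (suc N)) (λ i → R (iter p (toℕ i) c))
      orbit-∣ = subst (Q * Q ∣_) (sym orbit-sum) (*-pres-∣ Q∣A (∣n⇒∣m*n (suc N) ∣-refl))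

    F-rise : suc N ! * F ≡ ∑ (list EnumC) R
    F-rise = trans (sym (∑-*ʳ (list EnumV) _ (suc N !))) (trans (∑-cong (list EnumV) pt) (sym (Subtype.∑-restrict (member μ) (list EnumV) (λ v → rise (Q ∸ size (desVec v)) (suc N)))))
      where
      comm₃ : ∀ a b c → a * (b * c) ≡ b * (a * c)
      comm₃ a b c = trans (sym (ℕP.*-assoc a b c)) (trans (cong (_* c) (ℕP.*-comm a b)) (ℕP.*-assoc b a c))
      pt : ∀ v → suc N ! * (ind (Mem? μ v) * compatible v) ≡ ind (T? (member μ v)) * rise (Q ∸ size (desVec v)) (suc N)
      pt v with T? (member μ v)
      ... | yes t = trans (comm₃ (suc N !) 1 (compatible v)) (cong (1 *_) (count-rise v (proj₁ (member⇒Mem μ v t))))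
      ... | no _  = ℕP.*-zeroʳ (suc N !)

    -- Every power of `p` permutes the class, so summing over n of them multiplies the total by n
    -- and regroups it into sums along rotations, each divisible by Q².
    F-∣ : Q * Q ∣ suc N * (suc N ! * F)
    F-∣ = subst (Q * Q ∣_) (sym (trans (cong (suc N *_) F-rise) eq)) (∑-∣ (list EnumC) orbit-∣)
      where
      eq : suc N * ∑ (list EnumC) R ≡ ∑ (list EnumC) (λ c → ∑ (allFin (suc N)) (λ i → R (iter p (toℕ i) c)))
      eq = trans (cong (_* ∑ (list EnumC) R) (sym (ListP.length-tabulate {n = suc N} id))) (trans (sym (∑-const (allFin (suc N)) (∑ (list EnumC) R)))
        (trans (∑-cong (allFin (suc N)) (λ i → sym (∑-perm EnumC (iter p (toℕ i)) (iter-inj p-inj (toℕ i)) (iter-surj (toℕ i)) R)))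
          (∑-swap (allFin (suc N)) (list EnumC) _)))

-- Letters modulo Q and free shifts of words

module Letters (Q′ : ℕ) where
  Q : ℕ
  Q = suc Q′
  open Mod Q

  abstract
    infixl 6 _⊕_
    _⊕_ : Fin Q → Fin Q → Fin Q
    a ⊕ x = fromℕ< (m%n<n (toℕ a + toℕ x) Q)

    ⊖_ : Fin Q → Fin Q
    ⊖ a = fromℕ< (m%n<n (Q ∸ toℕ a) Q)

    private
      toℕ-⊕ : ∀ a x → toℕ (a ⊕ x) ≡ (toℕ a + toℕ x) % Q
      toℕ-⊕ a x = toℕ-fromℕ< (m%n<n (toℕ a + toℕ x) Q)
      toℕ-% : ∀ (a : Fin Q) → toℕ a % Q ≡ toℕ a
      toℕ-% a = m<n⇒m%n≡m (toℕ<n a)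
      neg : ∀ a → toℕ (⊖ a) + toℕ a ≈ 0
      neg a = trans (cong (λ k → (k + toℕ a) % Q) (toℕ-fromℕ< (m%n<n (Q ∸ toℕ a) Q))) (compl {toℕ a} (ℕP.<⇒≤ (toℕ<n a)))

    ⊕-zero : ∀ a → a ⊕ zero ≡ a
    ⊕-zero a = toℕ-injective (trans (toℕ-⊕ a zero) (trans (cong (_% Q) (ℕP.+-identityʳ (toℕ a))) (toℕ-% a)))

    ⊖-⊕-self : ∀ a → ⊖ a ⊕ a ≡ zero
    ⊖-⊕-self a = toℕ-injective (trans (toℕ-⊕ (⊖ a) a) (trans (neg a) zero%))

    private
      undo : ∀ a b x → toℕ a + toℕ b ≈ 0 → a ⊕ (b ⊕ x) ≡ x
      undo a b x e = toℕ-injective (trans (toℕ-⊕ a (b ⊕ x)) (trans (cong (λ k → (toℕ a + k) % Q) (toℕ-⊕ b x))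
        (trans (≈-+ {toℕ a} {toℕ a} {(toℕ b + toℕ x) % Q} {toℕ b + toℕ x} refl (≈-% (toℕ b + toℕ x))) (trans (cong (_% Q) (sym (ℕP.+-assoc (toℕ a) (toℕ b) (toℕ x)))) (trans (≈-+ {toℕ a + toℕ b} {0} {toℕ x} {toℕ x} e refl) (toℕ-% x))))))

    ⊖-⊕ : ∀ a x → ⊖ a ⊕ (a ⊕ x) ≡ x
    ⊖-⊕ a x = undo (⊖ a) a x (neg a)

    ⊕-⊖ : ∀ a x → a ⊕ (⊖ a ⊕ x) ≡ x
    ⊕-⊖ a x = undo a (⊖ a) x (trans (cong (_% Q) (ℕP.+-comm (toℕ a) (toℕ (⊖ a)))) (neg a))

  ⊕-inj : ∀ a → Inj (a ⊕_)
  ⊕-inj a {x} {y} e = trans (sym (⊖-⊕ a x)) (trans (cong (⊖ a ⊕_) e) (⊖-⊕ a y))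

  -- Q and -Q modulo Q², the latter written as Q (Q - 1) to stay within the natural numbers.
  δ : Bool → ℕ
  δ false = Q * Q′
  δ true  = Q

  δ-not : ∀ b → δ b + δ (not b) ≡ Q * Q
  δ-not true  = sym (ℕP.*-suc Q Q′)
  δ-not false = trans (ℕP.+-comm (Q * Q′) Q) (sym (ℕP.*-suc Q Q′))

  module Shift {n : ℕ} (χ : Fin n → Bool) where
    Word : Set
    Word = Vec (Fin Q) n

    words : Enum Word
    words = Enum-Vec (Enum-Fin Q) n

    shift : Fin Q → Fin Q → Word → Word
    shift a b f = tabulate (λ x → (if χ x then a else b) ⊕ lookup f x)

    shift-lookup : ∀ a b f x → lookup (shift a b f) x ≡ (if χ x then a else b) ⊕ lookup f x
    shift-lookup a b f = lookup∘tabulate (λ x → (if χ x then a else b) ⊕ lookup f x)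

    shift-resp : ∀ a b f {x y} → χ x ≡ χ y → lookup f x ≡ lookup f y → lookup (shift a b f) x ≡ lookup (shift a b f) y
    shift-resp a b f {x} {y} e e′ = trans (shift-lookup a b f x) (trans (cong₂ (λ c d → (if c then a else b) ⊕ d) e e′) (sym (shift-lookup a b f y)))

    shift-reflects : ∀ a b f {x y} → χ x ≡ χ y → lookup (shift a b f) x ≡ lookup (shift a b f) y → lookup f x ≡ lookup f y
    shift-reflects a b f {x} {y} e e′ = ⊕-inj (if χ x then a else b) (trans (sym (shift-lookup a b f x)) (trans e′ (trans (shift-lookup a b f y) (cong (λ c → (if c then a else b) ⊕ lookup f y) (sym e)))))

    private
      if-⊖ : ∀ c a b x → (if c then ⊖ a else ⊖ b) ⊕ ((if c then a else b) ⊕ x) ≡ x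
      if-⊖ true  a b x = ⊖-⊕ a x
      if-⊖ false a b x = ⊖-⊕ b x

      if-⊖′ : ∀ c a b x → (if c then a else b) ⊕ ((if c then ⊖ a else ⊖ b) ⊕ x) ≡ x
      if-⊖′ true  a b x = ⊕-⊖ a x
      if-⊖′ false a b x = ⊕-⊖ b x

    shift-⊖ : ∀ a b f → shift (⊖ a) (⊖ b) (shift a b f) ≡ f
    shift-⊖ a b f = lookup-ext λ x → trans (shift-lookup (⊖ a) (⊖ b) (shift a b f) x) (trans (cong ((if χ x then ⊖ a else ⊖ b) ⊕_) (shift-lookup a b f x)) (if-⊖ (χ x) a b (lookup f x)))

    ⊖-shift : ∀ a b f → shift a b (shift (⊖ a) (⊖ b) f) ≡ f
    ⊖-shift a b f = lookup-ext λ x → trans (shift-lookup a b (shift (⊖ a) (⊖ b) f) x) (trans (cong ((if χ x then a else b) ⊕_) (shift-lookup (⊖ a) (⊖ b) f x)) (if-⊖′ (χ x) a b (lookup f x)))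

    module _ {P : Word → Set} (P? : ∀ f → Dec (P f)) (inv : ∀ a b f → P f → P (shift a b f)) {z z′ : Fin n} (χz : χ z ≡ true) (χz′ : χ z′ ≡ false) where
      private
        At : Fin Q → Fin Q → Word → Set
        At c d f = c ≡ lookup f z × d ≡ lookup f z′ × P f
        At? : ∀ c d f → Dec (At c d f)
        At? c d f = (c FinP.≟ lookup f z) ×-dec ((d FinP.≟ lookup f z′) ×-dec P? f)

        at-z : ∀ a b f → lookup (shift a b f) z ≡ a ⊕ lookup f z
        at-z a b f = trans (shift-lookup a b f z) (cong (λ c → (if c then a else b) ⊕ lookup f z) χz)
        at-z′ : ∀ a b f → lookup (shift a b f) z′ ≡ b ⊕ lookup f z′
        at-z′ a b f = trans (shift-lookup a b f z′) (cong (λ c → (if c then a else b) ⊕ lookup f z′) χz′)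

        level : ∀ c d → # (At? c d) (list words) ≡ # (At? zero zero) (list words)
        level c d = #-bij (At? c d) (At? zero zero) words words (shift (⊖ c) (⊖ d)) (shift c d)
          (λ { f (refl , refl , p) → sym (trans (at-z (⊖ c) (⊖ d) f) (⊖-⊕-self c)) , sym (trans (at-z′ (⊖ c) (⊖ d) f) (⊖-⊕-self d)) , inv (⊖ c) (⊖ d) f p })
          (λ { f (e , e′ , p) → sym (trans (at-z c d f) (trans (cong (c ⊕_) (sym e)) (⊕-zero c))) , sym (trans (at-z′ c d f) (trans (cong (d ⊕_) (sym e′)) (⊕-zero d))) , inv c d f p })
          (λ f _ → ⊖-shift c d f) (λ f _ → shift-⊖ c d f)

        one : ∀ (c : Fin Q) k → ∑ (allFin Q) (λ x → ind (x FinP.≟ c) * k) ≡ k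
        one c k = trans (∑-cong (allFin Q) (λ x → cong (_* k) (ind-cong (x FinP.≟ c) (c FinP.≟ x) sym sym))) (∑-single FinP._≟_ (Enum-Fin Q) c (λ _ → k))

        split : ∀ f → ind (P? f) ≡ ∑ (allFin Q) (λ c → ∑ (allFin Q) (λ d → ind (At? c d f)))
        split f = sym (trans (∑-cong (allFin Q) (λ c → trans (∑-cong (allFin Q) (λ d → trans (ind-× (c FinP.≟ lookup f z) ((d FinP.≟ lookup f z′) ×-dec P? f)) (cong (ind (c FinP.≟ lookup f z) *_) (ind-× (d FinP.≟ lookup f z′) (P? f)))))
          (trans (∑-*ʳ (allFin Q) (λ d → ind (d FinP.≟ lookup f z′) * ind (P? f)) (ind (c FinP.≟ lookup f z))) (cong (ind (c FinP.≟ lookup f z) *_) (one (lookup f z′) (ind (P? f)))))))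
          (one (lookup f z) (ind (P? f))))

      -- The shifts act freely, through the letters at z and z′.
      shift-∣ : Q * Q ∣ # P? (list words)
      shift-∣ = divides (# (At? zero zero) (list words)) (trans (∑-cong (list words) split) (trans (∑-swap (list words) (allFin Q) _)
        (trans (∑-cong (allFin Q) (λ c → trans (∑-swap (list words) (allFin Q) _) (trans (∑-cong (allFin Q) (λ d → level c d)) (trans (∑-const (allFin Q) k) (cong (_* k) lenQ)))))
        (trans (∑-const (allFin Q) (Q * k)) (trans (cong (_* (Q * k)) lenQ) (trans (sym (ℕP.*-assoc Q Q k)) (ℕP.*-comm (Q * Q) k)))))))
        where
        k : ℕ
        k = # (At? zero zero) (list words)
        lenQ : length (allFin Q) ≡ Q
        lenQ = ListP.length-tabulate id

does-cong : {P R : Set} (p : Dec P) (q : Dec R) → (P → R) → (R → P) → does p ≡ does q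
does-cong (yes p) q f g = sym (does-true⁻ q (f p))
does-cong (no ¬p) q f g = sym (does-false⁻ q (¬p ∘ g))

prime∤⇒coprime : ∀ {q m} → Prime q → ¬ q ∣ m → Coprime q m
prime∤⇒coprime pq ∤ (d∣q , d∣m) with prime⇒irreducible pq d∣q
... | inj₁ d≡1  = d≡1
... | inj₂ refl = ⊥-elim (∤ d∣m)

-- `true` for an odd number of primes: for a square-free product this is the sign of the Möbius
-- function.
parity : List ℕ → Bool
parity []       = false
parity (_ ∷ ps) = not (parity ps)

all-equal : ∀ {r : ℕ} (xs : List ℕ) → (∀ {x} → x ∈ xs → x ≡ r) → xs ≡ replicate (length xs) r
all-equal []       h = refl
all-equal (x ∷ xs) h = cong₂ _∷_ (h (here refl)) (all-equal xs (h ∘ there))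

abstract
  Inj? : ∀ {n} (v : Vec (Fin n) n) → Dec (Inj (lookup v))
  Inj? v with T? (distinctᵇ v)
  ... | yes t = yes (distinct⇒inj v t)
  ... | no ¬t = no (λ inj → ¬t (inj⇒distinct v inj))

-- Commuting pairs of permutations

module Orbits {N : ℕ} (l : ℕ) where
  E : Set
  E = Fin (suc N)
  r : ℕ
  r = suc l
  z : E
  z = zero

  -- The orbit of the base point under `σ` and `g`, with bounded exponents so as to be decidable.
  -- For commuting permutations with `σ` of period `r` the bounds lose nothing (`Orbit.near`).
  Near : (σ g : E → E) → E → Set
  Near σ g y = ∃ λ (a : Fin r) → ∃ λ (b : E) → iter σ (toℕ a) (iter g (toℕ b) z) ≡ y

  abstract
    Near? : ∀ σ g y → Dec (Near σ g y)
    Near? σ g y = any? λ a → any? λ b → iter σ (toℕ a) (iter g (toℕ b) z) FinP.≟ y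

  Trans : (π g : E → E) → Set
  Trans π g = ∀ y → Near π g y

  -- Independence at the base point: the powers of `g` meet the `π`-cycle of `z` in `z` alone.
  Free : (π g : E → E) → Set
  Free π g = ∀ (a : Fin r) (b : E) → iter g (toℕ b) z ≡ iter π (toℕ a) z → iter π (toℕ a) z ≡ z

  abstract
    Free? : ∀ π g → Dec (Free π g)
    Free? π g = all? λ a → all? λ b → (_ FinP.≟ _) →-dec (_ FinP.≟ _)

  module Orbit (σ g : E → E) (σ-per : ∀ x → iter σ r x ≡ x) (g-inj : Inj g) (comm : ∀ x → g (σ x) ≡ σ (g x)) where
    module G = CyclesOf g g-inj

    O : E → Set
    O y = ∃₂ λ a b → iter σ a (iter g b z) ≡ y

    near : ∀ {y} → O y → Near σ g y
    near {y} (a , b , e) = fromℕ< (m%n<n a r) , fromℕ< b< , trans (cong₂ (λ a b → iter σ a (iter g b z)) (toℕ-fromℕ< (m%n<n a r)) (toℕ-fromℕ< b<))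
        (trans (sym (iter-% r (σ-per _) a)) (trans (cong (iter σ a) (sym (iter-% (G.len z) {{nz}} (G.len-return z) b))) e))
      where
      nz : NonZero (G.len z)
      nz = ℕ.>-nonZero (G.len-pos z)
      b< : (b % G.len z) {{nz}} < suc N
      b< = ℕP.<-≤-trans (m%n<n b (G.len z) {{nz}}) (G.len≤n z)

    O? : ∀ y → Dec (O y)
    O? y = map′ (λ (a , b , e) → toℕ a , toℕ b , e) near (Near? σ g y)

    χ : E → Bool
    χ y = does (O? y)

    O-σ : ∀ {y} → O y → O (σ y)
    O-σ (a , b , e) = suc a , b , cong σ e

    O-σ⁻ : ∀ {y} → O (σ y) → O y
    O-σ⁻ {y} (a , b , e) = l + a , b , trans (iter-+ σ l a _) (trans (cong (iter σ l) e) (trans (sym (iter-suc σ l y)) (σ-per y)))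

    O-g : ∀ {y} → O y → O (g y)
    O-g (a , b , e) = a , suc b , trans (sym (iter-conj g comm a _)) (cong g e)

    O-g⁻ : ∀ {y} → O (g y) → O y
    O-g⁻ {y} o = subst O (trans (sym (iter-suc g (pred (G.len y)) y)) (trans (cong (λ k → iter g k y) (ℕP.suc-pred (G.len y) {{ℕ.>-nonZero (G.len-pos y)}})) (G.len-return y))) (many (pred (G.len y)) o)
      where
      many : ∀ k {y} → O y → O (iter g k y)
      many zero    o = o
      many (suc k) o = O-g (many k o)

    χ-σ : ∀ y → χ (σ y) ≡ χ y
    χ-σ y = does-cong (O? (σ y)) (O? y) O-σ⁻ O-σ

    χ-g : ∀ y → χ (g y) ≡ χ y
    χ-g y = does-cong (O? (g y)) (O? y) O-g⁻ O-g

    χ-iter : ∀ k y → χ (iter σ k y) ≡ χ y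
    χ-iter zero    y = refl
    χ-iter (suc k) y = trans (χ-σ (iter σ k y)) (χ-iter k y)

    χ-z : χ z ≡ true
    χ-z = does-true⁻ (O? z) (0 , 0 , refl)

  -- The two coordinate rotations of an s × r torus.
  module Torus (s′ : ℕ) (n≡ : suc N ≡ suc s′ * suc l) where
    module R = Cyc l
    module S = Cyc s′
    s : ℕ
    s = suc s′

    enc : Fin s × Fin r → E
    enc (i , a) = cast (sym n≡) (combine i a)

    dec : E → Fin s × Fin r
    dec x = remQuot r (cast n≡ x)

    dec-enc : ∀ p → dec (enc p) ≡ p
    dec-enc (i , a) = trans (cong (remQuot r) (trans (cast-trans (sym n≡) n≡ (combine i a)) (cast-is-id refl (combine i a)))) (remQuot-combine i a)

    enc-dec : ∀ x → enc (dec x) ≡ x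
    enc-dec x = trans (cong (cast (sym n≡)) (combine-remQuot {s} r (cast n≡ x))) (trans (cast-trans n≡ (sym n≡) x) (cast-is-id refl x))

    dec-inj : Inj dec
    dec-inj {x} {y} e = trans (sym (enc-dec x)) (trans (cong enc e) (enc-dec y))

    π₀ g₀ : Fin s × Fin r → Fin s × Fin r
    π₀ (i , a) = i , predMod a
    g₀ (i , a) = predMod i , a

    π g : E → E
    π x = enc (π₀ (dec x))
    g x = enc (g₀ (dec x))

    iter-π₀ : ∀ k i a → iter π₀ k (i , a) ≡ (i , iter predMod k a)
    iter-π₀ zero    i a = refl
    iter-π₀ (suc k) i a = cong π₀ (iter-π₀ k i a)

    iter-g₀ : ∀ k i a → iter g₀ k (i , a) ≡ (iter predMod k i , a)
    iter-g₀ zero    i a = refl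
    iter-g₀ (suc k) i a = cong g₀ (iter-g₀ k i a)

    dec-π : ∀ k x → dec (iter π k x) ≡ (proj₁ (dec x) , iter predMod k (proj₂ (dec x)))
    dec-π k x = trans (iter-conj dec (λ y → dec-enc (π₀ (dec y))) k x) (iter-π₀ k (proj₁ (dec x)) (proj₂ (dec x)))

    dec-g : ∀ k x → dec (iter g k x) ≡ (iter predMod k (proj₁ (dec x)) , proj₂ (dec x))
    dec-g k x = trans (iter-conj dec (λ y → dec-enc (g₀ (dec y))) k x) (iter-g₀ k (proj₁ (dec x)) (proj₂ (dec x)))

    π-inj : Inj π
    π-inj {x} {y} e = dec-inj (cong₂ _,_ (cong proj₁ e′) (R.predMod-inj (cong proj₂ e′)))
      where
      e′ : π₀ (dec x) ≡ π₀ (dec y)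
      e′ = trans (sym (dec-enc (π₀ (dec x)))) (trans (cong dec e) (dec-enc (π₀ (dec y))))

    g-inj : Inj g
    g-inj {x} {y} e = dec-inj (cong₂ _,_ (S.predMod-inj (cong proj₁ e′)) (cong proj₂ e′))
      where
      e′ : g₀ (dec x) ≡ g₀ (dec y)
      e′ = trans (sym (dec-enc (g₀ (dec x)))) (trans (cong dec e) (dec-enc (g₀ (dec y))))

    comm : ∀ x → g (π x) ≡ π (g x)
    comm x = cong enc (trans (cong g₀ (dec-enc (π₀ (dec x)))) (cong π₀ (sym (dec-enc (g₀ (dec x))))))

    per : ∀ x → iter π r x ≡ x
    per x = dec-inj (trans (dec-π r x) (cong (proj₁ (dec x) ,_) (R.iter-pred-n (proj₂ (dec x)))))

    free : ∀ x j → iter π j x ≡ x → r ∣ j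
    free x j e = pred-free (proj₂ (dec x)) j (trans (sym (cong proj₂ (dec-π j x))) (cong (proj₂ ∘ dec) e))

    private module C = CyclesOf π π-inj

    orb⇒row : ∀ {x y} → C.C.Orb x y → proj₁ (dec x) ≡ proj₁ (dec y)
    orb⇒row {x} (k , refl) = sym (trans (cong (proj₁ ∘ dec) (C.it k x)) (cong proj₁ (dec-π k x)))

    row⇒orb : ∀ {x y} → proj₁ (dec x) ≡ proj₁ (dec y) → C.C.Orb x y
    row⇒orb {x} {y} e = let k , e′ = pred-reach (proj₂ (dec x)) (proj₂ (dec y)) in
      k , trans (C.it k x) (dec-inj (trans (dec-π k x) (cong₂ _,_ e e′)))

    mins-count : length C.C.mins ≡ s
    mins-count = ℕP.≤-antisym
      (subst₂ _≤_ (ListP.length-map row C.C.mins) (ListP.length-tabulate {n = s} id)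
        (unique-⊆⇒length≤ {xs = map row C.C.mins} {ys = allFin s} (map-unique (λ x∈ y∈ e → C.C.min-unique (C.C.mins-∈ x∈) (C.C.mins-∈ y∈) (row⇒orb e)) C.C.mins-unique) (λ {i} _ → ∈-allFin i)))
      (subst (_≤ length C.C.mins) (trans (ListP.length-map start (allFin s)) (ListP.length-tabulate {n = s} id))
        (unique-⊆⇒length≤ {xs = map start (allFin s)} (map-unique (λ {i} {j} _ _ e → start-inj {i} {j} e) (UniqueP.allFin⁺ s)) start∈))
      where
      row : E → Fin s
      row x = proj₁ (dec x)
      start : Fin s → E
      start i = C.C.minOf (enc (i , zero))
      row-start : ∀ i → row (start i) ≡ i
      row-start i = trans (sym (orb⇒row (C.C.minOf-orb (enc (i , zero))))) (cong proj₁ (dec-enc (i , zero)))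
      start-inj : Inj start
      start-inj {i} {j} e = trans (sym (row-start i)) (trans (cong row e) (row-start j))
      start∈ : ∀ {x} → x ∈ map start (allFin s) → x ∈ C.C.mins
      start∈ x∈ = let i , _ , e = ∈-map⁻ start {xs = allFin s} x∈ in subst (_∈ C.C.mins) (sym e) (C.C.∈-mins (C.C.minOf-min (enc (i , zero))))

    mem : Mem (replicate s r) π
    mem = π-inj , trans (all-equal (cycleType (tabulate π)) all-r) (cong (λ k → replicate k r) (trans C.C.length-cycleType mins-count))
      where
      all-r : ∀ {x} → x ∈ cycleType (tabulate π) → x ≡ r
      all-r x∈ = let y , e = C.C.cycleType-∈ x∈ in trans (sym e) (C.len-unique y r (s≤s z≤n) (per y) (free y))

    transitive : Trans π g
    transitive y = let a , e = pred-reach (proj₂ (dec z)) (proj₂ (dec y))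
                       b , e′ = pred-reach (proj₁ (dec z)) (proj₁ (dec y)) in
      Orbit.near π g per g-inj comm (a , b , dec-inj (trans (dec-π a (iter g b z)) (cong₂ _,_ (trans (cong proj₁ (dec-g b z)) e′) (trans (cong (iter predMod a ∘ proj₂) (dec-g b z)) e))))

    independent : Free π g
    independent a b e = dec-inj (trans (dec-π (toℕ a) z) (cong (proj₁ (dec z) ,_) (trans (sym (cong proj₂ (dec-π (toℕ a) z))) (trans (cong (proj₂ ∘ dec) (sym e)) (cong proj₂ (dec-g (toℕ b) z))))))

  module RegularPairs (s : ℕ) where
    μ : List ℕ
    μ = replicate s r

    V : Set
    V = Vec E (suc N)

    EnumV : Enum V
    EnumV = Enum-Vec (Enum-Fin (suc N)) (suc N)

    mem-len : ∀ {π : E → E} → (mem : Mem μ π) → ∀ x → CyclesOf.len π (proj₁ mem) x ≡ r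
    mem-len {π} (inj , ct) x = replicate-∈ s (subst (CyclesOf.len π inj x ∈_) ct (CyclesOf.C.∈-cycleType π inj x))

    mem-per : ∀ {π : E → E} → Mem μ π → ∀ x → iter π r x ≡ x
    mem-per {π} mem x = subst (λ k → iter π k x ≡ x) (mem-len mem x) (CyclesOf.len-return π (proj₁ mem) x)

    mem-free : ∀ {π : E → E} → Mem μ π → ∀ x j → iter π j x ≡ x → r ∣ j
    mem-free {π} mem x j eq = subst (_∣ j) (mem-len mem x) (CyclesOf.len-∣ π (proj₁ mem) x j eq)

    Comm : V → V → Set
    Comm v g = Inj (lookup g) × (∀ x → lookup g (lookup v x) ≡ lookup v (lookup g x))

    abstract
      Comm? : ∀ v g → Dec (Comm v g)
      Comm? v g = Inj? g ×-dec (all? λ x → _ FinP.≟ _)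

      Reg? : ∀ v g → Dec (Trans (lookup v) (lookup g) × Free (lookup v) (lookup g))
      Reg? v g = (all? (Near? (lookup v) (lookup g))) ×-dec Free? (lookup v) (lookup g)

    Good? : ∀ v g → Dec (Mem μ (lookup v) × Comm v g × Trans (lookup v) (lookup g) × Free (lookup v) (lookup g))
    Good? v g = Mem? μ v ×-dec (Comm? v g ×-dec Reg? v g)

    -- Counts the pairs that act transitively and independently. No letters occur in it, so Q may
    -- later be chosen in terms of it.
    K : ℕ
    K = ∑ (list EnumV) (λ v → # (Good? v) (list EnumV))

    K-pos : ∀ s′ → s ≡ suc s′ → suc N ≡ suc s′ * suc l → 1 ≤ K
    K-pos s′ refl n≡ = subst (_< K) (∑-0 (list EnumV) (λ _ → refl)) (∑-mono-< (complete EnumV v) (λ _ → z≤n)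
        (subst (_< # (Good? v) (list EnumV)) (∑-0 (list EnumV) (λ _ → refl)) (∑-mono-< (complete EnumV g) (λ _ → z≤n) (ℕP.≤-reflexive (sym (ind-yes (Good? v g) good))))))
      where
      module To = Torus s′ n≡
      v g : V
      v = tabulate To.π
      g = tabulate To.g
      v≡ : ∀ x → lookup v x ≡ To.π x
      v≡ = lookup∘tabulate To.π
      g≡ : ∀ x → lookup g x ≡ To.g x
      g≡ = lookup∘tabulate To.g
      good : Mem μ (lookup v) × Comm v g × Trans (lookup v) (lookup g) × Free (lookup v) (lookup g)
      good = Mem-iso id id (λ x → sym (v≡ x)) To.mem
           , (tab-inj To.g-inj , λ x → trans (trans (g≡ (lookup v x)) (cong To.g (v≡ x))) (trans (To.comm x) (sym (trans (v≡ (lookup g x)) (cong To.π (g≡ x))))))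
           , (λ y → let a , b , e = To.transitive y in a , b , trans (trans (iter-cong v≡ (toℕ a) (iter (lookup g) (toℕ b) z)) (cong (iter To.π (toℕ a)) (iter-cong g≡ (toℕ b) z))) e)
           , (λ a b e → trans (iter-cong v≡ (toℕ a) z) (To.independent a b (trans (sym (iter-cong g≡ (toℕ b) z)) (trans e (iter-cong v≡ (toℕ a) z)))))

  -- Invariant primitive words modulo Q²

  module Pairs (Q′ : ℕ) where
    open Letters Q′

    FixG : (g : E → E) (f : E → Fin Q) → Set
    FixG g f = ∀ x → f (g x) ≡ f x

    abstract
      FixG? : ∀ g f → Dec (FixG g f)
      FixG? g f = all? λ x → _ FinP.≟ _

    PrimB : (π : E → E) (f : E → Fin Q) → Set
    PrimB π f = ∀ x (j : Fin r) → (∀ (i : Fin r) → f (iter π (toℕ i) x) ≡ f (iter π (toℕ i) (iter π (toℕ j) x))) → iter π (toℕ j) x ≡ x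

    abstract
      PrimB? : ∀ π f → Dec (PrimB π f)
      PrimB? π f = all? λ x → all? λ j → (all? λ i → _ FinP.≟ _) →-dec (_ FinP.≟ _)

    words : List (Vec (Fin Q) (suc N))
    words = list (Enum-Vec (Enum-Fin Q) (suc N))

    X : (π g : E → E) → ℕ
    X π g = # (λ f → FixG? g (lookup f) ×-dec PrimB? π (lookup f)) words

    shift-fix : ∀ {g} (χ : E → Bool) → (∀ y → χ (g y) ≡ χ y) → ∀ a b f → FixG g (lookup f) → FixG g (lookup (Shift.shift χ a b f))
    shift-fix χ χ-g a b f fix x = Shift.shift-resp χ a b f (χ-g x) (fix x)

    module Pair (π g : E → E) (per : ∀ x → iter π r x ≡ x) (free : ∀ x j → iter π j x ≡ x → r ∣ j) (g-inj : Inj g) (comm : ∀ x → g (π x) ≡ π (g x)) where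
      module P₁ = Orbit π g per g-inj comm

      -- Adding one constant on the orbit of `z` and another one outside it preserves invariance
      -- under `g` and primitivity along `π`; these Q² shifts act freely.
      nontransitive : ¬ Trans π g → Q * Q ∣ X π g
      nontransitive ¬t with FinP.¬∀⟶∃¬ (suc N) (Near π g) (Near? π g) ¬t
      ... | z′ , ¬o = shift-∣ (λ f → FixG? g (lookup f) ×-dec PrimB? π (lookup f)) inv {z} {z′} P₁.χ-z (does-false⁻ (P₁.O? z′) (¬o ∘ P₁.near))
        where
        open Shift P₁.χ
        inv : ∀ a b f → FixG g (lookup f) × PrimB π (lookup f) → FixG g (lookup (shift a b f)) × PrimB π (lookup (shift a b f))
        inv a b f (fix , prim) = shift-fix P₁.χ P₁.χ-g a b f fix , λ x j h → prim x j (λ i → shift-reflects a b f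
          (trans (P₁.χ-iter (toℕ i) x) (sym (trans (P₁.χ-iter (toℕ i) (iter π (toℕ j) x)) (P₁.χ-iter (toℕ j) x)))) (h i))

      fix-iter : ∀ {f : E → Fin Q} → FixG g f → ∀ b x → f (iter g b x) ≡ f x
      fix-iter fix zero    x = refl
      fix-iter fix (suc b) x = trans (fix (iter g b x)) (fix-iter fix b x)

      comm-iter : ∀ a b x → iter g b (iter π a x) ≡ iter π a (iter g b x)
      comm-iter a b x = iter-conj (iter g b) (λ y → sym (iter-conj {f = g} {g = g} π (λ w → sym (comm w)) b y)) a x

      fix-π : ∀ {f : E → Fin Q} → FixG g f → ∀ a b x → f (iter π a (iter g b x)) ≡ f (iter π a x)
      fix-π {f} fix a b x = trans (cong f (sym (comm-iter a b x))) (fix-iter fix b (iter π a x))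

      -- If a power of `g` carries `z` to another point of its `π`-cycle, an invariant word reads
      -- the same from both points, so it is not primitive.
      nonfree : ¬ Free π g → X π g ≡ 0
      nonfree ¬fr = ∑-0 words λ f → ind-no (FixG? g (lookup f) ×-dec PrimB? π (lookup f)) λ (fix , prim) → ¬fr λ a b e →
        prim z a λ i → trans (sym (fix-π {lookup f} fix (toℕ i) (toℕ b) z)) (cong (λ w → lookup f (iter π (toℕ i) w)) e)

      Period : ℕ → (E → Fin Q) → Set
      Period j f = ∀ x → f (iter π j x) ≡ f x

      abstract
        Period? : ∀ j f → Dec (Period j f)
        Period? j f = all? λ x → _ FinP.≟ _

      module _ {f : E → Fin Q} where
        Period-cancel : ∀ a d → Period a f → Period (a + d) f → Period d f
        Period-cancel a d pa pad x = trans (sym (pa (iter π d x))) (trans (cong f (sym (iter-+ π a d x))) (pad x))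

        Period-* : ∀ k a → Period a f → Period (k * a) f
        Period-* zero    a pa x = refl
        Period-* (suc k) a pa x = trans (cong f (iter-+ π a (k * a) x)) (trans (pa _) (Period-* k a pa x))

        Period-∣ : ∀ {a b} → a ∣ b → Period a f → Period b f
        Period-∣ {a} (divides k refl) = Period-* k a

        Period-gcd : ∀ a b → Period a f → Period b f → Period (gcd a b) f
        Period-gcd a b pa pb with Bézout.identity (gcd-GCD a b)
        ... | Bézout.+- x y eq = Period-cancel (y * b) (gcd a b) (Period-* y b pb) (subst (λ k → Period k f) (sym (trans (ℕP.+-comm (y * b) _) eq)) (Period-* x a pa))
        ... | Bézout.-+ x y eq = Period-cancel (x * a) (gcd a b) (Period-* x a pa) (subst (λ k → Period k f) (sym (trans (ℕP.+-comm (x * a) _) eq)) (Period-* y b pb))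

      MinPer : ℕ → (E → Fin Q) → Set
      MinPer e f = Period e f × (∀ (j : Fin e) → 1 ≤ toℕ j → ¬ Period (toℕ j) f)

      abstract
        MinPer? : ∀ e f → Dec (MinPer e f)
        MinPer? e f = Period? e f ×-dec (all? λ j → (1 ℕ.≤? toℕ j) →-dec ¬? (Period? (toℕ j) f))

      minPer-< : ∀ {e f} → MinPer e f → ∀ j → 1 ≤ j → j < e → ¬ Period j f
      minPer-< {e} {f} (_ , min) j 1≤j j<e pj = min (fromℕ< j<e) (subst (1 ≤_) (sym (toℕ-fromℕ< j<e)) 1≤j) (subst (λ k → Period k f) (sym (toℕ-fromℕ< j<e)) pj)

      minPer-∣ : ∀ {e f} .{{_ : NonZero e}} → MinPer e f → ∀ j → Period j f → e ∣ j
      minPer-∣ {e} {f} mp j pj = m%n≡0⇒n∣m j e (go (j % e) refl)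
        where
        go : ∀ k → j % e ≡ k → k ≡ 0
        go zero    _  = refl
        go (suc k) eq = ⊥-elim (minPer-< mp (suc k) (s≤s z≤n) (subst (_< e) eq (m%n<n j e))
          (subst (λ k → Period k f) eq (Period-cancel ((j / e) * e) (j % e) (Period-* (j / e) e (proj₁ mp)) (subst (λ k → Period k f) (trans (m≡m%n+[m/n]*n j e) (ℕP.+-comm (j % e) _)) pj))))

      ∣-minPer : ∀ {e f} → Period e f → (∀ j → Period j f → e ∣ j) → MinPer e f
      ∣-minPer pe h = pe , λ j 1≤j pj → ℕP.<⇒≱ (toℕ<n j) (∣⇒≤ {{ℕ.>-nonZero 1≤j}} (h (toℕ j) pj))

      W? : ∀ e (f : Vec (Fin Q) (suc N)) → Dec (FixG g (lookup f) × MinPer e (lookup f))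
      W? e f = FixG? g (lookup f) ×-dec MinPer? e (lookup f)

      W : ℕ → ℕ
      W e = # (W? e) words

      module Regular (trans-πg : Trans π g) (free-πg : Free π g) where

        free-πg′ : ∀ a b → iter g b z ≡ iter π a z → r ∣ a
        free-πg′ a b e = free z a (trans (iter-% r (per z) a) (trans (cong (λ k → iter π k z) (sym (toℕ-fromℕ< a<)))
            (free-πg (fromℕ< a<) (fromℕ< b<) (trans (cong (λ k → iter g k z) (toℕ-fromℕ< b<)) (trans (sym (iter-% (G.len z) {{nz}} (G.len-return z) b)) (trans e (trans (iter-% r (per z) a) (cong (λ k → iter π k z) (sym (toℕ-fromℕ< a<))))))))))
          where
          module G = CyclesOf g g-inj
          nz : NonZero (G.len z)
          nz = ℕ.>-nonZero (G.len-pos z)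
          a< : a % r < r
          a< = m%n<n a r
          b< : (b % G.len z) {{nz}} < suc N
          b< = ℕP.<-≤-trans (m%n<n b (G.len z) {{nz}}) (G.len≤n z)

        module Step (q e′ : ℕ) (pq : Prime q) (q∤e′ : ¬ q ∣ e′) .{{_ : NonZero e′}} (qe∣r : q * e′ ∣ r) where
          private instance
            nzq : NonZero q
            nzq = prime⇒nonZero pq
            nzqe : NonZero (q * e′)
            nzqe = ℕP.m*n≢0 q e′

          σ : E → E
          σ = iter π q

          σ-per : ∀ x → iter σ r x ≡ x
          σ-per x = trans (sym (iter-* π r q x)) (trans (cong (λ k → iter π k x) (ℕP.*-comm r q)) (iter-period r (per x) q))

          module O = Orbit σ g σ-per g-inj (λ x → comm-iter q 1 x)
          open Shift O.χ hiding (words)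

          χ-q : ∀ j x → O.χ (iter π (q * j) x) ≡ O.χ x
          χ-q j x = trans (cong O.χ (trans (cong (λ k → iter π k x) (ℕP.*-comm q j)) (iter-* π j q x))) (O.χ-iter j x)

          -- The minimal period is e′ or q * e′.
          U : (E → Fin Q) → Set
          U f = FixG g f × Period (q * e′) f × (∀ (j : Fin e′) → 1 ≤ toℕ j → ¬ Period (q * toℕ j) f)

          U? : ∀ (f : Vec (Fin Q) (suc N)) → Dec (U (lookup f))
          U? f = FixG? g (lookup f) ×-dec (Period? (q * e′) (lookup f) ×-dec (all? λ j → (1 ℕ.≤? toℕ j) →-dec ¬? (Period? (q * toℕ j) (lookup f))))

          U-shift : ∀ a b f → U (lookup f) → U (lookup (shift a b f))
          U-shift a b f (fix , p , h) = shift-fix O.χ O.χ-g a b f fix , (λ x → shift-resp a b f (χ-q e′ x) (p x)) ,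
            λ j 1≤j pj → h j 1≤j (λ x → shift-reflects a b f (χ-q (toℕ j) x) (pj x))

          -- Two independent constants require a second orbit of `π ^ q` and `g`. Were `π z` in the
          -- orbit of `z`, freeness would make `r`, hence q, divide a number that is 1 modulo q.
          πz∉ : O.χ (π z) ≡ false
          πz∉ = does-false⁻ (O.O? (π z)) λ (a , b , e) → ¬prime[1] (subst Prime (∣1⇒≡1 (∣m+n∣m⇒∣n (subst (q ∣_) (ℕP.+-comm 1 _) (∣-trans (∣-trans (m∣m*n e′) qe∣r)
              (free-πg′ (suc (l * (a * q))) b (lem a b e)))) (∣n⇒∣m*n l (n∣m*n a)))) pq)
            where
            lem : ∀ a b → iter σ a (iter g b z) ≡ π z → iter g b z ≡ iter π (suc (l * (a * q))) z
            lem a b e = trans (sym (iter-period r (per _) (a * q))) (trans (cong (λ k → iter π k (iter g b z)) (trans (ℕP.*-suc (a * q) l) (trans (cong (a * q +_) (ℕP.*-comm (a * q) l)) (ℕP.+-comm (a * q) _))))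
              (trans (iter-+ π (l * (a * q)) (a * q) (iter g b z)) (trans (cong (iter π (l * (a * q))) (trans (iter-* π a q (iter g b z)) e)) (sym (iter-suc π (l * (a * q)) z)))))

          e<qe : e′ < q * e′
          e<qe = subst (_< q * e′) (ℕP.*-identityˡ e′) (ℕP.*-monoˡ-< e′ (ℕ.nonTrivial⇒n>1 q {{prime⇒nonTrivial pq}}))

          -- As q is coprime to `e′`, the minimal period `e′` divides `q * j` only if it divides
          -- `j`.
          W⇒U₁ : ∀ {f} → MinPer e′ f → Period (q * e′) f × (∀ (j : Fin e′) → 1 ≤ toℕ j → ¬ Period (q * toℕ j) f)
          W⇒U₁ mp = Period-* q e′ (proj₁ mp) , λ j 1≤j pj → ℕP.<⇒≱ (toℕ<n j) (∣⇒≤ {{ℕ.>-nonZero 1≤j}}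
            (coprime-divisor (coprime-sym (prime∤⇒coprime pq q∤e′)) (minPer-∣ mp (q * toℕ j) pj)))

          W⇒U₂ : ∀ {f} → MinPer (q * e′) f → Period (q * e′) f × (∀ (j : Fin e′) → 1 ≤ toℕ j → ¬ Period (q * toℕ j) f)
          W⇒U₂ mp = proj₁ mp , λ j 1≤j pj → ℕP.<⇒≱ (toℕ<n j) (∣⇒≤ {{ℕ.>-nonZero 1≤j}} (*-cancelˡ-∣ q (minPer-∣ mp (q * toℕ j) pj)))

          U⇒W₁ : ∀ {f} → (∀ (j : Fin e′) → 1 ≤ toℕ j → ¬ Period (q * toℕ j) f) → Period e′ f → MinPer e′ f
          U⇒W₁ h pe = pe , λ j 1≤j pj → h j 1≤j (Period-* q (toℕ j) pj)

          -- Replace a smaller period by its greatest common divisor `d` with `q * e′`. If q does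
          -- not divide `d`, then `d` divides `e′`; otherwise `d` is q times a number below `e′`.
          -- Both are excluded.
          U⇒W₂ : ∀ {f} → Period (q * e′) f × (∀ (j : Fin e′) → 1 ≤ toℕ j → ¬ Period (q * toℕ j) f) → ¬ Period e′ f → MinPer (q * e′) f
          U⇒W₂ {f} (pqe , h) ¬pe = pqe , λ j 1≤j pj → go (toℕ j) 1≤j (toℕ<n j) (gcd (toℕ j) (q * e′)) refl (Period-gcd (toℕ j) (q * e′) pj pqe)
            where
            go : ∀ j → 1 ≤ j → j < q * e′ → ∀ d → gcd j (q * e′) ≡ d → Period d f → ⊥
            go j 1≤j j< d refl pd with q Data.Nat.Divisibility.∣? d
            ... | no q∤d = ¬pe (Period-∣ (coprime-divisor (coprime-sym (prime∤⇒coprime pq q∤d)) (gcd[m,n]∣n j (q * e′))) pd)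
            ... | yes (divides d′ eq) = h (fromℕ< d′<e) (subst (1 ≤_) (sym (toℕ-fromℕ< d′<e)) 1≤d′) (subst (λ k → Period k f) (trans d≡ (cong (q *_) (sym (toℕ-fromℕ< d′<e)))) pd)
              where
              d≡ : d ≡ q * d′
              d≡ = trans eq (ℕP.*-comm d′ q)
              1≤d′ : 1 ≤ d′
              1≤d′ = ℕP.n≢0⇒n>0 λ { refl → ℕP.<-irrefl (sym (gcd[m,n]≡0⇒m≡0 {j} {q * e′} eq)) 1≤j }
              d′<e : d′ < e′
              d′<e = ℕP.*-cancelˡ-< q d′ e′ (subst (_< q * e′) d≡ (ℕP.≤-<-trans (∣⇒≤ {{ℕ.>-nonZero 1≤j}} (gcd[m,n]∣m j (q * e′))) j<))

          split : ∀ f → ind (U? f) ≡ ind (W? e′ f) + ind (W? (q * e′) f)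
          split f = go (Period? e′ (lookup f))
            where
            go : Dec (Period e′ (lookup f)) → ind (U? f) ≡ ind (W? e′ f) + ind (W? (q * e′) f)
            go (yes pe) = trans (ind-cong (U? f) (W? e′ f) (λ (fix , p , h) → fix , U⇒W₁ h pe) (λ (fix , mp) → fix , W⇒U₁ mp))
                  (trans (sym (ℕP.+-identityʳ _)) (cong (ind (W? e′ f) +_) (sym (ind-no (W? (q * e′) f) λ (_ , mp) → minPer-< mp e′ (ℕ.>-nonZero⁻¹ e′) e<qe pe))))
            go (no ¬pe) = trans (ind-cong (U? f) (W? (q * e′) f) (λ (fix , u) → fix , U⇒W₂ u ¬pe) (λ (fix , mp) → fix , W⇒U₂ mp))
                  (cong (_+ ind (W? (q * e′) f)) (sym (ind-no (W? e′ f) λ (_ , mp) → ¬pe (proj₁ mp))))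

          W-∣ : Q * Q ∣ W e′ + W (q * e′)
          W-∣ = subst (Q * Q ∣_) (trans (∑-cong words split) (∑-+ words _ _)) (shift-∣ U? U-shift {z} {π z} O.χ-z πz∉)

        -- By transitivity an invariant word of period 1 is constant.
        W-1 : W 1 ≡ Q
        W-1 = trans (#-bij {Q = λ _ → z ≡ z} (W? 1) (λ _ → z FinP.≟ z) (Enum-Vec (Enum-Fin Q) (suc N)) (Enum-Fin Q) (λ f → lookup f z) (Vec.replicate (suc N))
            (λ _ _ → refl)
            (λ c _ → (λ x → trans (lookup-replicate (g x) c) (sym (lookup-replicate x c))) , ∣-minPer (λ x → trans (lookup-replicate (π x) c) (sym (lookup-replicate x c))) (λ j _ → divides j (sym (ℕP.*-identityʳ j))))
            (λ f (fix , mp) → lookup-ext λ x → trans (lookup-replicate x (lookup f z)) (const f fix (proj₁ mp) x))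
            (λ c _ → lookup-replicate z c))
          (trans (∑-cong (allFin Q) (λ _ → ind-yes (z FinP.≟ z) refl)) (trans (∑-const (allFin Q) 1) (trans (ℕP.*-identityʳ _) (ListP.length-tabulate id))))
          where
          const : ∀ f → FixG g (lookup f) → Period 1 (lookup f) → ∀ x → lookup f z ≡ lookup f x
          const f fix p x = let a , b , e = trans-πg x in trans (sym (subst (λ k → Period k (lookup f)) (ℕP.*-identityʳ (toℕ a)) (Period-* (toℕ a) 1 p) z))
            (trans (sym (fix-π {lookup f} fix (toℕ a) (toℕ b) z)) (cong (lookup f) e))

        -- Starting from the Q constant words, each further prime changes the sign. Square-freeness
        -- guarantees that the new prime does not divide the product of the others.
        good : ∀ ps → All Prime ps → SquareFree (product ps) → product ps ∣ r → Q * Q ∣ W (product ps) + δ (parity ps)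
        good [] [] sf _ = ∣-reflexive (trans (ℕP.*-suc Q Q′) (cong (_+ Q * Q′) (sym W-1)))
        good (q ∷ ps) (pq ∷ pps) sf qe∣r = ∣m+n∣m⇒∣n {m = W e′ + δ (parity ps)} (subst (Q * Q ∣_) arith (∣m∣n⇒∣m+n (S.W-∣) (∣-reflexive (sym (δ-not (parity ps))))))
            (good ps pps (λ p pp d → sf p pp (∣n⇒∣m*n q d)) (∣-trans (n∣m*n q) qe∣r))
          where
          e′ : ℕ
          e′ = product ps
          nz : NonZero e′
          nz = ℕ.≢-nonZero λ e0 → ℕP.1+n≢0 {l} (Data.Nat.Divisibility.0∣⇒≡0 (subst (_∣ r) (trans (cong (q *_) e0) (ℕP.*-zeroʳ q)) qe∣r))
          q∤e′ : ¬ q ∣ e′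
          q∤e′ d = sf q pq (*-monoʳ-∣ q d)
          module S = Step q e′ pq q∤e′ {{nz}} qe∣r
          arith : W e′ + W (q * e′) + (δ (parity ps) + δ (not (parity ps))) ≡ W e′ + δ (parity ps) + (W (q * e′) + δ (not (parity ps)))
          arith = lem (W e′) (W (q * e′)) (δ (parity ps)) (δ (not (parity ps)))
            where
            open +-*-Solver
            lem : ∀ a b c d → a + b + (c + d) ≡ a + c + (b + d)
            lem = solve 4 (λ a b c d → a :+ b :+ (c :+ d) := a :+ c :+ (b :+ d)) refl

        -- For a transitive pair all cycles of `π` carry the same word up to rotation, so
        -- primitivity on each cycle says that the common minimal period is `r`.
        X≡W : X π g ≡ W r
        X≡W = #-cong (λ f → FixG? g (lookup f) ×-dec PrimB? π (lookup f)) (W? r) words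
            (λ f (fix , prim) → fix , (λ x → cong (lookup f) (per x)) , λ j 1≤j pj → ℕP.<⇒≱ (toℕ<n j) (∣⇒≤ {{ℕ.>-nonZero 1≤j}}
              (free z (toℕ j) (prim z j (λ i → trans (sym (pj (iter π (toℕ i) z))) (cong (lookup f) (iter-comm π (toℕ j) (toℕ i) z)))))))
            (λ f (fix , mp) → fix , λ x j h → back f fix mp x (toℕ j) (λ i → unb f x (toℕ j) h i))
          where
          unb : ∀ f x j → (∀ (i : Fin r) → lookup f (iter π (toℕ i) x) ≡ lookup f (iter π (toℕ i) (iter π j x))) → ∀ i → lookup f (iter π i x) ≡ lookup f (iter π i (iter π j x))
          unb f x j h i = trans (cong (lookup f) (red x)) (trans (h (fromℕ< i<)) (cong (lookup f) (sym (red (iter π j x)))))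
            where
            i< : i % r < r
            i< = m%n<n i r
            red : ∀ y → iter π i y ≡ iter π (toℕ (fromℕ< i<)) y
            red y = trans (iter-% r (per y) i) (cong (λ k → iter π k y) (sym (toℕ-fromℕ< i<)))
          back : ∀ f → FixG g (lookup f) → MinPer r (lookup f) → ∀ x j → (∀ i → lookup f (iter π i x) ≡ lookup f (iter π i (iter π j x))) → iter π j x ≡ x
          back f fix mp x j h with minPer-∣ mp j Pj
            where
            F : E → Fin Q
            F = lookup f
            c d : ℕ
            c = toℕ (proj₁ (trans-πg x))
            d = toℕ (proj₁ (proj₂ (trans-πg x)))
            x≡ : iter π c (iter g d z) ≡ x
            x≡ = proj₂ (proj₂ (trans-πg x))
            from-x : ∀ k → F (iter π k x) ≡ F (iter π (k + c) z)
            from-x k = trans (cong (λ w → F (iter π k w)) (sym x≡)) (trans (cong F (sym (iter-+ π k c (iter g d z)))) (fix-π {F} fix (k + c) d z))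
            Pj : Period j F
            Pj y = trans (cong (λ w → F (iter π j w)) (sym y≡)) (trans (cong F (sym (iter-+ π j a (iter g b z)))) (trans (fix-π {F} fix (j + a) b z)
                (trans (sym (at (j + a))) (trans (cong F (cong (λ k → iter π k x) (trans (ℕP.+-assoc j a (l * c)) (ℕP.+-comm j _)))) (trans (cong F (iter-+ π (a + l * c) j x)) (trans (sym (h (a + l * c))) (trans (at a)
                (trans (sym (fix-π {F} fix a b z)) (cong F y≡)))))))))
              where
              a b : ℕ
              a = toℕ (proj₁ (trans-πg y))
              b = toℕ (proj₁ (proj₂ (trans-πg y)))
              y≡ : iter π a (iter g b z) ≡ y
              y≡ = proj₂ (proj₂ (trans-πg y))
              at : ∀ k → F (iter π (k + l * c) x) ≡ F (iter π k z)
              at k = trans (from-x (k + l * c)) (cong F (trans (cong (λ m → iter π m z) (trans (ℕP.+-assoc k (l * c) c) (cong (k +_) (trans (ℕP.+-comm (l * c) c) (ℕP.*-comm r c)))))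
                (trans (iter-+ π k (c * r) z) (cong (iter π k) (iter-period r (per z) c)))))
          ... | divides m refl = iter-period r (per x) m

        regular : ∀ ps → All Prime ps → r ≡ product ps → SquareFree r → Q * Q ∣ X π g + δ (parity ps)
        regular ps pps r≡ sf = subst (λ k → Q * Q ∣ k + δ (parity ps)) (trans (cong W (sym r≡)) (sym X≡W)) (good ps pps (subst SquareFree r≡ sf) (∣-reflexive (sym r≡)))

    -- The Burnside count of compatible words

    module Burnside (s : ℕ) where
      open RegularPairs s
      open Compatible {N} μ Q using (F)
      open Descents {N} Q using (Comp?)

      Ws : Enum (Vec (Fin Q) (suc N))
      Ws = Enum-Vec (Enum-Fin Q) (suc N)

      -- The number of relabellings `φ`. Conjugation by any of them preserves the count `F`, so
      -- pairs taken together with a free choice of `φ` number `q * F`.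
      q : ℕ
      q = # Inj? (list EnumV)

      Conj? : ∀ (φ : V) (p : V × Vec (Fin Q) (suc N)) → Dec (Mem μ (lookup (proj₁ p)) × Comp (lookup φ) (lookup (proj₁ p)) (lookup (proj₂ p) ∘ lookup φ))
      Conj? φ (v , f) = Mem? μ v ×-dec Comp? (lookup φ) (lookup v) (lookup f ∘ lookup φ)

      Id? : ∀ (p : V × Vec (Fin Q) (suc N)) → Dec (Mem μ (lookup (proj₁ p)) × Comp id (lookup (proj₁ p)) (lookup (proj₂ p)))
      Id? (v , f) = Mem? μ v ×-dec Comp? id (lookup v) (lookup f)

      F≡ : F ≡ # Id? (list (Enum-× EnumV Ws))
      F≡ = sym (trans (∑-× (list EnumV) words (λ p → ind (Id? p))) (∑-cong (list EnumV) (λ v → trans (∑-cong words (λ f → ind-× (Mem? μ v) (Comp? id (lookup v) (lookup f)))) (∑-*ʳ words (λ f → ind (Comp? id (lookup v) (lookup f))) (ind (Mem? μ v))))))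

      module Conjugate (φ : V) (φ-inj : Inj (lookup φ)) where
        open Inverse φ-inj
        Φ : E → E
        Φ = lookup φ
        push pull : V → V
        push v = tabulate (Φ ∘ lookup v ∘ inv)
        pull w = tabulate (inv ∘ lookup w ∘ Φ)
        push≡ : ∀ v x → lookup (push v) x ≡ Φ (lookup v (inv x))
        push≡ v = lookup∘tabulate (Φ ∘ lookup v ∘ inv)
        pull≡ : ∀ w x → lookup (pull w) x ≡ inv (lookup w (Φ x))
        pull≡ w = lookup∘tabulate (inv ∘ lookup w ∘ Φ)

        push-comp : ∀ v (f : Vec (Fin Q) (suc N)) → Comp Φ (lookup v) (lookup f ∘ Φ) → Comp id (lookup (push v)) (lookup f)
        push-comp v f c a b lt with c (inv a) (inv b) (subst₂ Fin._<_ (sym (rinv a)) (sym (rinv b)) lt)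
        ... | inj₁ l< = inj₁ (subst₂ (λ x y → lookup f x Fin.< lookup f y) (rinv a) (rinv b) l<)
        ... | inj₂ (e , l<) = inj₂ (trans (sym (cong (lookup f) (rinv a))) (trans e (cong (lookup f) (rinv b))) , subst₂ Fin._<_ (sym (push≡ v a)) (sym (push≡ v b)) l<)

        pull-comp : ∀ w (f : Vec (Fin Q) (suc N)) → Comp id (lookup w) (lookup f) → Comp Φ (lookup (pull w)) (lookup f ∘ Φ)
        pull-comp w f c x y lt with c (Φ x) (Φ y) lt
        ... | inj₁ l< = inj₁ l<
        ... | inj₂ (e , l<) = inj₂ (e , subst₂ Fin._<_ (at x) (at y) l<)
          where
          at : ∀ x → lookup w (Φ x) ≡ Φ (lookup (pull w) x)
          at x = sym (trans (cong Φ (pull≡ w x)) (rinv (lookup w (Φ x))))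

        #≡ : # (Conj? φ) (list (Enum-× EnumV Ws)) ≡ # Id? (list (Enum-× EnumV Ws))
        #≡ = #-bij (Conj? φ) Id? (Enum-× EnumV Ws) (Enum-× EnumV Ws) (λ (v , f) → push v , f) (λ (w , f) → pull w , f)
          (λ (v , f) (m , c) → Mem-iso Φ φ-inj (λ x → sym (trans (push≡ v (Φ x)) (cong (Φ ∘ lookup v) (linv x)))) m , push-comp v f c)
          (λ (w , f) (m , c) → Mem-iso inv inv-inj (λ x → sym (trans (pull≡ w (inv x)) (cong (inv ∘ lookup w) (rinv x)))) m , pull-comp w f c)
          (λ (v , f) _ → cong (_, f) (lookup-ext λ x → trans (pull≡ (push v) x) (trans (cong inv (trans (push≡ v (Φ x)) (cong (Φ ∘ lookup v) (linv x)))) (linv (lookup v x)))))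
          (λ (w , f) _ → cong (_, f) (lookup-ext λ x → trans (push≡ (pull w) x) (trans (cong Φ (trans (pull≡ w (inv x)) (cong (inv ∘ lookup w) (rinv x)))) (rinv (lookup w x)))))

      comm₃ : ∀ a b c → a * (b * c) ≡ b * (a * c)
      comm₃ a b c = trans (sym (ℕP.*-assoc a b c)) (trans (cong (_* c) (ℕP.*-comm a b)) (ℕP.*-assoc b a c))

      Lft? : ∀ (v : V) (p : V × Vec (Fin Q) (suc N)) → Dec (Inj (lookup (proj₁ p)) × Comp (lookup (proj₁ p)) (lookup v) (lookup (proj₂ p) ∘ lookup (proj₁ p)))
      Lft? v (φ , f) = Inj? φ ×-dec Comp? (lookup φ) (lookup v) (lookup f ∘ lookup φ)

      -- Double counting of triples of a relabelling, a permutation and a word: a fixed relabelling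
      -- contributes `F`, a fixed permutation the left side of the bijection in `GR`.
      qF : q * F ≡ ∑ (list EnumV) (λ v → ind (Mem? μ v) * # (Lft? v) (list (Enum-× EnumV Ws)))
      qF = trans (ℕP.*-comm q F) (trans (sym (∑-*ʳ (list EnumV) (λ φ → ind (Inj? φ)) F))
        (trans (∑-cong (list EnumV) per-φ) (trans (∑-swap (list EnumV) (list EnumV) _) (∑-cong (list EnumV) per-v))))
        where
        body : V → V → ℕ
        body φ v = ind (Mem? μ v) * ∑ words (λ f → ind (Lft? v (φ , f)))
        per-φ : ∀ φ → F * ind (Inj? φ) ≡ ∑ (list EnumV) (body φ)
        per-φ φ = trans (ℕP.*-comm F _) (trans (go (Inj? φ)) (trans (sym (∑-*ʳ (list EnumV) _ (ind (Inj? φ)))) (∑-cong (list EnumV) λ v →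
            trans (comm₃ (ind (Inj? φ)) (ind (Mem? μ v)) _) (cong (ind (Mem? μ v) *_) (trans (sym (∑-*ʳ words _ (ind (Inj? φ)))) (∑-cong words λ f → sym (ind-× (Inj? φ) (Comp? (lookup φ) (lookup v) (lookup f ∘ lookup φ)))))))))
          where
          c : V → ℕ
          c v = ind (Mem? μ v) * ∑ words (λ f → ind (Comp? (lookup φ) (lookup v) (lookup f ∘ lookup φ)))
          go : (d : Dec (Inj (lookup φ))) → ind d * F ≡ ind d * ∑ (list EnumV) c
          go (no _) = refl
          go (yes inj) = cong (_+ 0) (trans F≡ (trans (sym (Conjugate.#≡ φ inj)) (trans (∑-× (list EnumV) words (λ p → ind (Conj? φ p)))
            (∑-cong (list EnumV) λ v → trans (∑-cong words (λ f → ind-× (Mem? μ v) (Comp? (lookup φ) (lookup v) (lookup f ∘ lookup φ)))) (∑-*ʳ words _ (ind (Mem? μ v)))))))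
        per-v : ∀ v → ∑ (list EnumV) (λ φ → body φ v) ≡ ind (Mem? μ v) * # (Lft? v) (list (Enum-× EnumV Ws))
        per-v v = trans (∑-*ʳ (list EnumV) _ (ind (Mem? μ v))) (cong (ind (Mem? μ v) *_) (sym (∑-× (list EnumV) words (λ p → ind (Lft? v p)))))

      module One (v : V) (mem : Mem μ (lookup v)) where
        π : E → E
        π = lookup v
        per : ∀ x → iter π r x ≡ x
        per = mem-per mem
        Right : Vec (Fin Q) (suc N) × V → Set
        Right = GR.One.Right {N} Q l π (proj₁ mem) per

        red : ∀ i y → iter π i y ≡ iter π (toℕ (fromℕ< (m%n<n i r))) y
        red i y = trans (iter-% r (per y) i) (cong (λ k → iter π k y) (sym (toℕ-fromℕ< (m%n<n i r))))

        PrimF⇒PrimB : ∀ {f} → PrimF π f → PrimB π f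
        PrimF⇒PrimB {f} prim x j h = prim x (toℕ j) (λ i → trans (cong f (red i x)) (trans (h (fromℕ< (m%n<n i r))) (cong f (sym (red i _)))))

        PrimB⇒PrimF : ∀ {f} → PrimB π f → PrimF π f
        PrimB⇒PrimF {f} prim x j h = trans (red j x) (prim x (fromℕ< (m%n<n j r)) (λ i → trans (h (toℕ i)) (cong (λ y → f (iter π (toℕ i) y)) (red j x))))

        BRight : Vec (Fin Q) (suc N) × V → Set
        BRight (f , g) = Comm v g × FixG (lookup g) (lookup f) × PrimB π (lookup f)

        B? : ∀ p → Dec (BRight p)
        B? (f , g) = Comm? v g ×-dec (FixG? (lookup g) (lookup f) ×-dec PrimB? π (lookup f))

        B⇒R : ∀ p → BRight p → Right p
        B⇒R (f , g) ((i , c) , fix , pr) = i , c , fix , PrimB⇒PrimF {lookup f} pr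

        R⇒B : ∀ p → Right p → BRight p
        R⇒B (f , g) (i , c , fix , pr) = (i , c) , fix , PrimF⇒PrimB {lookup f} pr

        R? : ∀ p → Dec (Right p)
        R? p = map′ (B⇒R p) (R⇒B p) (B? p)

        #Lft : # (Lft? v) (list (Enum-× EnumV Ws)) ≡ ∑ (list EnumV) (λ g → ind (Comm? v g) * X π (lookup g))
        #Lft = trans (GR.One.#Left≡#Right {N} Q l π (proj₁ mem) per (Lft? v) R?) (trans (∑-cong (list (Enum-× Ws EnumV)) (λ p → ind-cong (R? p) (B? p) (R⇒B p) (B⇒R p)))
          (trans (∑-× words (list EnumV) (λ p → ind (B? p))) (trans (∑-swap words (list EnumV) _) (∑-cong (list EnumV) λ g →
            trans (∑-cong words (λ f → ind-× (Comm? v g) (FixG? (lookup g) (lookup f) ×-dec PrimB? π (lookup f)))) (∑-*ʳ words _ (ind (Comm? v g)))))))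

      qF≡ : q * F ≡ ∑ (list EnumV) (λ v → ∑ (list EnumV) (λ g → ind (Mem? μ v) * (ind (Comm? v g) * X (lookup v) (lookup g))))
      qF≡ = trans qF (∑-cong (list EnumV) λ v → trans (go v (Mem? μ v)) (sym (∑-*ʳ (list EnumV) _ (ind (Mem? μ v)))))
        where
        go : ∀ v (d : Dec (Mem μ (lookup v))) → ind d * # (Lft? v) (list (Enum-× EnumV Ws)) ≡ ind d * ∑ (list EnumV) (λ g → ind (Comm? v g) * X (lookup v) (lookup g))
        go v (no _)    = refl
        go v (yes mem) = cong (_+ 0) (One.#Lft v mem)

      module _ (sf : SquareFree r) where
        ps : List ℕ
        ps = PrimeFactorisation.factors (factorise r)

        d : ℕ
        d = δ (parity ps)

        term : ∀ v g → Q * Q ∣ ind (Mem? μ v) * (ind (Comm? v g) * X (lookup v) (lookup g)) + ind (Good? v g) * d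
        term v g = go (Mem? μ v) (Comm? v g) (Reg? v g)
          where
          go : (a : Dec (Mem μ (lookup v))) (b : Dec (Comm v g)) (c : Dec (Trans (lookup v) (lookup g) × Free (lookup v) (lookup g))) →
            Q * Q ∣ ind a * (ind b * X (lookup v) (lookup g)) + ind (a ×-dec (b ×-dec c)) * d
          go (no _) b c = (Q * Q) ∣0
          go (yes _) (no _) c = (Q * Q) ∣0
          go (yes m) (yes (i , cm)) (yes (t , fr)) = subst₂ (λ a b → Q * Q ∣ a + b) (sym (trans (ℕP.+-identityʳ _) (ℕP.+-identityʳ _))) (sym (ℕP.+-identityʳ d))
            (Pair.Regular.regular (lookup v) (lookup g) (mem-per m) (mem-free m) i cm t fr ps (PrimeFactorisation.factorsPrime (factorise r)) (PrimeFactorisation.isFactorisation (factorise r)) sf)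
          go (yes m) (yes (i , cm)) (no ¬reg) = subst (Q * Q ∣_) (sym (trans (ℕP.+-identityʳ _) (trans (ℕP.+-identityʳ _) (ℕP.+-identityʳ _)))) (vanish (Free? (lookup v) (lookup g)))
            where
            module P = Pair (lookup v) (lookup g) (mem-per m) (mem-free m) i cm
            vanish : Dec (Free (lookup v) (lookup g)) → Q * Q ∣ X (lookup v) (lookup g)
            vanish (no ¬fr) = subst (Q * Q ∣_) (sym (P.nonfree ¬fr)) ((Q * Q) ∣0)
            vanish (yes fr) = P.nontransitive (λ t → ¬reg (t , fr))

        qF+K : Q * Q ∣ q * F + K * d
        qF+K = subst (Q * Q ∣_) eq (∑-∣ (list EnumV) (λ v → ∑-∣ (list EnumV) (term v)))
          where
          eq : ∑ (list EnumV) (λ v → ∑ (list EnumV) (λ g → ind (Mem? μ v) * (ind (Comm? v g) * X (lookup v) (lookup g)) + ind (Good? v g) * d)) ≡ q * F + K * d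
          eq = trans (∑-cong (list EnumV) (λ v → ∑-+ (list EnumV) _ _)) (trans (∑-+ (list EnumV) _ _) (cong₂ _+_ (sym qF≡)
            (trans (∑-cong (list EnumV) (λ v → trans (∑-cong (list EnumV) (λ g → ℕP.*-comm (ind (Good? v g)) d)) (∑-*ʳ (list EnumV) _ d))) (trans (∑-*ʳ (list EnumV) _ d) (ℕP.*-comm d K)))))

-- The contradiction and the two directions of the theorem

δ-∣ : ∀ Q′ b m → suc Q′ * suc Q′ ∣ m * Letters.δ Q′ b → suc Q′ ∣ m * Q′ ⊎ suc Q′ ∣ m
δ-∣ Q′ true m h = inj₂ (*-cancelˡ-∣ (suc Q′) (subst (suc Q′ * suc Q′ ∣_) (ℕP.*-comm m (suc Q′)) h))
δ-∣ Q′ false m h = inj₁ (*-cancelˡ-∣ (suc Q′) (subst (suc Q′ * suc Q′ ∣_) (trans (sym (ℕP.*-assoc m (suc Q′) Q′)) (trans (cong (_* Q′) (ℕP.*-comm m (suc Q′))) (ℕP.*-assoc (suc Q′) m Q′))) h))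

noExtension : ∀ {N} (l s : ℕ) → SquareFree (suc l) → suc N ≡ s * suc l → ¬ HasCyclicExtension (suc N) (replicate s (suc l))
noExtension {N} l (suc s′) sf n≡ (cDes , p , ext) = absurd (δ-∣ Q′ (parity (B.ps sf)) Q′ step)
  where
  s = suc s′
  module RP = Orbits.RegularPairs {N} l s
  M Q′ Q : ℕ
  M = suc N * suc N !
  -- With this choice the coefficient of `d` in the final congruence is Q - 1, which is prime to Q;
  -- moreover Q exceeds n, as the rotation argument requires.
  Q′ = M * RP.K
  Q = suc Q′
  1≤K : 1 ≤ RP.K
  1≤K = RP.K-pos s′ refl n≡
  n≤Q′ : suc N ≤ Q′
  n≤Q′ = ℕP.≤-trans (ℕP.m≤m*n (suc N) (suc N !) {{ℕP._!≢0 (suc N)}}) (ℕP.m≤m*n M RP.K {{ℕ.>-nonZero 1≤K}})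
  module B = Orbits.Pairs.Burnside {N} l Q′ s
  module A = Compatible {N} (replicate s (suc l)) Q
  module Rot = A.Rotation cDes p ext (ℕP.≤-trans (ℕP.n≤1+n N) (ℕP.≤-trans n≤Q′ (ℕP.n≤1+n Q′)))
  -- `M` times the Burnside congruence minus `q` times the rotation congruence: the terms with `F`
  -- cancel.
  step : Q * Q ∣ Q′ * B.d sf
  step = ∣m+n∣m⇒∣n {m = M * (B.q * A.F)} (subst (Q * Q ∣_) (trans (ℕP.*-distribˡ-+ M (B.q * A.F) (RP.K * B.d sf)) (cong (M * (B.q * A.F) +_) (sym (ℕP.*-assoc M RP.K (B.d sf))))) (∣n⇒∣m*n M (B.qF+K sf)))
    (subst (Q * Q ∣_) (B.comm₃ B.q M A.F) (∣n⇒∣m*n B.q (subst (Q * Q ∣_) (sym (ℕP.*-assoc (suc N) (suc N !) A.F)) Rot.F-∣)))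
  nope : ¬ Q ∣ Q′
  nope h = ℕP.1+n≰n (∣⇒≤ {{ℕ.>-nonZero (ℕP.≤-trans (s≤s z≤n) n≤Q′)}} h)
  absurd : Q ∣ Q′ * Q′ ⊎ Q ∣ Q′ → ⊥
  absurd (inj₂ h) = nope h
  -- Q = Q′ + 1 divides Q′ Q′ + Q′, so it would divide Q′ as well.
  absurd (inj₁ h) = nope (∣m+n∣m⇒∣n (subst (Q ∣_) (trans (ℕP.*-suc Q′ Q′) (ℕP.+-comm Q′ _)) (n∣m*n Q′)) h)

sum-replicate : ∀ s r → sum (replicate s r) ≡ s * r
sum-replicate zero    r = refl
sum-replicate (suc s) r = cong (r +_) (sum-replicate s r)

square-divisor : ∀ r → 1 ≤ r → ¬ SquareFree r → ∃ λ p → Prime p × p * p ∣ r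
square-divisor r 1≤r ¬sf with any? (λ k → prime? (toℕ {suc r} k) ×-dec (toℕ k * toℕ k ∣? r))
... | yes (k , pp , d) = toℕ k , pp , d
... | no ¬ex = ⊥-elim (¬sf λ p pp d →
  let p≤r : p < suc r
      p≤r = s≤s (∣⇒≤ {{ℕ.>-nonZero 1≤r}} (∣-trans (m∣m*n p) d))
  in ¬ex (fromℕ< p≤r , subst Prime (sym (toℕ-fromℕ< p≤r)) pp , subst (λ k → k * k ∣ r) (sym (toℕ-fromℕ< p≤r)) d))

rectangular : ∀ {N} s r → 1 ≤ r → ¬ SquareFree r → HasCyclicExtension (suc N) (replicate s r)
rectangular {N} s r 1≤r ¬sf with square-divisor r 1≤r ¬sf
-- r = k p p is split as p times k p, and the second factor is still divisible by p.
... | p , pp , divides k refl = subst (λ r → HasCyclicExtension (suc N) (replicate s r)) p*rp≡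
    (Rect.RectCoding.extension p (k * p) s pp {{prime⇒nonZero pp}} {{nz}} (n∣m*n k))
  where
  p*rp≡ : p * (k * p) ≡ k * (p * p)
  p*rp≡ = trans (ℕP.*-comm p (k * p)) (ℕP.*-assoc k p p)
  nz : NonZero (k * p)
  nz = ℕ.≢-nonZero λ e → ℕP.<-irrefl (trans (sym (ℕP.*-zeroʳ p)) (trans (cong (p *_) (sym e)) p*rp≡)) 1≤r

theorem1p4 : (n : ℕ) → 1 ≤ n → (μ : List ℕ) → IsPartition n μ →
  (HasCyclicExtension n μ ⇔ (¬ IsSquareFreeRectangle μ))
theorem1p4 (suc N) _ μ (pos , _ , sum≡) = mk⇔ necessary (sufficient μ pos sum≡)
  where
  necessary : HasCyclicExtension (suc N) μ → ¬ IsSquareFreeRectangle μ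
  necessary ext (suc l , s , _ , sf , refl) = noExtension l s sf (trans (sym sum≡) (sum-replicate s (suc l))) ext

  sufficient : ∀ μ → All (1 ≤_) μ → sum μ ≡ suc N → ¬ IsSquareFreeRectangle μ → HasCyclicExtension (suc N) μ
  -- Either some part differs from the first one, or all parts are equal to a number that is not
  -- square-free.
  sufficient (a ∷ rest) (1≤a ∷ _) _ ¬rect with Any.any? (λ b → ¬? (b ℕ.≟ a)) rest
  ... | yes ex = let b , b∈ , b≢a = find ex in TwoLengths.extension (a ∷ rest) (here refl) (there b∈) (b≢a ∘ sym)
  ... | no ¬ex = subst (HasCyclicExtension (suc N)) (sym μ≡)
      (rectangular (suc (length rest)) a 1≤a (λ sf → ¬rect (a , suc (length rest) , 1≤a , sf , μ≡)))
    where
    μ≡ : a ∷ rest ≡ replicate (suc (length rest)) a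
    μ≡ = cong (a ∷_) (all-equal rest (λ {b} b∈ → decidable-stable (b ℕ.≟ a) (λ b≢a → ¬ex (lose b∈ b≢a))))
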